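{- For a nonnegative integer $n$, let $b_9(n)$ denote the number of $9$-regular partitions of $n$. The series $\sum_{n=0}^{\infty}b_9(4n)q^n$ is lacunary modulo $2$.
   Context: For a positive integer $\ell$, an $\ell$-regular partition of $n$ is a partition of $n$ none of whose parts is divisible by $\ell$; $b_\ell(n)$ denotes the number of $\ell$-regular partitions of $n$, with $b_\ell(0)=1$. Equivalently, $\sum_{n=0}^{\infty}b_{\ell}(n)q^n=\prod_{j=1}^{\infty}\frac{1-q^{\ell j}}{1-q^{j}}$. For a positive integer $M$, a power series $F(q)=\sum_{n=0}^{\infty}a(n)q^n$ with integer coefficients is called lacunary modulo $M$ if $$\lim_{X\to\infty}\frac{\#\{n\leq X: a(n)\equiv 0 \pmod{M}\}}{X}=1,$$ where $n$ ranges over nonnegative integers. -}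

module Defs where

open import Data.Integer.Base using (ℤ; +_)
open import Data.Integer.Divisibility.Signed using (_∣?_)
open import Data.List.Base
  using (List; []; _∷_; length; filter; upTo; cartesianProductWith)
open import Data.List.Membership.Propositional using (_∈_)
open import Data.List.Membership.Propositional.Properties
  using (∈-filter⁺; ∈-filter⁻; ∈-upTo⁺; ∈-cartesianProductWith⁺
        ; ∈-cartesianProductWith⁻)
open import Data.List.Properties using (∷-injective)
open import Data.List.Relation.Unary.All as All using (All; []; _∷_)
open import Data.List.Relation.Unary.AllPairs using ([]; _∷_)
open import Data.List.Relation.Unary.Any using (here; there)
open import Data.List.Relation.Unary.Linked using (Linked; linked?)
open import Data.List.Relation.Unary.Unique.Propositional using (Unique)
open import Data.List.Relation.Unary.Unique.Propositional.Properties
  using (filter⁺; upTo⁺; cartesianProductWith⁺)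
open import Data.Nat.Base
  using (ℕ; zero; suc; _≤_; _<_; _≥_; z≤n; s≤s; NonZero)
import Data.Nat.Divisibility as ℕ∣
open import Data.Nat.ListAction using (sum)
open import Data.Nat.Properties
  using (_≟_; _<?_; _≥?_; ≤-trans; m≤m+n; m≤n+m; +-mono-≤)
open import Data.Product.Base using (_,_; proj₂; ∃-syntax)
open import Data.Rational.Base as ℚ using (ℚ; 0ℚ; 1ℚ; _/_; ∣_∣)
open import Function.Bundles using (_⇔_; mk⇔)
open import Relation.Binary.PropositionalEquality using (_≡_; refl)
open import Relation.Nullary using (¬_; Dec; ¬?)
open import Relation.Nullary.Decidable using (map′; _×-dec_)

record IsPartition (n : ℕ) (xs : List ℕ) : Set where
  constructor mkIsPartition
  field
    decreasing : Linked _≥_ xs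
    positive   : All (0 <_) xs
    sums-to    : sum xs ≡ n

record IsRegularPartition (ℓ n : ℕ) (xs : List ℕ) : Set where
  constructor mkIsRegularPartition
  field
    isPartition : IsPartition n xs
    regular     : All (λ p → ¬ (ℓ ℕ∣.∣ p)) xs

isPartition? : ∀ n xs → Dec (IsPartition n xs)
isPartition? n xs =
  map′ (λ (d , p , s) → mkIsPartition d p s)
       (λ (mkIsPartition d p s) → d , p , s)
       (linked? _≥?_ xs ×-dec All.all? (0 <?_) xs ×-dec sum xs ≟ n)

isRegularPartition? : ∀ ℓ n xs → Dec (IsRegularPartition ℓ n xs)
isRegularPartition? ℓ n xs =
  map′ (λ (p , r) → mkIsRegularPartition p r)
       (λ (mkIsRegularPartition p r) → p , r)
       (isPartition? n xs ×-dec All.all? (λ p → ¬? (ℓ ℕ∣.∣? p)) xs)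

lists≤ : ℕ → List ℕ → List (List ℕ)
lists≤ zero    as = [] ∷ []
lists≤ (suc k) as = [] ∷ cartesianProductWith _∷_ as (lists≤ k as)

-- A partition of n has at most n parts, each at most n, so the candidates
-- searched here include every partition; see ∈-regularPartitions and
-- regularPartitions-unique.
regularPartitions : (ℓ n : ℕ) → List (List ℕ)
regularPartitions ℓ n =
  filter (isRegularPartition? ℓ n) (lists≤ n (upTo (suc n)))

b : (ℓ n : ℕ) → ℕ
b ℓ n = length (regularPartitions ℓ n)

private
  ∈-lists≤ : ∀ {as} k xs → length xs ≤ k → All (_∈ as) xs → xs ∈ lists≤ k as
  ∈-lists≤ zero    []       _         _          = here refl
  ∈-lists≤ (suc k) []       _         _          = here refl
  ∈-lists≤ (suc k) (x ∷ xs) (s≤s len) (x∈ ∷ xs∈) =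
    there (∈-cartesianProductWith⁺ _∷_ x∈ (∈-lists≤ k xs len xs∈))

  lists≤-unique : ∀ {as} k → Unique as → Unique (lists≤ k as)
  lists≤-unique      zero    _  = [] ∷ []
  lists≤-unique {as} (suc k) as! =
    All.tabulate []≢
    ∷ cartesianProductWith⁺ _∷_ ∷-injective as! (lists≤-unique k as!)
    where
    []≢ : ∀ {ys} → ys ∈ cartesianProductWith _∷_ as (lists≤ k as) → ¬ ([] ≡ ys)
    []≢ ys∈ refl with ∈-cartesianProductWith⁻ _∷_ as (lists≤ k as) ys∈
    ... | _ , _ , _ , _ , ()

  length≤sum : ∀ {xs} → All (0 <_) xs → length xs ≤ sum xs
  length≤sum []         = z≤n
  length≤sum (px ∷ pxs) = +-mono-≤ px (length≤sum pxs)

  parts≤sum : ∀ xs → All (_≤ sum xs) xs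
  parts≤sum []       = []
  parts≤sum (x ∷ xs) =
    m≤m+n x (sum xs) ∷ All.map (λ p → ≤-trans p (m≤n+m (sum xs) x)) (parts≤sum xs)

∈-regularPartitions : ∀ ℓ n xs →
  xs ∈ regularPartitions ℓ n ⇔ IsRegularPartition ℓ n xs
∈-regularPartitions ℓ n xs = mk⇔
  (λ xs∈ → proj₂ (∈-filter⁻ (isRegularPartition? ℓ n)
                   {xs = lists≤ n (upTo (suc n))} xs∈))
  λ { r@(mkIsRegularPartition (mkIsPartition _ pos refl) _) →
      ∈-filter⁺ (isRegularPartition? ℓ n)
        (∈-lists≤ n xs (length≤sum pos)
          (All.map (λ p → ∈-upTo⁺ (s≤s p)) (parts≤sum xs)))
        r }

regularPartitions-unique : ∀ ℓ n → Unique (regularPartitions ℓ n)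
regularPartitions-unique ℓ n =
  filter⁺ (isRegularPartition? ℓ n) (lists≤-unique n (upTo⁺ (suc n)))

-- A power series is given by its sequence of coefficients.
ℤ⟦q⟧ : Set
ℤ⟦q⟧ = ℕ → ℤ

-- f X → L as X → ∞, where f need only be defined for X ≥ 1.
Lim : ((X : ℕ) .{{_ : NonZero X}} → ℚ) → ℚ → Set
Lim f L = ∀ (ε : ℚ) → 0ℚ ℚ.< ε →
  ∃[ N ] (∀ (X : ℕ) .{{_ : NonZero X}} → N ≤ X → ∣ f X ℚ.- L ∣ ℚ.< ε)

-- #{ 0 ≤ n ≤ X : a n ≡ 0 (mod M) }
zerosMod : (M : ℕ) → ℤ⟦q⟧ → ℕ → ℕ
zerosMod M a X = length (filter (λ n → + M ∣? a n) (upTo (suc X)))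

LacunaryMod : (M : ℕ) .{{_ : NonZero M}} → ℤ⟦q⟧ → Set
LacunaryMod M a = Lim (λ X → + zerosMod M a X / X) 1ℚ

-- Everything takes place modulo 2, with f = ∏ (1 + qⁿ) ≡ ∏ (1 - qⁿ). The Jacobi triple product and 3-dissections of f and f³
-- express Σ b₉(4n) qⁿ, up to f(q²), which involves only n with 12n + 1 a square, through three series Σ x^m y^l Q^(ml).
-- These are quotients of theta functions and count factorisations of 3·4n + 1 = 12n + 1 into factors from prescribed classes
-- modulo 9. If a prime p ≡ ±1 (mod 9) divides 12n + 1 exactly once, moving p from one factor to the other pairs these
-- factorisations off, so b₉(4n) is even.
--
-- It remains to see that almost every 12n + 1 has such a prime divisor, that is, that the reciprocals of these primes have a
-- divergent sum. They are, but for 3, the primes modulo which x³ - 6x² + 9x - 1 has a root, that is, which divide the norm form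
-- of the cubic field ℚ(ζ₉ + ζ₉⁻¹) at a vector that they do not divide. In a large box of vectors a positive proportion is
-- primitive and, there being few smooth numbers, has norm divisible by such a prime above a given bound; by a pigeonhole argument in the
-- lattices of zeros modulo p, a prime p accounts for at most a proportion O(1/p) of the box. So each block of these primes
-- contributes a fixed amount to the sum, and sieving by finitely many of them leaves an arbitrarily small density.
module Submission where

-- Kronecker's formula makes the sum of x^m y^l Q^(ml) over pairs of equal sign a quotient of theta
-- functions in x, y and xy. For x = Q/y² those of y and xy cancel and the reciprocal of a single
-- theta function remains; with Q = q⁹ this covers the three components of the 3-dissection of f.
--
-- The 4 in b₉(4n) comes from clearing denominators. Times f f(q³), the three series plus the
-- partition series give f(q³)⁴ + q f(q⁹)⁴; a further factor f³ f(q³)³ turns the multiplier into a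
-- series in q⁴ and keeps the right side of degree 2 in q over such series, so that only its
-- constant term reaches exponents divisible by 4.
--
-- The arithmetic obstacle is a case of Dirichlet's theorem, the classes ±1 modulo 9. No L-function
-- is used; the norm form that replaces it needs elementary proofs that the primes in question lie
-- in these classes (Frobenius acts on ζ + ζ⁻¹) and that it has no nontrivial zero (2 is inert).
-- Densities are compared as natural numbers, with point counts standing for 1/p, so that neither
-- logarithms nor real sums occur.

-- Power series over the field with two elements

module Series where

  open import Algebra.Bundles using (CommutativeRing; RawRing)
  import Algebra.Solver.Ring
  open import Algebra.Solver.Ring.AlmostCommutativeRing using (fromCommutativeRing; _-Raw-AlmostCommutative⟶_)
  open import Data.Bool.Base using (Bool; true; false; _∧_; _xor_)
  open import Data.Bool.Properties hiding (_≤?_; _<?_; <-trans; <-cmp; ≤-trans; ≤-refl; ≤-reflexive; _≟_)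
  import Data.Bool.Properties as Bool
  open import Data.Bool.Solver using (module xor-∧-Solver)
  open import Data.Maybe.Base using (Maybe; just; nothing)
  open import Data.Nat.Base
  open import Data.Nat.Properties
  open import Data.Product.Base using (_,_)
  open import Relation.Binary.PropositionalEquality hiding (setoid)
  open import Relation.Nullary using (yes; no)
  import Relation.Binary.Reasoning.Setoid as SetoidReasoning

  F₂⟦q⟧ : Set
  F₂⟦q⟧ = ℕ → Bool

  infix 4 _≈_ _≈[_]_

  record _≈_ (f g : F₂⟦q⟧) : Set where
    constructor coeffwise
    field at : ∀ n → f n ≡ g n
  open _≈_ public

  -- Congruence modulo q^N. Identities between infinite sums and products are proved at each finite
  -- precision, where partial sums and products suffice, and glued by `≈[]⇒≈`.
  record _≈[_]_ (f : F₂⟦q⟧) (N : ℕ) (g : F₂⟦q⟧) : Set where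
    constructor coeffwise<
    field at< : ∀ {n} → n < N → f n ≡ g n
  open _≈[_]_ public

  infixl 6 _⊕_
  infixl 7 _⊛_

  0s 1s : F₂⟦q⟧
  0s _ = false
  1s zero    = true
  1s (suc _) = false

  tl : F₂⟦q⟧ → F₂⟦q⟧
  tl f n = f (suc n)

  scale : Bool → F₂⟦q⟧ → F₂⟦q⟧
  scale c f n = c ∧ f n

  section : ℕ → F₂⟦q⟧ → F₂⟦q⟧
  section k f n = f (n * k)

  opaque
    _⊕_ : F₂⟦q⟧ → F₂⟦q⟧ → F₂⟦q⟧
    (f ⊕ g) n = f n xor g n

    -- The Cauchy product unrolled along f = f(0) + q · tl f instead of written as a convolution, so
    -- that the ring laws are inductions on the coefficient index with the first factor generalised.
    _⊛_ : F₂⟦q⟧ → F₂⟦q⟧ → F₂⟦q⟧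
    (f ⊛ g) zero    = f 0 ∧ g 0
    (f ⊛ g) (suc n) = (f 0 ∧ g (suc n)) xor (tl f ⊛ g) n

  ≈-refl : ∀ {f} → f ≈ f
  ≈-refl = coeffwise λ _ → refl

  ≈-sym : ∀ {f g} → f ≈ g → g ≈ f
  ≈-sym e = coeffwise λ n → sym (at e n)

  ≈-trans : ∀ {f g h} → f ≈ g → g ≈ h → f ≈ h
  ≈-trans e e′ = coeffwise λ n → trans (at e n) (at e′ n)

  opaque
    unfolding _⊕_ _⊛_

    ⊕-cong : ∀ {f f′ g g′} → f ≈ f′ → g ≈ g′ → f ⊕ g ≈ f′ ⊕ g′
    ⊕-cong e e′ = coeffwise λ n → cong₂ _xor_ (at e n) (at e′ n)

    ⊛-cong≤ : ∀ n {f f′ g g′} → (∀ {i} → i ≤ n → f i ≡ f′ i) → (∀ {i} → i ≤ n → g i ≡ g′ i) →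
              (f ⊛ g) n ≡ (f′ ⊛ g′) n
    ⊛-cong≤ zero    e e′ = cong₂ _∧_ (e z≤n) (e′ z≤n)
    ⊛-cong≤ (suc n) e e′ = cong₂ _xor_ (cong₂ _∧_ (e z≤n) (e′ ≤-refl))
      (⊛-cong≤ n (λ i≤n → e (s≤s i≤n)) (λ i≤n → e′ (m≤n⇒m≤1+n i≤n)))

    ⊛-cong : ∀ {f f′ g g′} → f ≈ f′ → g ≈ g′ → f ⊛ g ≈ f′ ⊛ g′
    ⊛-cong e e′ = coeffwise λ n → ⊛-cong≤ n (λ {i} _ → at e i) (λ {i} _ → at e′ i)

    private
      swap₄ : ∀ a b c d → (a xor b) xor (c xor d) ≡ (a xor c) xor (b xor d)
      swap₄ = solve 4 (λ a b c d → (a :+ b) :+ (c :+ d) := (a :+ c) :+ (b :+ d)) refl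
        where open xor-∧-Solver

    ⊛-distribʳ : ∀ h f g → (f ⊕ g) ⊛ h ≈ (f ⊛ h) ⊕ (g ⊛ h)
    ⊛-distribʳ h f g = coeffwise (go f g)
      where
      go : ∀ f g n → ((f ⊕ g) ⊛ h) n ≡ ((f ⊛ h) ⊕ (g ⊛ h)) n
      go f g zero    = ∧-distribʳ-xor (h 0) (f 0) (g 0)
      go f g (suc n) = trans
        (cong₂ _xor_ (∧-distribʳ-xor (h (suc n)) (f 0) (g 0)) (go (tl f) (tl g) n))
        (swap₄ (f 0 ∧ h (suc n)) (g 0 ∧ h (suc n)) _ _)

    ⊛-distribˡ : ∀ h f g → h ⊛ (f ⊕ g) ≈ (h ⊛ f) ⊕ (h ⊛ g)
    ⊛-distribˡ h f g = coeffwise (go h)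
      where
      go : ∀ h n → (h ⊛ (f ⊕ g)) n ≡ ((h ⊛ f) ⊕ (h ⊛ g)) n
      go h zero    = ∧-distribˡ-xor (h 0) (f 0) (g 0)
      go h (suc n) = trans
        (cong₂ _xor_ (∧-distribˡ-xor (h 0) (f (suc n)) (g (suc n))) (go (tl h) n))
        (swap₄ (h 0 ∧ f (suc n)) (h 0 ∧ g (suc n)) _ _)

    ⊛-scale : ∀ c f g → scale c f ⊛ g ≈ scale c (f ⊛ g)
    ⊛-scale c f g = coeffwise (go f)
      where
      go : ∀ f n → (scale c f ⊛ g) n ≡ c ∧ (f ⊛ g) n
      go f zero    = ∧-assoc c (f 0) (g 0)
      go f (suc n) = trans (cong₂ _xor_ (∧-assoc c (f 0) (g (suc n))) (go (tl f) n))
        (sym (∧-distribˡ-xor c (f 0 ∧ g (suc n)) _))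

    ⊛-assoc : ∀ f g h → (f ⊛ g) ⊛ h ≈ f ⊛ (g ⊛ h)
    ⊛-assoc f g h = coeffwise (go f)
      where
      go : ∀ f n → ((f ⊛ g) ⊛ h) n ≡ (f ⊛ (g ⊛ h)) n
      go f zero    = ∧-assoc (f 0) (g 0) (h 0)
      go f (suc n) = begin
        ((f 0 ∧ g 0) ∧ h (suc n)) xor (tl (f ⊛ g) ⊛ h) n
          ≡⟨ cong₂ _xor_ (∧-assoc (f 0) (g 0) (h (suc n)))
               (trans (at (⊛-distribʳ h (scale (f 0) (tl g)) (tl f ⊛ g)) n)
                 (cong₂ _xor_ (at (⊛-scale (f 0) (tl g) h) n) (go (tl f) n))) ⟩
        (f 0 ∧ (g 0 ∧ h (suc n))) xor ((f 0 ∧ (tl g ⊛ h) n) xor (tl f ⊛ (g ⊛ h)) n)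
          ≡⟨ solve 4 (λ a b c d → a :* b :+ (a :* c :+ d) := a :* (b :+ c) :+ d) refl
               (f 0) (g 0 ∧ h (suc n)) ((tl g ⊛ h) n) _ ⟩
        (f 0 ∧ (g ⊛ h) (suc n)) xor (tl f ⊛ (g ⊛ h)) n ∎
        where
        open ≡-Reasoning
        open xor-∧-Solver

    -- The same recursion read off from the second factor; commutativity follows by playing the two
    -- recursions against each other.
    ⊛-unfoldʳ : ∀ f g n → (f ⊛ g) (suc n) ≡ (f (suc n) ∧ g 0) xor (f ⊛ tl g) n
    ⊛-unfoldʳ f g zero    = xor-comm (f 0 ∧ g 1) (f 1 ∧ g 0)
    ⊛-unfoldʳ f g (suc n) = trans (cong ((f 0 ∧ g (2 + n)) xor_) (⊛-unfoldʳ (tl f) g n))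
      (solve 3 (λ a b c → a :+ (b :+ c) := b :+ (a :+ c)) refl (f 0 ∧ g (2 + n)) (f (2 + n) ∧ g 0) _)
      where open xor-∧-Solver

    ⊛-comm : ∀ f g → f ⊛ g ≈ g ⊛ f
    ⊛-comm f g = coeffwise (go f g)
      where
      go : ∀ f g n → (f ⊛ g) n ≡ (g ⊛ f) n
      go f g zero    = ∧-comm (f 0) (g 0)
      go f g (suc n) = trans (cong₂ _xor_ (∧-comm (f 0) (g (suc n))) (go (tl f) g n))
        (sym (⊛-unfoldʳ g f n))

    0s-⊛ : ∀ f → 0s ⊛ f ≈ 0s
    0s-⊛ f = coeffwise go
      where
      go : ∀ n → (0s ⊛ f) n ≡ false
      go zero    = refl
      go (suc n) = go n

    1s-⊛ : ∀ f → 1s ⊛ f ≈ f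
    1s-⊛ f = coeffwise go
      where
      go : ∀ n → (1s ⊛ f) n ≡ f n
      go zero    = refl
      go (suc n) = trans (cong (f (suc n) xor_) (at (0s-⊛ f) n)) (xor-identityʳ _)

    ⊛-1s : ∀ f → f ⊛ 1s ≈ f
    ⊛-1s f = ≈-trans (⊛-comm f 1s) (1s-⊛ f)

    ⊕-assoc : ∀ f g h → (f ⊕ g) ⊕ h ≈ f ⊕ (g ⊕ h)
    ⊕-assoc f g h = coeffwise λ n → xor-assoc (f n) (g n) (h n)

    ⊕-comm : ∀ f g → f ⊕ g ≈ g ⊕ f
    ⊕-comm f g = coeffwise λ n → xor-comm (f n) (g n)

    ⊕-identityˡ : ∀ f → 0s ⊕ f ≈ f
    ⊕-identityˡ f = ≈-refl

    ⊕-identityʳ : ∀ f → f ⊕ 0s ≈ f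
    ⊕-identityʳ f = coeffwise λ n → xor-identityʳ (f n)

    ⊕-self : ∀ f → f ⊕ f ≈ 0s
    ⊕-self f = coeffwise λ n → xor-same (f n)

    ⊕-cancel : ∀ f g → f ⊕ g ≈ 0s → f ≈ g
    ⊕-cancel f g e = coeffwise λ n → lem (f n) (g n) (at e n)
      where
      lem : ∀ a b → a xor b ≡ false → a ≡ b
      lem true  true  _ = refl
      lem false false _ = refl

    ⊕-at : ∀ f g n → (f ⊕ g) n ≡ f n xor g n
    ⊕-at f g n = refl

    ⊛-at-0 : ∀ f g → (f ⊛ g) 0 ≡ f 0 ∧ g 0
    ⊛-at-0 f g = refl

  series-ring : CommutativeRing _ _
  series-ring = record
    { Carrier = F₂⟦q⟧ ; _≈_ = _≈_ ; _+_ = _⊕_ ; _*_ = _⊛_ ; -_ = λ f → f ; 0# = 0s ; 1# = 1s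
    ; isCommutativeRing = record
      { isRing = record
        { +-isAbelianGroup = record
          { isGroup = record
            { isMonoid = record
              { isSemigroup = record
                { isMagma = record
                  { isEquivalence = record { refl = ≈-refl ; sym = ≈-sym ; trans = ≈-trans }
                  ; ∙-cong = ⊕-cong }
                ; assoc = ⊕-assoc }
              ; identity = ⊕-identityˡ , ⊕-identityʳ }
            ; inverse = ⊕-self , ⊕-self
            ; ⁻¹-cong = λ e → e }
          ; comm = ⊕-comm }
        ; *-cong = ⊛-cong
        ; *-assoc = ⊛-assoc
        ; *-identity = 1s-⊛ , ⊛-1s
        ; distrib = ⊛-distribˡ , ⊛-distribʳ }
      ; *-comm = ⊛-comm } }

  open CommutativeRing series-ring public using (setoid)

  private
    F₂ : RawRing _ _
    F₂ = CommutativeRing.rawRing xor-∧-commutativeRing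

    const : Bool → F₂⟦q⟧
    const false = 0s
    const true  = 1s

    F₂→series : F₂ -Raw-AlmostCommutative⟶ fromCommutativeRing series-ring
    F₂→series = record
      { ⟦_⟧    = const
      ; +-homo = λ { false b → ≈-sym (⊕-identityˡ _) ; true false → ≈-sym (⊕-identityʳ 1s)
                   ; true true → ≈-sym (⊕-self 1s) }
      ; *-homo = λ { false b → ≈-sym (0s-⊛ _) ; true b → ≈-sym (1s-⊛ _) }
      ; -‿homo = λ { false → ≈-refl ; true → ≈-refl }
      ; 0-homo = ≈-refl
      ; 1-homo = ≈-refl }

    const-≟ : ∀ a b → Maybe (const a ≈ const b)
    const-≟ a b with a Bool.≟ b
    ... | yes refl = just ≈-refl
    ... | no  _    = nothing

  -- Coefficients are taken in the two-element field, so the solver knows x + x = 0 and proves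
  -- identities such as (a + b)² = a² + b² that fail over the integers.
  module Char2Solver = Algebra.Solver.Ring F₂ (fromCommutativeRing series-ring) F₂→series const-≟

  module ≈-Reasoning = SetoidReasoning setoid

  ≈[]-refl : ∀ {f N} → f ≈[ N ] f
  ≈[]-refl = coeffwise< λ _ → refl

  ≈[]-sym : ∀ {f g N} → f ≈[ N ] g → g ≈[ N ] f
  ≈[]-sym e = coeffwise< λ n< → sym (at< e n<)

  ≈[]-trans : ∀ {f g h N} → f ≈[ N ] g → g ≈[ N ] h → f ≈[ N ] h
  ≈[]-trans e e′ = coeffwise< λ n< → trans (at< e n<) (at< e′ n<)

  ≈⇒≈[] : ∀ {f g N} → f ≈ g → f ≈[ N ] g
  ≈⇒≈[] e = coeffwise< λ {n} _ → at e n

  ≈[]⇒≈ : ∀ {f g} → (∀ N → f ≈[ N ] g) → f ≈ g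
  ≈[]⇒≈ e = coeffwise λ n → at< (e (suc n)) ≤-refl

  ≈[]-weaken : ∀ {f g M N} → M ≤ N → f ≈[ N ] g → f ≈[ M ] g
  ≈[]-weaken M≤N e = coeffwise< λ n<M → at< e (≤-trans n<M M≤N)

  opaque
    unfolding _⊕_ _⊛_

    ⊕-cong[] : ∀ {f f′ g g′ N} → f ≈[ N ] f′ → g ≈[ N ] g′ → f ⊕ g ≈[ N ] f′ ⊕ g′
    ⊕-cong[] e e′ = coeffwise< λ n< → cong₂ _xor_ (at< e n<) (at< e′ n<)

    ⊛-cong[] : ∀ {f f′ g g′ N} → f ≈[ N ] f′ → g ≈[ N ] g′ → f ⊛ g ≈[ N ] f′ ⊛ g′
    ⊛-cong[] e e′ = coeffwise< λ {n} n<N → ⊛-cong≤ n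
      (λ i≤n → at< e (≤-<-trans i≤n n<N)) (λ i≤n → at< e′ (≤-<-trans i≤n n<N))

  sh : F₂⟦q⟧ → F₂⟦q⟧
  sh f zero    = false
  sh f (suc n) = f n

  shⁿ : ℕ → F₂⟦q⟧ → F₂⟦q⟧
  shⁿ zero    f = f
  shⁿ (suc k) f = sh (shⁿ k f)

  q^ : ℕ → F₂⟦q⟧
  q^ k = shⁿ k 1s

  sh-cong : ∀ {f g} → f ≈ g → sh f ≈ sh g
  sh-cong e = coeffwise λ { zero → refl ; (suc n) → at e n }

  shⁿ-cong : ∀ k {f g} → f ≈ g → shⁿ k f ≈ shⁿ k g
  shⁿ-cong zero    e = e
  shⁿ-cong (suc k) e = sh-cong (shⁿ-cong k e)

  sh-cong[] : ∀ {f g N} → f ≈[ N ] g → sh f ≈[ suc N ] sh g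
  sh-cong[] e = coeffwise< λ { {zero} _ → refl ; {suc n} (s≤s n<) → at< e n< }

  shⁿ-cong[] : ∀ k {f g N} → f ≈[ N ] g → shⁿ k f ≈[ k + N ] shⁿ k g
  shⁿ-cong[] zero    e = e
  shⁿ-cong[] (suc k) e = sh-cong[] (shⁿ-cong[] k e)

  opaque
    unfolding _⊕_ _⊛_

    sh-⊛ : ∀ f g → sh f ⊛ g ≈ sh (f ⊛ g)
    sh-⊛ f g = coeffwise λ { zero → refl ; (suc n) → refl }

    tl-decomp : ∀ f → f ≈ scale (f 0) 1s ⊕ sh (tl f)
    tl-decomp f = coeffwise λ
      { zero → sym (trans (xor-identityʳ _) (∧-identityʳ (f 0)))
      ; (suc n) → sym (cong (_xor f (suc n)) (∧-zeroʳ (f 0))) }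

    section-⊕ : ∀ k f g → section k (f ⊕ g) ≈ section k f ⊕ section k g
    section-⊕ k f g = coeffwise λ n → refl

  scale-1s-⊛ : ∀ c f → scale c 1s ⊛ f ≈ scale c f
  scale-1s-⊛ c f = ≈-trans (⊛-scale c 1s f) (coeffwise λ n → cong (c ∧_) (at (1s-⊛ f) n))

  shⁿ-⊛ : ∀ k f g → shⁿ k f ⊛ g ≈ shⁿ k (f ⊛ g)
  shⁿ-⊛ zero    f g = ≈-refl
  shⁿ-⊛ (suc k) f g = ≈-trans (sh-⊛ (shⁿ k f) g) (sh-cong (shⁿ-⊛ k f g))

  ⊛-shⁿ : ∀ k f g → f ⊛ shⁿ k g ≈ shⁿ k (f ⊛ g)
  ⊛-shⁿ k f g = ≈-trans (⊛-comm f _) (≈-trans (shⁿ-⊛ k g f) (shⁿ-cong k (⊛-comm g f)))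

  q^-⊛ : ∀ k f → q^ k ⊛ f ≈ shⁿ k f
  q^-⊛ k f = ≈-trans (shⁿ-⊛ k 1s f) (shⁿ-cong k (1s-⊛ f))

  shⁿ-+ : ∀ j k f → shⁿ j (shⁿ k f) ≡ shⁿ (j + k) f
  shⁿ-+ zero    k f = refl
  shⁿ-+ (suc j) k f = cong sh (shⁿ-+ j k f)

  q^-+ : ∀ j k → q^ j ⊛ q^ k ≈ q^ (j + k)
  q^-+ j k = ≈-trans (q^-⊛ j (q^ k)) (coeffwise λ n → cong (λ f → f n) (shⁿ-+ j k 1s))

  q^-≡ : ∀ {j k} → j ≡ k → q^ j ≈ q^ k
  q^-≡ refl = ≈-refl

  shⁿ-at-+ : ∀ k f n → shⁿ k f (k + n) ≡ f n
  shⁿ-at-+ zero    f n = refl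
  shⁿ-at-+ (suc k) f n = shⁿ-at-+ k f n

  shⁿ-at-< : ∀ k f {n} → n < k → shⁿ k f n ≡ false
  shⁿ-at-< (suc k) f {zero}  _         = refl
  shⁿ-at-< (suc k) f {suc n} (s≤s n<k) = shⁿ-at-< k f n<k

  q^-at : ∀ k n → q^ k n ≡ (k ≡ᵇ n)
  q^-at zero    zero    = refl
  q^-at zero    (suc n) = refl
  q^-at (suc k) zero    = refl
  q^-at (suc k) (suc n) = q^-at k n

  q^-cong[] : ∀ k {f g N} → f ≈[ N ] g → q^ k ⊛ f ≈[ k + N ] q^ k ⊛ g
  q^-cong[] k e = ≈[]-trans (≈⇒≈[] (q^-⊛ k _)) (≈[]-trans (shⁿ-cong[] k e) (≈⇒≈[] (≈-sym (q^-⊛ k _))))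

  -- With u = 1 + q t, the difference d of `f` and `g` satisfies d = q t d, so each pass through
  -- this equation gains one place and d vanishes to every order.
  ⊛-cancelˡ : ∀ {u f g} → u 0 ≡ true → u ⊛ f ≈ u ⊛ g → f ≈ g
  ⊛-cancelˡ {u} {f} {g} u₀ e = ⊕-cancel f g (≈[]⇒≈ go)
    where
    d = f ⊕ g
    ud≈0 : u ⊛ d ≈ 0s
    ud≈0 = ≈-trans (⊛-distribˡ u f g) (≈-trans (⊕-cong e ≈-refl) (⊕-self (u ⊛ g)))
    d≈ : d ≈ sh (tl u ⊛ d)
    d≈ = ⊕-cancel d _ (≈-trans (≈-sym step) ud≈0)
      where
      step : u ⊛ d ≈ d ⊕ sh (tl u ⊛ d)
      step = ≈-trans (⊛-cong (tl-decomp u) ≈-refl) (≈-trans (⊛-distribʳ d _ _)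
        (⊕-cong (≈-trans (scale-1s-⊛ (u 0) d) (coeffwise λ n → cong (_∧ d n) u₀))
                (sh-⊛ (tl u) d)))
    go : ∀ N → d ≈[ N ] 0s
    go zero    = coeffwise< λ ()
    go (suc N) = ≈[]-trans (≈⇒≈[] d≈) (≈[]-trans
      (sh-cong[] (≈[]-trans (⊛-cong[] ≈[]-refl (go N)) (≈⇒≈[] (≈-trans (⊛-comm (tl u) 0s) (0s-⊛ (tl u))))))
      (coeffwise< λ { {zero} _ → refl ; {suc n} _ → refl }))

  -- 1/(1 - q t) as the limit of the iterates of g ↦ 1 + q t g
  private
    approx : F₂⟦q⟧ → ℕ → F₂⟦q⟧
    approx t zero    = 0s
    approx t (suc N) = 1s ⊕ sh (t ⊛ approx t N)

  opaque
    inv : F₂⟦q⟧ → F₂⟦q⟧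
    inv u n = approx (tl u) (suc n) n

  approx-step : ∀ t N → approx t (suc N) ≈[ N ] approx t N
  approx-step t zero    = coeffwise< λ ()
  approx-step t (suc N) = ⊕-cong[] {1s} ≈[]-refl (sh-cong[] (⊛-cong[] {t} ≈[]-refl (approx-step t N)))

  limit : ∀ (F : ℕ → F₂⟦q⟧) → (∀ N → F (suc N) ≈[ N ] F N) → ∀ d {N} → F (d + N) ≈[ N ] F N
  limit F step zero    = ≈[]-refl
  limit F step (suc d) {N} = ≈[]-trans (≈[]-weaken (m≤n+m N d) (step (d + N))) (limit F step d)

  -- Coefficient n no longer changes from index n + 1 on, so the diagonal is the limit of the
  -- sequence.
  diagonal : ∀ (F : ℕ → F₂⟦q⟧) → (∀ N → F (suc N) ≈[ N ] F N) → ∀ N → (λ n → F (suc n) n) ≈[ N ] F N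
  diagonal F step N = coeffwise< λ {n} n<N →
    sym (trans (cong (λ M → F M n) (sym (m∸n+n≡m n<N))) (at< (limit F step (N ∸ suc n) {suc n}) ≤-refl))

  opaque
    unfolding inv

    inv-inverseʳ : ∀ u → u 0 ≡ true → u ⊛ inv u ≈ 1s
    inv-inverseʳ u u₀ = ≈[]⇒≈ λ N → begin[ N ]
      where
      t : F₂⟦q⟧
      t = tl u
      u≈ : u ≈ 1s ⊕ sh t
      u≈ = ≈-trans (tl-decomp u) (⊕-cong (coeffwise λ n → cong (_∧ 1s n) u₀) ≈-refl)
      begin[_] : ∀ N → u ⊛ inv u ≈[ N ] 1s
      begin[ N ] = ≈[]-trans (⊛-cong[] ≈[]-refl (≈[]-weaken (n≤1+n N) (diagonal (approx t) (approx-step t) (suc N))))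
        (≈[]-trans (≈⇒≈[] (≈-trans (⊛-cong u≈ ≈-refl) (≈-trans (⊛-distribʳ _ 1s (sh t))
            (⊕-cong (1s-⊛ _) (sh-⊛ t _)))))
        (≈[]-trans (⊕-cong[] ≈[]-refl (≈[]-weaken (n≤1+n N) (sh-cong[] (⊛-cong[] ≈[]-refl (approx-step t N)))))
        (≈⇒≈[] (≈-trans (⊕-assoc 1s _ _) (≈-trans (⊕-cong ≈-refl (⊕-self _)) (⊕-identityʳ 1s))))))

  -- The substitution q ↦ q^(1+k)

  mutual
    sub : ℕ → F₂⟦q⟧ → F₂⟦q⟧
    sub k f zero    = f 0
    sub k f (suc n) = sub-wait k k (tl f) n

    -- `c` counts the zeros still to be emitted before the next coefficient of `f`; in this way no
    -- index is ever divided by k + 1.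
    sub-wait : ℕ → ℕ → F₂⟦q⟧ → F₂⟦q⟧
    sub-wait k zero    f n       = sub k f n
    sub-wait k (suc c) f zero    = false
    sub-wait k (suc c) f (suc n) = sub-wait k c f n

  sub-wait-shⁿ : ∀ k c f → sub-wait k c f ≈ shⁿ c (sub k f)
  sub-wait-shⁿ k zero    f = ≈-refl
  sub-wait-shⁿ k (suc c) f = coeffwise λ { zero → refl ; (suc n) → at (sub-wait-shⁿ k c f) n }

  tl-sub : ∀ k f → tl (sub k f) ≈ shⁿ k (sub k (tl f))
  tl-sub k f = sub-wait-shⁿ k k (tl f)

  sub-decomp : ∀ k f → sub k f ≈ scale (f 0) 1s ⊕ shⁿ (suc k) (sub k (tl f))
  sub-decomp k f = ≈-trans (tl-decomp (sub k f)) (⊕-cong ≈-refl (sh-cong (tl-sub k f)))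

  mutual
    sub-cong : ∀ k {f g} → f ≈ g → sub k f ≈ sub k g
    sub-cong k e = coeffwise λ n → sub-cong′ k e n

    private
      sub-cong′ : ∀ k {f g} → f ≈ g → ∀ n → sub k f n ≡ sub k g n
      sub-cong′ k e zero    = at e 0
      sub-cong′ k e (suc n) = sub-wait-cong k k (coeffwise λ m → at e (suc m)) n

      sub-wait-cong : ∀ k c {f g} → f ≈ g → ∀ n → sub-wait k c f n ≡ sub-wait k c g n
      sub-wait-cong k zero    e n       = sub-cong′ k e n
      sub-wait-cong k (suc c) e zero    = refl
      sub-wait-cong k (suc c) e (suc n) = sub-wait-cong k c e n

  opaque
    unfolding _⊕_

    mutual
      sub-⊕′ : ∀ k f g n → sub k (f ⊕ g) n ≡ sub k f n xor sub k g n
      sub-⊕′ k f g zero    = refl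
      sub-⊕′ k f g (suc n) = sub-wait-⊕ k k (tl f) (tl g) n

      sub-wait-⊕ : ∀ k c f g n → sub-wait k c (f ⊕ g) n ≡ sub-wait k c f n xor sub-wait k c g n
      sub-wait-⊕ k zero    f g n       = sub-⊕′ k f g n
      sub-wait-⊕ k (suc c) f g zero    = refl
      sub-wait-⊕ k (suc c) f g (suc n) = sub-wait-⊕ k c f g n

    sub-⊕ : ∀ k f g → sub k (f ⊕ g) ≈ sub k f ⊕ sub k g
    sub-⊕ k f g = coeffwise (sub-⊕′ k f g)

  mutual
    private
      sub-0s′ : ∀ k n → sub k 0s n ≡ false
      sub-0s′ k zero    = refl
      sub-0s′ k (suc n) = sub-wait-0s k k n

      sub-wait-0s : ∀ k c n → sub-wait k c 0s n ≡ false
      sub-wait-0s k zero    n       = sub-0s′ k n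
      sub-wait-0s k (suc c) zero    = refl
      sub-wait-0s k (suc c) (suc n) = sub-wait-0s k c n

  sub-0s : ∀ k → sub k 0s ≈ 0s
  sub-0s k = coeffwise (sub-0s′ k)

  sub-scale : ∀ k c f → sub k (scale c f) ≈ scale c (sub k f)
  sub-scale k false f = sub-0s k
  sub-scale k true  f = ≈-refl

  sub-sh : ∀ k f → sub k (sh f) ≈ shⁿ (suc k) (sub k f)
  sub-sh k f = ≈-trans (sub-decomp k (sh f))
    (≈-trans (⊕-cong {g = shⁿ (suc k) (sub k f)} (coeffwise λ _ → refl) ≈-refl) (⊕-identityˡ _))

  sub-⊛ : ∀ k f g → sub k (f ⊛ g) ≈ sub k f ⊛ sub k g
  sub-⊛ k f g = ≈[]⇒≈ λ N → go N f g
    where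
    go : ∀ N f g → sub k (f ⊛ g) ≈[ N ] sub k f ⊛ sub k g
    go zero    f g = coeffwise< λ ()
    go (suc N) f g = ≈[]-trans (≈⇒≈[] expandˡ) (≈[]-trans
      (⊕-cong[] (≈[]-refl {f = scale (f 0) (sub k g)})
        (≈[]-weaken (s≤s (m≤n+m N k)) (shⁿ-cong[] (suc k) (go N (tl f) g)))) (≈⇒≈[] (≈-sym expandʳ)))
      where
      c = f 0
      t = tl f
      fg = f ⊛ g
      expandʳ : sub k f ⊛ sub k g ≈ scale c (sub k g) ⊕ shⁿ (suc k) (sub k t ⊛ sub k g)
      expandʳ = ≈-trans (⊛-cong (sub-decomp k f) ≈-refl) (≈-trans (⊛-distribʳ (sub k g) _ _)
        (⊕-cong (scale-1s-⊛ c (sub k g))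
                (shⁿ-⊛ (suc k) (sub k t) (sub k g))))
      expandˡ : sub k fg ≈ scale c (sub k g) ⊕ shⁿ (suc k) (sub k (t ⊛ g))
      expandˡ = begin
        sub k fg
          ≈⟨ sub-cong k (≈-trans (⊛-cong (tl-decomp f) ≈-refl) (≈-trans (⊛-distribʳ g _ _)
               (⊕-cong (scale-1s-⊛ c g) (sh-⊛ t g)))) ⟩
        sub k (scale c g ⊕ sh (t ⊛ g))
          ≈⟨ sub-⊕ k (scale c g) (sh (t ⊛ g)) ⟩
        sub k (scale c g) ⊕ sub k (sh (t ⊛ g))
          ≈⟨ ⊕-cong (sub-scale k c g) (sub-sh k (t ⊛ g)) ⟩
        scale c (sub k g) ⊕ shⁿ (suc k) (sub k (t ⊛ g)) ∎
        where open ≈-Reasoning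

  sub-1s : ∀ k → sub k 1s ≈ 1s
  sub-1s k = coeffwise λ { zero → refl ; (suc n) → sub-wait-0s k k n }

  sub-shⁿ : ∀ k j f → sub k (shⁿ j f) ≈ shⁿ (j * suc k) (sub k f)
  sub-shⁿ k zero    f = ≈-refl
  sub-shⁿ k (suc j) f = ≈-trans (sub-sh k (shⁿ j f)) (≈-trans (shⁿ-cong (suc k) (sub-shⁿ k j f))
    (coeffwise λ n → cong (λ g → g n) (shⁿ-+ (suc k) (j * suc k) (sub k f))))

  sub-q^ : ∀ k j → sub k (q^ j) ≈ q^ (j * suc k)
  sub-q^ k j = ≈-trans (sub-shⁿ k j 1s) (shⁿ-cong (j * suc k) (sub-1s k))

  sub-cong[] : ∀ k {N f g} → f ≈[ N ] g → sub k f ≈[ N ] sub k g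
  sub-cong[] k {zero}  e = coeffwise< λ ()
  sub-cong[] k {suc N} {f} {g} e = ≈[]-trans (≈⇒≈[] (sub-decomp k f)) (≈[]-trans
    (⊕-cong[] (coeffwise< λ {n} _ → cong (_∧ 1s n) (at< e z<s))
      (≈[]-weaken (s≤s (m≤n+m N k)) (shⁿ-cong[] (suc k) (sub-cong[] k {N} (coeffwise< λ n< → at< e (s≤s n<))))))
    (≈⇒≈[] (≈-sym (sub-decomp k g))))

  sub-sub : ∀ j k f → sub j (sub k f) ≈ sub (j + k * suc j) f
  sub-sub j k f = ≈[]⇒≈ λ N → go N f
    where
    m = j + k * suc j
    go : ∀ N f → sub j (sub k f) ≈[ N ] sub m f
    go zero    f = coeffwise< λ ()
    go (suc N) f = ≈[]-trans (≈⇒≈[] (≈-trans (sub-cong j (sub-decomp k f)) (≈-trans (sub-⊕ j _ _)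
        (⊕-cong (≈-trans (sub-scale j (f 0) 1s) (coeffwise λ n → cong (f 0 ∧_) (at (sub-1s j) n)))
                (sub-shⁿ j (suc k) (sub k (tl f)))))))
      (≈[]-trans (⊕-cong[] (≈[]-refl {f = scale (f 0) 1s})
          (≈[]-weaken (s≤s (m≤n+m N m)) (shⁿ-cong[] (suc m) (go N (tl f)))))
        (≈⇒≈[] (≈-sym (sub-decomp m f))))

  -- In characteristic 2 the cross terms vanish: the square of c + q t is c + q² t², which is also
  -- how `sub 1` unrolls.
  frobenius : ∀ f → sub 1 f ≈ f ⊛ f
  frobenius f = ≈[]⇒≈ λ N → go N f
    where
    go : ∀ N f → sub 1 f ≈[ N ] f ⊛ f
    go zero    f = coeffwise< λ ()
    go (suc N) f = ≈[]-trans (≈⇒≈[] (sub-decomp 1 f)) (≈[]-trans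
      (⊕-cong[] ≈[]-refl (≈[]-weaken (s≤s (n≤1+n N)) (shⁿ-cong[] 2 (go N (tl f)))))
      (≈⇒≈[] (≈-sym square)))
      where
      t = tl f
      e = scale (f 0) 1s
      idem : e ⊛ e ≈ e
      idem = ≈-trans (scale-1s-⊛ (f 0) e) (coeffwise λ n →
        trans (sym (∧-assoc (f 0) (f 0) (1s n))) (cong (_∧ 1s n) (∧-idem (f 0))))
      square : f ⊛ f ≈ e ⊕ shⁿ 2 (t ⊛ t)
      square = ≈-trans (⊛-cong (tl-decomp f) (tl-decomp f)) (≈-trans
        (solve 2 (λ a b → (a :+ b) :* (a :+ b) := a :* a :+ b :* b) ≈-refl e (sh t))
        (⊕-cong idem (≈-trans (sh-⊛ t (sh t)) (sh-cong (⊛-shⁿ 1 t t)))))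
        where open Char2Solver

  -- The section f ↦ Σ f(kn) q^n

  section-cong : ∀ k {f g} → f ≈ g → section k f ≈ section k g
  section-cong k e = coeffwise λ n → at e (n * k)

  section-shⁿ : ∀ k f → section (suc k) (shⁿ (suc k) f) ≈ sh (section (suc k) f)
  section-shⁿ k f = coeffwise λ { zero → refl ; (suc n) → shⁿ-at-+ (suc k) f (n * suc k) }

  -- Sections are linear over series in q^(k+1). A multiplier that is such a series passes through,
  -- after which residue classes of exponents can be read off.
  section-sub-⊛ : ∀ k f g → section (suc k) (sub k f ⊛ g) ≈ f ⊛ section (suc k) g
  section-sub-⊛ k f g = ≈[]⇒≈ λ N → go N f
    where
    S = section (suc k)
    go : ∀ N f → S (sub k f ⊛ g) ≈[ N ] f ⊛ S g
    go zero    f = coeffwise< λ ()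
    go (suc N) f = ≈[]-trans (≈⇒≈[] expandˡ) (≈[]-trans
      (⊕-cong[] (≈[]-refl {f = scale c (S g)}) (sh-cong[] (go N t))) (≈⇒≈[] (≈-sym expandʳ)))
      where
      c = f 0
      t = tl f
      expandʳ : f ⊛ S g ≈ scale c (S g) ⊕ sh (t ⊛ S g)
      expandʳ = ≈-trans (⊛-cong (tl-decomp f) ≈-refl) (≈-trans (⊛-distribʳ (S g) _ _)
        (⊕-cong (scale-1s-⊛ c (S g)) (sh-⊛ t (S g))))
      expandˡ : S (sub k f ⊛ g) ≈ scale c (S g) ⊕ sh (S (sub k t ⊛ g))
      expandˡ = ≈-trans (section-cong (suc k)
          (≈-trans (⊛-cong (sub-decomp k f) ≈-refl) (≈-trans (⊛-distribʳ g _ _)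
            (⊕-cong (scale-1s-⊛ c g)
                    (shⁿ-⊛ (suc k) (sub k t) g)))))
        (≈-trans (section-⊕ (suc k) (scale c g) _) (⊕-cong (≈-refl {f = scale c (S g)}) (section-shⁿ k (sub k t ⊛ g))))

  sub-at-* : ∀ k f n → sub k f (n * suc k) ≡ f n
  sub-at-* k f n = trans (at (section-cong (suc k) (≈-sym (⊛-1s (sub k f)))) n)
    (trans (at (section-sub-⊛ k f 1s) n) (trans (⊛-cong≤ n (λ _ → refl) (λ {i} _ → sec1 i)) (at (⊛-1s f) n)))
    where
    sec1 : ∀ i → 1s (i * suc k) ≡ 1s i
    sec1 zero    = refl
    sec1 (suc i) = refl

  sub-at-< : ∀ k f n {r} → suc r ≤ k → sub k f (suc r + n * suc k) ≡ false
  sub-at-< k f n {r} r<k = trans (at (tl-sub k f) (r + n * suc k)) (go n f)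
    where
    go : ∀ n f → shⁿ k (sub k (tl f)) (r + n * suc k) ≡ false
    go zero    f = shⁿ-at-< k _ (subst (_< k) (sym (+-identityʳ r)) r<k)
    go (suc n) f = trans (cong (shⁿ k (sub k (tl f))) eq)
      (trans (shⁿ-at-+ k (sub k (tl f)) (suc (r + n * suc k))) (trans (at (tl-sub k (tl f)) (r + n * suc k)) (go n (tl f))))
      where
      eq : r + (suc k + n * suc k) ≡ k + suc (r + n * suc k)
      eq = trans (sym (+-assoc r (suc k) _)) (trans (cong (_+ n * suc k) (trans (+-suc r k) (cong suc (+-comm r k))))
        (trans (cong suc (+-assoc k r _)) (sym (+-suc k _))))

-- The Jacobi triple product modulo 2

module Theta where

  open Series
  open import Data.Bool.Base using (true)
  open import Data.Nat.Base
  open import Data.Nat.Properties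
  open import Data.Nat.Tactic.RingSolver using (solve-∀)
  open import Relation.Binary.PropositionalEquality hiding (setoid)
  open Char2Solver using (solve; _:+_; _:*_; _:=_; con)

  -- ∏_{i<n} (1 + q^(ik+u)) and its limit

  progression-product< : ℕ → ℕ → ℕ → F₂⟦q⟧
  progression-product< k u zero    = 1s
  progression-product< k u (suc n) = progression-product< k u n ⊛ (1s ⊕ q^ (n * k + u))

  progression-product : ℕ → ℕ → F₂⟦q⟧
  progression-product k u n = progression-product< k u (suc n) n

  q^-≈0 : ∀ k → q^ k ≈[ k ] 0s
  q^-≈0 k = coeffwise< (shⁿ-at-< k 1s)

  1⊕q^-≈1 : ∀ k → 1s ⊕ q^ k ≈[ k ] 1s
  1⊕q^-≈1 k = ≈[]-trans (⊕-cong[] ≈[]-refl (q^-≈0 k)) (≈⇒≈[] (⊕-identityʳ 1s))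

  module _ (k u : ℕ) .{{_ : NonZero k}} .{{_ : NonZero u}} where
    private
      order : ∀ n → n ≤ n * k + u
      order n = ≤-trans (m≤m*n n k) (m≤m+n (n * k) u)

    progression-product<-step : ∀ n → progression-product< k u (suc n) ≈[ n ] progression-product< k u n
    progression-product<-step n = ≈[]-trans
      (⊛-cong[] ≈[]-refl (≈[]-weaken (order n) (1⊕q^-≈1 (n * k + u)))) (≈⇒≈[] (⊛-1s _))

    progression-product-≈[] : ∀ N → progression-product k u ≈[ N ] progression-product< k u N
    progression-product-≈[] = diagonal (progression-product< k u) progression-product<-step

  ap-0 : ∀ k u .{{_ : NonZero u}} n → progression-product< k u n 0 ≡ true
  ap-0 k u       zero    = refl
  ap-0 k (suc u) (suc n) = trans (⊛-at-0 (progression-product< k (suc u) n) _)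
    (cong₂ Data.Bool.Base._∧_ (ap-0 k (suc u) n)
      (trans (⊕-at 1s _ 0) (cong (true Data.Bool.Base.xor_) (cong (λ m → q^ m 0) (+-suc (n * k) u)))))

  Σ≤ : ℕ → (ℕ → F₂⟦q⟧) → F₂⟦q⟧
  Σ≤ zero    F = F 0
  Σ≤ (suc N) F = Σ≤ N F ⊕ F (suc N)

  Σ≤-cong : ∀ N {F G} → (∀ {i} → i ≤ N → F i ≈ G i) → Σ≤ N F ≈ Σ≤ N G
  Σ≤-cong zero    e = e z≤n
  Σ≤-cong (suc N) e = ⊕-cong (Σ≤-cong N (λ i≤N → e (m≤n⇒m≤1+n i≤N))) (e ≤-refl)

  Σ≤-cong[] : ∀ N {F G M} → (∀ {i} → i ≤ N → F i ≈[ M ] G i) → Σ≤ N F ≈[ M ] Σ≤ N G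
  Σ≤-cong[] zero    e = e z≤n
  Σ≤-cong[] (suc N) e = ⊕-cong[] (Σ≤-cong[] N (λ i≤N → e (m≤n⇒m≤1+n i≤N))) (e ≤-refl)

  Σ≤-unfoldˡ : ∀ N F → Σ≤ (suc N) F ≈ F 0 ⊕ Σ≤ N (λ i → F (suc i))
  Σ≤-unfoldˡ zero    F = ≈-refl
  Σ≤-unfoldˡ (suc N) F = ≈-trans (⊕-cong (Σ≤-unfoldˡ N F) ≈-refl) (⊕-assoc (F 0) _ _)

  Σ≤-⊛ : ∀ N g F → g ⊛ Σ≤ N F ≈ Σ≤ N (λ i → g ⊛ F i)
  Σ≤-⊛ zero    g F = ≈-refl
  Σ≤-⊛ (suc N) g F = ≈-trans (⊛-distribˡ g _ _) (⊕-cong (Σ≤-⊛ N g F) ≈-refl)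

  Σ≤-⊕ : ∀ N F G → Σ≤ N (λ i → F i ⊕ G i) ≈ Σ≤ N F ⊕ Σ≤ N G
  Σ≤-⊕ zero    F G = ≈-refl
  Σ≤-⊕ (suc N) F G = ≈-trans (⊕-cong (Σ≤-⊕ N F G) ≈-refl)
    (solve 4 (λ a b c d → (a :+ b) :+ (c :+ d) := (a :+ c) :+ (b :+ d)) ≈-refl (Σ≤ N F) (Σ≤ N G) (F (suc N)) (G (suc N)))

  -- pent u v j = (u+v) j(j-1)/2 + u j; at -j it takes the value pent v u j.

  pent : ℕ → ℕ → ℕ → ℕ
  pent u v zero    = 0
  pent u v (suc j) = (u + j * (u + v)) + pent u v j

  pent-≥ : ∀ u v .{{_ : NonZero u}} j → j ≤ pent u v j
  pent-≥ u v zero    = z≤n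
  pent-≥ (suc u) v (suc j) = s≤s (≤-trans (pent-≥ (suc u) v j) (m≤n+m _ (u + j * (suc u + v))))

  -- the bilateral partial sums Σ_{-N≤j≤N} q^(exponent j)

  bilateral : (ℕ → ℕ) → (ℕ → ℕ) → ℕ → F₂⟦q⟧
  bilateral p m zero    = q^ (p 0)
  bilateral p m (suc N) = bilateral p m N ⊕ (q^ (p (suc N)) ⊕ q^ (m (suc N)))

  -- Ramanujan's theta function f(q^u, q^v) modulo 2. For positive u and v the exponents at j and -j
  -- are at least j, so coefficient n is settled by the partial sum of index n + 1.
  theta : ℕ → ℕ → F₂⟦q⟧
  theta u v n = bilateral (pent u v) (pent v u) (suc n) n

  bilateral-step : ∀ p m → (∀ j → j ≤ p j) → (∀ j → j ≤ m j) → ∀ N → bilateral p m (suc N) ≈[ suc N ] bilateral p m N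
  bilateral-step p m p≥ m≥ N = ≈[]-trans (⊕-cong[] ≈[]-refl (≈[]-trans
    (⊕-cong[] (≈[]-weaken (p≥ (suc N)) (q^-≈0 _)) (≈[]-weaken (m≥ (suc N)) (q^-≈0 _))) (≈⇒≈[] (⊕-identityʳ 0s))))
    (≈⇒≈[] (⊕-identityʳ _))

  theta-≈[] : ∀ u v .{{_ : NonZero u}} .{{_ : NonZero v}} N →
              theta u v ≈[ N ] bilateral (pent u v) (pent v u) N
  theta-≈[] u v = diagonal _ λ N → ≈[]-weaken (n≤1+n N)
    (bilateral-step (pent u v) (pent v u) (pent-≥ u v) (pent-≥ v u) N)

  theta-0 : ∀ u v .{{_ : NonZero u}} .{{_ : NonZero v}} → theta u v 0 ≡ true
  theta-0 u v = at< (bilateral-step (pent u v) (pent v u) (pent-≥ u v) (pent-≥ v u) 0) z<s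

  private
    ring₁ : ∀ N d → N + (d + N) ≡ d + (N + N)
    ring₁ = solve-∀
    ring₂ : ∀ u v a p → v + ((u + a) + p) ≡ (u + v + a) + p
    ring₂ = solve-∀
    ring₃ : ∀ k c v p → (k + c + v) + p ≡ k + ((c + v) + p)
    ring₃ = solve-∀
    ring₄ : ∀ d i k u p → ((d + i) * k + u) + p ≡ d * k + ((u + i * k) + p)
    ring₄ = solve-∀
    ring₅ : ∀ a b u v p → (a * (u + v) + u) + ((v + b * (v + u)) + p) ≡ (a + suc b) * (u + v) + p
    ring₅ = solve-∀

  module JacobiTripleProduct (u v : ℕ) .{{_ : NonZero u}} .{{_ : NonZero v}} where

    private
      k = u + v
      instance
        k≢0 : NonZero k
        k≢0 = >-nonZero (≤-trans (>-nonZero⁻¹ u) (m≤m+n u v))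

      Q^ : ℕ → F₂⟦q⟧
      Q^ i = q^ (i * k)

      ⟨Q⟩ : ℕ → F₂⟦q⟧
      ⟨Q⟩ = progression-product< k k

      ⟨Q⟩-suc : ∀ i → ⟨Q⟩ (suc i) ≈ ⟨Q⟩ i ⊛ (1s ⊕ Q^ (suc i))
      ⟨Q⟩-suc i = ⊛-cong ≈-refl (⊕-cong ≈-refl (q^-≡ (+-comm (i * k) k)))

      -- The reciprocal of (Q; Q)_i, so that `⟨Q⟩ N ⊛ h i ⊛ h (N ∸ i)` is a Gaussian binomial
      -- coefficient.
      h : ℕ → F₂⟦q⟧
      h i = inv (⟨Q⟩ i)

      ⟨Q⟩-h : ∀ i → ⟨Q⟩ i ⊛ h i ≈ 1s
      ⟨Q⟩-h i = inv-inverseʳ (⟨Q⟩ i) (ap-0 k k i)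

      h-suc : ∀ i → (1s ⊕ Q^ (suc i)) ⊛ h (suc i) ≈ h i
      h-suc i = ⊛-cancelˡ (ap-0 k k i) (begin
        ⟨Q⟩ i ⊛ ((1s ⊕ Q^ (suc i)) ⊛ h (suc i)) ≈⟨ ⊛-assoc _ _ _ ⟨
        ⟨Q⟩ i ⊛ (1s ⊕ Q^ (suc i)) ⊛ h (suc i)   ≈⟨ ⊛-cong (⟨Q⟩-suc i) ≈-refl ⟨
        ⟨Q⟩ (suc i) ⊛ h (suc i)                 ≈⟨ ⟨Q⟩-h (suc i) ⟩
        1s                                       ≈⟨ ⟨Q⟩-h i ⟨
        ⟨Q⟩ i ⊛ h i                             ∎)
        where open ≈-Reasoning

      -- the exponent of index i - b
      e : ℕ → ℕ → ℕ
      e zero    i       = pent u v i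
      e (suc b) zero    = pent v u (suc b)
      e (suc b) (suc i) = e b i

      e-0 : ∀ b → e b 0 ≡ pent v u b
      e-0 zero    = refl
      e-0 (suc b) = refl

      H : ℕ → ℕ → F₂⟦q⟧
      H b N = Σ≤ N (λ i → h i ⊛ h (N ∸ i) ⊛ q^ (e b i))

      ⟨0⟩ : 1s ⊕ Q^ 0 ≈ 0s
      ⟨0⟩ = ⊕-self 1s

      -- Both recursions split 1 + Q^(N+1) so that each half lowers one of the two indices
      -- of h i h (N+1-i), the boundary terms being killed by 1 + Q^0 = 0.
      drop-first : ∀ N (G : ℕ → F₂⟦q⟧) →
        Σ≤ (suc N) (λ i → ((1s ⊕ Q^ i) ⊛ h i) ⊛ G i) ≈ Σ≤ N (λ i → h i ⊛ G (suc i))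
      drop-first N G = ≈-trans (Σ≤-unfoldˡ N _) (≈-trans
        (⊕-cong (≈-trans (⊛-cong (≈-trans (⊛-cong ⟨0⟩ ≈-refl) (0s-⊛ _)) ≈-refl) (0s-⊛ _))
                (Σ≤-cong N (λ {i} _ → ⊛-cong (h-suc i) ≈-refl)))
        (⊕-identityˡ _))

      drop-last : ∀ N (G : ℕ → F₂⟦q⟧) →
        Σ≤ (suc N) (λ i → ((1s ⊕ Q^ (suc N ∸ i)) ⊛ h (suc N ∸ i)) ⊛ G i) ≈ Σ≤ N (λ i → h (N ∸ i) ⊛ G i)
      drop-last N G = ≈-trans (⊕-cong
        (Σ≤-cong N (λ {i} i≤N → ⊛-cong (≈-trans (reindex (+-∸-assoc 1 i≤N)) (h-suc (N ∸ i))) ≈-refl))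
        (≈-trans (⊛-cong (≈-trans (reindex (n∸n≡0 N)) (≈-trans (⊛-cong ⟨0⟩ ≈-refl) (0s-⊛ _))) ≈-refl) (0s-⊛ _)))
        (⊕-identityʳ _)
        where
        reindex : ∀ {i j} → i ≡ j → (1s ⊕ Q^ i) ⊛ h i ≈ (1s ⊕ Q^ j) ⊛ h j
        reindex refl = ≈-refl

      split : ∀ {i M} → i ≤ M → 1s ⊕ Q^ M ≈ (1s ⊕ Q^ i) ⊕ Q^ i ⊛ (1s ⊕ Q^ (M ∸ i))
      split {i} {M} i≤M = ≈-trans
        (⊕-cong ≈-refl (≈-trans (q^-≡ (trans (cong (_* k) (sym (m+[n∸m]≡n i≤M))) (*-distribʳ-+ k i (M ∸ i)))) (≈-sym (q^-+ (i * k) ((M ∸ i) * k)))))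
        (solve 2 (λ a b → con true :+ a :* b := (con true :+ a) :+ a :* (con true :+ b)) ≈-refl (Q^ i) (Q^ (M ∸ i)))

      split′ : ∀ {i M} → i ≤ M → 1s ⊕ Q^ M ≈ (1s ⊕ Q^ (M ∸ i)) ⊕ Q^ (M ∸ i) ⊛ (1s ⊕ Q^ i)
      split′ {i} {M} i≤M = ≈-trans (split (m∸n≤m M i)) (⊕-cong ≈-refl (⊛-cong ≈-refl (⊕-cong ≈-refl (q^-≡ (cong (_* k) (m∸[m∸n]≡n i≤M))))))

      -- Moving the origin of the index changes the quadratic exponent by a linear term. The
      -- constant part of that term, b k + v, is the exponent in the next factor of the product.
      e-b : ∀ b i → (b * k + v) + e b i ≡ i * k + e (suc b) i
      e-b zero    zero    = sym (+-identityʳ (v + 0))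
      e-b zero    (suc i) = ring₂ u v (i * k) (pent u v i)
      e-b (suc b) zero    = cong (_+ pent v u (suc b))
        (trans (cong (λ m → m + b * m + v) (+-comm u v)) (+-comm ((v + u) + b * (v + u)) v))
      e-b (suc b) (suc i) = trans (ring₃ k (b * k) v (e b i)) (trans (cong (k +_) (e-b b i)) (sym (+-assoc k (i * k) _)))

      e-a : ∀ a b {i} → i ≤ a + b → (a * k + u) + e b i ≡ ((a + b) ∸ i) * k + e b (suc i)
      e-a a zero {i} i≤ = begin
        (a * k + u) + pent u v i                   ≡⟨ cong (λ m → (m * k + u) + pent u v i) (sym (m∸n+n≡m i≤a)) ⟩
        ((a ∸ i + i) * k + u) + pent u v i         ≡⟨ ring₄ (a ∸ i) i k u (pent u v i) ⟩
        (a ∸ i) * k + ((u + i * k) + pent u v i)   ≡⟨ cong (λ m → (m ∸ i) * k + pent u v (suc i)) (sym (+-identityʳ a)) ⟩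
        ((a + 0) ∸ i) * k + pent u v (suc i)       ∎
        where
        open ≡-Reasoning
        i≤a : i ≤ a
        i≤a = subst (i ≤_) (+-identityʳ a) i≤
      e-a a (suc b) {zero} _ = trans (ring₅ a b u v (pent v u b)) (cong ((a + suc b) * k +_) (sym (e-0 b)))
      e-a a (suc b) {suc i} si≤ = subst (λ m → (a * k + u) + e b i ≡ (m ∸ suc i) * k + e b (suc i))
        (sym (+-suc a b)) (e-a a b (s≤s⁻¹ (subst (suc i ≤_) (+-suc a b) si≤)))

      H-b : ∀ b N → (1s ⊕ Q^ (suc N)) ⊛ H (suc b) (suc N) ≈ (1s ⊕ q^ (b * k + v)) ⊛ H b N
      H-b b N = begin
        (1s ⊕ Q^ (suc N)) ⊛ H (suc b) (suc N)
          ≈⟨ Σ≤-⊛ (suc N) _ _ ⟩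
        Σ≤ (suc N) (λ i → (1s ⊕ Q^ (suc N)) ⊛ (h i ⊛ h (suc N ∸ i) ⊛ q^ (e (suc b) i)))
          ≈⟨ Σ≤-cong (suc N) (λ {i} i≤ → ≈-trans (⊛-cong (split i≤) ≈-refl)
               (solve 6 (λ a b c x y z → (a :+ b :* c) :* (x :* y :* z) := (a :* x) :* (y :* z) :+ (c :* y) :* (x :* (b :* z)))
                  ≈-refl (1s ⊕ Q^ i) (Q^ i) (1s ⊕ Q^ (suc N ∸ i)) (h i) (h (suc N ∸ i)) (q^ (e (suc b) i)))) ⟩
        Σ≤ (suc N) (λ i → ((1s ⊕ Q^ i) ⊛ h i) ⊛ (h (suc N ∸ i) ⊛ q^ (e (suc b) i))
                        ⊕ ((1s ⊕ Q^ (suc N ∸ i)) ⊛ h (suc N ∸ i)) ⊛ (h i ⊛ (Q^ i ⊛ q^ (e (suc b) i))))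
          ≈⟨ Σ≤-⊕ (suc N) _ _ ⟩
        _ ≈⟨ ⊕-cong (drop-first N _) (drop-last N _) ⟩
        Σ≤ N (λ i → h i ⊛ (h (N ∸ i) ⊛ q^ (e b i)))
          ⊕ Σ≤ N (λ i → h (N ∸ i) ⊛ (h i ⊛ (Q^ i ⊛ q^ (e (suc b) i))))
          ≈⟨ Σ≤-⊕ N _ _ ⟨
        Σ≤ N (λ i → h i ⊛ (h (N ∸ i) ⊛ q^ (e b i)) ⊕ h (N ∸ i) ⊛ (h i ⊛ (Q^ i ⊛ q^ (e (suc b) i))))
          ≈⟨ Σ≤-cong N (λ {i} _ → ≈-trans
               (⊕-cong ≈-refl (⊛-cong ≈-refl (⊛-cong ≈-refl (≈-trans (q^-+ (i * k) (e (suc b) i)) (≈-trans (q^-≡ (sym (e-b b i))) (≈-sym (q^-+ (b * k + v) (e b i))))))))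
               (solve 4 (λ x y z w → x :* (y :* z) :+ y :* (x :* (w :* z)) := (con true :+ w) :* (x :* y :* z))
                 ≈-refl (h i) (h (N ∸ i)) (q^ (e b i)) (q^ (b * k + v)))) ⟩
        Σ≤ N (λ i → (1s ⊕ q^ (b * k + v)) ⊛ (h i ⊛ h (N ∸ i) ⊛ q^ (e b i)))
          ≈⟨ Σ≤-⊛ N _ _ ⟨
        (1s ⊕ q^ (b * k + v)) ⊛ H b N ∎
        where open ≈-Reasoning

      H-a : ∀ a b → (1s ⊕ Q^ (suc (a + b))) ⊛ H b (suc (a + b)) ≈ (1s ⊕ q^ (a * k + u)) ⊛ H b (a + b)
      H-a a b = begin
        (1s ⊕ Q^ (suc N)) ⊛ H b (suc N)
          ≈⟨ Σ≤-⊛ (suc N) _ _ ⟩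
        Σ≤ (suc N) (λ i → (1s ⊕ Q^ (suc N)) ⊛ (h i ⊛ h (suc N ∸ i) ⊛ q^ (e b i)))
          ≈⟨ Σ≤-cong (suc N) (λ {i} i≤ → ≈-trans (⊛-cong (split′ i≤) ≈-refl)
               (solve 6 (λ a b c x y z → (a :+ b :* c) :* (x :* y :* z) := (c :* x) :* (y :* (b :* z)) :+ (a :* y) :* (x :* z))
                  ≈-refl (1s ⊕ Q^ (suc N ∸ i)) (Q^ (suc N ∸ i)) (1s ⊕ Q^ i) (h i) (h (suc N ∸ i)) (q^ (e b i)))) ⟩
        Σ≤ (suc N) (λ i → ((1s ⊕ Q^ i) ⊛ h i) ⊛ (h (suc N ∸ i) ⊛ (Q^ (suc N ∸ i) ⊛ q^ (e b i)))
                        ⊕ ((1s ⊕ Q^ (suc N ∸ i)) ⊛ h (suc N ∸ i)) ⊛ (h i ⊛ q^ (e b i)))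
          ≈⟨ Σ≤-⊕ (suc N) _ _ ⟩
        _ ≈⟨ ⊕-cong (drop-first N _) (drop-last N _) ⟩
        Σ≤ N (λ i → h i ⊛ (h (N ∸ i) ⊛ (Q^ (N ∸ i) ⊛ q^ (e b (suc i)))))
          ⊕ Σ≤ N (λ i → h (N ∸ i) ⊛ (h i ⊛ q^ (e b i)))
          ≈⟨ Σ≤-⊕ N _ _ ⟨
        Σ≤ N (λ i → h i ⊛ (h (N ∸ i) ⊛ (Q^ (N ∸ i) ⊛ q^ (e b (suc i)))) ⊕ h (N ∸ i) ⊛ (h i ⊛ q^ (e b i)))
          ≈⟨ Σ≤-cong N (λ {i} i≤ → ≈-trans
               (⊕-cong (⊛-cong ≈-refl (⊛-cong ≈-refl (≈-trans (q^-+ ((N ∸ i) * k) (e b (suc i))) (≈-trans (q^-≡ (sym (e-a a b i≤))) (≈-sym (q^-+ (a * k + u) (e b i))))))) ≈-refl)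
               (solve 4 (λ x y z w → x :* (y :* (w :* z)) :+ y :* (x :* z) := (con true :+ w) :* (x :* y :* z))
                 ≈-refl (h i) (h (N ∸ i)) (q^ (e b i)) (q^ (a * k + u)))) ⟩
        Σ≤ N (λ i → (1s ⊕ q^ (a * k + u)) ⊛ (h i ⊛ h (N ∸ i) ⊛ q^ (e b i)))
          ≈⟨ Σ≤-⊛ N _ _ ⟨
        (1s ⊕ q^ (a * k + u)) ⊛ H b N ∎
        where
        open ≈-Reasoning
        N = a + b

      -- The finite triple product, that is, the q-binomial theorem. The numbers of factors from the
      -- two progressions are independent, so that factors can be adjoined one at a time.
      finite : ∀ a b → progression-product< k u a ⊛ progression-product< k v b ≈ ⟨Q⟩ (a + b) ⊛ H b (a + b)
      finite zero zero = ⊛-cong ≈-refl (≈-sym (≈-trans (⊛-1s _) (≈-trans (⊛-cong h0 h0) (⊛-1s 1s))))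
        where
        h0 : h 0 ≈ 1s
        h0 = ≈-trans (≈-sym (1s-⊛ _)) (⟨Q⟩-h 0)
      finite zero (suc b) = begin
        1s ⊛ (progression-product< k v b ⊛ y)        ≈⟨ ⊛-assoc _ _ _ ⟨
        1s ⊛ progression-product< k v b ⊛ y          ≈⟨ ⊛-cong (finite zero b) ≈-refl ⟩
        ⟨Q⟩ b ⊛ H b b ⊛ y                            ≈⟨ ≈-trans (⊛-assoc _ _ _) (⊛-cong ≈-refl (⊛-comm _ _)) ⟩
        ⟨Q⟩ b ⊛ (y ⊛ H b b)                          ≈⟨ ⊛-cong ≈-refl (H-b b b) ⟨
        ⟨Q⟩ b ⊛ ((1s ⊕ Q^ (suc b)) ⊛ H (suc b) (suc b)) ≈⟨ ⊛-assoc _ _ _ ⟨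
        ⟨Q⟩ b ⊛ (1s ⊕ Q^ (suc b)) ⊛ H (suc b) (suc b)   ≈⟨ ⊛-cong (⟨Q⟩-suc b) ≈-refl ⟨
        ⟨Q⟩ (suc b) ⊛ H (suc b) (suc b)              ∎
        where
        open ≈-Reasoning
        y = 1s ⊕ q^ (b * k + v)
      finite (suc a) b = begin
        progression-product< k u a ⊛ x ⊛ progression-product< k v b
          ≈⟨ solve 3 (λ p x r → p :* x :* r := p :* r :* x) ≈-refl _ _ _ ⟩
        progression-product< k u a ⊛ progression-product< k v b ⊛ x ≈⟨ ⊛-cong (finite a b) ≈-refl ⟩
        ⟨Q⟩ N ⊛ H b N ⊛ x                            ≈⟨ ≈-trans (⊛-assoc _ _ _) (⊛-cong ≈-refl (⊛-comm _ _)) ⟩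
        ⟨Q⟩ N ⊛ (x ⊛ H b N)                          ≈⟨ ⊛-cong ≈-refl (H-a a b) ⟨
        ⟨Q⟩ N ⊛ ((1s ⊕ Q^ (suc N)) ⊛ H b (suc N))    ≈⟨ ⊛-assoc _ _ _ ⟨
        ⟨Q⟩ N ⊛ (1s ⊕ Q^ (suc N)) ⊛ H b (suc N)      ≈⟨ ⊛-cong (⟨Q⟩-suc N) ≈-refl ⟨
        ⟨Q⟩ (suc N) ⊛ H b (suc N)                    ∎
        where
        open ≈-Reasoning
        N = a + b
        x = 1s ⊕ q^ (a * k + u)

      ⟨Q⟩∞ = progression-product k k

      ⟨Q⟩-stable : ∀ d i → ⟨Q⟩ (d + i) ≈[ i ] ⟨Q⟩ i
      ⟨Q⟩-stable zero    i = ≈[]-refl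
      ⟨Q⟩-stable (suc d) i = ≈[]-trans (≈[]-weaken (m≤n+m i d) (progression-product<-step k k (d + i))) (⟨Q⟩-stable d i)

      ⟨Q⟩h≈1 : ∀ {i M} → i ≤ M → ⟨Q⟩ M ⊛ h i ≈[ i ] 1s
      ⟨Q⟩h≈1 {i} {M} i≤M = ≈[]-trans
        (⊛-cong[] (subst (λ m → ⟨Q⟩ m ≈[ i ] ⟨Q⟩ i) (m∸n+n≡m i≤M) (⟨Q⟩-stable (M ∸ i) i)) ≈[]-refl) (≈⇒≈[] (⟨Q⟩-h i))

      ⟨Q⟩∞h≈1 : ∀ i → ⟨Q⟩∞ ⊛ h i ≈[ i ] 1s
      ⟨Q⟩∞h≈1 i = ≈[]-trans (⊛-cong[] (progression-product-≈[] k k i) ≈[]-refl) (≈⇒≈[] (⟨Q⟩-h i))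

      -- With `e-≥′` this bounds the exponent at index i below by the distance of i from b, which
      -- makes up for the low precision near both ends of the sum.
      e-≥ : ∀ b i → b ≤ e b i + i
      e-≥ zero    i       = z≤n
      e-≥ (suc b) zero    = ≤-trans (pent-≥ v u (suc b)) (m≤m+n _ 0)
      e-≥ (suc b) (suc i) = subst (suc b ≤_) (sym (+-suc (e b i) i)) (s≤s (e-≥ b i))

      e-≥′ : ∀ b i → i ≤ e b i + b
      e-≥′ zero    i       = ≤-trans (pent-≥ u v i) (m≤m+n _ 0)
      e-≥′ (suc b) zero    = z≤n
      e-≥′ (suc b) (suc i) = subst (suc i ≤_) (sym (+-suc (e b i) b)) (s≤s (e-≥′ b i))

      -- Index i stands for i - N; passing from N to N + 1 adds one term at each end.
      Σe : ∀ N → Σ≤ (N + N) (λ i → q^ (e N i)) ≈ bilateral (pent u v) (pent v u) N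
      Σe zero    = ≈-refl
      Σe (suc N) = ≈-trans (≈-trans (subst (λ M → Σ≤ (suc M) F ≈ Σ≤ (suc (suc (N + N))) F) (sym (+-suc N N)) ≈-refl)
        (⊕-cong (Σ≤-unfoldˡ (N + N) F) ≈-refl))
        (≈-trans (⊕-cong (⊕-cong ≈-refl (Σe N)) (q^-≡ (last N)))
        (solve 3 (λ a b c → (a :+ b) :+ c := b :+ (c :+ a)) ≈-refl _ _ _))
        where
        F = λ i → q^ (e (suc N) i)
        last : ∀ N → e N (suc (N + N)) ≡ pent u v (suc N)
        last N = subst (λ m → e N m ≡ pent u v (suc N)) (+-suc N N) (shift N (suc N))
          where
          shift : ∀ b j → e b (b + j) ≡ pent u v j
          shift zero    j = refl
          shift (suc b) j = shift b j

    jacobi-triple-product :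
      theta u v ≈ progression-product (u + v) u ⊛ progression-product (u + v) v ⊛ progression-product (u + v) (u + v)
    jacobi-triple-product = ≈[]⇒≈ λ N → ≈[]-sym (≈[]-trans
      (⊛-cong[] (⊛-cong[] (progression-product-≈[] k u N) (progression-product-≈[] k v N)) (≈[]-refl {f = ⟨Q⟩∞}))
      (≈[]-trans (≈⇒≈[] (≈-trans (⊛-cong (finite N N) ≈-refl) (≈-trans
        (solve 3 (λ a b c → a :* b :* c := (a :* c) :* b) ≈-refl (⟨Q⟩ (N + N)) (H N (N + N)) ⟨Q⟩∞) (Σ≤-⊛ (N + N) _ _))))
      (≈[]-trans (Σ≤-cong[] (N + N) (λ {i} → term N {i}))
      (≈[]-trans (≈⇒≈[] (Σe N)) (≈[]-sym (theta-≈[] u v N))))))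
      where
      -- `⟨Q⟩∞ ⊛ h i` is 1 up to order i, the other pair is 1 up to order 2N - i, and the monomial
      -- shifts the error by its exponent, which is at least the distance of i from N. Together the
      -- error starts at order N or later.
      term : ∀ N {i} → i ≤ N + N → ⟨Q⟩ (N + N) ⊛ ⟨Q⟩∞ ⊛ (h i ⊛ h (N + N ∸ i) ⊛ q^ (e N i)) ≈[ N ] q^ (e N i)
      term N {i} i≤ = ≈[]-trans
        (≈⇒≈[] (solve 5 (λ a b x y z → a :* b :* (x :* y :* z) := z :* ((a :* y) :* (b :* x))) ≈-refl
          (⟨Q⟩ (N + N)) ⟨Q⟩∞ (h i) (h (N + N ∸ i)) (q^ (e N i))))
        (≈[]-trans (≈[]-weaken N≤ (q^-cong[] (e N i) (⊛-cong[]
            (≈[]-weaken (m⊓n≤n i _) (⟨Q⟩h≈1 (m∸n≤m (N + N) i))) (≈[]-weaken (m⊓n≤m i _) (⟨Q⟩∞h≈1 i)))))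
          (≈⇒≈[] (≈-trans (⊛-cong ≈-refl (⊛-1s 1s)) (⊛-1s _))))
        where
        N≤ : N ≤ e N i + (i ⊓ (N + N ∸ i))
        N≤ = subst (N ≤_) (sym (+-distribˡ-⊓ (e N i) i (N + N ∸ i))) (⊓-glb (e-≥ N i)
          (+-cancelʳ-≤ i N _ (begin
            N + i                          ≤⟨ +-monoʳ-≤ N (e-≥′ N i) ⟩
            N + (e N i + N)                ≡⟨ ring₁ N (e N i) ⟩
            e N i + (N + N)                ≡⟨ cong (e N i +_) (sym (m∸n+n≡m i≤)) ⟩
            e N i + ((N + N ∸ i) + i)      ≡⟨ sym (+-assoc (e N i) _ i) ⟩
            (e N i + (N + N ∸ i)) + i      ∎)))
          where
          open ≤-Reasoning

-- Products modulo 2 and the theta functions of modulus 9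

module Eta where

  open Series
  open Theta
  open import Data.Bool.Base using (true; _∧_)
  open import Data.Nat.Base
  open import Data.Nat.Properties
  open import Data.Nat.Tactic.RingSolver using (solve-∀)
  open import Relation.Binary.PropositionalEquality hiding (setoid)
  open Char2Solver using (solve; _:*_; _:=_; con)
  open ≈-Reasoning

  Π< : ℕ → (ℕ → F₂⟦q⟧) → F₂⟦q⟧
  Π< zero    F = 1s
  Π< (suc c) F = Π< c F ⊛ F c

  Π<-⊛ : ∀ c F G → Π< c F ⊛ Π< c G ≈ Π< c (λ r → F r ⊛ G r)
  Π<-⊛ zero    F G = 1s-⊛ 1s
  Π<-⊛ (suc c) F G = ≈-trans
    (solve 4 (λ a b c d → (a :* b) :* (c :* d) := (a :* c) :* (b :* d)) ≈-refl _ _ _ _)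
    (⊛-cong (Π<-⊛ c F G) ≈-refl)

  Π<-cong : ∀ c {F G} → (∀ r → F r ≈ G r) → Π< c F ≈ Π< c G
  Π<-cong zero    e = ≈-refl
  Π<-cong (suc c) e = ⊛-cong (Π<-cong c e) (e c)

  Π<-cong[] : ∀ c {N F G} → (∀ r → F r ≈[ N ] G r) → Π< c F ≈[ N ] Π< c G
  Π<-cong[] zero    e = ≈[]-refl
  Π<-cong[] (suc c) e = ⊛-cong[] (Π<-cong[] c e) (e c)

  progression-product<-+ : ∀ k u c m → progression-product< k u (c + m) ≈
    progression-product< k u m ⊛ Π< c (λ r → 1s ⊕ q^ ((r + m) * k + u))
  progression-product<-+ k u zero    m = ≈-sym (⊛-1s _)
  progression-product<-+ k u (suc c) m = ≈-trans (⊛-cong (progression-product<-+ k u c m) ≈-refl) (⊛-assoc _ _ _)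

  private
    ring₂ : ∀ r n c k u → (r + n * c) * k + u ≡ n * (c * k) + (u + r * k)
    ring₂ = solve-∀

  progression-product<-split : ∀ k u c n → progression-product< k u (n * c) ≈
    Π< c (λ r → progression-product< (c * k) (u + r * k) n)
  progression-product<-split k u c zero    = ≈-sym (ones c)
    where
    ones : ∀ c → Π< c (λ _ → 1s) ≈ 1s
    ones zero    = ≈-refl
    ones (suc c) = ≈-trans (⊛-1s _) (ones c)
  progression-product<-split k u c (suc n) = ≈-trans (progression-product<-+ k u c (n * c)) (≈-trans
    (⊛-cong (progression-product<-split k u c n) (Π<-cong c λ r → ⊕-cong ≈-refl (q^-≡ (ring₂ r n c k u))))
    (Π<-⊛ c _ _))

  progression-product-split : ∀ k u c .{{_ : NonZero k}} .{{_ : NonZero u}} .{{_ : NonZero c}} →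
    progression-product k u ≈ Π< c (λ r → progression-product (c * k) (u + r * k))
  progression-product-split k (suc u) c = ≈[]⇒≈ λ N → ≈[]-trans
    (≈[]-weaken (m≤m*n N c) (progression-product-≈[] k (suc u) (N * c)))
    (≈[]-trans (≈⇒≈[] (progression-product<-split k (suc u) c N))
      (≈[]-sym (Π<-cong[] c λ r → progression-product-≈[] (c * k) (suc u + r * k) {{m*n≢0 c k}} N)))

  private
    ring₁ : ∀ N k u s → (N * k + u) * s ≡ N * (k * s) + u * s
    ring₁ = solve-∀

  sub-progression-product : ∀ j k u .{{_ : NonZero k}} .{{_ : NonZero u}} →
    sub j (progression-product k u) ≈ progression-product (k * suc j) (u * suc j)
  sub-progression-product j k u = ≈[]⇒≈ λ N → ≈[]-trans
    (sub-cong[] j (progression-product-≈[] k u N)) (≈[]-trans (≈⇒≈[] (finite N))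
      (≈[]-sym (progression-product-≈[] (k * suc j) (u * suc j) {{m*n≢0 k (suc j)}} {{m*n≢0 u (suc j)}} N)))
    where
    finite : ∀ N → sub j (progression-product< k u N) ≈ progression-product< (k * suc j) (u * suc j) N
    finite zero    = sub-1s j
    finite (suc N) = ≈-trans (sub-⊛ j _ _) (⊛-cong (finite N) (≈-trans (sub-⊕ j _ _)
      (⊕-cong (sub-1s j) (≈-trans (sub-q^ j (N * k + u)) (q^-≡ (ring₁ N k u (suc j)))))))

  -- By the pentagonal number theorem `f` is the product of all 1 + qⁿ; `ψ` is Ramanujan's sum of
  -- q^(n(n+1)/2).
  f f₃ f₉ f₂₇ ψ : F₂⟦q⟧
  f   = theta 1 2
  f₃  = sub 2 f
  f₉  = sub 2 f₃
  f₂₇ = sub 2 f₉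
  ψ   = theta 1 3

  f-0 : f 0 ≡ true
  f-0 = theta-0 1 2

  private
    pp = progression-product

    -- The triple product for u = 1, v = 2 runs over the classes 1, 2 and 0 modulo 3, hence over all
    -- exponents.
    f≈pp : f ≈ pp 1 1
    f≈pp = ≈-trans (JacobiTripleProduct.jacobi-triple-product 1 2)
      (≈-trans (⊛-cong (⊛-cong (≈-sym (1s-⊛ _)) ≈-refl) ≈-refl) (≈-sym (progression-product-split 1 1 3)))

    sub-f : ∀ j → sub j f ≈ pp (suc j) (suc j)
    sub-f j = ≈-trans (sub-cong j f≈pp) (≈-trans (sub-progression-product j 1 1)
      (coeffwise λ n → cong (λ m → pp m m n) (*-identityˡ (suc j))))

  euler-product : f ≈ progression-product 1 1
  euler-product = f≈pp

  sub8≈sub2∘sub2 : ∀ g → sub 8 g ≈ sub 2 (sub 2 g)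
  sub8≈sub2∘sub2 g = ≈-sym (sub-sub 2 2 g)

  fourth-power : ∀ g → sub 3 g ≈ (g ⊛ g) ⊛ (g ⊛ g)
  fourth-power g = ≈-trans (≈-sym (sub-sub 1 1 g)) (≈-trans (frobenius (sub 1 g)) (⊛-cong (frobenius g) (frobenius g)))

  cube : F₂⟦q⟧ → F₂⟦q⟧
  cube g = g ⊛ g ⊛ g

  cube-cong : ∀ {g h} → g ≈ h → cube g ≈ cube h
  cube-cong e = ⊛-cong (⊛-cong e e) e

  sub-cube : ∀ j g → sub j (cube g) ≈ cube (sub j g)
  sub-cube j g = ≈-trans (sub-⊛ j _ g) (⊛-cong (sub-⊛ j g g) ≈-refl)

  ⊛-unit : ∀ {g h} → g 0 ≡ true → h 0 ≡ true → (g ⊛ h) 0 ≡ true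
  ⊛-unit {g} {h} e e′ = trans (⊛-at-0 g h) (cong₂ _∧_ e e′)

  -- Jacobi's identity for the cube, modulo 2. After multiplication by f² a fourth power appears,
  -- which is f(q⁴), and both sides become products over the classes modulo 4.
  cube-f : cube f ≈ ψ
  cube-f = ⊛-cancelˡ (⊛-unit {f} {f} f-0 f-0) (begin
    (f ⊛ f) ⊛ cube f                ≈⟨ solve 1 (λ x → (x :* x) :* (x :* x :* x) := x :* ((x :* x) :* (x :* x))) ≈-refl f ⟩
    f ⊛ ((f ⊛ f) ⊛ (f ⊛ f))         ≈⟨ ⊛-cong ≈-refl (fourth-power f) ⟨
    f ⊛ sub 3 f                     ≈⟨ ⊛-cong (≈-trans f≈pp (progression-product-split 1 1 4)) (sub-f 3) ⟩
    (1s ⊛ a ⊛ b ⊛ c ⊛ d) ⊛ d        ≈⟨ solve 4 (λ a b c d → (con true :* a :* b :* c :* d) :* d := (con true :* b :* d) :* (a :* c :* d)) ≈-refl a b c d ⟩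
    (1s ⊛ b ⊛ d) ⊛ (a ⊛ c ⊛ d)      ≈⟨ ⊛-cong (≈-trans (sub-f 1) (progression-product-split 2 2 2)) (JacobiTripleProduct.jacobi-triple-product 1 3) ⟨
    sub 1 f ⊛ ψ                     ≈⟨ ⊛-cong (frobenius f) ≈-refl ⟩
    (f ⊛ f) ⊛ ψ                     ∎)
    where
    a = pp 4 1
    b = pp 4 2
    c = pp 4 3
    d = pp 4 4

  -- The components of the 3-dissection of `f`. The parameters are ordered so that the second one is
  -- even, since `Reciprocal` treats theta functions with v = 2b.
  α β γ : F₂⟦q⟧
  α = theta 1 8
  β = theta 7 2
  γ = theta 5 4

  -- The three triple products run over the six classes prime to 3 modulo 9 once each and over the
  -- class 0 three times; `f₃` supplies the classes 3 and 6 and another 0.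
  αβγ : α ⊛ β ⊛ γ ⊛ f₃ ≈ cube f₉ ⊛ f
  αβγ = begin
    α ⊛ β ⊛ γ ⊛ f₃
      ≈⟨ ⊛-cong (⊛-cong (⊛-cong (JacobiTripleProduct.jacobi-triple-product 1 8) (JacobiTripleProduct.jacobi-triple-product 7 2)) (JacobiTripleProduct.jacobi-triple-product 5 4))
           (≈-trans (sub-f 2) (progression-product-split 3 3 3)) ⟩
    (p 1 ⊛ p 8 ⊛ p 9) ⊛ (p 7 ⊛ p 2 ⊛ p 9) ⊛ (p 5 ⊛ p 4 ⊛ p 9) ⊛ (1s ⊛ p 3 ⊛ p 6 ⊛ p 9)
      ≈⟨ solve 9 (λ a b c d e f g h i →
           (a :* h :* i) :* (g :* b :* i) :* (e :* d :* i) :* (con true :* c :* f :* i)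
             := (i :* i :* i) :* (con true :* a :* b :* c :* d :* e :* f :* g :* h :* i))
           ≈-refl (p 1) (p 2) (p 3) (p 4) (p 5) (p 6) (p 7) (p 8) (p 9) ⟩
    cube (p 9) ⊛ (1s ⊛ p 1 ⊛ p 2 ⊛ p 3 ⊛ p 4 ⊛ p 5 ⊛ p 6 ⊛ p 7 ⊛ p 8 ⊛ p 9)
      ≈⟨ ⊛-cong (cube-cong (≈-trans (≈-sym (sub8≈sub2∘sub2 f)) (sub-f 8))) (≈-trans f≈pp (progression-product-split 1 1 9)) ⟨
    cube f₉ ⊛ f ∎
    where
    p = pp 9

-- Dissections, and the section of exponents divisible by 4

module Dissect where

  open Series
  open Theta
  open Eta
  open import Data.Bool.Base using (true)
  open import Data.Nat.Base
  open import Data.Nat.Properties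
  open import Data.Nat.Tactic.RingSolver using (solve-∀)
  open import Relation.Binary.PropositionalEquality hiding (setoid)
  open Char2Solver using (solve; _:+_; _:*_; _:=_; con)
  open ≈-Reasoning

  private
    ring₆ : ∀ u v j p → (u + (2 + j * 3) * (u + v)) + ((u + (1 + j * 3) * (u + v)) + ((u + j * 3 * (u + v)) + p * 3)) ≡ ((u + (u + v) + j * (u + (u + v) + (v + (u + v)))) + p) * 3
    ring₆ = solve-∀

  pent-3j : ∀ u v j → pent u v (j * 3) ≡ pent (u + (u + v)) (v + (u + v)) j * 3
  pent-3j u v zero    = refl
  pent-3j u v (suc j) = trans (cong (λ p → (u + (2 + j * 3) * (u + v)) + ((u + (1 + j * 3) * (u + v)) + ((u + j * 3 * (u + v)) + p))) (pent-3j u v j))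
    (ring₆ u v j (pent (u + (u + v)) (v + (u + v)) j))

  private
    ring₇ : ∀ u v j p → (u + (3 + j * 3) * (u + v)) + ((u + (2 + j * 3) * (u + v)) + ((u + (1 + j * 3) * (u + v)) + (u + p * 3))) ≡ u + ((u + 2 * (u + v) + j * (u + 2 * (u + v) + v)) + p) * 3
    ring₇ = solve-∀

  pent-3j+1 : ∀ u v j → pent u v (suc (j * 3)) ≡ u + pent (u + 2 * (u + v)) v j * 3
  pent-3j+1 u v zero    = cong (_+ 0) (+-identityʳ u)
  pent-3j+1 u v (suc j) = trans (cong (λ p → (u + (3 + j * 3) * (u + v)) + ((u + (2 + j * 3) * (u + v)) + ((u + (1 + j * 3) * (u + v)) + p))) (pent-3j+1 u v j))
    (ring₇ u v j (pent (u + 2 * (u + v)) v j))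

  private
    ring₈ : ∀ u v → (u + 1 * (u + v)) + ((u + 0 * (u + v)) + 0) ≡ v + ((u + 0 * (u + (v + 2 * (u + v)))) + 0) * 3
    ring₈ = solve-∀
    ring₉ : ∀ u v j p → (u + (4 + j * 3) * (u + v)) + ((u + (3 + j * 3) * (u + v)) + ((u + (2 + j * 3) * (u + v)) + (v + p * 3))) ≡ v + ((u + (1 + j) * (u + (v + 2 * (u + v)))) + p) * 3
    ring₉ = solve-∀

  pent-3j+2 : ∀ u v j → pent u v (2 + j * 3) ≡ v + pent u (v + 2 * (u + v)) (suc j) * 3
  pent-3j+2 u v zero    = ring₈ u v
  pent-3j+2 u v (suc j) = trans (cong (λ p → (u + (4 + j * 3) * (u + v)) + ((u + (3 + j * 3) * (u + v)) + ((u + (2 + j * 3) * (u + v)) + p))) (pent-3j+2 u v j))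
    (ring₉ u v j (pent u (v + 2 * (u + v)) (suc j)))

  bilateral-cong : ∀ {p p′ m m′} → (∀ j → p j ≡ p′ j) → (∀ j → m (suc j) ≡ m′ (suc j)) → ∀ N → bilateral p m N ≈ bilateral p′ m′ N
  bilateral-cong e e′ zero    = q^-≡ (e 0)
  bilateral-cong e e′ (suc N) = ⊕-cong (bilateral-cong e e′ N) (⊕-cong (q^-≡ (e (suc N))) (q^-≡ (e′ N)))

  -- bilateral ignores m 0, so nothing is required of m₁ 0.
  bilateral-mod3 : ∀ (p m : ℕ → ℕ) (p₂ m₁ : ℕ → ℕ) → p₂ 0 ≡ m 1 → (∀ j → p₂ (suc j) ≡ p (2 + j * 3)) → (∀ j → m₁ (suc j) ≡ m (2 + j * 3)) →
    ∀ N → bilateral p m (suc (N * 3)) ≈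
      bilateral (λ j → p (j * 3)) (λ j → m (j * 3)) N
      ⊕ bilateral (λ j → p (suc (j * 3))) m₁ N
      ⊕ bilateral p₂ (λ j → m (suc (j * 3))) N
  bilateral-mod3 p m p₂ m₁ e₀ e₁ e₂ zero    = ≈-trans (≈-sym (⊕-assoc _ _ _)) (⊕-cong ≈-refl (q^-≡ (sym e₀)))
  bilateral-mod3 p m p₂ m₁ e₀ e₁ e₂ (suc N) = ≈-trans
    (⊕-cong (⊕-cong (⊕-cong (bilateral-mod3 p m p₂ m₁ e₀ e₁ e₂ N)
      (⊕-cong (q^-≡ (sym (e₁ N))) (q^-≡ (sym (e₂ N))))) ≈-refl) ≈-refl)
    (solve 9 (λ a b c d e f g h i → (((a :+ b :+ c) :+ (d :+ e)) :+ (f :+ g)) :+ (h :+ i)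
        := (a :+ (f :+ g)) :+ (b :+ (h :+ e)) :+ (c :+ (d :+ i))) ≈-refl _ _ _ _ _ _ _ _ _)

  sub-bilateral : ∀ k p m N → sub k (bilateral p m N) ≈ bilateral (λ j → p j * suc k) (λ j → m j * suc k) N
  sub-bilateral k p m zero    = sub-q^ k (p 0)
  sub-bilateral k p m (suc N) = ≈-trans (sub-⊕ k _ _) (⊕-cong (sub-bilateral k p m N)
    (≈-trans (sub-⊕ k _ _) (⊕-cong (sub-q^ k (p (suc N))) (sub-q^ k (m (suc N))))))

  q^-bilateral : ∀ a p m N → q^ a ⊛ bilateral p m N ≈ bilateral (λ j → a + p j) (λ j → a + m j) N
  q^-bilateral a p m zero    = q^-+ a (p 0)
  q^-bilateral a p m (suc N) = ≈-trans (⊛-distribˡ (q^ a) _ _) (⊕-cong (q^-bilateral a p m N)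
    (≈-trans (⊛-distribˡ (q^ a) _ _) (⊕-cong (q^-+ a (p (suc N))) (q^-+ a (m (suc N))))))

  private
    ring₁₀ : ∀ u v → v + 0 ≡ (v + 0) + 0
    ring₁₀ = solve-∀

  -- The summation index is split by its residue modulo 3; on each class the exponent, after a shift
  -- and division by 3, is quadratic of the same kind with u + v tripled.
  theta-mod3 : ∀ u v .{{_ : NonZero u}} .{{_ : NonZero v}} → theta u v ≈
    sub 2 (theta (u + (u + v)) (v + (u + v)))
    ⊕ q^ u ⊛ sub 2 (theta (u + 2 * (u + v)) v)
    ⊕ q^ v ⊛ sub 2 (theta u (v + 2 * (u + v)))
  theta-mod3 u@(suc _) v@(suc _) = ≈[]⇒≈ λ N → ≈[]-trans
    (≈[]-weaken (≤-trans (m≤m*n N 3) (n≤1+n _)) (theta-≈[] u v (suc (N * 3))))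
    (≈[]-trans (≈⇒≈[] (≈-trans
      (bilateral-mod3 (pent u v) (pent v u) (λ j → v + pent u (v + 2 * (u + v)) j * 3) (λ j → u + pent v (u + 2 * (v + u)) j * 3)
        (ring₁₀ u v) (λ j → sym (pent-3j+2 u v j)) (λ j → sym (pent-3j+2 v u j)) N)
      (⊕-cong (⊕-cong
        (≈-trans (bilateral-cong (pent-3j u v) (λ j → trans (pent-3j v u (suc j)) (cong (λ k → pent (v + k) (u + k) (suc j) * 3) (+-comm v u))) N)
          (≈-sym (sub-bilateral 2 _ _ N)))
        (≈-trans (bilateral-cong (pent-3j+1 u v) (λ j → cong (λ k → u + pent v (u + 2 * k) (suc j) * 3) (+-comm v u)) N)
          (≈-trans (≈-sym (q^-bilateral u _ _ N)) (⊛-cong ≈-refl (≈-sym (sub-bilateral 2 _ _ N))))))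
        (≈-trans (bilateral-cong (λ _ → refl) (λ j → trans (pent-3j+1 v u (suc j)) (cong (λ k → v + pent (v + 2 * k) u (suc j) * 3) (+-comm v u))) N)
          (≈-trans (≈-sym (q^-bilateral v _ _ N)) (⊛-cong ≈-refl (≈-sym (sub-bilateral 2 _ _ N))))))))
    (⊕-cong[] (⊕-cong[] (sub-cong[] 2 (≈[]-sym (theta-≈[] _ _ N)))
      (⊛-cong[] ≈[]-refl (sub-cong[] 2 (≈[]-sym (theta-≈[] _ _ N)))))
      (⊛-cong[] ≈[]-refl (sub-cong[] 2 (≈[]-sym (theta-≈[] _ _ N))))))

  theta-swap : ∀ u v .{{_ : NonZero u}} .{{_ : NonZero v}} → theta u v ≈ theta v u
  theta-swap u v = ≈[]⇒≈ λ N → ≈[]-trans (theta-≈[] u v N) (≈[]-trans (≈⇒≈[] (go N)) (≈[]-sym (theta-≈[] v u N)))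
    where
    go : ∀ N → bilateral (pent u v) (pent v u) N ≈ bilateral (pent v u) (pent u v) N
    go zero    = ≈-refl
    go (suc N) = ⊕-cong (go N) (⊕-comm _ _)

  private
    ring₁ : ∀ u v j k p → ((u + j * (u + v)) + p) * k ≡ u * k + j * (u * k + v * k) + p * k
    ring₁ = solve-∀

  sub-theta : ∀ k u v .{{_ : NonZero u}} .{{_ : NonZero v}} → sub k (theta u v) ≈ theta (u * suc k) (v * suc k)
  sub-theta k u@(suc _) v@(suc _) = ≈[]⇒≈ λ N → ≈[]-trans (sub-cong[] k (theta-≈[] u v N)) (≈[]-trans
    (≈⇒≈[] (≈-trans (sub-bilateral k _ _ N) (bilateral-cong (lem u v) (λ j → lem v u (suc j)) N))) (≈[]-sym (theta-≈[] _ _ N)))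
    where
    lem : ∀ u v j → pent u v j * suc k ≡ pent (u * suc k) (v * suc k) j
    lem u v zero    = refl
    lem u v (suc j) = trans (ring₁ u v j (suc k) (pent u v j)) (cong (u * suc k + j * (u * suc k + v * suc k) +_) (lem u v j))

  private
    ring₂ : ∀ j p → (1 + (1 + j * 2) * 3) + ((1 + j * 2 * 3) + p) ≡ (5 + j * 12) + p
    ring₂ = solve-∀
    ring₃ : ∀ j p → (2 + (1 + j * 2) * 3) + ((2 + j * 2 * 3) + p) ≡ (7 + j * 12) + p
    ring₃ = solve-∀
    ring₄ : ∀ j p → (1 + (2 + j * 2) * 3) + ((1 + (1 + j * 2) * 3) + (1 + p)) ≡ 1 + ((11 + j * 12) + p)
    ring₄ = solve-∀
    ring₅ : ∀ j p → (2 + (2 + j * 2) * 3) + ((2 + (1 + j * 2) * 3) + (1 + p)) ≡ 1 + ((1 + (1 + j) * 12) + p)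
    ring₅ = solve-∀

  -- Dissection by the parity of the summation index. In `ψ-mod3` these are the two pieces of `ψ`
  -- with exponents divisible by 3, which thereby recombine into f(q³).
  f-mod2 : f ≈ theta 5 7 ⊕ q^ 1 ⊛ theta 1 11
  f-mod2 = ≈[]⇒≈ λ N → ≈[]-trans
    (≈[]-weaken (m≤m*n N 2) (theta-≈[] 1 2 (N * 2)))
    -- The range from -2N to 2N does not fall apart evenly into odd and even indices, so the term of
    -- index 2N + 1 is adjoined; it vanishes to order N, as does the placeholder q^(N+1).
    (≈[]-trans (≈[]-sym (≈[]-trans (⊕-cong[] ≈[]-refl (≈[]-weaken (n≤1+n N) (q^-≈0 (suc N)))) (≈⇒≈[] (⊕-identityʳ _))))
    (≈[]-trans (≈[]-weaken (≤-refl) (⊕-cong[] ≈[]-refl (≈[]-trans (q^-small N) (≈[]-sym (odd-small N)))))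
    (≈[]-trans (≈⇒≈[] (split N))
    (⊕-cong[] (≈[]-sym (theta-≈[] 5 7 N)) (⊛-cong[] ≈[]-refl (≈[]-sym (≈[]-trans (≈⇒≈[] (theta-swap 1 11)) (theta-≈[] 11 1 N))))))))
    where
    even₁ : ∀ j → pent 1 2 (j * 2) ≡ pent 5 7 j
    even₁ zero    = refl
    even₁ (suc j) = trans (cong (λ p → (1 + (1 + j * 2) * 3) + ((1 + j * 2 * 3) + p)) (even₁ j)) (ring₂ j (pent 5 7 j))
    even₂ : ∀ j → pent 2 1 (j * 2) ≡ pent 7 5 j
    even₂ zero    = refl
    even₂ (suc j) = trans (cong (λ p → (2 + (1 + j * 2) * 3) + ((2 + j * 2 * 3) + p)) (even₂ j)) (ring₃ j (pent 7 5 j))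
    odd₁ : ∀ j → pent 1 2 (suc (j * 2)) ≡ 1 + pent 11 1 j
    odd₁ zero    = refl
    odd₁ (suc j) = trans (cong (λ p → (1 + (2 + j * 2) * 3) + ((1 + (1 + j * 2) * 3) + p)) (odd₁ j)) (ring₄ j (pent 11 1 j))
    odd₂ : ∀ j → pent 2 1 (suc (j * 2)) ≡ 1 + pent 1 11 (suc j)
    odd₂ zero    = refl
    odd₂ (suc j) = trans (cong (λ p → (2 + (2 + j * 2) * 3) + ((2 + (1 + j * 2) * 3) + p)) (odd₂ j)) (ring₅ j (pent 1 11 (suc j)))
    q^-small : ∀ N → q^ (suc N) ≈[ N ] 0s
    q^-small N = ≈[]-weaken (n≤1+n N) (q^-≈0 (suc N))
    odd-small : ∀ N → q^ (pent 1 2 (suc (N * 2))) ≈[ N ] 0s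
    odd-small N = ≈[]-weaken (≤-trans (m≤m*n N 2) (≤-trans (n≤1+n (N * 2)) (pent-≥ 1 2 (suc (N * 2))))) (q^-≈0 _)
    split : ∀ N → bilateral (pent 1 2) (pent 2 1) (N * 2) ⊕ q^ (pent 1 2 (suc (N * 2)))
      ≈ bilateral (pent 5 7) (pent 7 5) N ⊕ q^ 1 ⊛ bilateral (pent 11 1) (pent 1 11) N
    split zero    = ⊕-cong ≈-refl (≈-sym (q^-+ 1 0))
    split (suc N) = begin
      bilateral (pent 1 2) (pent 2 1) (N * 2) ⊕ (a ⊕ b) ⊕ (c ⊕ d) ⊕ e
        ≈⟨ solve 6 (λ x a b c d e → x :+ (a :+ b) :+ (c :+ d) :+ e := (x :+ a) :+ (c :+ d) :+ (e :+ b)) ≈-refl _ a b c d e ⟩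
      (bilateral (pent 1 2) (pent 2 1) (N * 2) ⊕ a) ⊕ (c ⊕ d) ⊕ (e ⊕ b)
        ≈⟨ ⊕-cong (⊕-cong (split N) (⊕-cong (q^-≡ (even₁ (suc N))) (q^-≡ (even₂ (suc N)))))
             (⊕-cong (≈-trans (q^-≡ (odd₁ (suc N))) (≈-sym (q^-+ 1 (pent 11 1 (suc N))))) (≈-trans (q^-≡ (odd₂ N)) (≈-sym (q^-+ 1 (pent 1 11 (suc N)))))) ⟩
      (x ⊕ q^ 1 ⊛ y) ⊕ z ⊕ (q^ 1 ⊛ w ⊕ q^ 1 ⊛ t)
        ≈⟨ solve 6 (λ x q y z w t → (x :+ q :* y) :+ z :+ (q :* w :+ q :* t) := (x :+ z) :+ q :* (y :+ (w :+ t))) ≈-refl x (q^ 1) y z w t ⟩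
      (x ⊕ z) ⊕ q^ 1 ⊛ (y ⊕ (w ⊕ t)) ∎
      where
      a = q^ (pent 1 2 (suc (N * 2)))
      b = q^ (pent 2 1 (suc (N * 2)))
      c = q^ (pent 1 2 (suc N * 2))
      d = q^ (pent 2 1 (suc N * 2))
      e = q^ (pent 1 2 (suc (suc N * 2)))
      x = bilateral (pent 5 7) (pent 7 5) N
      y = bilateral (pent 11 1) (pent 1 11) N
      z = q^ (pent 5 7 (suc N)) ⊕ q^ (pent 7 5 (suc N))
      w = q^ (pent 11 1 (suc N))
      t = q^ (pent 1 11 (suc N))

  ψ-mod3 : ψ ≈ f₃ ⊕ q^ 1 ⊛ sub 8 ψ
  ψ-mod3 = begin
    ψ
      ≈⟨ theta-mod3 1 3 ⟩
    sub 2 (theta 5 7) ⊕ q^ 1 ⊛ sub 2 (theta 9 3) ⊕ q^ 3 ⊛ sub 2 (theta 1 11)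
      ≈⟨ ⊕-cong (⊕-cong ≈-refl (⊛-cong ≈-refl (≈-sym (≈-trans (sub-cong 8 (theta-swap 1 3)) (≈-trans (sub8≈sub2∘sub2 _) (sub-cong 2 (sub-theta 2 3 1)))))))
           (⊛-cong (≈-sym (sub-q^ 2 1)) ≈-refl) ⟩
    sub 2 (theta 5 7) ⊕ q^ 1 ⊛ sub 8 ψ ⊕ sub 2 (q^ 1) ⊛ sub 2 (theta 1 11)
      ≈⟨ solve 3 (λ a b c → a :+ b :+ c := (a :+ c) :+ b) ≈-refl _ _ _ ⟩
    (sub 2 (theta 5 7) ⊕ sub 2 (q^ 1) ⊛ sub 2 (theta 1 11)) ⊕ q^ 1 ⊛ sub 8 ψ
      ≈⟨ ⊕-cong (≈-trans (sub-cong 2 f-mod2) (≈-trans (sub-⊕ 2 _ _) (⊕-cong ≈-refl (sub-⊛ 2 _ _)))) ≈-refl ⟨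
    f₃ ⊕ q^ 1 ⊛ sub 8 ψ ∎

  cube-f-mod3 : cube f ≈ f₃ ⊕ q^ 1 ⊛ cube f₉
  cube-f-mod3 = ≈-trans cube-f (≈-trans ψ-mod3 (⊕-cong ≈-refl (⊛-cong ≈-refl
    (≈-trans (sub-cong 8 (≈-sym cube-f)) (≈-trans (sub-cube 8 f) (cube-cong (sub8≈sub2∘sub2 f)))))))

  f-mod3 : f ≈ sub 2 γ ⊕ q^ 1 ⊛ sub 2 β ⊕ q^ 2 ⊛ sub 2 α
  f-mod3 = ≈-trans (theta-mod3 1 2) (⊕-cong (⊕-cong (sub-cong 2 (theta-swap 4 5)) ≈-refl) ≈-refl)

  -- The order v of a nonzero solution would satisfy v = 1 + 3v. In the induction the factor `q`
  -- gains one place each time.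
  sub-fixed⇒≈0 : ∀ g → g ≈ q^ 1 ⊛ sub 2 g → g ≈ 0s
  sub-fixed⇒≈0 g e = ≈[]⇒≈ go
    where
    go : ∀ N → g ≈[ N ] 0s
    go zero    = coeffwise< λ ()
    go (suc N) = ≈[]-trans (≈⇒≈[] e) (≈[]-trans (q^-cong[] 1 (≈[]-trans (sub-cong[] 2 (go N)) (≈⇒≈[] (sub-0s 2))))
      (≈⇒≈[] (≈-trans (⊛-comm _ _) (0s-⊛ _))))

  -- In terms of `ψ` this reads ψ(q) ψ(q³) = ψ(q⁴) + q ψ(q¹²) modulo 2. Inserting `cube-f-mod3`
  -- shows that the difference Δ of the two sides satisfies Δ = q Δ(q³), and `sub-fixed⇒≈0` applies.
  cube-product : cube f ⊛ cube f₃ ≈ cube (sub 3 f) ⊕ q^ 1 ⊛ cube (sub 3 f₃)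
  cube-product = ≈-trans (⊕-cancel _ _ Δ≈0)
    (≈-sym (⊕-cong (≈-trans (cube-cong (fourth-power f)) (cube⁴ f))
      (⊛-cong ≈-refl (≈-trans (cube-cong (fourth-power f₃)) (cube⁴ f₃)))))
    where
    _⁴ : F₂⟦q⟧ → F₂⟦q⟧
    g ⁴ = (g ⊛ g) ⊛ (g ⊛ g)
    cube⁴ : ∀ g → cube (g ⁴) ≈ (cube g) ⁴
    cube⁴ = solve 1 (λ g → let g⁴ = (g :* g) :* (g :* g) ; g³ = g :* g :* g in
      g⁴ :* g⁴ :* g⁴ := (g³ :* g³) :* (g³ :* g³)) ≈-refl
    s t r : F₂⟦q⟧
    s = cube f
    t = cube f₃
    r = cube f₉
    Δ : F₂⟦q⟧
    Δ = s ⊛ t ⊕ (s ⁴ ⊕ q^ 1 ⊛ t ⁴)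
    subΔ : sub 2 Δ ≈ t ⊛ r ⊕ (t ⁴ ⊕ q^ 1 ⊛ q^ 1 ⊛ q^ 1 ⊛ r ⁴)
    subΔ = ≈-trans (sub-⊕ 2 _ _) (⊕-cong (≈-trans (sub-⊛ 2 s t) (⊛-cong (sub-cube 2 f) (sub-cube 2 f₃)))
      (≈-trans (sub-⊕ 2 _ _) (⊕-cong (sub⁴ (sub-cube 2 f)) (≈-trans (sub-⊛ 2 _ _) (⊛-cong q³ (sub⁴ (sub-cube 2 f₃)))))))
      where
      q³ : sub 2 (q^ 1) ≈ q^ 1 ⊛ q^ 1 ⊛ q^ 1
      q³ = ≈-trans (sub-q^ 2 1) (≈-sym (≈-trans (⊛-cong (q^-+ 1 1) ≈-refl) (q^-+ 2 1)))
      sub⁴ : ∀ {g g′} → sub 2 g ≈ g′ → sub 2 (g ⁴) ≈ g′ ⁴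
      sub⁴ {g} e = ≈-trans (sub-⊛ 2 _ _) (⊛-cong sq sq)
        where sq = ≈-trans (sub-⊛ 2 g g) (⊛-cong e e)
    Δ≈0 : Δ ≈ 0s
    Δ≈0 = sub-fixed⇒≈0 Δ (begin
      s ⊛ t ⊕ (s ⁴ ⊕ q^ 1 ⊛ t ⁴)
        ≈⟨ ⊕-cong (⊛-cong cube-f-mod3 ≈-refl) (⊕-cong (⊛-cong (⊛-cong cube-f-mod3 cube-f-mod3) (⊛-cong cube-f-mod3 cube-f-mod3)) ≈-refl) ⟩
      (f₃ ⊕ q^ 1 ⊛ r) ⊛ t ⊕ ((f₃ ⊕ q^ 1 ⊛ r) ⁴ ⊕ q^ 1 ⊛ t ⁴)
        ≈⟨ solve 3 (λ q g r → let t = g :* g :* g ; x = g :+ q :* r ; _^4 = λ y → (y :* y) :* (y :* y) in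
             x :* t :+ ((x ^4) :+ q :* (t ^4)) := q :* (t :* r :+ ((t ^4) :+ q :* q :* q :* (r ^4)))) ≈-refl (q^ 1) f₃ r ⟩
      q^ 1 ⊛ (t ⊛ r ⊕ (t ⁴ ⊕ q^ 1 ⊛ q^ 1 ⊛ q^ 1 ⊛ r ⁴))
        ≈⟨ ⊛-cong ≈-refl subΔ ⟨
      q^ 1 ⊛ sub 2 Δ ∎)

  -- The constant term of the 3-dissection of f³
  sum-of-cubes : cube γ ⊕ q^ 1 ⊛ cube β ⊕ q^ 2 ⊛ cube α ≈ f
  sum-of-cubes = begin
    X₀ ≈⟨ ≈-sym (sect X₀ X₁ X₂) ⟩
    section 3 (sub 2 X₀ ⊕ sub 2 X₁ ⊛ q^ 1 ⊕ sub 2 X₂ ⊛ q^ 2)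
      ≈⟨ section-cong 3 expand ⟨
    section 3 (cube f)
      ≈⟨ section-cong 3 (≈-trans cube-f-mod3 (≈-trans (⊕-cong ≈-refl (≈-trans (⊛-comm _ _) (⊛-cong (≈-sym (sub-cube 2 f₃)) ≈-refl)))
           (≈-sym (≈-trans (⊕-cong ≈-refl (≈-trans (⊛-cong (sub-0s 2) ≈-refl) (0s-⊛ _))) (⊕-identityʳ _))))) ⟩
    section 3 (sub 2 f ⊕ sub 2 (cube f₃) ⊛ q^ 1 ⊕ sub 2 0s ⊛ q^ 2)
      ≈⟨ sect f (cube f₃) 0s ⟩
    f ∎
    where
    sect : ∀ x y z → section 3 (sub 2 x ⊕ sub 2 y ⊛ q^ 1 ⊕ sub 2 z ⊛ q^ 2) ≈ x
    sect x y z = begin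
      section 3 (sub 2 x ⊕ sub 2 y ⊛ q^ 1 ⊕ sub 2 z ⊛ q^ 2)
        ≈⟨ ≈-trans (section-⊕ 3 _ _) (⊕-cong (section-⊕ 3 _ _) ≈-refl) ⟩
      section 3 (sub 2 x) ⊕ section 3 (sub 2 y ⊛ q^ 1) ⊕ section 3 (sub 2 z ⊛ q^ 2)
        ≈⟨ ⊕-cong (⊕-cong (coeffwise (sub-at-* 2 x))
             (≈-trans (section-sub-⊛ 2 y (q^ 1)) (≈-trans (⊛-cong ≈-refl (coeffwise λ { zero → refl ; (suc n) → refl })) (≈-trans (⊛-comm y 0s) (0s-⊛ y)))))
             (≈-trans (section-sub-⊛ 2 z (q^ 2)) (≈-trans (⊛-cong ≈-refl (coeffwise λ { zero → refl ; (suc n) → refl })) (≈-trans (⊛-comm z 0s) (0s-⊛ z)))) ⟩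
      x ⊕ 0s ⊕ 0s ≈⟨ ≈-trans (⊕-identityʳ _) (⊕-identityʳ _) ⟩
      x ∎
    q = q^ 1
    X₀ X₁ X₂ : F₂⟦q⟧
    X₀ = cube γ ⊕ q^ 1 ⊛ cube β ⊕ q^ 2 ⊛ cube α
    X₁ = γ ⊛ γ ⊛ β ⊕ q ⊛ γ ⊛ α ⊛ α ⊕ q ⊛ β ⊛ β ⊛ α
    X₂ = γ ⊛ β ⊛ β ⊕ γ ⊛ γ ⊛ α ⊕ q ⊛ β ⊛ α ⊛ α
    A B C : F₂⟦q⟧
    A = sub 2 γ
    B = sub 2 β
    C = sub 2 α
    s₃ : ∀ a b c → sub 2 (a ⊛ b ⊛ c) ≈ sub 2 a ⊛ sub 2 b ⊛ sub 2 c
    s₃ a b c = ≈-trans (sub-⊛ 2 _ _) (⊛-cong (sub-⊛ 2 a b) ≈-refl)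
    s₄ : ∀ a b c d → sub 2 (a ⊛ b ⊛ c ⊛ d) ≈ sub 2 a ⊛ sub 2 b ⊛ sub 2 c ⊛ sub 2 d
    s₄ a b c d = ≈-trans (sub-⊛ 2 _ _) (⊛-cong (s₃ a b c) ≈-refl)
    s⊕ : ∀ a b c → sub 2 (a ⊕ b ⊕ c) ≈ sub 2 a ⊕ sub 2 b ⊕ sub 2 c
    s⊕ a b c = ≈-trans (sub-⊕ 2 _ _) (⊕-cong (sub-⊕ 2 a b) ≈-refl)
    p₃ : sub 2 q ≈ cube q
    p₃ = ≈-trans (sub-q^ 2 1) (≈-sym (≈-trans (⊛-cong (q^-+ 1 1) ≈-refl) (q^-+ 2 1)))
    p₆ : sub 2 (q^ 2) ≈ cube q ⊛ cube q
    p₆ = ≈-trans (sub-cong 2 (≈-sym (q^-+ 1 1))) (≈-trans (sub-⊛ 2 q q) (⊛-cong p₃ p₃))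
    expand : cube f ≈ sub 2 X₀ ⊕ sub 2 X₁ ⊛ q^ 1 ⊕ sub 2 X₂ ⊛ q^ 2
    expand = begin
      cube f
        ≈⟨ cube-cong (≈-trans f-mod3 (⊕-cong ≈-refl (⊛-cong (≈-sym (q^-+ 1 1)) ≈-refl))) ⟩
      cube (A ⊕ q ⊛ B ⊕ q ⊛ q ⊛ C)
        ≈⟨ solve 4 (λ q a b c → let q³ = q :* q :* q ; y = a :+ q :* b :+ q :* q :* c in
             y :* y :* y :=
             (a :* a :* a :+ q³ :* (b :* b :* b) :+ q³ :* q³ :* (c :* c :* c))
             :+ (a :* a :* b :+ q³ :* a :* c :* c :+ q³ :* b :* b :* c) :* q
             :+ (a :* b :* b :+ a :* a :* c :+ q³ :* b :* c :* c) :* (q :* q)) ≈-refl q A B C ⟩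
      (cube A ⊕ cube q ⊛ cube B ⊕ cube q ⊛ cube q ⊛ cube C)
      ⊕ (A ⊛ A ⊛ B ⊕ cube q ⊛ A ⊛ C ⊛ C ⊕ cube q ⊛ B ⊛ B ⊛ C) ⊛ q
      ⊕ (A ⊛ B ⊛ B ⊕ A ⊛ A ⊛ C ⊕ cube q ⊛ B ⊛ C ⊛ C) ⊛ (q ⊛ q)
        ≈⟨ ⊕-cong (⊕-cong
             (≈-trans (s⊕ _ _ _) (⊕-cong (⊕-cong (sub-cube 2 γ) (≈-trans (sub-⊛ 2 _ _) (⊛-cong p₃ (sub-cube 2 β)))) (≈-trans (sub-⊛ 2 _ _) (⊛-cong p₆ (sub-cube 2 α)))))
             (⊛-cong (≈-trans (s⊕ _ _ _) (⊕-cong (⊕-cong (s₃ γ γ β) (t₄ γ α α)) (t₄ β β α))) ≈-refl))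
             (⊛-cong (≈-trans (s⊕ _ _ _) (⊕-cong (⊕-cong (s₃ γ β β) (s₃ γ γ α)) (t₄ β α α))) (≈-sym (q^-+ 1 1))) ⟨
      sub 2 X₀ ⊕ sub 2 X₁ ⊛ q^ 1 ⊕ sub 2 X₂ ⊛ q^ 2 ∎
      where
      t₄ : ∀ a b c → sub 2 (q ⊛ a ⊛ b ⊛ c) ≈ cube q ⊛ sub 2 a ⊛ sub 2 b ⊛ sub 2 c
      t₄ a b c = ≈-trans (s₄ q a b c) (⊛-cong (⊛-cong (⊛-cong p₃ ≈-refl) ≈-refl) ≈-refl)

  -- With shifts 1, 2, 3, an exponent N yields 3N + 1 equal to 9x + 4, 9x + 7, 9x + 10, and 4 = 4·1,
  -- 7 = 1·7, 10 = 2·5 are the products b u belonging to `α`, `β`, `γ`.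
  lambert : F₂⟦q⟧ → F₂⟦q⟧ → F₂⟦q⟧ → F₂⟦q⟧
  lambert Jα Jβ Jγ = q^ 1 ⊛ sub 2 Jα ⊕ q^ 2 ⊛ sub 2 Jβ ⊕ q^ 3 ⊛ sub 2 Jγ

  module _ (Jα Jβ Jγ B : F₂⟦q⟧)
    (αJα : α ⊛ Jα ≈ sub 8 ψ) (βJβ : β ⊛ Jβ ≈ sub 8 ψ) (γJγ : γ ⊛ Jγ ≈ sub 8 ψ) (Bf : B ⊛ f ≈ f₉)
    where

    private
      L : F₂⟦q⟧
      L = lambert Jα Jβ Jγ
      q = q^ 1
      a₀ b₀ c₀ Y a b c e₂ : F₂⟦q⟧
      a₀ = sub 2 γ
      b₀ = sub 2 β
      c₀ = sub 2 α
      Y = cube f₂₇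
      a = a₀
      b = q ⊛ b₀
      c = q ⊛ q ⊛ c₀
      e₂ = a ⊛ b ⊕ a ⊛ c ⊕ b ⊛ c

      f₃-0 : f₃ 0 ≡ true
      f₃-0 = f-0

      J-sub : ∀ {x J} → x ⊛ J ≈ sub 8 ψ → sub 2 x ⊛ sub 2 J ≈ Y
      J-sub {x} {J} e = ≈-trans (≈-sym (sub-⊛ 2 x J)) (≈-trans (sub-cong 2 (≈-trans e (≈-trans (sub-cong 8 (≈-sym cube-f))
        (≈-trans (sub-cube 8 f) (cube-cong (sub8≈sub2∘sub2 f)))))) (sub-cube 2 f₉))

      f≈abc : f ≈ a ⊕ b ⊕ c
      f≈abc = ≈-trans f-mod3 (⊕-cong ≈-refl (⊛-cong (≈-sym (q^-+ 1 1)) ≈-refl))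

      abc-f₉ : a₀ ⊛ b₀ ⊛ c₀ ⊛ f₉ ≈ Y ⊛ f₃
      abc-f₉ = begin
        a₀ ⊛ b₀ ⊛ c₀ ⊛ f₉
          ≈⟨ solve 4 (λ a b c d → a :* b :* c :* d := c :* b :* a :* d) ≈-refl a₀ b₀ c₀ f₉ ⟩
        c₀ ⊛ b₀ ⊛ a₀ ⊛ sub 2 f₃
          ≈⟨ ≈-trans (sub-⊛ 2 _ _) (⊛-cong (≈-trans (sub-⊛ 2 _ _) (⊛-cong (sub-⊛ 2 α β) ≈-refl)) ≈-refl) ⟨
        sub 2 (α ⊛ β ⊛ γ ⊛ f₃) ≈⟨ sub-cong 2 αβγ ⟩
        sub 2 (cube f₉ ⊛ f) ≈⟨ ≈-trans (sub-⊛ 2 _ _) (⊛-cong (sub-cube 2 f₉) ≈-refl) ⟩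
        Y ⊛ f₃ ∎

      Y-0 : Y 0 ≡ true
      Y-0 = ⊛-unit {f₂₇ ⊛ f₂₇} {f₂₇} (⊛-unit {f₂₇} {f₂₇} f-0 f-0) f-0

      q²≈ : q^ 2 ≈ q ⊛ q
      q²≈ = ≈-sym (q^-+ 1 1)
      q³≈ : q^ 3 ≈ q ⊛ q ⊛ q
      q³≈ = ≈-sym (≈-trans (⊛-cong (q^-+ 1 1) ≈-refl) (q^-+ 2 1))

      -- At q³ each reciprocal is `Y` divided by one of `a₀`, `b₀`, `c₀`, while their product is Y
      -- f₃ / f₉. So each summand of `L` is a product of the other two components, times f₉ / f₃.
      lambert-f₃ : L ⊛ f₃ ≈ e₂ ⊛ f₉
      lambert-f₃ = ⊛-cancelˡ Y-0 (begin
        Y ⊛ (L ⊛ f₃)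
          ≈⟨ solve 3 (λ x y z → x :* (y :* z) := y :* (x :* z)) ≈-refl Y L f₃ ⟩
        L ⊛ (Y ⊛ f₃) ≈⟨ ⊛-cong (⊕-cong (⊕-cong ≈-refl (⊛-cong q²≈ ≈-refl)) (⊛-cong q³≈ ≈-refl)) (≈-sym abc-f₉) ⟩
        (q ⊛ jα ⊕ q ⊛ q ⊛ jβ ⊕ q ⊛ q ⊛ q ⊛ jγ) ⊛ (a₀ ⊛ b₀ ⊛ c₀ ⊛ f₉)
          ≈⟨ solve 8 (λ q x y z a b c g → (q :* x :+ q :* q :* y :+ q :* q :* q :* z) :* (a :* b :* c :* g)
               := (q :* a :* b :* (c :* x) :+ q :* q :* a :* c :* (b :* y) :+ q :* q :* q :* b :* c :* (a :* z)) :* g) ≈-refl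
               q jα jβ jγ a₀ b₀ c₀ f₉ ⟩
        (q ⊛ a₀ ⊛ b₀ ⊛ (c₀ ⊛ jα) ⊕ q ⊛ q ⊛ a₀ ⊛ c₀ ⊛ (b₀ ⊛ jβ) ⊕ q ⊛ q ⊛ q ⊛ b₀ ⊛ c₀ ⊛ (a₀ ⊛ jγ)) ⊛ f₉
          ≈⟨ ⊛-cong (⊕-cong (⊕-cong (⊛-cong ≈-refl (J-sub αJα)) (⊛-cong ≈-refl (J-sub βJβ))) (⊛-cong ≈-refl (J-sub γJγ))) ≈-refl ⟩
        (q ⊛ a₀ ⊛ b₀ ⊛ Y ⊕ q ⊛ q ⊛ a₀ ⊛ c₀ ⊛ Y ⊕ q ⊛ q ⊛ q ⊛ b₀ ⊛ c₀ ⊛ Y) ⊛ f₉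
          ≈⟨ solve 6 (λ q a b c y g → (q :* a :* b :* y :+ q :* q :* a :* c :* y :+ q :* q :* q :* b :* c :* y) :* g
               := y :* ((a :* (q :* b) :+ a :* (q :* q :* c) :+ (q :* b) :* (q :* q :* c)) :* g)) ≈-refl q a₀ b₀ c₀ Y f₉ ⟩
        Y ⊛ (e₂ ⊛ f₉) ∎)
        where
        jα = sub 2 Jα
        jβ = sub 2 Jβ
        jγ = sub 2 Jγ

      p₃ : cube a ⊕ cube b ⊕ cube c ≈ f₃
      p₃ = begin
        cube a ⊕ cube b ⊕ cube c
          ≈⟨ solve 4 (λ q x y z → x :* x :* x :+ (q :* y) :* (q :* y) :* (q :* y) :+ (q :* q :* z) :* (q :* q :* z) :* (q :* q :* z)
               := x :* x :* x :+ q :* q :* q :* (y :* y :* y) :+ (q :* q :* q) :* (q :* q :* q) :* (z :* z :* z)) ≈-refl q a₀ b₀ c₀ ⟩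
        cube a₀ ⊕ cube q ⊛ cube b₀ ⊕ cube q ⊛ cube q ⊛ cube c₀
          ≈⟨ ⊕-cong (⊕-cong (sub-cube 2 γ) (≈-trans (sub-⊛ 2 _ _) (⊛-cong s₁ (sub-cube 2 β)))) (≈-trans (sub-⊛ 2 _ _) (⊛-cong s₂ (sub-cube 2 α))) ⟨
        sub 2 (cube γ) ⊕ sub 2 (q ⊛ cube β) ⊕ sub 2 (q^ 2 ⊛ cube α)
          ≈⟨ ≈-trans (sub-⊕ 2 _ _) (⊕-cong (sub-⊕ 2 _ _) ≈-refl) ⟨
        sub 2 (cube γ ⊕ q ⊛ cube β ⊕ q^ 2 ⊛ cube α) ≈⟨ sub-cong 2 sum-of-cubes ⟩
        f₃ ∎
        where
        s₁ : sub 2 q ≈ cube q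
        s₁ = ≈-trans (sub-q^ 2 1) q³≈
        s₂ : sub 2 (q^ 2) ≈ cube q ⊛ cube q
        s₂ = ≈-trans (sub-cong 2 q²≈) (≈-trans (sub-⊛ 2 q q) (⊛-cong s₁ s₁))

      -- Newton's identity p₃ = e₁³ + e₁ e₂ + e₃ modulo 2, where e₁ = `f` by the dissection and p₃ =
      -- `f₃` by `sum-of-cubes`.
      f-e₂ : f ⊛ e₂ ≈ cube f ⊕ f₃ ⊕ a ⊛ b ⊛ c
      f-e₂ = begin
        f ⊛ e₂ ≈⟨ ⊛-cong f≈abc ≈-refl ⟩
        (a ⊕ b ⊕ c) ⊛ e₂
          ≈⟨ solve 3 (λ a b c → let s = a :+ b :+ c in s :* (a :* b :+ a :* c :+ b :* c)
               := s :* s :* s :+ (a :* a :* a :+ b :* b :* b :+ c :* c :* c) :+ a :* b :* c) ≈-refl a b c ⟩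
        cube (a ⊕ b ⊕ c) ⊕ (cube a ⊕ cube b ⊕ cube c) ⊕ a ⊛ b ⊛ c
          ≈⟨ ⊕-cong (⊕-cong (cube-cong (≈-sym f≈abc)) p₃) ≈-refl ⟩
        cube f ⊕ f₃ ⊕ a ⊛ b ⊛ c ∎

      -- The power q³ in a b c makes the term q³ Y of `cube-f-mod3`, taken at q³, available to
      -- eliminate `Y`.
      abc : a ⊛ b ⊛ c ⊛ f₉ ≈ (cube f₃ ⊕ f₉) ⊛ f₃
      abc = begin
        a ⊛ b ⊛ c ⊛ f₉
          ≈⟨ solve 5 (λ q x y z g → x :* (q :* y) :* (q :* q :* z) :* g := (q :* q :* q) :* (x :* y :* z :* g)) ≈-refl q a₀ b₀ c₀ f₉ ⟩
        q ⊛ q ⊛ q ⊛ (a₀ ⊛ b₀ ⊛ c₀ ⊛ f₉) ≈⟨ ⊛-cong (≈-trans (≈-sym q³≈) (≈-sym (sub-q^ 2 1))) abc-f₉ ⟩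
        sub 2 q ⊛ (Y ⊛ f₃) ≈⟨ ⊛-assoc _ _ _ ⟨
        sub 2 q ⊛ Y ⊛ f₃ ≈⟨ ⊛-cong q³Y ≈-refl ⟩
        (cube f₃ ⊕ f₉) ⊛ f₃ ∎
        where
        q³Y : sub 2 q ⊛ Y ≈ cube f₃ ⊕ f₉
        q³Y = begin
          sub 2 q ⊛ Y ≈⟨ solve 2 (λ x y → x := (y :+ x) :+ y) ≈-refl _ f₉ ⟩
          (f₉ ⊕ sub 2 q ⊛ Y) ⊕ f₉
            ≈⟨ ⊕-cong (≈-trans (sub-⊕ 2 _ _) (⊕-cong ≈-refl (≈-trans (sub-⊛ 2 _ _) (⊛-cong ≈-refl (sub-cube 2 f₉))))) ≈-refl ⟨
          sub 2 (f₃ ⊕ q ⊛ cube f₉) ⊕ f₉ ≈⟨ ⊕-cong (≈-trans (sub-cong 2 (≈-sym cube-f-mod3)) (sub-cube 2 f)) ≈-refl ⟩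
          cube f₃ ⊕ f₉ ∎

      lambert-f-f₃ : L ⊛ f ⊛ f₃ ≈ q ⊛ cube f₉ ⊛ f₉ ⊕ f₉ ⊛ f₃ ⊕ cube f₃ ⊛ f₃
      lambert-f-f₃ = begin
        L ⊛ f ⊛ f₃
          ≈⟨ solve 3 (λ x y z → x :* y :* z := y :* (x :* z)) ≈-refl L f f₃ ⟩
        f ⊛ (L ⊛ f₃) ≈⟨ ⊛-cong ≈-refl lambert-f₃ ⟩
        f ⊛ (e₂ ⊛ f₉) ≈⟨ ⊛-assoc _ _ _ ⟨
        f ⊛ e₂ ⊛ f₉ ≈⟨ ⊛-cong f-e₂ ≈-refl ⟩
        (cube f ⊕ f₃ ⊕ a ⊛ b ⊛ c) ⊛ f₉
          ≈⟨ solve 4 (λ x y z w → (x :+ y :+ z) :* w := (x :+ y) :* w :+ z :* w) ≈-refl (cube f) f₃ (a ⊛ b ⊛ c) f₉ ⟩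
        (cube f ⊕ f₃) ⊛ f₉ ⊕ a ⊛ b ⊛ c ⊛ f₉ ≈⟨ ⊕-cong (⊛-cong (⊕-cong cube-f-mod3 ≈-refl) ≈-refl) abc ⟩
        (f₃ ⊕ q ⊛ cube f₉ ⊕ f₃) ⊛ f₉ ⊕ (cube f₃ ⊕ f₉) ⊛ f₃
          ≈⟨ solve 5 (λ x r w y g → (x :+ r :* w :+ x) :* g :+ (y :+ g) :* x := r :* w :* g :+ g :* x :+ y :* x) ≈-refl f₃ q (cube f₉) (cube f₃) f₉ ⟩
        q ⊛ cube f₉ ⊛ f₉ ⊕ f₉ ⊛ f₃ ⊕ cube f₃ ⊛ f₃ ∎

      F G K : F₂⟦q⟧
      F = sub 3 f
      G = sub 3 f₃
      K = sub 3 f₉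

      -- The cross term f₃ f₉ occurs in both series and cancels; what remains are fourth powers, so
      -- series in q⁴ times 1 and q.
      difference : (L ⊕ B) ⊛ f ⊛ f₃ ≈ G ⊕ q ⊛ K
      difference = begin
        (L ⊕ B) ⊛ f ⊛ f₃
          ≈⟨ solve 4 (λ x b g h → (x :+ b) :* g :* h := x :* g :* h :+ b :* g :* h) ≈-refl L B f f₃ ⟩
        L ⊛ f ⊛ f₃ ⊕ B ⊛ f ⊛ f₃ ≈⟨ ⊕-cong lambert-f-f₃ (⊛-cong Bf ≈-refl) ⟩
        (q ⊛ cube f₉ ⊛ f₉ ⊕ f₉ ⊛ f₃ ⊕ cube f₃ ⊛ f₃) ⊕ f₉ ⊛ f₃
          ≈⟨ solve 3 (λ q x y → (q :* (y :* y :* y) :* y :+ y :* x :+ (x :* x :* x) :* x) :+ y :* x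
               := (x :* x) :* (x :* x) :+ q :* ((y :* y) :* (y :* y))) ≈-refl q f₃ f₉ ⟩
        ((f₃ ⊛ f₃) ⊛ (f₃ ⊛ f₃)) ⊕ q ⊛ ((f₉ ⊛ f₉) ⊛ (f₉ ⊛ f₉)) ≈⟨ ⊕-cong (fourth-power f₃) (⊛-cong ≈-refl (fourth-power f₉)) ⟨
        G ⊕ q ⊛ K ∎

      -- The cubes of `f` and `f₃` complete the multiplier f f₃ to a fourth power, and
      -- `cube-product` is what expresses these cubes through series in q⁴ with only 1 and q
      -- besides.
      difference′ : sub 3 (f ⊛ f₃) ⊛ (L ⊕ B) ≈ sub 3 (f₃ ⊛ cube f) ⊛ 1s ⊕ sub 3 (f₉ ⊛ cube f ⊕ f₃ ⊛ cube f₃) ⊛ q ⊕ sub 3 (f₉ ⊛ cube f₃) ⊛ q^ 2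
      difference′ = begin
        sub 3 (f ⊛ f₃) ⊛ (L ⊕ B) ≈⟨ ⊛-cong (≈-trans (sub-⊛ 3 f f₃) (⊛-cong (fourth-power f) (fourth-power f₃))) ≈-refl ⟩
        ((f ⊛ f) ⊛ (f ⊛ f)) ⊛ ((f₃ ⊛ f₃) ⊛ (f₃ ⊛ f₃)) ⊛ (L ⊕ B)
          ≈⟨ solve 3 (λ x y z → ((x :* x) :* (x :* x)) :* ((y :* y) :* (y :* y)) :* z := (z :* x :* y) :* ((x :* x :* x) :* (y :* y :* y))) ≈-refl f f₃ (L ⊕ B) ⟩
        ((L ⊕ B) ⊛ f ⊛ f₃) ⊛ (cube f ⊛ cube f₃) ≈⟨ ⊛-cong difference cube-product ⟩
        (G ⊕ q ⊛ K) ⊛ (cube F ⊕ q ⊛ cube G)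
          ≈⟨ solve 5 (λ q g k x y → (g :+ q :* k) :* (x :+ q :* y) := (g :* x) :* con true :+ (k :* x :+ g :* y) :* q :+ (k :* y) :* (q :* q)) ≈-refl q G K (cube F) (cube G) ⟩
        (G ⊛ cube F) ⊛ 1s ⊕ (K ⊛ cube F ⊕ G ⊛ cube G) ⊛ q ⊕ (K ⊛ cube G) ⊛ (q ⊛ q)
          ≈⟨ ⊕-cong (⊕-cong (⊛-cong (s f₃ f) ≈-refl) (⊛-cong (≈-trans (sub-⊕ 3 _ _) (⊕-cong (s f₉ f) (s f₃ f₃))) ≈-refl)) (⊛-cong (s f₉ f₃) q²≈) ⟨
        sub 3 (f₃ ⊛ cube f) ⊛ 1s ⊕ sub 3 (f₉ ⊛ cube f ⊕ f₃ ⊛ cube f₃) ⊛ q ⊕ sub 3 (f₉ ⊛ cube f₃) ⊛ q^ 2 ∎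
        where
        s : ∀ x y → sub 3 (x ⊛ cube y) ≈ sub 3 x ⊛ cube (sub 3 y)
        s x y = ≈-trans (sub-⊛ 3 _ _) (⊛-cong ≈-refl (sub-cube 3 y))

    -- Of the three terms on the right of `difference′` only the one without `q` meets exponents
    -- divisible by 4. It contributes f₃ f³, and dividing by f f₃ leaves f² = f(q²).
    section-lambert : section 4 (lambert Jα Jβ Jγ) ⊕ section 4 B ≈ sub 1 f
    section-lambert = ⊛-cancelˡ (⊛-unit {f} {f₃} f-0 f₃-0) (begin
      f ⊛ f₃ ⊛ (section 4 L ⊕ section 4 B) ≈⟨ ⊛-cong ≈-refl (section-⊕ 4 L B) ⟨
      f ⊛ f₃ ⊛ section 4 (L ⊕ B) ≈⟨ section-sub-⊛ 3 (f ⊛ f₃) (L ⊕ B) ⟨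
      section 4 (sub 3 (f ⊛ f₃) ⊛ (L ⊕ B)) ≈⟨ section-cong 4 difference′ ⟩
      section 4 (sub 3 x ⊛ 1s ⊕ sub 3 y ⊛ q ⊕ sub 3 z ⊛ q^ 2)
        ≈⟨ ≈-trans (section-⊕ 4 _ _) (⊕-cong (section-⊕ 4 _ _) ≈-refl) ⟩
      section 4 (sub 3 x ⊛ 1s) ⊕ section 4 (sub 3 y ⊛ q) ⊕ section 4 (sub 3 z ⊛ q^ 2)
        ≈⟨ ⊕-cong (⊕-cong (≈-trans (section-sub-⊛ 3 x 1s) (≈-trans (⊛-cong ≈-refl (coeffwise λ { zero → refl ; (suc n) → refl })) (⊛-1s x)))
             (≈-trans (section-sub-⊛ 3 y q) (≈-trans (⊛-cong ≈-refl (coeffwise λ { zero → refl ; (suc n) → refl })) (≈-trans (⊛-comm y 0s) (0s-⊛ y)))))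
             (≈-trans (section-sub-⊛ 3 z (q^ 2)) (≈-trans (⊛-cong ≈-refl (coeffwise λ { zero → refl ; (suc n) → refl })) (≈-trans (⊛-comm z 0s) (0s-⊛ z)))) ⟩
      x ⊕ 0s ⊕ 0s ≈⟨ ≈-trans (⊕-identityʳ _) (⊕-identityʳ _) ⟩
      f₃ ⊛ cube f ≈⟨ solve 2 (λ x y → y :* (x :* x :* x) := (x :* y) :* (x :* x)) ≈-refl f f₃ ⟩
      (f ⊛ f₃) ⊛ (f ⊛ f) ≈⟨ ⊛-cong ≈-refl (frobenius f) ⟨
      f ⊛ f₃ ⊛ sub 1 f ∎)
      where
      x y z : F₂⟦q⟧
      x = f₃ ⊛ cube f
      y = f₉ ⊛ cube f ⊕ f₃ ⊛ cube f₃
      z = f₉ ⊛ cube f₃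

-- The generating function of regular partitions modulo 2

module Partition where

  open import Defs using (mkIsPartition; IsRegularPartition; mkIsRegularPartition; b; ∈-regularPartitions; regularPartitions-unique)
  open Series
  open Theta
  open Eta
  open import Data.Bool.Base using (Bool; true; false; _xor_; not)
  open import Data.Bool.Properties using (not-distribˡ-xor; xor-identityʳ)
  open import Data.Empty using (⊥-elim)
  open import Data.List.Base using (List; []; _∷_; _++_; map; length)
  open import Data.List.Properties using (length-++; length-map; ∷-injectiveʳ)
  open import Data.List.Membership.Propositional using (_∈_)
  open import Data.List.Membership.Propositional.Properties using (∈-map⁺; ∈-map⁻; ∈-++⁺ˡ; ∈-++⁺ʳ; ∈-++⁻; ∈-∃++)
  open import Data.List.Relation.Binary.Subset.Propositional using (_⊆_)
  open import Data.List.Relation.Unary.All as All using (All; []; _∷_)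
  open import Data.List.Relation.Unary.AllPairs using ([]; _∷_)
  open import Data.List.Relation.Unary.Any using (here; there)
  open import Data.List.Relation.Unary.Linked as Linked using (Linked; []; [-]; _∷_)
  open import Data.List.Relation.Unary.Unique.Propositional using (Unique)
  import Data.List.Relation.Unary.Unique.Propositional.Properties as Unique
  open import Data.Nat.Base
  open import Data.Nat.Divisibility using (_∣_; _∣?_; ∣m+n∣m⇒∣n; n∣m*n; >⇒∤)
  open import Data.Nat.ListAction using (sum)
  open import Data.Nat.Properties
  open import Data.Nat.Tactic.RingSolver using (solve-∀)
  open import Data.Product.Base using (_×_; _,_)
  open import Data.Sum.Base using (inj₁; inj₂)
  open import Function.Bundles using (Equivalence)
  open import Relation.Binary.PropositionalEquality hiding (setoid)
  open import Relation.Nullary using (¬_; Dec; yes; no; contradiction)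

  length-⊆ : ∀ {A : Set} {xs ys : List A} → Unique xs → xs ⊆ ys → length xs ≤ length ys
  length-⊆ {xs = []}     _        _   = z≤n
  length-⊆ {xs = x ∷ xs} (x∉ ∷ u) sub with ∈-∃++ (sub (here refl))
  ... | as , bs , refl = subst (suc (length xs) ≤_) (sym (trans (length-++ as) (trans (+-suc _ _) (cong suc (sym (length-++ as))))))
    (s≤s (length-⊆ u sub′))
    where
    sub′ : xs ⊆ as ++ bs
    sub′ y∈ with ∈-++⁻ as (sub (there y∈))
    ... | inj₁ y∈as         = ∈-++⁺ˡ y∈as
    ... | inj₂ (here refl)  = ⊥-elim (All.lookup x∉ y∈ refl)
    ... | inj₂ (there y∈bs) = ∈-++⁺ʳ as y∈bs

  odd : ℕ → Bool
  odd zero    = false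
  odd (suc n) = not (odd n)

  odd-+ : ∀ m n → odd (m + n) ≡ odd m xor odd n
  odd-+ zero    n = refl
  odd-+ (suc m) n = trans (cong not (odd-+ m n)) (not-distribˡ-xor (odd m) (odd n))

  private
    ring₁ : ∀ x → suc x ≡ x * 1 + 1
    ring₁ = solve-∀
    ring₂ : ∀ l n → (n * 1 + 1) * suc l ≡ (l + n * suc l) * 1 + 1
    ring₂ = solve-∀

  module RegularPartitions (l : ℕ) where
    private
      ℓ = suc l

    -- the regular partitions of n into parts at most m, for large enough fuel
    enum : ℕ → ℕ → ℕ → List (List ℕ)
    enum k       zero    zero    = [] ∷ []
    enum k       zero    (suc n) = []
    enum zero    (suc m) n       = []
    enum (suc k) (suc m) n       with ℓ ∣? suc m | suc m ≤? n
    ... | no _ | yes _ = enum k m n ++ map (suc m ∷_) (enum k (suc m) (n ∸ suc m))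
    ... | _    | _     = enum k m n

    Bounded : ℕ → ℕ → List ℕ → Set
    Bounded m n xs = Linked _≥_ (m ∷ xs) × All (0 <_) xs × sum xs ≡ n × All (λ p → ¬ ℓ ∣ p) xs

    private
      weaken : ∀ {m n xs} → Bounded m n xs → Bounded (suc m) n xs
      weaken ([-] , rest)      = [-] , rest
      weaken (m≥x ∷ lk , rest) = (m≤n⇒m≤1+n m≥x ∷ lk) , rest

    enum-sound : ∀ k m n {xs} → xs ∈ enum k m n → Bounded m n xs
    enum-sound k       zero    zero    (here refl) = [-] , [] , refl , []
    enum-sound (suc k) (suc m) n       xs∈ with ℓ ∣? suc m | suc m ≤? n
    ... | yes _ | yes _ = weaken (enum-sound k m n xs∈)
    ... | yes _ | no  _ = weaken (enum-sound k m n xs∈)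
    ... | no  _ | no  _ = weaken (enum-sound k m n xs∈)
    ... | no ∤m | yes m≤n with ∈-++⁻ (enum k m n) xs∈
    ...   | inj₁ xs∈′ = weaken (enum-sound k m n xs∈′)
    ...   | inj₂ xs∈′ with ∈-map⁻ (suc m ∷_) xs∈′
    ...     | ys , ys∈ , refl with enum-sound k (suc m) (n ∸ suc m) ys∈
    ...       | lk , pos , refl-sum , reg = (≤-refl ∷ lk) , (z<s ∷ pos) , trans (cong (suc m +_) refl-sum) (m+[n∸m]≡n m≤n) , (∤m ∷ reg)

    enum-complete : ∀ k m n {xs} → m + n ≤ k → Bounded m n xs → xs ∈ enum k m n
    enum-complete k       zero    zero    {[]}     _ _ = here refl
    enum-complete k       zero    (suc n) {[]}     _ (_ , _ , () , _)
    enum-complete k       zero    n       {x ∷ xs} _ (z≤n ∷ _ , () ∷ _ , _)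
    enum-complete (suc k) (suc m) n       {xs} (s≤s m+n≤k) bd with ℓ ∣? suc m | suc m ≤? n
    ... | yes d | yes _ = enum-complete k m n m+n≤k (tighten bd)
      where
      tighten : ∀ {xs} → Bounded (suc m) n xs → Bounded m n xs
      tighten ([-] , rest) = [-] , rest
      tighten (m≥x ∷ lk , pos , s , (∤x ∷ reg)) with m≤n⇒m<n∨m≡n m≥x
      ... | inj₁ (s≤s m≥x′) = (m≥x′ ∷ lk) , pos , s , (∤x ∷ reg)
      ... | inj₂ refl = contradiction d ∤x
    ... | yes d | no m≰n = enum-complete k m n m+n≤k (tighten bd)
      where
      tighten : ∀ {xs} → Bounded (suc m) n xs → Bounded m n xs
      tighten ([-] , rest) = [-] , rest
      tighten (m≥x ∷ lk , pos , s , (∤x ∷ reg)) with m≤n⇒m<n∨m≡n m≥x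
      ... | inj₁ (s≤s m≥x′) = (m≥x′ ∷ lk) , pos , s , (∤x ∷ reg)
      ... | inj₂ refl = contradiction d ∤x
    ... | no _ | no m≰n = enum-complete k m n m+n≤k (tighten bd)
      where
      tighten : ∀ {xs} → Bounded (suc m) n xs → Bounded m n xs
      tighten ([-] , rest) = [-] , rest
      tighten {x ∷ xs} (m≥x ∷ lk , pos , refl , reg) with m≤n⇒m<n∨m≡n m≥x
      ... | inj₁ (s≤s m≥x′) = (m≥x′ ∷ lk) , pos , refl , reg
      ... | inj₂ refl = contradiction (m≤m+n (suc m) (sum xs)) m≰n
    enum-complete (suc k) (suc m) n {[]} (s≤s m+n≤k) (_ , pos , s , reg) | no _ | yes m≤n =
      ∈-++⁺ˡ (enum-complete k m n m+n≤k ([-] , pos , s , reg))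
    enum-complete (suc k) (suc m) n {x ∷ xs} (s≤s m+n≤k) (m≥x ∷ lk , (0<x ∷ pos) , refl , (∤x ∷ reg)) | no _ | yes m≤n
      with m≤n⇒m<n∨m≡n m≥x
    ... | inj₁ (s≤s m≥x′) = ∈-++⁺ˡ (enum-complete k m n m+n≤k ((m≥x′ ∷ lk) , (0<x ∷ pos) , refl , (∤x ∷ reg)))
    ... | inj₂ refl = ∈-++⁺ʳ (enum k m n) (∈-map⁺ (suc m ∷_)
      (enum-complete k (suc m) _ (subst (_≤ k) (sym (m+[n∸m]≡n m≤n)) (≤-trans (m≤n+m _ m) m+n≤k)) (lk , pos , sym (m+n∸m≡n (suc m) (sum xs)) , reg)))

    enum-unique : ∀ k m n → Unique (enum k m n)
    enum-unique k       zero    zero    = [] ∷ []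
    enum-unique k       zero    (suc n) = []
    enum-unique zero    (suc m) n       = []
    enum-unique (suc k) (suc m) n with ℓ ∣? suc m | suc m ≤? n
    ... | yes _ | yes _ = enum-unique k m n
    ... | yes _ | no  _ = enum-unique k m n
    ... | no  _ | no  _ = enum-unique k m n
    ... | no  _ | yes _ = Unique.++⁺ (enum-unique k m n) (Unique.map⁺ ∷-injectiveʳ (enum-unique k (suc m) (n ∸ suc m))) disjoint
      where
      disjoint : ∀ {xs} → ¬ (xs ∈ enum k m n × xs ∈ map (suc m ∷_) (enum k (suc m) (n ∸ suc m)))
      disjoint (xs∈ , xs∈′) with ∈-map⁻ (suc m ∷_) xs∈′
      ... | _ , _ , refl with enum-sound k m n xs∈
      ...   | m≥1+m ∷ _ , _ = 1+n≰n m≥1+m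

    -- Independence of the fuel is seen on the members: both are lists without repetition of the
    -- same partitions.
    length-enum : ∀ k k′ m n → m + n ≤ k → m + n ≤ k′ → length (enum k m n) ≡ length (enum k′ m n)
    length-enum k k′ m n le le′ = ≤-antisym
      (length-⊆ (enum-unique k m n) λ xs∈ → enum-complete k′ m n le′ (enum-sound k m n xs∈))
      (length-⊆ (enum-unique k′ m n) λ xs∈ → enum-complete k m n le (enum-sound k′ m n xs∈))

    -- The bound n + 1 on the parts, where n would do, matches the limit of the series `P m`, whose
    -- coefficient n is taken from `P (suc n)`.
    b≡length-enum : ∀ n → b ℓ n ≡ length (enum (suc n + n) (suc n) n)
    b≡length-enum n = ≤-antisym
      (length-⊆ (regularPartitions-unique ℓ n) λ {xs} xs∈ → enum-complete (suc n + n) (suc n) n ≤-refl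
        (to-bounded (Equivalence.to (∈-regularPartitions ℓ n xs) xs∈)))
      (length-⊆ (enum-unique (suc n + n) (suc n) n) λ {xs} xs∈ → Equivalence.from (∈-regularPartitions ℓ n xs)
        (from-bounded (enum-sound (suc n + n) (suc n) n xs∈)))
      where
      to-bounded : ∀ {xs} → IsRegularPartition ℓ n xs → Bounded (suc n) n xs
      to-bounded {[]}     (mkIsRegularPartition (mkIsPartition _ pos s) reg) = [-] , pos , s , reg
      to-bounded {x ∷ xs} (mkIsRegularPartition (mkIsPartition lk pos refl) reg) =
        (m≤n⇒m≤1+n (m≤m+n x (sum xs)) ∷ lk) , pos , refl , reg
      from-bounded : ∀ {xs} → Bounded (suc n) n xs → IsRegularPartition ℓ n xs
      from-bounded (lk , pos , s , reg) = mkIsRegularPartition (mkIsPartition (Linked.tail lk) pos s) reg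

    private
      P : ℕ → F₂⟦q⟧
      P m n = odd (length (enum (m + n) m n))

    factor : ℕ → F₂⟦q⟧
    factor i with ℓ ∣? i
    ... | yes _ = 1s
    ... | no  _ = 1s ⊕ q^ i

    factor-∣ : ∀ {i} → ℓ ∣ i → factor i ≈ 1s
    factor-∣ {i} d with ℓ ∣? i
    ... | yes _ = ≈-refl
    ... | no ∤i = contradiction d ∤i

    factor-∤ : ∀ {i} → ¬ ℓ ∣ i → factor i ≈ 1s ⊕ q^ i
    factor-∤ {i} ∤i with ℓ ∣? i
    ... | yes d = contradiction d ∤i
    ... | no  _ = ≈-refl

    regular-product< : ℕ → F₂⟦q⟧
    regular-product< zero    = 1s
    regular-product< (suc n) = regular-product< n ⊛ factor (suc n)

    private
      P-zero : P 0 ≈ 1s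
      P-zero = coeffwise λ { zero → refl ; (suc n) → refl }

      enum-∣ : ∀ k m n → ℓ ∣ suc m → enum (suc k) (suc m) n ≡ enum k m n
      enum-∣ k m n d with ℓ ∣? suc m | suc m ≤? n
      ... | yes _ | yes _ = refl
      ... | yes _ | no  _ = refl
      ... | no ∤m | _     = contradiction d ∤m

      enum-> : ∀ k m n → ¬ suc m ≤ n → enum (suc k) (suc m) n ≡ enum k m n
      enum-> k m n m≰n with ℓ ∣? suc m | suc m ≤? n
      ... | _     | yes m≤n = contradiction m≤n m≰n
      ... | yes _ | no  _   = refl
      ... | no  _ | no  _   = refl

      enum-≤ : ∀ k m n → ¬ ℓ ∣ suc m → suc m ≤ n →
        enum (suc k) (suc m) n ≡ enum k m n ++ map (suc m ∷_) (enum k (suc m) (n ∸ suc m))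
      enum-≤ k m n ∤m m≤n with ℓ ∣? suc m | suc m ≤? n
      ... | yes d | _       = contradiction d ∤m
      ... | no  _ | yes _   = refl
      ... | no  _ | no m≰n = contradiction m≤n m≰n

      -- A partition into parts at most m + 1 either has no part m + 1, or loses one and is still of
      -- that kind; the second case is empty if ℓ divides m + 1.
      P-suc : ∀ m → P (suc m) ⊛ factor (suc m) ≈ P m
      P-suc m = by-cases (ℓ ∣? suc m)
        where
        go : ∀ n → ¬ ℓ ∣ suc m → Dec (suc m ≤ n) → P (suc m) n ≡ P m n xor shⁿ (suc m) (P (suc m)) n
        go n ∤m (no m≰n) = trans (cong (λ xs → odd (length xs)) (enum-> (m + n) m n m≰n))
          (sym (trans (cong (P m n xor_) (shⁿ-at-< (suc m) _ (≰⇒> m≰n))) (xor-identityʳ _)))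
        go n ∤m (yes m≤n) = trans (cong odd (trans (cong length (enum-≤ (m + n) m n ∤m m≤n)) (length-++ (enum (m + n) m n))))
          (trans (odd-+ (length (enum (m + n) m n)) _) (cong (P m n xor_) (trans
            (cong odd (trans (length-map (suc m ∷_) (enum (m + n) (suc m) (n ∸ suc m)))
              (length-enum (m + n) (suc m + (n ∸ suc m)) (suc m) (n ∸ suc m) (≤-trans (≤-reflexive (m+[n∸m]≡n m≤n)) (m≤n+m n m)) ≤-refl)))
            (sym (trans (cong (shⁿ (suc m) (P (suc m))) (sym (m+[n∸m]≡n m≤n))) (shⁿ-at-+ (suc m) (P (suc m)) (n ∸ suc m)))))))
        by-cases : Dec (ℓ ∣ suc m) → P (suc m) ⊛ factor (suc m) ≈ P m
        by-cases (yes d) = ≈-trans (⊛-cong ≈-refl (factor-∣ d)) (≈-trans (⊛-1s _)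
          (coeffwise λ n → cong (λ xs → odd (length xs)) (enum-∣ (m + n) m n d)))
        by-cases (no ∤m) = ≈-trans (⊛-cong (≈-refl {P (suc m)}) (factor-∤ ∤m)) (≈-trans (⊛-distribˡ _ 1s _)
          (≈-trans (⊕-cong (⊛-1s _) (≈-trans (⊛-comm _ _) (q^-⊛ (suc m) _)))
          (≈-trans (⊕-cong P≈ ≈-refl) (≈-trans (⊕-assoc _ _ _) (≈-trans (⊕-cong ≈-refl (⊕-self _)) (⊕-identityʳ _))))))
          where
          P≈ : P (suc m) ≈ P m ⊕ shⁿ (suc m) (P (suc m))
          P≈ = coeffwise λ n → trans (go n ∤m (suc m ≤? n)) (sym (⊕-at (P m) _ n))

      P-inverse : ∀ m → P m ⊛ regular-product< m ≈ 1s
      P-inverse zero    = ≈-trans (⊛-1s _) P-zero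
      P-inverse (suc m) = ≈-trans (⊛-cong ≈-refl (⊛-comm _ _)) (≈-trans (≈-sym (⊛-assoc _ _ _))
        (≈-trans (⊛-cong (P-suc m) ≈-refl) (P-inverse m)))

      factor-≈1 : ∀ m → factor (suc m) ≈[ m ] 1s
      factor-≈1 m with ℓ ∣? suc m
      ... | yes _ = ≈[]-refl
      ... | no  _ = ≈[]-weaken (n≤1+n m) (1⊕q^-≈1 (suc m))

      P-step : ∀ m → P (suc m) ≈[ m ] P m
      P-step m = ≈[]-trans (≈[]-sym (≈[]-trans (⊛-cong[] ≈[]-refl (factor-≈1 m)) (≈⇒≈[] (⊛-1s _)))) (≈⇒≈[] (P-suc m))

      run : ∀ r n → r ≤ l → regular-product< (r + n * ℓ) ≈ regular-product< (n * ℓ) ⊛ Π< r (λ i → 1s ⊕ q^ ((i + n * ℓ) * 1 + 1))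
      run zero    n _   = ≈-sym (⊛-1s _)
      run (suc r) n r<l = ≈-trans (⊛-cong (run r n (<⇒≤ r<l)) (≈-trans (factor-∤ ∤) (⊕-cong ≈-refl (q^-≡ (ring₁ (r + n * ℓ))))))
        (⊛-assoc _ _ _)
        where
        ∤ : ¬ ℓ ∣ suc (r + n * ℓ)
        ∤ d = >⇒∤ (s≤s r<l) (∣m+n∣m⇒∣n (subst (ℓ ∣_) (trans (cong suc (+-comm r _)) (sym (+-suc (n * ℓ) r))) d) (n∣m*n n))

      -- The factors at multiples of ℓ, missing from the regular product, are those of the
      -- substituted product.
      split : ∀ n → regular-product< (n * ℓ) ⊛ sub l (progression-product< 1 1 n) ≈ progression-product< 1 1 (n * ℓ)
      split zero    = ≈-trans (1s-⊛ _) (sub-1s l)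
      split (suc n) = begin
        regular-product< (l + n * ℓ) ⊛ factor (suc (l + n * ℓ)) ⊛ sub l (progression-product< 1 1 n ⊛ (1s ⊕ q^ (n * 1 + 1)))
          ≈⟨ ⊛-cong (⊛-cong (run l n ≤-refl) (factor-∣ (n∣m*n (suc n)))) (≈-trans (sub-⊛ l _ _)
               (⊛-cong ≈-refl (≈-trans (sub-⊕ l _ _) (⊕-cong (sub-1s l) (≈-trans (sub-q^ l (n * 1 + 1)) (q^-≡ (ring₂ l n))))))) ⟩
        regular-product< (n * ℓ) ⊛ X ⊛ 1s ⊛ (sub l (progression-product< 1 1 n) ⊛ (1s ⊕ q^ ((l + n * ℓ) * 1 + 1)))
          ≈⟨ solve 4 (λ a x s y → a :* x :* con true :* (s :* y) := a :* s :* (x :* y)) ≈-refl (regular-product< (n * ℓ)) X (sub l (progression-product< 1 1 n)) (1s ⊕ q^ ((l + n * ℓ) * 1 + 1)) ⟩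
        regular-product< (n * ℓ) ⊛ sub l (progression-product< 1 1 n) ⊛ (X ⊛ (1s ⊕ q^ ((l + n * ℓ) * 1 + 1)))
          ≈⟨ ⊛-cong (split n) ≈-refl ⟩
        progression-product< 1 1 (n * ℓ) ⊛ (X ⊛ (1s ⊕ q^ ((l + n * ℓ) * 1 + 1)))
          ≈⟨ progression-product<-+ 1 1 ℓ (n * ℓ) ⟨
        progression-product< 1 1 (ℓ + n * ℓ) ∎
        where
        open ≈-Reasoning
        open Char2Solver using (solve; _:*_; _:=_; con)
        X = Π< l (λ i → 1s ⊕ q^ ((i + n * ℓ) * 1 + 1))

    b-series : F₂⟦q⟧
    b-series n = odd (b ℓ n)

    -- The Euler product of regular partitions, cross-multiplied. Signs are lost modulo 2, so `f`
    -- serves for numerator and denominator.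
    b-series-f : b-series ⊛ f ≈ sub l f
    b-series-f = ≈[]⇒≈ λ N → ≈[]-trans (⊛-cong[] (≈[]-trans (≈⇒≈[] (coeffwise λ n → cong odd (b≡length-enum n)))
          (≈[]-weaken (m≤m*n N ℓ) (diagonal P P-step (N * ℓ))))
        (≈[]-trans (≈⇒≈[] euler-product) (≈[]-weaken (m≤m*n N ℓ) (progression-product-≈[] 1 1 (N * ℓ)))))
      (≈[]-trans (≈⇒≈[] (≈-trans (⊛-cong ≈-refl (≈-sym (split N))) (≈-trans (≈-sym (⊛-assoc _ _ _))
          (≈-trans (⊛-cong (P-inverse (N * ℓ)) ≈-refl) (1s-⊛ _)))))
        (≈[]-sym (≈[]-trans (≈⇒≈[] (sub-cong l euler-product)) (sub-cong[] l (progression-product-≈[] 1 1 N)))))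

-- Parity of finite counts

module Parity where

  open Series
  open Partition using (odd; length-⊆)
  open import Data.Bool.Base using (Bool; true; false; _∧_; _xor_; not)
  open import Data.Bool.Properties using (xor-assoc; xor-comm; ∧-assoc; not-involutive) renaming (_≟_ to _≟ᵇ_)
  open import Data.Empty using (⊥-elim)
  open import Data.List.Base using (List; []; _∷_; _++_; map; length; filter; cartesianProduct)
  open import Data.List.Properties using (length-++; length-map)
  open import Data.List.Membership.Propositional using (_∈_)
  open import Data.List.Membership.Propositional.Properties
  open import Data.List.Relation.Binary.Subset.Propositional using (_⊆_)
  open import Data.List.Relation.Unary.All as All using (All; []; _∷_)
  open import Data.List.Relation.Unary.AllPairs using ([]; _∷_)
  open import Data.List.Relation.Unary.Any using (here; there)
  open import Data.List.Relation.Unary.Unique.Propositional using (Unique)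
  import Data.List.Relation.Unary.Unique.Propositional.Properties as Unique
  open import Data.Nat.Base
  open import Data.Nat.Properties
  open import Data.Product.Base using (_×_; _,_; proj₁; proj₂)
  open import Data.Sum.Base using (inj₁; inj₂)
  open import Relation.Binary.PropositionalEquality hiding (setoid)
  open import Relation.Nullary using (¬_)

  private variable
    A B : Set

  par : (A → Bool) → List A → Bool
  par p []       = false
  par p (x ∷ xs) = p x xor par p xs

  par-cong : ∀ {p q : A → Bool} xs → (∀ x → x ∈ xs → p x ≡ q x) → par p xs ≡ par q xs
  par-cong []       e = refl
  par-cong (x ∷ xs) e = cong₂ _xor_ (e x (here refl)) (par-cong xs λ y y∈ → e y (there y∈))

  par-xor : ∀ (p q : A → Bool) xs → par (λ x → p x xor q x) xs ≡ par p xs xor par q xs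
  par-xor p q []       = refl
  par-xor p q (x ∷ xs) = trans (cong ((p x xor q x) xor_) (par-xor p q xs)) (lem (p x) (q x) (par p xs) (par q xs))
    where
    lem : ∀ a b c d → (a xor b) xor (c xor d) ≡ (a xor c) xor (b xor d)
    lem a b c d = trans (xor-assoc a b _) (trans (cong (a xor_) (trans (sym (xor-assoc b c d))
      (trans (cong (_xor d) (xor-comm b c)) (xor-assoc c b d)))) (sym (xor-assoc a c _)))

  support : (A → Bool) → List A → List A
  support p = filter (λ x → p x ≟ᵇ true)

  par-support : ∀ (p : A → Bool) xs → par p xs ≡ odd (length (support p xs))
  par-support p []       = refl
  par-support p (x ∷ xs) with p x
  ... | true  = cong not (par-support p xs)
  ... | false = par-support p xs

  -- The head and its partner are removed together and the involution restricts to the rest, so the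
  -- recursion is on a bound for the length.
  even-involution : ∀ (ι : A → A) xs → Unique xs →
    (∀ {x} → x ∈ xs → ι x ∈ xs × ι (ι x) ≡ x × ι x ≢ x) → odd (length xs) ≡ false
  even-involution ι xs = go (length xs) xs ≤-refl
    where
    go : ∀ n xs → length xs ≤ n → Unique xs → (∀ {x} → x ∈ xs → ι x ∈ xs × ι (ι x) ≡ x × ι x ≢ x) → odd (length xs) ≡ false
    go n       []       _         _        _ = refl
    go (suc n) (x ∷ xs) (s≤s len) (x∉ ∷ u) h with h (here refl)
    ... | here ιx≡x , _   , ιx≢x = ⊥-elim (ιx≢x ιx≡x)
    ... | there ιx∈ , ιιx , _    with ∈-∃++ ιx∈
    ...   | as , bs , refl = trans (cong (λ m → not (odd m)) len≡)
              (trans (not-involutive _) (go n (as ++ bs) len′ (proj₁ dropped) h′))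
      where
      len≡ : length (as ++ ι x ∷ bs) ≡ suc (length (as ++ bs))
      len≡ = trans (length-++ as) (trans (+-suc _ _) (cong suc (sym (length-++ as))))
      len′ : length (as ++ bs) ≤ n
      len′ = ≤-trans (n≤1+n _) (subst (_≤ n) len≡ len)
      drop : ∀ as → Unique (as ++ ι x ∷ bs) → Unique (as ++ bs) × ¬ ι x ∈ as ++ bs
      drop []       (y∉ ∷ u) = u , λ y∈ → All.lookup y∉ y∈ refl
      drop (a ∷ as) (a∉ ∷ u) with drop as u
      ... | u′ , ιx∉ = All.tabulate (λ y∈ → All.lookup a∉ (weaken as y∈)) ∷ u′ , λ
        { (here refl) → All.lookup a∉ (∈-++⁺ʳ as (here refl)) refl ; (there y∈) → ιx∉ y∈ }
        where
        weaken : ∀ as {y} → y ∈ as ++ bs → y ∈ as ++ ι x ∷ bs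
        weaken as y∈ with ∈-++⁻ as y∈
        ... | inj₁ y∈as = ∈-++⁺ˡ y∈as
        ... | inj₂ y∈bs = ∈-++⁺ʳ as (there y∈bs)
      dropped = drop as u
      h′ : ∀ {y} → y ∈ as ++ bs → ι y ∈ as ++ bs × ι (ι y) ≡ y × ι y ≢ y
      h′ {y} y∈ with h {y} (there (insert y∈))
        where
        insert : ∀ {y} → y ∈ as ++ bs → y ∈ as ++ ι x ∷ bs
        insert y∈ with ∈-++⁻ as y∈
        ... | inj₁ y∈as = ∈-++⁺ˡ y∈as
        ... | inj₂ y∈bs = ∈-++⁺ʳ as (there y∈bs)
      ... | here ιy≡x , ιιy , _ = ⊥-elim (proj₂ dropped (subst (_∈ as ++ bs) (trans (sym ιιy) (cong ι ιy≡x)) y∈))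
      ... | there ιy∈ , ιιy , ιy≢y with ∈-++⁻ as ιy∈
      ...   | inj₁ ιy∈as = ∈-++⁺ˡ ιy∈as , ιιy , ιy≢y
      ...   | inj₂ (there ιy∈bs) = ∈-++⁺ʳ as ιy∈bs , ιιy , ιy≢y
      ...   | inj₂ (here ιy≡ιx) = ⊥-elim (All.lookup x∉ (subst (_∈ as ++ ι x ∷ bs) y≡x (weaken y∈)) refl)
        where
        y≡x : y ≡ x
        y≡x = trans (sym ιιy) (trans (cong ι ιy≡ιx) ιιx)
        weaken : ∀ {y} → y ∈ as ++ bs → y ∈ as ++ ι x ∷ bs
        weaken y∈ with ∈-++⁻ as y∈
        ... | inj₁ y∈as = ∈-++⁺ˡ y∈as
        ... | inj₂ y∈bs = ∈-++⁺ʳ as (there y∈bs)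

  par-involution : ∀ (p : A → Bool) (ι : A → A) xs → Unique xs →
    (∀ {x} → x ∈ xs → p x ≡ true → ι x ∈ xs × p (ι x) ≡ true × ι (ι x) ≡ x × ι x ≢ x) → par p xs ≡ false
  par-involution p ι xs u h = trans (par-support p xs) (even-involution ι (support p xs) (Unique.filter⁺ _ u) h′)
    where
    h′ : ∀ {x} → x ∈ support p xs → ι x ∈ support p xs × ι (ι x) ≡ x × ι x ≢ x
    h′ x∈ with ∈-filter⁻ (λ x → p x ≟ᵇ true) {xs = xs} x∈
    ... | x∈xs , px with h x∈xs px
    ...   | ιx∈ , pιx , rest = ∈-filter⁺ (λ x → p x ≟ᵇ true) ιx∈ pιx , rest

  length-injection : ∀ (f : A → B) {xs ys} → Unique xs → (∀ {x} → x ∈ xs → f x ∈ ys) →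
    (∀ {x y} → x ∈ xs → y ∈ xs → f x ≡ f y → x ≡ y) → length xs ≤ length ys
  length-injection f {xs} {ys} u into inj = subst (_≤ length ys) (length-map f xs) (length-⊆ (unique-map xs u inj) map⊆)
    where
    unique-map : ∀ xs → Unique xs → (∀ {x y} → x ∈ xs → y ∈ xs → f x ≡ f y → x ≡ y) → Unique (map f xs)
    unique-map []       _        _   = []
    unique-map (x ∷ xs) (x∉ ∷ u) inj = All.tabulate fresh ∷ unique-map xs u λ x∈ y∈ → inj (there x∈) (there y∈)
      where
      fresh : ∀ {z} → z ∈ map f xs → f x ≢ z
      fresh z∈ fx≡z with ∈-map⁻ f z∈
      ... | y , y∈ , refl = All.lookup x∉ (subst (_∈ xs) (sym (inj (here refl) (there y∈) fx≡z)) y∈) refl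
    map⊆ : map f xs ⊆ ys
    map⊆ z∈ with ∈-map⁻ f z∈
    ... | x , x∈ , refl = into x∈

  par-bijection : ∀ (p : A → Bool) (q : B → Bool) (f : A → B) (g : B → A) {xs ys} → Unique xs → Unique ys →
    (∀ {x} → x ∈ xs → p x ≡ true → f x ∈ ys × q (f x) ≡ true × g (f x) ≡ x) →
    (∀ {y} → y ∈ ys → q y ≡ true → g y ∈ xs × p (g y) ≡ true × f (g y) ≡ y) → par p xs ≡ par q ys
  par-bijection {A} {B} p q f g {xs} {ys} u v to from = trans (par-support p xs) (trans (cong odd (≤-antisym
      (length-injection f (Unique.filter⁺ _ u) to-∈ (λ x∈ y∈ e → trans (sym (gf x∈)) (trans (cong g e) (gf y∈))))
      (length-injection g (Unique.filter⁺ _ v) from-∈ (λ x∈ y∈ e → trans (sym (fg x∈)) (trans (cong f e) (fg y∈))))))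
    (sym (par-support q ys)))
    where
    to-∈ : ∀ {x} → x ∈ support p xs → f x ∈ support q ys
    to-∈ x∈ with ∈-filter⁻ (λ x → p x ≟ᵇ true) {xs = xs} x∈
    ... | x∈xs , px = ∈-filter⁺ (λ x → q x ≟ᵇ true) (proj₁ (to x∈xs px)) (proj₁ (proj₂ (to x∈xs px)))
    gf : ∀ {x} → x ∈ support p xs → g (f x) ≡ x
    gf x∈ with ∈-filter⁻ (λ x → p x ≟ᵇ true) {xs = xs} x∈
    ... | x∈xs , px = proj₂ (proj₂ (to x∈xs px))
    from-∈ : ∀ {x} → x ∈ support q ys → g x ∈ support p xs
    from-∈ x∈ with ∈-filter⁻ (λ x → q x ≟ᵇ true) {xs = ys} x∈
    ... | x∈ys , qx = ∈-filter⁺ (λ x → p x ≟ᵇ true) (proj₁ (from x∈ys qx)) (proj₁ (proj₂ (from x∈ys qx)))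
    fg : ∀ {x} → x ∈ support q ys → f (g x) ≡ x
    fg x∈ with ∈-filter⁻ (λ x → q x ≟ᵇ true) {xs = ys} x∈
    ... | x∈ys , qx = proj₂ (proj₂ (from x∈ys qx))

  -- Σ_{x ∈ xs, w x} q^(e x)

  monomials : (A → Bool) → (A → ℕ) → List A → F₂⟦q⟧
  monomials w e []       = 0s
  monomials w e (x ∷ xs) = scale (w x) (q^ (e x)) ⊕ monomials w e xs

  monomials-at : ∀ (w : A → Bool) e xs n → monomials w e xs n ≡ par (λ x → w x ∧ (e x ≡ᵇ n)) xs
  monomials-at w e []       n = refl
  monomials-at w e (x ∷ xs) n = trans (⊕-at _ _ n) (cong₂ _xor_ (cong (w x ∧_) (q^-at (e x) n)) (monomials-at w e xs n))

  monomials-++ : ∀ (w : A → Bool) e xs ys → monomials w e (xs ++ ys) ≈ monomials w e xs ⊕ monomials w e ys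
  monomials-++ w e []       ys = ≈-sym (⊕-identityˡ _)
  monomials-++ w e (x ∷ xs) ys = ≈-trans (⊕-cong ≈-refl (monomials-++ w e xs ys)) (≈-sym (⊕-assoc _ _ _))

  monomials-⊛ : ∀ (w : A → Bool) e (w′ : B → Bool) e′ xs ys → monomials w e xs ⊛ monomials w′ e′ ys ≈
    monomials (λ xy → w (proj₁ xy) ∧ w′ (proj₂ xy)) (λ xy → e (proj₁ xy) + e′ (proj₂ xy)) (cartesianProduct xs ys)
  monomials-⊛ {A} {B} w e w′ e′ xs ys = go xs
    where
    W : A × B → Bool
    W xy = w (proj₁ xy) ∧ w′ (proj₂ xy)
    E : A × B → ℕ
    E xy = e (proj₁ xy) + e′ (proj₂ xy)
    row : ∀ x ys → scale (w x) (q^ (e x)) ⊛ monomials w′ e′ ys ≈ monomials W E (map (x ,_) ys)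
    row x []       = ≈-trans (⊛-comm _ 0s) (0s-⊛ _)
    row x (y ∷ ys) = ≈-trans (⊛-distribˡ _ _ _) (⊕-cong (≈-trans (⊛-scale (w x) _ _)
      (≈-trans (coeffwise λ n → cong (w x ∧_) (trans (at (≈-trans (⊛-comm _ _) (⊛-scale (w′ y) _ _)) n)
         (cong (w′ y ∧_) (at (≈-trans (⊛-comm _ _) (q^-+ (e x) (e′ y))) n))))
         (coeffwise λ n → sym (∧-assoc (w x) (w′ y) _)))) (row x ys))
    go : ∀ xs → monomials w e xs ⊛ monomials w′ e′ ys ≈ monomials W E (cartesianProduct xs ys)
    go []       = 0s-⊛ _
    go (x ∷ xs) = ≈-trans (⊛-distribʳ _ _ _) (≈-trans (⊕-cong (row x ys) (go xs)) (≈-sym (monomials-++ W E (map (x ,_) ys) _)))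

-- Kronecker's formula for the reciprocal of a theta function

module JLemma where

  open Series
  open Theta
  open Eta using (ψ)
  open Parity
  open import Data.Bool.Base using (Bool; true; false; _∧_; _xor_; not)
  open import Data.Bool.Properties using (xor-identityʳ; ∧-identityʳ; T-≡)
  open import Data.Integer.Base as ℤ using (ℤ; +_; -[1+_]; ∣_∣; 0ℤ; 1ℤ)
  import Data.Integer.Properties as ℤ
  import Data.Integer.Tactic.RingSolver as ℤ-Ring
  open import Data.List.Base using (List; []; _∷_; cartesianProduct; downFrom)
  open import Data.List.Membership.Propositional using (_∈_)
  open import Data.List.Membership.Propositional.Properties using (∈-cartesianProduct⁺; ∈-cartesianProduct⁻; ∈-downFrom⁺)
  open import Data.List.Relation.Unary.All as All using (All; []; _∷_)
  open import Data.List.Relation.Unary.AllPairs using ([]; _∷_)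
  open import Data.List.Relation.Unary.Any using (here; there)
  open import Data.List.Relation.Unary.Unique.Propositional using (Unique)
  import Data.List.Relation.Unary.Unique.Propositional.Properties as Unique
  open import Data.Nat.Base
  open import Data.Nat.Properties
  open import Data.Nat.Tactic.RingSolver using (solve-∀)
  open import Data.Product.Base using (_×_; _,_; proj₁; proj₂; Σ-syntax)
  open import Data.Sum.Base using (inj₁; inj₂)
  open import Function.Bundles using (Equivalence)
  open import Relation.Binary.PropositionalEquality hiding (setoid; J)
  open import Relation.Nullary using (¬_; Dec; yes; no; does; contradiction)
  open import Relation.Nullary.Decidable using (dec-true; dec-false)

  range : ℕ → List ℤ
  range zero    = + 0 ∷ []
  range (suc N) = + suc N ∷ -[1+ N ] ∷ range N

  ∈-range : ∀ N {i} → ∣ i ∣ ≤ N → i ∈ range N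
  ∈-range zero    {+ zero} _ = here refl
  ∈-range (suc N) {i} le with m≤n⇒m<n∨m≡n le
  ∈-range (suc N) {i}        le | inj₁ (s≤s lt) = there (there (∈-range N lt))
  ∈-range (suc N) {+ _}      le | inj₂ refl     = here refl
  ∈-range (suc N) { -[1+ _ ]} le | inj₂ refl     = there (here refl)

  range-≤ : ∀ N {i} → i ∈ range N → ∣ i ∣ ≤ N
  range-≤ zero    (here refl)         = z≤n
  range-≤ (suc N) (here refl)         = ≤-refl
  range-≤ (suc N) (there (here refl)) = ≤-refl
  range-≤ (suc N) (there (there i∈))  = m≤n⇒m≤1+n (range-≤ N i∈)

  range-unique : ∀ N → Unique (range N)
  range-unique zero    = [] ∷ []
  range-unique (suc N) = ((λ ()) ∷ All.tabulate (λ { i∈ refl → 1+n≰n (range-≤ N i∈) }))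
    ∷ All.tabulate (λ { i∈ refl → 1+n≰n (range-≤ N i∈) }) ∷ range-unique N

  nonneg : ℤ → Bool
  nonneg (+ _)      = true
  nonneg -[1+ _ ]   = false

  same-sign : ℤ → ℤ → Bool
  same-sign m l = not (nonneg m xor nonneg l)

  ∧-true : ∀ {a b} → a ∧ b ≡ true → a ≡ true × b ≡ true
  ∧-true {true} {true} _ = refl , refl

  does-true : ∀ {P : Set} (d : Dec P) → does d ≡ true → P
  does-true (yes p) _ = p

  bool-iff : ∀ {a b} → (a ≡ true → b ≡ true) → (b ≡ true → a ≡ true) → a ≡ b
  bool-iff {true}  {b}     f g = sym (f refl)
  bool-iff {false} {true}  f g = g refl
  bool-iff {false} {false} f g = refl

  ≡ᵇ-true : ∀ m n → (m ≡ᵇ n) ≡ true → m ≡ n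
  ≡ᵇ-true m n e = ≡ᵇ⇒≡ m n (Equivalence.from T-≡ e)

  ≡⇒≡ᵇ-true : ∀ m n → m ≡ n → (m ≡ᵇ n) ≡ true
  ≡⇒≡ᵇ-true m n e = Equivalence.to T-≡ (≡⇒≡ᵇ m n e)

  2*-≢-1 : ∀ x → x ℤ.+ x ≢ ℤ.- 1ℤ
  2*-≢-1 (+ n)     ()
  2*-≢-1 -[1+ n ]  ()

  private
    ring₄₃ : ∀ u v → + 0 ≡ (u ℤ.+ v) ℤ.* + 0 ℤ.+ + 2 ℤ.* u ℤ.* + 0
    ring₄₃ = ℤ-Ring.solve-∀
    ring₄₄ : ∀ u v n → + 2 ℤ.* (u ℤ.+ n ℤ.* (u ℤ.+ v)) ℤ.+ ((u ℤ.+ v) ℤ.* (n ℤ.* (n ℤ.- + 1)) ℤ.+ + 2 ℤ.* u ℤ.* n) ≡ (u ℤ.+ v) ℤ.* ((+ 1 ℤ.+ n) ℤ.* ((+ 1 ℤ.+ n) ℤ.- + 1)) ℤ.+ + 2 ℤ.* u ℤ.* (+ 1 ℤ.+ n)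
    ring₄₄ = ℤ-Ring.solve-∀

  -- Doubling clears the denominator of j(j - 1)/2, so the exponent becomes an integer polynomial
  -- that also makes sense for negative arguments.
  pos-pent : ∀ u v n → + 2 ℤ.* + pent u v n ≡ (+ u ℤ.+ + v) ℤ.* (+ n ℤ.* (+ n ℤ.- + 1)) ℤ.+ + 2 ℤ.* + u ℤ.* + n
  pos-pent u v zero    = ring₄₃ (+ u) (+ v)
  pos-pent u v (suc n) = trans (cong (λ x → + 2 ℤ.* (+ u ℤ.+ x ℤ.+ + pent u v n)) (ℤ.pos-* n (u + v)))
    (trans (ℤ.*-distribˡ-+ (+ 2) (+ u ℤ.+ + n ℤ.* (+ u ℤ.+ + v)) (+ pent u v n))
    (trans (cong (λ y → + 2 ℤ.* (+ u ℤ.+ + n ℤ.* (+ u ℤ.+ + v)) ℤ.+ y) (pos-pent u v n)) (ring₄₄ (+ u) (+ v) (+ n))))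

  tri : ℕ → ℕ
  tri zero    = 0
  tri (suc i) = suc i + tri i

  private
    ring₄₅ : ∀ i → + 2 ℤ.* (+ 1 ℤ.+ i) ℤ.+ (i ℤ.* i ℤ.+ i) ≡ (+ 1 ℤ.+ i) ℤ.* (+ 1 ℤ.+ i) ℤ.+ (+ 1 ℤ.+ i)
    ring₄₅ = ℤ-Ring.solve-∀

  pos-tri : ∀ i → + 2 ℤ.* + tri i ≡ + i ℤ.* + i ℤ.+ + i
  pos-tri zero    = refl
  pos-tri (suc i) = trans (ℤ.*-distribˡ-+ (+ 2) (+ suc i) (+ tri i)) (trans (cong (λ y → + 2 ℤ.* + suc i ℤ.+ y) (pos-tri i)) (ring₄₅ (+ i)))

  private
    ring₄₀ : ∀ N t → (1 + suc N * 4) + t ≡ (3 + N * 2) + ((2 + N * 2) + t)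
    ring₄₀ = solve-∀
    ring₄₁ : ∀ N t → (3 + N * 4) + t ≡ (2 + N * 2) + ((1 + N * 2) + t)
    ring₄₁ = solve-∀

  -- The indices j and -j contribute the triangular numbers of index 2j - 1 and 2j.
  bilateral-tri : ∀ N → bilateral (pent 1 3) (pent 3 1) N ≈ monomials (λ _ → true) tri (downFrom (suc (N * 2)))
  bilateral-tri zero    = ≈-sym (⊕-identityʳ _)
  bilateral-tri (suc N) = ≈-trans (⊕-cong (bilateral-tri N) (⊕-cong (q^-≡ (odd-tri N)) (q^-≡ (even-tri (suc N)))))
    (solve 3 (λ x a b → x :+ (a :+ b) := b :+ (a :+ x)) ≈-refl _ _ _)
    where
    open Char2Solver using (solve; _:+_; _:=_)
    odd-tri : ∀ N → pent 1 3 (suc N) ≡ tri (suc (N * 2))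
    odd-tri zero    = refl
    odd-tri (suc N) = trans (cong (λ y → 1 + suc N * 4 + y) (odd-tri N)) (ring₄₀ N (tri (suc (N * 2))))
    even-tri : ∀ N → pent 3 1 N ≡ tri (N * 2)
    even-tri zero    = refl
    even-tri (suc N) = trans (cong (λ y → 3 + N * 4 + y) (even-tri N)) (ring₄₁ N (tri (N * 2)))

  private
    ring₁ : ∀ i → i ℤ.+ i ℤ.- + 2 ℤ.* i ℤ.- + 2 ℤ.* + 0 ≡ + 0
    ring₁ = ℤ-Ring.solve-∀
    ring₂ : ∀ a v s → a ≡ a ℤ.+ v ℤ.* (ℤ.- s) ℤ.+ v ℤ.* s
    ring₂ = ℤ-Ring.solve-∀
    ring₃ : ∀ x → x ℤ.- x ℤ.- + 1 ≡ ℤ.- + 1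
    ring₃ = ℤ-Ring.solve-∀
    ring₄ : ∀ l → l ≡ ℤ.- + 1 ℤ.- (ℤ.- (+ 1 ℤ.+ l))
    ring₄ = ℤ-Ring.solve-∀
    ring₅ : ∀ j m → (j ℤ.+ m) ℤ.+ (j ℤ.+ m) ℤ.+ (m ℤ.+ m) ≡ (j ℤ.+ + 2 ℤ.* m) ℤ.+ (j ℤ.+ + 2 ℤ.* m)
    ring₅ = ℤ-Ring.solve-∀
    ring₆ : ∀ j m l → ℤ.- (+ 2 ℤ.+ l) ℤ.- + 2 ℤ.* (ℤ.- (+ 1 ℤ.+ j)) ℤ.- + 2 ℤ.* (ℤ.- m) ≡ ℤ.- (l ℤ.- + 2 ℤ.* j ℤ.- + 2 ℤ.* m)
    ring₆ = ℤ-Ring.solve-∀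
    ring₇ : ∀ u b j → (u ℤ.+ (b ℤ.+ b)) ℤ.* (j ℤ.* (j ℤ.- + 1)) ℤ.+ + 2 ℤ.* u ℤ.* j ℤ.+ + 2 ℤ.* ((u ℤ.+ (b ℤ.+ b)) ℤ.* + 0 ℤ.* (j ℤ.+ j) ℤ.+ u ℤ.* + 0 ℤ.+ b ℤ.* (j ℤ.+ j)) ≡ (j ℤ.* j ℤ.+ j) ℤ.* (u ℤ.+ (b ℤ.+ b))
    ring₇ = ℤ-Ring.solve-∀
    ring₈ : ∀ u v n → (v ℤ.+ u) ℤ.* (n ℤ.* (n ℤ.- + 1)) ℤ.+ + 2 ℤ.* v ℤ.* n ≡ (u ℤ.+ v) ℤ.* ((ℤ.- n) ℤ.* ((ℤ.- n) ℤ.- + 1)) ℤ.+ + 2 ℤ.* u ℤ.* (ℤ.- n)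
    ring₈ = ℤ-Ring.solve-∀
    ring₉ : ∀ a → (ℤ.- (+ 1 ℤ.+ a)) ℤ.* (ℤ.- (+ 1 ℤ.+ a)) ℤ.+ (ℤ.- (+ 1 ℤ.+ a)) ≡ (+ 1 ℤ.+ a) ℤ.* a
    ring₉ = ℤ-Ring.solve-∀
    ring₁₀ : ∀ u b j m l → (u ℤ.+ (b ℤ.+ b)) ℤ.* (j ℤ.* (j ℤ.- + 1)) ℤ.+ + 2 ℤ.* u ℤ.* j ℤ.+ + 2 ℤ.* ((u ℤ.+ (b ℤ.+ b)) ℤ.* m ℤ.* l ℤ.+ u ℤ.* m ℤ.+ b ℤ.* l) ≡ (u ℤ.+ (b ℤ.+ b)) ℤ.* ((j ℤ.+ + 2 ℤ.* m) ℤ.* (j ℤ.+ + 2 ℤ.* m) ℤ.+ (j ℤ.+ + 2 ℤ.* m)) ℤ.+ ((u ℤ.+ (b ℤ.+ b)) ℤ.+ (u ℤ.+ (b ℤ.+ b))) ℤ.* (m ℤ.* (l ℤ.- + 2 ℤ.* j ℤ.- + 2 ℤ.* m)) ℤ.+ (b ℤ.+ b) ℤ.* (l ℤ.- + 2 ℤ.* j ℤ.- + 2 ℤ.* m)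
    ring₁₀ = ℤ-Ring.solve-∀
    ring₁₁ : ∀ u b j m l → (u ℤ.+ (b ℤ.+ b)) ℤ.* (j ℤ.* (j ℤ.- + 1)) ℤ.+ + 2 ℤ.* u ℤ.* j ℤ.+ + 2 ℤ.* ((u ℤ.+ (b ℤ.+ b)) ℤ.* m ℤ.* l ℤ.+ u ℤ.* m ℤ.+ b ℤ.* l) ≡ (u ℤ.+ (b ℤ.+ b)) ℤ.* ((l ℤ.- j) ℤ.* (l ℤ.- j) ℤ.+ (l ℤ.- j)) ℤ.+ (u ℤ.+ (b ℤ.+ b)) ℤ.* ((ℤ.- (+ 1 ℤ.+ l)) ℤ.* (l ℤ.- + 2 ℤ.* j ℤ.- + 2 ℤ.* m)) ℤ.+ (b ℤ.+ b) ℤ.* (l ℤ.- + 2 ℤ.* j ℤ.- + 2 ℤ.* m)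
    ring₁₁ = ℤ-Ring.solve-∀
    ring₁₂ : ∀ j m l → (l ℤ.- + 2 ℤ.- + 4 ℤ.* j ℤ.- + 8 ℤ.* m) ℤ.- + 2 ℤ.* (ℤ.- + 1 ℤ.- j ℤ.- + 4 ℤ.* m) ℤ.- + 2 ℤ.* m ≡ l ℤ.- + 2 ℤ.* j ℤ.- + 2 ℤ.* m
    ring₁₂ = ℤ-Ring.solve-∀
    ring₁₃ : ∀ j m l → l ℤ.- + 2 ℤ.* (+ 2 ℤ.* l ℤ.+ + 1 ℤ.- j) ℤ.- + 2 ℤ.* (m ℤ.+ + 2 ℤ.* j ℤ.- + 2 ℤ.* l ℤ.- + 1) ≡ l ℤ.- + 2 ℤ.* j ℤ.- + 2 ℤ.* m
    ring₁₃ = ℤ-Ring.solve-∀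
    ring₁₄ : ∀ j m → ((ℤ.- + 1 ℤ.- j ℤ.- + 4 ℤ.* m) ℤ.+ + 2 ℤ.* m) ℤ.* ((ℤ.- + 1 ℤ.- j ℤ.- + 4 ℤ.* m) ℤ.+ + 2 ℤ.* m) ℤ.+ ((ℤ.- + 1 ℤ.- j ℤ.- + 4 ℤ.* m) ℤ.+ + 2 ℤ.* m) ≡ (j ℤ.+ + 2 ℤ.* m) ℤ.* (j ℤ.+ + 2 ℤ.* m) ℤ.+ (j ℤ.+ + 2 ℤ.* m)
    ring₁₄ = ℤ-Ring.solve-∀
    ring₁₅ : ∀ j l → (l ℤ.- (+ 2 ℤ.* l ℤ.+ + 1 ℤ.- j)) ℤ.* (l ℤ.- (+ 2 ℤ.* l ℤ.+ + 1 ℤ.- j)) ℤ.+ (l ℤ.- (+ 2 ℤ.* l ℤ.+ + 1 ℤ.- j)) ≡ (l ℤ.- j) ℤ.* (l ℤ.- j) ℤ.+ (l ℤ.- j)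
    ring₁₅ = ℤ-Ring.solve-∀
    ring₁₆ : ∀ j m → ℤ.- + 1 ℤ.- (ℤ.- + 1 ℤ.- j ℤ.- + 4 ℤ.* m) ℤ.- + 4 ℤ.* m ≡ j
    ring₁₆ = ℤ-Ring.solve-∀
    ring₁₇ : ∀ j m l → (l ℤ.- + 2 ℤ.- + 4 ℤ.* j ℤ.- + 8 ℤ.* m) ℤ.- + 2 ℤ.- + 4 ℤ.* (ℤ.- + 1 ℤ.- j ℤ.- + 4 ℤ.* m) ℤ.- + 8 ℤ.* m ≡ l
    ring₁₇ = ℤ-Ring.solve-∀
    ring₁₈ : ∀ j l → + 2 ℤ.* l ℤ.+ + 1 ℤ.- (+ 2 ℤ.* l ℤ.+ + 1 ℤ.- j) ≡ j
    ring₁₈ = ℤ-Ring.solve-∀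
    ring₁₉ : ∀ j m l → (m ℤ.+ + 2 ℤ.* j ℤ.- + 2 ℤ.* l ℤ.- + 1) ℤ.+ + 2 ℤ.* (+ 2 ℤ.* l ℤ.+ + 1 ℤ.- j) ℤ.- + 2 ℤ.* l ℤ.- + 1 ≡ m
    ring₁₉ = ℤ-Ring.solve-∀
    ring₂₀ : ∀ j → ℤ.- (+ 1 ℤ.+ (ℤ.- (+ 1 ℤ.+ j))) ≡ j
    ring₂₀ = ℤ-Ring.solve-∀
    ring₂₁ : ∀ l → ℤ.- (+ 2 ℤ.+ (ℤ.- (+ 2 ℤ.+ l))) ≡ l
    ring₂₁ = ℤ-Ring.solve-∀
    ring₂₂ : ∀ j m → (j ℤ.+ + 2 ℤ.* m) ℤ.+ (j ℤ.+ + 2 ℤ.* m) ≡ j ℤ.- (ℤ.- + 1 ℤ.- j ℤ.- + 4 ℤ.* m) ℤ.- + 1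
    ring₂₂ = ℤ-Ring.solve-∀
    ring₂₃ : ∀ j m l → (l ℤ.- j) ℤ.+ (l ℤ.- j) ≡ m ℤ.- (m ℤ.+ + 2 ℤ.* j ℤ.- + 2 ℤ.* l ℤ.- + 1) ℤ.- + 1
    ring₂₃ = ℤ-Ring.solve-∀
    ring₂₄ : ∀ j → j ℤ.+ j ≡ j ℤ.- (ℤ.- (+ 1 ℤ.+ j)) ℤ.- + 1
    ring₂₄ = ℤ-Ring.solve-∀
    ring₂₅ : ∀ j m → j ≡ (j ℤ.+ + 2 ℤ.* m) ℤ.- (m ℤ.+ m)
    ring₂₅ = ℤ-Ring.solve-∀
    ring₂₆ : ∀ j m l → l ≡ (l ℤ.- + 2 ℤ.* j ℤ.- + 2 ℤ.* m) ℤ.+ ((j ℤ.+ + 2 ℤ.* m) ℤ.+ (j ℤ.+ + 2 ℤ.* m)) ℤ.- (m ℤ.+ m)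
    ring₂₆ = ℤ-Ring.solve-∀
    ring₂₇ : ∀ n → (1 + 2 * n) + (2 * n + 2 * n) + (4 * n + 9) ≡ 10 * n + 10
    ring₂₇ = solve-∀
    ring₂₈ : ∀ n → 2 * n + (8 * n + 10) ≡ 10 * n + 10
    ring₂₈ = solve-∀
    ring₂₉ : ∀ n → 2 * n + ((1 + 2 * n) + (1 + 2 * n)) + (2 * n + 2 * n) + 8 ≡ 10 * n + 10
    ring₂₉ = solve-∀
    ring₃₀ : ∀ j l → j ≡ l ℤ.- (l ℤ.- j)
    ring₃₀ = ℤ-Ring.solve-∀
    ring₃₁ : ∀ j m l → m ℤ.+ m ≡ (l ℤ.- j) ℤ.+ (l ℤ.- j) ℤ.- (l ℤ.- + 2 ℤ.* j ℤ.- + 2 ℤ.* m) ℤ.- l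
    ring₃₁ = ℤ-Ring.solve-∀
    ring₃₂ : ∀ n → (1 + 2 * n) + (1 + 2 * n) + (6 * n + 8) ≡ 10 * n + 10
    ring₃₂ = solve-∀
    ring₃₃ : ∀ n → (1 + 2 * n) + (1 + 2 * n) + 2 * n + (1 + 2 * n) + (2 * n + 7) ≡ 10 * n + 10
    ring₃₃ = solve-∀
    ring₃₄ : ∀ n → 1 + 2 * n + (8 * n + 9) ≡ 10 * n + 10
    ring₃₄ = solve-∀
    ring₃₅ : ∀ x c m v → x ℤ.+ c ℤ.* (m ℤ.* + 0) ℤ.+ v ℤ.* + 0 ≡ x
    ring₃₅ = ℤ-Ring.solve-∀
    ring₃₆ : ∀ j m l → l ≡ (l ℤ.- + 2 ℤ.* j ℤ.- + 2 ℤ.* m) ℤ.+ ((j ℤ.+ m) ℤ.+ (j ℤ.+ m))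
    ring₃₆ = ℤ-Ring.solve-∀
    ring₃₇ : ∀ n → (1 + 2 * n) + (((1 + 2 * n) + (1 + 2 * n)) + ((1 + 2 * n) + (1 + 2 * n))) + 5 ≡ 10 * n + 10
    ring₃₇ = solve-∀
    ring₃₈ : ∀ n → ((1 + 2 * n) + (1 + 2 * n)) + (6 * n + 8) ≡ 10 * n + 10
    ring₃₈ = solve-∀
    ring₃₉ : ∀ j m → (ℤ.- (+ 1 ℤ.+ j) ℤ.+ + 2 ℤ.* (ℤ.- m)) ℤ.* (ℤ.- (+ 1 ℤ.+ j) ℤ.+ + 2 ℤ.* (ℤ.- m)) ℤ.+ (ℤ.- (+ 1 ℤ.+ j) ℤ.+ + 2 ℤ.* (ℤ.- m)) ≡ (j ℤ.+ + 2 ℤ.* m) ℤ.* (j ℤ.+ + 2 ℤ.* m) ℤ.+ (j ℤ.+ + 2 ℤ.* m)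
    ring₃₉ = ℤ-Ring.solve-∀
    ring₄₂ : ∀ u b m l → (u ℤ.+ (b ℤ.+ b)) ℤ.* m ℤ.* l ℤ.+ (b ℤ.+ b) ℤ.* m ℤ.+ (u ℤ.+ b) ℤ.* l ℤ.+ b ≡ (u ℤ.+ (b ℤ.+ b)) ℤ.* (ℤ.- (+ 1 ℤ.+ m)) ℤ.* (ℤ.- (+ 1 ℤ.+ l)) ℤ.+ u ℤ.* (ℤ.- (+ 1 ℤ.+ m)) ℤ.+ b ℤ.* (ℤ.- (+ 1 ℤ.+ l))
    ring₄₂ = ℤ-Ring.solve-∀

  -- With k = u + 2b, x = q^u, y = q^b and Q = q^k, the series J is Σ x^m y^l Q^(ml),
  -- summed over the pairs (m,l) of equal sign; x = Q/y² makes it ψ(Q) over a theta function.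
  module Reciprocal (u′ b′ : ℕ) where

    u b v k : ℕ
    u = suc u′
    b = suc b′
    v = b + b
    k = u + v

    e : ℤ → ℕ
    e (+ n)      = pent u v n
    e -[1+ n ]   = pent v u (suc n)

    -- The polynomial k m l + u m + b l, expanded for two negative arguments so that it is visibly a
    -- natural number. The value 0 for mixed signs is a default that `same-sign` masks.
    E : ℤ → ℤ → ℕ
    E (+ m)    (+ l)    = k * m * l + u * m + b * l
    E -[1+ m ] -[1+ l ] = k * m * l + v * m + (u + b) * l + b
    E _        _        = 0

    pairs : ℕ → List (ℤ × ℤ)
    pairs N = cartesianProduct (range N) (range N)

    -- The square of side `n` around 0 loses no pair, because both coordinates are bounded by the
    -- exponent `E`.
    J : F₂⟦q⟧
    J n = par (λ (m , l) → same-sign m l ∧ (E m l ≡ᵇ n)) (pairs n)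

    private
      -- Twice the exponent of the product of the theta term j and the term (m, l) of `J`, as a
      -- polynomial on all integers.
      Φ : ℤ → ℤ → ℤ → ℤ
      Φ j m l = + k ℤ.* (j ℤ.* (j ℤ.- + 1)) ℤ.+ + 2 ℤ.* + u ℤ.* j ℤ.+ + 2 ℤ.* (+ k ℤ.* m ℤ.* l ℤ.+ + u ℤ.* m ℤ.+ + b ℤ.* l)

      e-poly : ∀ j → + 2 ℤ.* + e j ≡ + k ℤ.* (j ℤ.* (j ℤ.- + 1)) ℤ.+ + 2 ℤ.* + u ℤ.* j
      e-poly (+ n)    = pos-pent u v n
      e-poly -[1+ n ] = trans (pos-pent v u (suc n)) (ring₈ (+ u) (+ v) (+ suc n))

    E-poly : ∀ m l → same-sign m l ≡ true → + E m l ≡ + k ℤ.* m ℤ.* l ℤ.+ + u ℤ.* m ℤ.+ + b ℤ.* l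
    E-poly (+ m) (+ l) _ = cong₂ ℤ._+_ (cong₂ ℤ._+_ (trans (ℤ.pos-* (k * m) l) (cong (λ y → y ℤ.* + l) (ℤ.pos-* k m))) (ℤ.pos-* u m)) (ℤ.pos-* b l)
    E-poly -[1+ m ] -[1+ l ] _ = trans
      (cong (λ y → y ℤ.+ + b) (cong₂ ℤ._+_ (cong₂ ℤ._+_ (trans (ℤ.pos-* (k * m) l) (cong (λ y → y ℤ.* + l) (ℤ.pos-* k m))) (ℤ.pos-* v m)) (ℤ.pos-* (u + b) l)))
      (ring₄₂ (+ u) (+ b) (+ m) (+ l))

    E-≥ : ∀ m l → same-sign m l ≡ true → ∣ m ∣ ≤ E m l × ∣ l ∣ ≤ E m l
    E-≥ (+ m) (+ l) _ = ≤-trans (m≤n*m m u) (≤-trans (m≤n+m (u * m) (k * m * l)) (m≤m+n _ (b * l)))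
                      , ≤-trans (m≤n*m l b) (m≤n+m (b * l) (k * m * l + u * m))
    E-≥ -[1+ m ] -[1+ l ] _ =
        subst (_≤ E -[1+ m ] -[1+ l ]) (+-comm m 1) (+-mono-≤ (≤-trans (m≤n*m m v) (≤-trans (m≤n+m (v * m) (k * m * l)) (m≤m+n _ ((u + b) * l)))) (s≤s z≤n))
      , subst (_≤ E -[1+ m ] -[1+ l ]) (+-comm l 1) (+-mono-≤ (≤-trans (m≤n*m l (u + b)) (m≤n+m ((u + b) * l) (k * m * l + v * m))) (s≤s z≤n))

    pairs-unique : ∀ N → Unique (pairs N)
    pairs-unique N = Unique.cartesianProduct⁺ (range-unique N) (range-unique N)

    J-≈[] : ∀ N → J ≈[ N ] monomials (λ (m , l) → same-sign m l) (λ (m , l) → E m l) (pairs N)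
    J-≈[] N = coeffwise< λ {n} n<N → trans
      (par-bijection _ _ (λ x → x) (λ x → x) (pairs-unique n) (pairs-unique N)
        (λ {(m , l)} x∈ px → ∈-cartesianProduct⁺
             (∈-range N (≤-trans (range-≤ n (proj₁ (∈-cartesianProduct⁻ (range n) (range n) x∈))) (<⇒≤ n<N)))
             (∈-range N (≤-trans (range-≤ n (proj₂ (∈-cartesianProduct⁻ (range n) (range n) x∈))) (<⇒≤ n<N))) , px , refl)
        (λ {(m , l)} _ px → small m l px , px , refl))
      (sym (monomials-at _ _ (pairs N) n))
      where
      small : ∀ m l {n} → same-sign m l ∧ (E m l ≡ᵇ n) ≡ true → (m , l) ∈ pairs n
      small m l {n} px with ∧-true px
      ... | ss , eq with ≡ᵇ-true (E m l) n eq
      ...   | refl = ∈-cartesianProduct⁺ (∈-range n (proj₁ (E-≥ m l ss))) (∈-range n (proj₂ (E-≥ m l ss)))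

    theta-monomials : ∀ N → bilateral (pent u v) (pent v u) N ≈ monomials (λ _ → true) e (range N)
    theta-monomials zero    = ≈-sym (⊕-identityʳ _)
    theta-monomials (suc N) = ≈-trans (⊕-cong (theta-monomials N) ≈-refl)
      (solve 3 (λ x a b → x :+ (a :+ b) := a :+ (b :+ x)) ≈-refl _ _ _)
      where open Char2Solver using (solve; _:+_; _:=_)

    private
      Triple : Set
      Triple = ℤ × ℤ × ℤ

      triples : ℕ → List Triple
      triples N = cartesianProduct (range N) (pairs N)

      triples-unique : ∀ N → Unique (triples N)
      triples-unique N = Unique.cartesianProduct⁺ (range-unique N) (pairs-unique N)

      ∈-triples : ∀ N {j m l} → ∣ j ∣ ≤ N → ∣ m ∣ ≤ N → ∣ l ∣ ≤ N → (j , m , l) ∈ triples N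
      ∈-triples N a b c = ∈-cartesianProduct⁺ (∈-range N a) (∈-cartesianProduct⁺ (∈-range N b) (∈-range N c))

    -- s is the y-degree of a term of the product; a term is determined by (i, m, s), where i = j + 2m.
    module Counting (n : ℕ) where
      -- One box serves all counts: it contains every triple satisfying `pA`, `pB` or `p₀`, hence
      -- also their images under the involutions, and its side exceeds n, so that truncating both
      -- factors there leaves coefficient n intact.
      N : ℕ
      N = 10 * n + 10

      s : Triple → ℤ
      s (j , m , l) = l ℤ.- + 2 ℤ.* j ℤ.- + 2 ℤ.* m

      eq zb pA pB p₀ p : Triple → Bool
      eq (j , m , l) = does (Φ j m l ℤ.≟ + 2 ℤ.* + n)
      zb t = does (s t ℤ.≟ 0ℤ)
      p  t@(j , m , l) = same-sign m l ∧ eq t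
      p₀ t@(j , m , l) = zb t ∧ (same-sign m l ∧ eq t)
      pA t@(j , m , l) = not (zb t) ∧ (same-sign (s t) m ∧ eq t)
      pB t@(j , m , l) = not (zb t) ∧ (not (same-sign (s t) l) ∧ eq t)

      -- For s ≠ 0, equality of signs of m and l is, modulo 2, the sum of "s and m have equal signs"
      -- and "s and l have different signs". Each of the two conditions is respected by a reflection
      -- that the original one does not respect.
      p-split : ∀ t → p t ≡ p₀ t xor (pA t xor pB t)
      p-split t@(j , m , l) = lem (nonneg m) (nonneg l) (nonneg (s t)) (zb t) (eq t)
        where
        lem : ∀ m l s z e → not (m xor l) ∧ e ≡
          (z ∧ (not (m xor l) ∧ e)) xor ((not z ∧ (not (s xor m) ∧ e)) xor (not z ∧ (not (not (s xor l)) ∧ e)))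
        lem true  true  true  true  true  = refl
        lem true  true  true  true  false = refl
        lem true  true  true  false true  = refl
        lem true  true  true  false false = refl
        lem true  true  false true  true  = refl
        lem true  true  false true  false = refl
        lem true  true  false false true  = refl
        lem true  true  false false false = refl
        lem true  false true  true  _     = refl
        lem true  false true  false true  = refl
        lem true  false true  false false = refl
        lem true  false false true  _     = refl
        lem true  false false false true  = refl
        lem true  false false false false = refl
        lem false true  true  true  _     = refl
        lem false true  true  false true  = refl
        lem false true  true  false false = refl
        lem false true  false true  _     = refl
        lem false true  false false true  = refl
        lem false true  false false false = refl
        lem false false true  true  true  = refl
        lem false false true  true  false = refl
        lem false false true  false true  = refl
        lem false false true  false false = refl
        lem false false false true  true  = refl
        lem false false false true  false = refl
        lem false false false false true  = refl
        lem false false false false false = refl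

      oblong : ∀ i → Σ[ x ∈ ℕ ] (i ℤ.* i ℤ.+ i ≡ + x × ∣ i ∣ ≤ suc x)
      oblong (+ a)    = a * a + a , cong (λ y → y ℤ.+ + a) (sym (ℤ.pos-* a a)) , ≤-trans (m≤n+m a (a * a)) (n≤1+n _)
      oblong -[1+ a ] = suc a * a , trans (ring₉ (+ a)) (sym (ℤ.pos-* (suc a) a)) , s≤s (m≤m+n a (a * a))

      -- Equal signs make c m s nonnegative. If both are negative, v s is not, but c > v leaves one
      -- copy of m s after absorbing it; so the equation bounds all three numbers.
      bound : ∀ c i m s → s ≢ 0ℤ → same-sign s m ≡ true → v < c →
        + k ℤ.* (i ℤ.* i ℤ.+ i) ℤ.+ + c ℤ.* (m ℤ.* s) ℤ.+ + v ℤ.* s ≡ + (2 * n) →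
        ∣ i ∣ ≤ suc (2 * n) × ∣ m ∣ ≤ 2 * n × ∣ s ∣ ≤ 2 * n
      bound c i m (+ zero) s≢0 _ _ _ = contradiction refl s≢0
      bound c i (+ m) (+ suc s) _ _ v<c h with oblong i
      ... | x , ix , i≤ = ≤-trans i≤ (s≤s (≤-trans (m≤n*m x k) (≤-trans (m≤m+n (k * x) _) kx≤)))
                        , ≤-trans (m≤m*n m (suc s)) (≤-trans (m≤n*m (m * suc s) c {{>-nonZero (≤-trans (s≤s z≤n) v<c)}}) (≤-trans (m≤n+m (c * (m * suc s)) (k * x)) kx≤))
                        , ≤-trans (m≤n*m (suc s) v) (≤-trans (m≤n+m (v * suc s) (k * x + c * (m * suc s))) (≤-reflexive h′))
        where
        h′ : k * x + c * (m * suc s) + v * suc s ≡ 2 * n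
        h′ = ℤ.+-injective (trans (cong₂ ℤ._+_ (cong₂ ℤ._+_ (trans (ℤ.pos-* k x) (cong (λ y → + k ℤ.* y) (sym ix)))
               (trans (ℤ.pos-* c (m * suc s)) (cong (λ y → + c ℤ.* y) (ℤ.pos-* m (suc s))))) (ℤ.pos-* v (suc s))) h)
        kx≤ : k * x + c * (m * suc s) ≤ 2 * n
        kx≤ = ≤-trans (m≤m+n _ (v * suc s)) (≤-reflexive h′)
      bound c i -[1+ m ] -[1+ s ] _ _ v<c h with oblong i
      ... | x , ix , i≤ = ≤-trans i≤ (s≤s (≤-trans (m≤n*m x k) (≤-trans (m≤m+n (k * x) _) key)))
                        , ≤-trans (m≤m*n (suc m) (suc s)) (≤-trans (m≤n+m _ (k * x)) key)
                        , ≤-trans (m≤n*m (suc s) (suc m)) (≤-trans (m≤n+m _ (k * x)) key)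
        where
        MS = suc m * suc s
        h′ : k * x + c * MS ≡ 2 * n + v * suc s
        h′ = ℤ.+-injective (trans (cong₂ ℤ._+_ (trans (ℤ.pos-* k x) (cong (λ y → + k ℤ.* y) (sym ix))) (ℤ.pos-* c MS))
          (trans (ring₂ (+ k ℤ.* (i ℤ.* i ℤ.+ i) ℤ.+ + c ℤ.* + MS) (+ v) (+ suc s)) (cong₂ ℤ._+_ h (sym (ℤ.pos-* v (suc s))))))
        key : k * x + MS ≤ 2 * n
        key = +-cancelʳ-≤ (v * suc s) _ _ (begin
          k * x + MS + v * suc s   ≤⟨ +-monoʳ-≤ (k * x + MS) (*-monoʳ-≤ v (m≤m+n (suc s) (m * suc s))) ⟩
          k * x + MS + v * MS      ≡⟨ +-assoc (k * x) MS (v * MS) ⟩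
          k * x + suc v * MS       ≤⟨ +-monoʳ-≤ (k * x) (*-monoˡ-≤ MS v<c) ⟩
          k * x + c * MS           ≡⟨ h′ ⟩
          2 * n + v * suc s        ∎)
          where open ≤-Reasoning

      private
        ≤-by : ∀ {x y} c → x + c ≡ y → x ≤ y
        ≤-by {x} c refl = m≤m+n x c

        ∣+∣≤ : ∀ {a b x y} → ∣ a ∣ ≤ x → ∣ b ∣ ≤ y → ∣ a ℤ.+ b ∣ ≤ x + y
        ∣+∣≤ {a} {b} p q = ≤-trans (ℤ.∣i+j∣≤∣i∣+∣j∣ a b) (+-mono-≤ p q)

        ∣-∣≤ : ∀ {a b x y} → ∣ a ∣ ≤ x → ∣ b ∣ ≤ y → ∣ a ℤ.- b ∣ ≤ x + y
        ∣-∣≤ {a} {b} p q = ≤-trans (ℤ.∣i-j∣≤∣i∣+∣j∣ a b) (+-mono-≤ p q)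

        ∣∣-≡ : ∀ {a b x} → a ≡ b → ∣ b ∣ ≤ x → ∣ a ∣ ≤ x
        ∣∣-≡ refl p = p

        half-≤ : ∀ m {x} → ∣ m ℤ.+ m ∣ ≤ x → ∣ m ∣ ≤ x
        half-≤ (+ m)    p = ≤-trans (m≤m+n m m) p
        half-≤ -[1+ m ] p = ≤-trans (s≤s (≤-trans (m≤m+n m m) (n≤1+n _))) p

        u+v>v : v < k
        u+v>v = m<n+m v z<s

        2n : + 2 ℤ.* + n ≡ + (2 * n)
        2n = sym (ℤ.pos-* 2 n)

      not-true : ∀ {b} → not b ≡ true → b ≡ false
      not-true {false} _ = refl

      does-false : ∀ {P : Set} (d : Dec P) → does d ≡ false → ¬ P
      does-false (no ¬p) _ = ¬p

      -- For given `m` and `s`, the index j enters only through i(i + 1) with i = j + 2m; in `Φ-B`,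
      -- for given `l` and `s`, only through i(i + 1) with i = l - j.
      Φ-A : ∀ j m l → Φ j m l ≡ + k ℤ.* ((j ℤ.+ + 2 ℤ.* m) ℤ.* (j ℤ.+ + 2 ℤ.* m) ℤ.+ (j ℤ.+ + 2 ℤ.* m))
        ℤ.+ + (k + k) ℤ.* (m ℤ.* s (j , m , l)) ℤ.+ + v ℤ.* s (j , m , l)
      Φ-A j m l = ring₁₀ (+ u) (+ b) j m l

      Φ-B : ∀ j m l → Φ j m l ≡ + k ℤ.* ((l ℤ.- j) ℤ.* (l ℤ.- j) ℤ.+ (l ℤ.- j))
        ℤ.+ + k ℤ.* ((ℤ.- (+ 1 ℤ.+ l)) ℤ.* s (j , m , l)) ℤ.+ + v ℤ.* s (j , m , l)
      Φ-B j m l = ring₁₁ (+ u) (+ b) j m l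

      -- All three realise i ↦ -1 - i, which fixes no integer. `ιA` keeps m and s, with i = j + 2m;
      -- `ιB` keeps l and s, with i = l - j; `ιC` serves s = 0, where only i = j + 2m matters and m
      -- may be negated.
      ιA ιB ιC : Triple → Triple
      ιA (j , m , l) = ℤ.- + 1 ℤ.- j ℤ.- + 4 ℤ.* m , m , l ℤ.- + 2 ℤ.- + 4 ℤ.* j ℤ.- + 8 ℤ.* m
      ιB (j , m , l) = + 2 ℤ.* l ℤ.+ + 1 ℤ.- j , m ℤ.+ + 2 ℤ.* j ℤ.- + 2 ℤ.* l ℤ.- + 1 , l
      ιC (j , m , l) = ℤ.- (+ 1 ℤ.+ j) , ℤ.- m , ℤ.- (+ 2 ℤ.+ l)

      s-ιA : ∀ t → s (ιA t) ≡ s t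
      s-ιA (j , m , l) = ring₁₂ j m l

      s-ιB : ∀ t → s (ιB t) ≡ s t
      s-ιB (j , m , l) = ring₁₃ j m l

      Φ-ιA : ∀ j m l → Φ (ℤ.- + 1 ℤ.- j ℤ.- + 4 ℤ.* m) m (l ℤ.- + 2 ℤ.- + 4 ℤ.* j ℤ.- + 8 ℤ.* m) ≡ Φ j m l
      Φ-ιA j m l = trans (Φ-A (ℤ.- + 1 ℤ.- j ℤ.- + 4 ℤ.* m) m (l ℤ.- + 2 ℤ.- + 4 ℤ.* j ℤ.- + 8 ℤ.* m)) (trans (cong₂ (λ x y → + k ℤ.* x ℤ.+ + (k + k) ℤ.* (m ℤ.* y) ℤ.+ + v ℤ.* y) (ring₁₄ j m) (s-ιA (j , m , l))) (sym (Φ-A j m l)))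

      Φ-ιB : ∀ j m l → Φ (+ 2 ℤ.* l ℤ.+ + 1 ℤ.- j) (m ℤ.+ + 2 ℤ.* j ℤ.- + 2 ℤ.* l ℤ.- + 1) l ≡ Φ j m l
      Φ-ιB j m l = trans (Φ-B (+ 2 ℤ.* l ℤ.+ + 1 ℤ.- j) (m ℤ.+ + 2 ℤ.* j ℤ.- + 2 ℤ.* l ℤ.- + 1) l) (trans (cong₂ (λ x y → + k ℤ.* x ℤ.+ + k ℤ.* ((ℤ.- (+ 1 ℤ.+ l)) ℤ.* y) ℤ.+ + v ℤ.* y) (ring₁₅ j l) (s-ιB (j , m , l))) (sym (Φ-B j m l)))

      pA-ιA : ∀ t → pA (ιA t) ≡ pA t
      pA-ιA t@(j , m , l) = cong₂ (λ y φ → not (does (y ℤ.≟ 0ℤ)) ∧ (same-sign y m ∧ does (φ ℤ.≟ + 2 ℤ.* + n))) (s-ιA t) (Φ-ιA j m l)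

      pB-ιB : ∀ t → pB (ιB t) ≡ pB t
      pB-ιB t@(j , m , l) = cong₂ (λ y φ → not (does (y ℤ.≟ 0ℤ)) ∧ (not (same-sign y l) ∧ does (φ ℤ.≟ + 2 ℤ.* + n))) (s-ιB t) (Φ-ιB j m l)

      ιA-ιA : ∀ t → ιA (ιA t) ≡ t
      ιA-ιA (j , m , l) = cong₂ (λ j l → j , m , l) (ring₁₆ j m) (ring₁₇ j m l)

      ιB-ιB : ∀ t → ιB (ιB t) ≡ t
      ιB-ιB (j , m , l) = cong₂ (λ j m → j , m , l) (ring₁₈ j l) (ring₁₉ j m l)

      ιC-ιC : ∀ t → ιC (ιC t) ≡ t
      ιC-ιC (j , m , l) = cong₂ _,_ (ring₂₀ j) (cong₂ _,_ (ℤ.neg-involutive m) (ring₂₁ l))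

      private
        x-x-1 : ∀ {x y} → y ≡ x → x ℤ.- y ℤ.- + 1 ≡ ℤ.- 1ℤ
        x-x-1 {x} refl = ring₃ x

      ιA-≢ : ∀ t → ιA t ≢ t
      ιA-≢ (j , m , l) e = 2*-≢-1 (j ℤ.+ + 2 ℤ.* m) (trans (ring₂₂ j m) (x-x-1 (cong proj₁ e)))

      ιB-≢ : ∀ t → ιB t ≢ t
      ιB-≢ (j , m , l) e = 2*-≢-1 (l ℤ.- j) (trans (ring₂₃ j m l) (x-x-1 (cong (λ t → proj₁ (proj₂ t)) e)))

      ιC-≢ : ∀ t → ιC t ≢ t
      ιC-≢ (j , m , l) e = 2*-≢-1 j (trans (ring₂₄ j) (x-x-1 (cong proj₁ e)))

      pA-bounded : ∀ t → pA t ≡ true → t ∈ triples N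
      pA-bounded t@(j , m , l) pt = ∈-triples N
                (∣∣-≡ (ring₂₅ j m) (≤-trans (∣-∣≤ {i} {m ℤ.+ m} i≤ mm≤) (≤-by (4 * n + 9) (ring₂₇ n))))
                (≤-trans m≤ (≤-by (8 * n + 10) (ring₂₈ n)))
                (∣∣-≡ (ring₂₆ j m l) (≤-trans (∣-∣≤ {s t ℤ.+ (i ℤ.+ i)} {m ℤ.+ m} (∣+∣≤ {s t} {i ℤ.+ i} s≤ (∣+∣≤ {i} {i} i≤ i≤)) mm≤) (≤-by 8 (ring₂₉ n))))
        where
        i = j ℤ.+ + 2 ℤ.* m
        bounds = let z , rest = ∧-true pt ; ss , eqt = ∧-true rest in
          bound (k + k) i m (s t) (does-false (s t ℤ.≟ 0ℤ) (not-true z)) ss (≤-trans u+v>v (m≤m+n k k))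
            (trans (sym (Φ-A j m l)) (trans (does-true (Φ j m l ℤ.≟ + 2 ℤ.* + n) eqt) 2n))
        i≤ = proj₁ bounds
        m≤ = proj₁ (proj₂ bounds)
        s≤ = proj₂ (proj₂ bounds)
        mm≤ = ∣+∣≤ {m} {m} m≤ m≤

      -- With 0 counted as nonnegative, l and -1 - l always differ in sign, and -1 - l is the
      -- cofactor of `s` in `Φ-B` to which `bound` is applied.
      flip : ∀ s l → not (same-sign s l) ≡ true → same-sign s (ℤ.- (+ 1 ℤ.+ l)) ≡ true
      flip (+ _)      -[1+ zero ]  _ = refl
      flip (+ _)      -[1+ suc _ ] _ = refl
      flip -[1+ _ ]   (+ _)        _ = refl

      pB-bounded : ∀ t → pB t ≡ true → t ∈ triples N
      pB-bounded t@(j , m , l) pt = ∈-triples N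
                (∣∣-≡ (ring₃₀ j l) (≤-trans (∣-∣≤ {l} {I} l≤ i≤) (≤-by (6 * n + 8) (ring₃₂ n))))
                (half-≤ m (∣∣-≡ (ring₃₁ j m l) (≤-trans (∣-∣≤ {I ℤ.+ I ℤ.- s t} {l} (∣-∣≤ {I ℤ.+ I} {s t} (∣+∣≤ {I} {I} i≤ i≤) s≤) l≤) (≤-by (2 * n + 7) (ring₃₃ n)))))
                (≤-trans l≤ (≤-by (8 * n + 9) (ring₃₄ n)))
        where
        I = l ℤ.- j
        M = ℤ.- (+ 1 ℤ.+ l)
        bounds = let z , rest = ∧-true pt ; ss , eqt = ∧-true rest in
          bound k I M (s t) (does-false (s t ℤ.≟ 0ℤ) (not-true z)) (flip (s t) l ss) u+v>v
            (trans (sym (Φ-B j m l)) (trans (does-true (Φ j m l ℤ.≟ + 2 ℤ.* + n) eqt) 2n))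
        i≤ = proj₁ bounds
        M≤ = proj₁ (proj₂ bounds)
        s≤ = proj₂ (proj₂ bounds)
        l≤ : ∣ l ∣ ≤ 1 + 2 * n
        l≤ = ∣∣-≡ (ring₄ l) (∣-∣≤ {ℤ.- + 1} {M} ≤-refl M≤)

      par-pA : par pA (triples N) ≡ false
      par-pA = par-involution pA ιA (triples N) (triples-unique N) λ {t} _ pt →
        let pιt = trans (pA-ιA t) pt in pA-bounded (ιA t) pιt , pιt , ιA-ιA t , ιA-≢ t

      par-pB : par pB (triples N) ≡ false
      par-pB = par-involution pB ιB (triples N) (triples-unique N) λ {t} _ pt →
        let pιt = trans (pB-ιB t) pt in pB-bounded (ιB t) pιt , pιt , ιB-ιB t , ιB-≢ t

      pC pD : Triple → Bool
      pC t@(j , m , l) = p₀ t ∧ not (does (m ℤ.≟ 0ℤ))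
      pD t@(j , m , l) = p₀ t ∧ does (m ℤ.≟ 0ℤ)

      Φ-diagonal : ∀ j m l → s (j , m , l) ≡ 0ℤ →
        Φ j m l ≡ + k ℤ.* ((j ℤ.+ + 2 ℤ.* m) ℤ.* (j ℤ.+ + 2 ℤ.* m) ℤ.+ (j ℤ.+ + 2 ℤ.* m))
      Φ-diagonal j m l s≡0 = trans (Φ-A j m l) (trans
        (cong (λ y → + k ℤ.* ((j ℤ.+ + 2 ℤ.* m) ℤ.* (j ℤ.+ + 2 ℤ.* m) ℤ.+ (j ℤ.+ + 2 ℤ.* m)) ℤ.+ + (k + k) ℤ.* (m ℤ.* y) ℤ.+ + v ℤ.* y) s≡0)
        (ring₃₅ (+ k ℤ.* ((j ℤ.+ + 2 ℤ.* m) ℤ.* (j ℤ.+ + 2 ℤ.* m) ℤ.+ (j ℤ.+ + 2 ℤ.* m))) (+ (k + k)) m (+ v)))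

      l-even : ∀ j m l → s (j , m , l) ≡ 0ℤ → l ≡ (j ℤ.+ m) ℤ.+ (j ℤ.+ m)
      l-even j m l s≡0 = trans (ring₃₆ j m l) (trans (cong (λ y → y ℤ.+ ((j ℤ.+ m) ℤ.+ (j ℤ.+ m))) s≡0) (ℤ.+-identityˡ _))

      p₀-elim : ∀ j m l → p₀ (j , m , l) ≡ true → s (j , m , l) ≡ 0ℤ × same-sign m l ≡ true × Φ j m l ≡ + 2 ℤ.* + n
      p₀-elim j m l pt = let z , rest = ∧-true pt ; ss , eqt = ∧-true rest in
        does-true (s (j , m , l) ℤ.≟ 0ℤ) z , ss , does-true (Φ j m l ℤ.≟ + 2 ℤ.* + n) eqt

      p₀-intro : ∀ j m l → s (j , m , l) ≡ 0ℤ → same-sign m l ≡ true → Φ j m l ≡ + 2 ℤ.* + n → p₀ (j , m , l) ≡ true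
      p₀-intro j m l s≡0 ss eqt = cong₂ _∧_ (dec-true (s (j , m , l) ℤ.≟ 0ℤ) s≡0) (cong₂ _∧_ ss (dec-true (Φ j m l ℤ.≟ + 2 ℤ.* + n) eqt))

      p₀-bounded : ∀ t → p₀ t ≡ true → t ∈ triples N
      p₀-bounded t@(j , m , l) pt = ∈-triples N
        (∣∣-≡ (ring₂₅ j m) (≤-trans (∣-∣≤ {i} {m ℤ.+ m} i≤ (∣+∣≤ {m} {m} m≤ m≤)) (≤-by 5 (ring₃₇ n))))
        (≤-trans m≤ (≤-by (6 * n + 8) (ring₃₈ n)))
        (≤-trans l≤ (≤-by (6 * n + 8) (ring₃₈ n)))
        where
        i = j ℤ.+ + 2 ℤ.* m
        i≤ : ∣ i ∣ ≤ suc (2 * n)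
        i≤ with oblong i | p₀-elim j m l pt
        ... | x , ix , i≤′ | s≡0 , _ , eqt = ≤-trans i≤′ (s≤s (≤-trans (m≤n*m x k) (≤-reflexive (ℤ.+-injective
          (trans (ℤ.pos-* k x) (trans (cong (λ y → + k ℤ.* y) (sym ix)) (trans (sym (Φ-diagonal j m l s≡0)) (trans eqt 2n))))))))
        same-sign-≤ : ∀ m l → same-sign m l ≡ true → ∣ m ∣ ≤ ∣ l ℤ.+ (m ℤ.+ m) ∣ × ∣ l ∣ ≤ ∣ l ℤ.+ (m ℤ.+ m) ∣
        same-sign-≤ (+ m) (+ l) _ = ≤-trans (m≤m+n m m) (m≤n+m _ l) , m≤m+n l _
        same-sign-≤ -[1+ m ] -[1+ l ] _ = s≤s (≤-trans (m≤m+n m m) (≤-trans (n≤1+n _) (≤-trans (m≤n+m (suc (m + m)) l) (n≤1+n _))))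
                                      , s≤s (≤-trans (m≤m+n l (suc (m + m))) (n≤1+n _))
        ll≤ : ∣ l ℤ.+ (m ℤ.+ m) ∣ ≤ suc (2 * n) + suc (2 * n)
        ll≤ = ∣∣-≡ (trans (cong (λ y → y ℤ.+ (m ℤ.+ m)) (l-even j m l (proj₁ (p₀-elim j m l pt)))) (ring₅ j m)) (∣+∣≤ {i} {i} i≤ i≤)
        m≤ = ≤-trans (proj₁ (same-sign-≤ m l (proj₁ (proj₂ (p₀-elim j m l pt))))) ll≤
        l≤ = ≤-trans (proj₂ (same-sign-≤ m l (proj₁ (proj₂ (p₀-elim j m l pt))))) ll≤

      -- The sign condition survives because s = 0 makes l even: l is then not -1, so -2 - l lies on
      -- the other side of 0, as -m does for m ≠ 0.
      pC-ιC : ∀ t → pC t ≡ true → pC (ιC t) ≡ true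
      pC-ιC t@(j , m , l) pt = cong₂ _∧_ (p₀-intro (ℤ.- (+ 1 ℤ.+ j)) (ℤ.- m) (ℤ.- (+ 2 ℤ.+ l)) s′ (opposite m l (j ℤ.+ m) m≢0 (l-even j m l s≡0) ss)
          (trans (Φ-diagonal (ℤ.- (+ 1 ℤ.+ j)) (ℤ.- m) (ℤ.- (+ 2 ℤ.+ l)) s′) (trans (cong (λ y → + k ℤ.* y) (ring₃₉ j m)) (trans (sym (Φ-diagonal j m l s≡0)) eqt))))
        (cong not (dec-false (ℤ.- m ℤ.≟ 0ℤ) λ e → m≢0 (trans (sym (ℤ.neg-involutive m)) (cong ℤ.-_ e))))
        where
        elim = p₀-elim j m l (proj₁ (∧-true pt))
        s≡0 = proj₁ elim
        ss = proj₁ (proj₂ elim)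
        eqt = proj₂ (proj₂ elim)
        m≢0 : m ≢ 0ℤ
        m≢0 = does-false (m ℤ.≟ 0ℤ) (not-true (proj₂ (∧-true {p₀ t} pt)))
        s′ : s (ιC t) ≡ 0ℤ
        s′ = trans (ring₆ j m l) (cong ℤ.-_ s≡0)
        opposite : ∀ m l x → m ≢ 0ℤ → l ≡ x ℤ.+ x → same-sign m l ≡ true → same-sign (ℤ.- m) (ℤ.- (+ 2 ℤ.+ l)) ≡ true
        opposite (+ zero)  l                  x m≢0 _ _ = contradiction refl m≢0
        opposite (+ suc m) (+ l)              x _ _ _ = refl
        opposite -[1+ m ]  -[1+ zero ]        x _ e _ = contradiction (sym e) (2*-≢-1 x)
        opposite -[1+ m ]  -[1+ suc zero ]    x _ _ _ = refl
        opposite -[1+ m ]  -[1+ suc (suc l) ] x _ _ _ = refl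

      par-pC : par pC (triples N) ≡ false
      par-pC = par-involution pC ιC (triples N) (triples-unique N) λ {t} _ pt →
        let pιt = pC-ιC t pt in p₀-bounded (ιC t) (proj₁ (∧-true pιt)) , pιt , ιC-ιC t , ιC-≢ t

      -- At m = 0 the sign condition makes l = 2j nonnegative, which leaves one term for each j ≥ 0,
      -- with exponent k times a triangular number.
      par-pD : par pD (triples N) ≡ par (λ i → tri i * k ≡ᵇ n) (downFrom (suc (N * 2)))
      par-pD = par-bijection pD _ (λ (j , _ , _) → ∣ j ∣) (λ i → + i , 0ℤ , + i ℤ.+ + i) (triples-unique N) (Unique.downFrom⁺ _)
        (λ {t} t∈ pt → to t t∈ pt) (λ {i} _ qi → from i (≡ᵇ-true (tri i * k) n qi))
        where
        Φ-tri : ∀ i → Φ (+ i) 0ℤ (+ i ℤ.+ + i) ≡ + 2 ℤ.* + (tri i * k)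
        Φ-tri i = trans (ring₇ (+ u) (+ b) (+ i)) (trans (cong (λ y → y ℤ.* + k) (sym (pos-tri i))) (trans (ℤ.*-assoc (+ 2) (+ tri i) (+ k))
          (cong (λ y → + 2 ℤ.* y) (sym (ℤ.pos-* (tri i) k)))))
        from : ∀ i → tri i * k ≡ n → (+ i , 0ℤ , + i ℤ.+ + i) ∈ triples N × pD (+ i , 0ℤ , + i ℤ.+ + i) ≡ true × i ≡ i
        from i e = p₀-bounded (+ i , 0ℤ , + i ℤ.+ + i) p₀t , trans (∧-identityʳ _) p₀t , refl
          where
          p₀t = p₀-intro (+ i) 0ℤ (+ i ℤ.+ + i) (ring₁ (+ i)) refl (trans (Φ-tri i) (cong (λ y → + 2 ℤ.* + y) e))
        shape : ∀ j l → l ≡ (j ℤ.+ 0ℤ) ℤ.+ (j ℤ.+ 0ℤ) → same-sign 0ℤ l ≡ true → j ≡ + ∣ j ∣ × l ≡ + ∣ j ∣ ℤ.+ + ∣ j ∣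
        shape (+ j) l e _ = refl , trans e (cong₂ ℤ._+_ (ℤ.+-identityʳ (+ j)) (ℤ.+-identityʳ (+ j)))
        shape -[1+ j ] (+ l) e _ with trans e (cong₂ ℤ._+_ (ℤ.+-identityʳ -[1+ j ]) (ℤ.+-identityʳ -[1+ j ]))
        ... | ()
        to : ∀ t → t ∈ triples N → pD t ≡ true →
          ∣ proj₁ t ∣ ∈ downFrom (suc (N * 2)) × (tri ∣ proj₁ t ∣ * k ≡ᵇ n) ≡ true × (+ ∣ proj₁ t ∣ , 0ℤ , + ∣ proj₁ t ∣ ℤ.+ + ∣ proj₁ t ∣) ≡ t
        to t@(j , m , l) t∈ pt with does-true (m ℤ.≟ 0ℤ) (proj₂ (∧-true {p₀ t} pt))
        ... | refl with shape j l (l-even j 0ℤ l (proj₁ el)) (proj₁ (proj₂ el))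
          where el = p₀-elim j 0ℤ l (proj₁ (∧-true pt))
        ...   | j≡ , l≡ = ∈-downFrom⁺ (s≤s (≤-trans (range-≤ N (proj₁ (∈-cartesianProduct⁻ (range N) (pairs N) t∈))) (m≤m*n N 2)))
                , ≡⇒≡ᵇ-true (tri ∣ j ∣ * k) n (ℤ.+-injective (ℤ.*-cancelˡ-≡ (+ 2) (+ (tri ∣ j ∣ * k)) (+ n) (trans (sym (Φ-tri ∣ j ∣))
                    (trans (cong₂ (λ j l → Φ j 0ℤ l) (sym j≡) (sym l≡)) (proj₂ (proj₂ (p₀-elim j 0ℤ l (proj₁ (∧-true pt)))))))))
                , cong₂ (λ j l → j , 0ℤ , l) (sym j≡) (sym l≡)

      p₀-split : ∀ t → p₀ t ≡ pC t xor pD t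
      p₀-split t@(j , m , l) = lem (p₀ t) (does (m ℤ.≟ 0ℤ))
        where
        lem : ∀ a c → a ≡ (a ∧ not c) xor (a ∧ c)
        lem true  true  = refl
        lem true  false = refl
        lem false _     = refl

      par-p : par p (triples N) ≡ par (λ i → tri i * k ≡ᵇ n) (downFrom (suc (N * 2)))
      par-p = trans (par-cong (triples N) λ t _ → trans (p-split t) (cong (_xor (pA t xor pB t)) (p₀-split t)))
        (trans (par-xor (λ t → pC t xor pD t) (λ t → pA t xor pB t) (triples N))
        (trans (cong₂ _xor_ (trans (par-xor pC pD (triples N)) (cong₂ _xor_ par-pC par-pD))
                 (trans (par-xor pA pB (triples N)) (cong₂ _xor_ par-pA par-pB)))
          (xor-identityʳ _)))

      p-agree : ∀ j m l → ((true ∧ same-sign m l) ∧ (e j + E m l ≡ᵇ n)) ≡ p (j , m , l)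
      p-agree j m l with same-sign m l in ss
      ... | false = refl
      ... | true  = bool-iff
        (λ h → dec-true (Φ j m l ℤ.≟ + 2 ℤ.* + n) (trans (sym value) (cong (λ y → + 2 ℤ.* + y) (≡ᵇ-true (e j + E m l) n h))))
        (λ h → ≡⇒≡ᵇ-true (e j + E m l) n (ℤ.+-injective (ℤ.*-cancelˡ-≡ (+ 2) (+ (e j + E m l)) (+ n) (trans value (does-true (Φ j m l ℤ.≟ + 2 ℤ.* + n) h)))))
        where
        value : + 2 ℤ.* + (e j + E m l) ≡ Φ j m l
        value = trans (ℤ.*-distribˡ-+ (+ 2) (+ e j) (+ E m l)) (cong₂ (λ x y → x ℤ.+ + 2 ℤ.* y) (e-poly j) (E-poly m l ss))

    -- Kronecker's formula at x = Q/y², modulo 2. The terms with s ≠ 0 cancel in pairs, so do those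
    -- with s = 0 and m ≠ 0, and the rest is ψ(Q).
    reciprocal : theta u v ⊛ J ≈ sub (u′ + v) ψ
    reciprocal = coeffwise λ n → let open Counting n in begin
      (theta u v ⊛ J) n
        ≡⟨ at< (⊛-cong[] (≈[]-trans (theta-≈[] u v N) (≈⇒≈[] (theta-monomials N))) (J-≈[] N)) (n< n) ⟩
      (monomials (λ _ → true) e (range N) ⊛ monomials (λ (m , l) → same-sign m l) (λ (m , l) → E m l) (pairs N)) n
        ≡⟨ trans (at (monomials-⊛ _ _ _ _ (range N) (pairs N)) n) (monomials-at _ _ (triples N) n) ⟩
      par (λ (j , m , l) → (true ∧ same-sign m l) ∧ (e j + E m l ≡ᵇ n)) (triples N)
        ≡⟨ par-cong (triples N) (λ (j , m , l) _ → p-agree j m l) ⟩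
      par p (triples N) ≡⟨ par-p ⟩
      par (λ i → tri i * k ≡ᵇ n) (downFrom (suc (N * 2)))
        ≡⟨ monomials-at (λ _ → true) (λ i → tri i * k) (downFrom (suc (N * 2))) n ⟨
      monomials (λ _ → true) (λ i → tri i * k) (downFrom (suc (N * 2))) n
        ≡⟨ at (sub-monomials (downFrom (suc (N * 2)))) n ⟨
      sub (u′ + v) (monomials (λ _ → true) tri (downFrom (suc (N * 2)))) n
        ≡⟨ at< (sub-cong[] (u′ + v) (≈[]-trans (theta-≈[] 1 3 N) (≈⇒≈[] (bilateral-tri N)))) (n< n) ⟨
      sub (u′ + v) ψ n ∎
      where
      open ≡-Reasoning
      n< : ∀ n → n < 10 * n + 10
      n< n = ≤-<-trans (m≤n*m n 10) (m<m+n (10 * n) z<s)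
      sub-monomials : ∀ xs → sub (u′ + v) (monomials (λ _ → true) tri xs) ≈ monomials (λ _ → true) (λ i → tri i * k) xs
      sub-monomials []       = sub-0s (u′ + v)
      sub-monomials (x ∷ xs) = ≈-trans (sub-⊕ (u′ + v) _ _) (⊕-cong (sub-q^ (u′ + v) (tri x)) (sub-monomials xs))

-- Parity of b₉(4n) from a prime factor of 12n + 1

module Divisors where

  open Series
  import Defs
  open Theta
  open Eta
  open Dissect using (lambert; section-lambert)
  open Partition using (odd; module RegularPartitions)
  open Parity
  open JLemma
  open import Data.Bool.Base using (Bool; true; false; _∧_; _xor_)
  open import Data.Bool.Properties using (¬-not)
  open import Data.Empty using (⊥; ⊥-elim)
  open import Data.Integer.Base as ℤ using (ℤ; +_; -[1+_]; ∣_∣)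
  import Data.Integer.Properties as ℤ
  import Data.Integer.Tactic.RingSolver as ℤ-Ring
  open import Data.Integer.Divisibility.Signed as ℤ∣ using (divides; ∣⇒∣ᵤ; ∣ᵤ⇒∣)
  open import Data.List.Membership.Propositional using (_∈_)
  open import Data.List.Membership.Propositional.Properties using (∈-cartesianProduct⁺)
  open import Data.Nat.Base
  open import Data.Nat.DivMod using (_%_; _/_; m≡m%n+[m/n]*n; m%n<n)
  import Data.Nat.Divisibility as ℕ
  open import Data.Nat.Primality using (Prime; euclidsLemma; ¬prime[0])
  open import Data.Nat.Properties
  open import Data.Nat.Tactic.RingSolver using (solve-∀)
  open import Data.Product.Base using (_×_; _,_; proj₁; proj₂; Σ-syntax)
  open import Data.Sum.Base using (_⊎_; inj₁; inj₂; reduce)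
  open import Relation.Binary.PropositionalEquality hiding (setoid; J)
  open import Relation.Nullary using (¬_; Dec; yes; no; contradiction)

  private
    ring₁ : ∀ e p d → e ℤ.* p ℤ.* d ≡ e ℤ.* (d ℤ.* p)
    ring₁ = ℤ-Ring.solve-∀
    ring₂ : ∀ e p d → e ℤ.* (d ℤ.* p) ≡ e ℤ.* p ℤ.* d
    ring₂ = ℤ-Ring.solve-∀
    ring₄ : ∀ k u b m l → (k ℤ.* m ℤ.+ b) ℤ.* (k ℤ.* l ℤ.+ u) ≡ k ℤ.* (k ℤ.* m ℤ.* l ℤ.+ u ℤ.* m ℤ.+ b ℤ.* l) ℤ.+ b ℤ.* u
    ring₄ = ℤ-Ring.solve-∀
    ring₅ : ∀ u b m → (u ℤ.+ (b ℤ.+ b)) ℤ.* (ℤ.- (+ 1 ℤ.+ m)) ℤ.+ b ≡ ℤ.- ((u ℤ.+ (b ℤ.+ b)) ℤ.* m ℤ.+ (u ℤ.+ b))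
    ring₅ = ℤ-Ring.solve-∀
    ring₆ : ∀ u b l → (u ℤ.+ (b ℤ.+ b)) ℤ.* (ℤ.- (+ 1 ℤ.+ l)) ℤ.+ u ≡ ℤ.- ((u ℤ.+ (b ℤ.+ b)) ℤ.* l ℤ.+ (b ℤ.+ b))
    ring₆ = ℤ-Ring.solve-∀
    ring₇ : ∀ k c x y → k ℤ.* ((+ 1 ℤ.+ k ℤ.* c) ℤ.* x ℤ.+ y ℤ.* c) ℤ.+ y ≡ (+ 1 ℤ.+ k ℤ.* c) ℤ.* (k ℤ.* x ℤ.+ y)
    ring₇ = ℤ-Ring.solve-∀
    ring₈ : ∀ k c x y z → k ℤ.* (x ℤ.- c ℤ.* z) ℤ.+ y ≡ k ℤ.* x ℤ.+ y ℤ.- k ℤ.* c ℤ.* z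
    ring₈ = ℤ-Ring.solve-∀
    ring₉ : ∀ k c z → z ℤ.* (+ 1 ℤ.+ k ℤ.* c) ℤ.- k ℤ.* c ℤ.* z ≡ z
    ring₉ = ℤ-Ring.solve-∀
    ring₁₀ : ∀ k c x y → (+ 1 ℤ.+ k ℤ.* c) ℤ.* x ℤ.+ y ℤ.* c ℤ.- c ℤ.* (k ℤ.* x ℤ.+ y) ≡ x
    ring₁₀ = ℤ-Ring.solve-∀
    ring₁₁ : ∀ k c x y z → (+ 1 ℤ.+ k ℤ.* c) ℤ.* (x ℤ.- c ℤ.* z) ℤ.+ y ℤ.* c ≡ x ℤ.+ c ℤ.* ((k ℤ.* x ℤ.+ y) ℤ.- z ℤ.* (+ 1 ℤ.+ k ℤ.* c))
    ring₁₁ = ℤ-Ring.solve-∀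
    ring₁₂ : ∀ k c x z → x ℤ.+ c ℤ.* (z ℤ.* (+ 1 ℤ.+ k ℤ.* c) ℤ.- z ℤ.* (+ 1 ℤ.+ k ℤ.* c)) ≡ x
    ring₁₂ = ℤ-Ring.solve-∀
    ring₁₃ : ∀ x y p → x ℤ.* p ℤ.* (y ℤ.* p) ≡ (x ℤ.* y) ℤ.* (p ℤ.* p)
    ring₁₃ = ℤ-Ring.solve-∀

  module EvenCoefficients (u′ b′ : ℕ) where
    open Reciprocal u′ b′

    -- The pairs (m,l) counted by J n are the factorisations of kn + bu as e(m) d(l);
    -- a prime P ≡ 1 (mod k), up to sign, dividing it exactly once can be moved from one factor to the other.
    module _ (n : ℕ) (P c : ℤ) (P≡ : P ≡ + 1 ℤ.+ + k ℤ.* c) (P-prime : Prime ∣ P ∣)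
      (P∣ : ∣ P ∣ ℕ.∣ k * n + b * u) (P²∤ : ¬ ∣ P ∣ * ∣ P ∣ ℕ.∣ k * n + b * u) where
      private
        M = k * n + b * u

        eₘ dₗ : ℤ → ℤ
        eₘ m = + k ℤ.* m ℤ.+ + b
        dₗ l = + k ℤ.* l ℤ.+ + u

        ed-poly : ∀ m l → eₘ m ℤ.* dₗ l ≡ + k ℤ.* (+ k ℤ.* m ℤ.* l ℤ.+ + u ℤ.* m ℤ.+ + b ℤ.* l) ℤ.+ + b ℤ.* + u
        ed-poly m l = ring₄ (+ k) (+ u) (+ b) m l

        pos-M : ∀ x → + (k * x + b * u) ≡ + k ℤ.* + x ℤ.+ + b ℤ.* + u
        pos-M x = cong₂ ℤ._+_ (ℤ.pos-* k x) (ℤ.pos-* b u)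

        q : ℤ × ℤ → Bool
        q (m , l) = same-sign m l ∧ (E m l ≡ᵇ n)

        q⇒ed : ∀ m l → q (m , l) ≡ true → eₘ m ℤ.* dₗ l ≡ + M
        q⇒ed m l h = trans (ed-poly m l) (trans (cong (λ y → + k ℤ.* y ℤ.+ + b ℤ.* + u)
          (trans (sym (E-poly m l (proj₁ (∧-true h)))) (cong +_ (≡ᵇ-true (E m l) n (proj₂ (∧-true h)))))) (sym (pos-M n)))

        e-pos : ∀ m → eₘ (+ m) ≡ + suc (k * m + b′)
        e-pos m = trans (cong (λ y → y ℤ.+ + b) (sym (ℤ.pos-* k m))) (cong +_ (+-suc (k * m) b′))

        e-neg : ∀ m → eₘ -[1+ m ] ≡ -[1+ k * m + (u′ + b) ]
        e-neg m = trans (ring₅ (+ u) (+ b) (+ m)) (cong ℤ.-_ (trans (cong (λ y → y ℤ.+ + (u + b)) (sym (ℤ.pos-* k m))) (cong +_ (+-suc (k * m) (u′ + b)))))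

        d-pos : ∀ l → dₗ (+ l) ≡ + suc (k * l + u′)
        d-pos l = trans (cong (λ y → y ℤ.+ + u) (sym (ℤ.pos-* k l))) (cong +_ (+-suc (k * l) u′))

        d-neg : ∀ l → dₗ -[1+ l ] ≡ -[1+ k * l + (b′ + b) ]
        d-neg l = trans (ring₆ (+ u) (+ b) (+ l)) (cong ℤ.-_ (trans (cong (λ y → y ℤ.+ + v) (sym (ℤ.pos-* k l))) (cong +_ (+-suc (k * l) (b′ + b)))))

        -- Since b and u lie strictly between 0 and k, the factors k m + b and k l + u have the
        -- signs of m and l. A positive product thus encodes the sign condition.
        ed⇒same : ∀ m l → eₘ m ℤ.* dₗ l ≡ + M → same-sign m l ≡ true
        ed⇒same (+ m)    (+ l)    _ = refl
        ed⇒same -[1+ m ] -[1+ l ] _ = refl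
        ed⇒same (+ m)    -[1+ l ] h = contradiction (trans (cong₂ ℤ._*_ (sym (e-pos m)) (sym (d-neg l))) h) λ ()
        ed⇒same -[1+ m ] (+ l)    h = contradiction (trans (cong₂ ℤ._*_ (sym (e-neg m)) (sym (d-pos l))) h) λ ()

        ed⇒q : ∀ m l → eₘ m ℤ.* dₗ l ≡ + M → q (m , l) ≡ true
        ed⇒q m l h = cong₂ _∧_ ss (≡⇒≡ᵇ-true (E m l) n (*-cancelˡ-≡ (E m l) n k (+-cancelʳ-≡ (b * u) _ _ (ℤ.+-injective
          (trans (pos-M (E m l)) (trans (cong (λ y → + k ℤ.* y ℤ.+ + b ℤ.* + u) (E-poly m l ss)) (trans (sym (ed-poly m l)) h)))))))
          where ss = ed⇒same m l h

        q⇒∈ : ∀ m l → q (m , l) ≡ true → (m , l) ∈ pairs n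
        q⇒∈ m l h = ∈-cartesianProduct⁺ (∈-range n (subst (∣ m ∣ ≤_) E≡ (proj₁ (E-≥ m l ss)))) (∈-range n (subst (∣ l ∣ ≤_) E≡ (proj₂ (E-≥ m l ss))))
          where
          ss = proj₁ (∧-true {same-sign m l} h)
          E≡ = ≡ᵇ-true (E m l) n (proj₂ (∧-true {same-sign m l} h))

        swap-with : ∀ m l → Dec (P ℤ∣.∣ dₗ l) → Dec (P ℤ∣.∣ eₘ m) → ℤ × ℤ
        swap-with m l (yes (divides d′ _)) _ = P ℤ.* m ℤ.+ + b ℤ.* c , l ℤ.- c ℤ.* d′
        swap-with m l (no _) (yes (divides e′ _)) = m ℤ.- c ℤ.* e′ , P ℤ.* l ℤ.+ + u ℤ.* c
        swap-with m l (no _) (no _) = m , l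

        swap : ℤ × ℤ → ℤ × ℤ
        swap (m , l) = swap-with m l (P ℤ∣.∣? dₗ l) (P ℤ∣.∣? eₘ m)

        -- P = 1 + k c preserves the class of k x + y modulo k, so multiplying the factor by `P` is
        -- an integral change of its parameter; `shrink` is the division.
        grow : ∀ x y → + k ℤ.* (P ℤ.* x ℤ.+ y ℤ.* c) ℤ.+ y ≡ P ℤ.* (+ k ℤ.* x ℤ.+ y)
        grow x y = trans (cong (λ p → + k ℤ.* (p ℤ.* x ℤ.+ y ℤ.* c) ℤ.+ y) P≡) (trans (ring₇ (+ k) c x y) (cong (λ p → p ℤ.* (+ k ℤ.* x ℤ.+ y)) (sym P≡)))

        shrink : ∀ x y z → + k ℤ.* x ℤ.+ y ≡ z ℤ.* P → + k ℤ.* (x ℤ.- c ℤ.* z) ℤ.+ y ≡ z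
        shrink x y z h = trans (ring₈ (+ k) c x y z) (trans (cong (λ w → w ℤ.- + k ℤ.* c ℤ.* z) (trans h (cong (z ℤ.*_) P≡))) (ring₉ (+ k) c z))

        ungrow : ∀ x y → P ℤ.* x ℤ.+ y ℤ.* c ℤ.- c ℤ.* (+ k ℤ.* x ℤ.+ y) ≡ x
        ungrow x y = trans (cong (λ p → p ℤ.* x ℤ.+ y ℤ.* c ℤ.- c ℤ.* (+ k ℤ.* x ℤ.+ y)) P≡) (ring₁₀ (+ k) c x y)

        unshrink : ∀ x y z → + k ℤ.* x ℤ.+ y ≡ z ℤ.* P → P ℤ.* (x ℤ.- c ℤ.* z) ℤ.+ y ℤ.* c ≡ x
        unshrink x y z h = trans (cong (λ p → p ℤ.* (x ℤ.- c ℤ.* z) ℤ.+ y ℤ.* c) P≡) (trans (ring₁₁ (+ k) c x y z)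
          (trans (cong (λ w → x ℤ.+ c ℤ.* (w ℤ.- z ℤ.* (+ 1 ℤ.+ + k ℤ.* c))) (trans h (cong (z ℤ.*_) P≡))) (ring₁₂ (+ k) c x z)))

        P≢0 : ∣ P ∣ ≢ 0
        P≢0 e = ¬prime[0] (subst Prime e P-prime)

        instance
          P-nonZero : ℤ.NonZero P
          P-nonZero = ℤ.≢-nonZero {P} (λ e → P≢0 (cong ∣_∣ e))

        P²∤ed : ∀ {x y} → x ℤ.* P ℤ.* (y ℤ.* P) ≢ + M
        P²∤ed {x} {y} h = P²∤ (ℕ.divides (∣ x ℤ.* y ∣) (trans (cong ∣_∣ (trans (sym h) (ring₁₃ x y P)))
          (trans (ℤ.abs-* (x ℤ.* y) (P ℤ.* P)) (cong (∣ x ℤ.* y ∣ *_) (ℤ.abs-* P P)))))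

        P∣e⊎P∣d : ∀ m l → eₘ m ℤ.* dₗ l ≡ + M → P ℤ∣.∣ eₘ m ⊎ P ℤ∣.∣ dₗ l
        P∣e⊎P∣d m l h with euclidsLemma ∣ eₘ m ∣ ∣ dₗ l ∣ P-prime (subst (∣ P ∣ ℕ.∣_) (trans (cong ∣_∣ (sym h)) (ℤ.abs-* (eₘ m) (dₗ l))) P∣)
        ... | inj₁ d = inj₁ (∣ᵤ⇒∣ d)
        ... | inj₂ d = inj₂ (∣ᵤ⇒∣ d)

        quotient-unique : ∀ {x y z} → z ≡ x ℤ.* P → z ≡ y ℤ.* P → x ≡ y
        quotient-unique {x} {y} h h′ = ℤ.*-cancelʳ-≡ x y P (trans (sym h) h′)

        swap-d : ∀ m l {d′} → dₗ l ≡ d′ ℤ.* P → swap (m , l) ≡ (P ℤ.* m ℤ.+ + b ℤ.* c , l ℤ.- c ℤ.* d′)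
        swap-d m l {d′} h with P ℤ∣.∣? dₗ l
        ... | yes (divides d″ h′) = cong (λ d → P ℤ.* m ℤ.+ + b ℤ.* c , l ℤ.- c ℤ.* d) (quotient-unique h′ h)
        ... | no ∤d               = contradiction (divides d′ h) ∤d

        swap-e : ∀ m l {e′} → eₘ m ℤ.* dₗ l ≡ + M → eₘ m ≡ e′ ℤ.* P → swap (m , l) ≡ (m ℤ.- c ℤ.* e′ , P ℤ.* l ℤ.+ + u ℤ.* c)
        swap-e m l {e′} ed h with P ℤ∣.∣? dₗ l | P ℤ∣.∣? eₘ m
        ... | yes (divides d′ h′) | _ = ⊥-elim (P²∤ed {e′} {d′} (trans (sym (cong₂ ℤ._*_ h h′)) ed))
        ... | no _ | yes (divides e″ h″) = cong (λ e → m ℤ.- c ℤ.* e , P ℤ.* l ℤ.+ + u ℤ.* c) (quotient-unique h″ h)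
        ... | no _ | no ∤e = contradiction (divides e′ h) ∤e

        Valid : ℤ × ℤ → Set
        Valid (m , l) = eₘ m ℤ.* dₗ l ≡ + M

        swap-lemma : ∀ t → Valid t → Valid (swap t) × swap (swap t) ≡ t × swap t ≢ t
        swap-lemma (m , l) h with P∣e⊎P∣d m l h
        ... | inj₂ (divides d′ hd) = subst (λ t → Valid t × swap t ≡ (m , l) × t ≢ (m , l)) (sym (swap-d m l hd)) (valid , back , moved)
          where
          m′ = P ℤ.* m ℤ.+ + b ℤ.* c
          l′ = l ℤ.- c ℤ.* d′
          e≡ : eₘ m′ ≡ eₘ m ℤ.* P
          e≡ = trans (grow m (+ b)) (ℤ.*-comm P (eₘ m))
          d≡ : dₗ l′ ≡ d′
          d≡ = shrink l (+ u) d′ hd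
          valid : eₘ m′ ℤ.* dₗ l′ ≡ + M
          valid = trans (cong₂ ℤ._*_ e≡ d≡) (trans (ring₁ (eₘ m) P d′) (trans (cong (eₘ m ℤ.*_) (sym hd)) h))
          back : swap (m′ , l′) ≡ (m , l)
          back = trans (swap-e m′ l′ valid e≡) (cong₂ _,_ (ungrow m (+ b)) (unshrink l (+ u) d′ hd))
          moved : (m′ , l′) ≢ (m , l)
          -- A fixed pair would keep its first factor under multiplication by `P`; that factor and
          -- the second would then both be multiples of `P`.
          moved eq = P²∤ed {eₘ m} {d′} (trans (cong₂ ℤ._*_ (trans (sym e≡) (cong (λ t → eₘ (proj₁ t)) eq)) (sym hd)) h)
        ... | inj₁ (divides e′ he) = subst (λ t → Valid t × swap t ≡ (m , l) × t ≢ (m , l)) (sym (swap-e m l h he)) (valid , back , moved)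
          where
          m′ = m ℤ.- c ℤ.* e′
          l′ = P ℤ.* l ℤ.+ + u ℤ.* c
          e≡ : eₘ m′ ≡ e′
          e≡ = shrink m (+ b) e′ he
          d≡ : dₗ l′ ≡ dₗ l ℤ.* P
          d≡ = trans (grow l (+ u)) (ℤ.*-comm P (dₗ l))
          valid : eₘ m′ ℤ.* dₗ l′ ≡ + M
          valid = trans (cong₂ ℤ._*_ e≡ d≡) (trans (ring₂ e′ P (dₗ l)) (trans (cong (ℤ._* dₗ l) (sym he)) h))
          back : swap (m′ , l′) ≡ (m , l)
          back = trans (swap-d m′ l′ d≡) (cong₂ _,_ (unshrink m (+ b) e′ he) (ungrow l (+ u)))
          moved : (m′ , l′) ≢ (m , l)
          moved eq = P²∤ed {e′} {dₗ l} (trans (cong₂ ℤ._*_ (sym he) (trans (sym d≡) (cong (λ t → dₗ (proj₂ t)) eq))) h)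

      J-even : J n ≡ false
      J-even = par-involution q swap (pairs n) (pairs-unique n) λ { {m , l} _ h →
        let valid , back , moved = swap-lemma (m , l) (q⇒ed m l h)
            m′ = proj₁ (swap (m , l)) ; l′ = proj₂ (swap (m , l))
            h′ = ed⇒q m′ l′ valid
        in q⇒∈ m′ l′ h′ , h′ , back , moved }

  private
    coefficient : ∀ a g {N} → ¬ N < a → (q^ a ⊛ g) N ≡ g (N ∸ a)
    coefficient a g {N} N≮a = trans (at (q^-⊛ a g) N) (trans (cong (shⁿ a g) (sym (m+[n∸m]≡n (≮⇒≥ N≮a)))) (shⁿ-at-+ a g (N ∸ a)))

  q^-sub-2-at : ∀ a g N → (q^ a ⊛ sub 2 g) N ≡ false ⊎ Σ[ x ∈ ℕ ] (a + x * 3 ≡ N × (q^ a ⊛ sub 2 g) N ≡ g x)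
  q^-sub-2-at a g N with N <? a
  ... | yes N<a = inj₁ (trans (at (q^-⊛ a (sub 2 g)) N) (shⁿ-at-< a _ N<a))
  ... | no  N≮a with (N ∸ a) % 3 | (N ∸ a) / 3 | m≡m%n+[m/n]*n (N ∸ a) 3 | m%n<n (N ∸ a) 3
  ...   | zero  | x | eq | _ = inj₂ (x , trans (cong (λ y → a + y) (sym eq)) (m+[n∸m]≡n (≮⇒≥ N≮a)) ,
            trans (coefficient a (sub 2 g) N≮a) (trans (cong (sub 2 g) eq) (sub-at-* 2 g x)))
  ...   | suc r | x | eq | s≤s r< = inj₁ (trans (coefficient a (sub 2 g) N≮a) (trans (cong (sub 2 g) eq) (sub-at-< 2 g x r<)))

  bilateral-support : ∀ p m N n → bilateral p m N n ≡ true → Σ[ j ∈ ℕ ] (p j ≡ n ⊎ m j ≡ n)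
  bilateral-support p m zero    n h = 0 , inj₁ (≡ᵇ-true (p 0) n (trans (sym (q^-at (p 0) n)) h))
  bilateral-support p m (suc N) n h with bilateral p m N n in eq | q^ (p (suc N)) n in eq₁ | q^ (m (suc N)) n in eq₂
  ... | true  | _     | _     = bilateral-support p m N n eq
  ... | false | true  | _     = suc N , inj₁ (≡ᵇ-true (p (suc N)) n (trans (sym (q^-at (p (suc N)) n)) eq₁))
  ... | false | false | true  = suc N , inj₂ (≡ᵇ-true (m (suc N)) n (trans (sym (q^-at (m (suc N)) n)) eq₂))
  ... | false | false | false with trans (sym h) (trans (⊕-at _ _ n) (cong₂ _xor_ eq (trans (⊕-at _ _ n) (cong₂ _xor_ eq₁ eq₂))))
  ...   | ()

  private
    ring₁₆ : ∀ a p → 24 * (a + p) + 1 ≡ 24 * a + (24 * p + 1)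
    ring₁₆ = solve-∀
    ring₁₇ : ∀ j → 24 * (1 + (1 + j) * 3) + (6 * j + 5) * (6 * j + 5) ≡ (6 * (1 + j) + 5) * (6 * (1 + j) + 5)
    ring₁₇ = solve-∀
    ring₁₈ : ∀ j → 24 * (2 + j * 3) + (6 * j + 1) * (6 * j + 1) ≡ (6 * (1 + j) + 1) * (6 * (1 + j) + 1)
    ring₁₈ = solve-∀

  -- Completing the square: 24 times a pentagonal number, plus 1, is (6j ± 1)².
  f-support : ∀ n → f n ≡ true → Σ[ x ∈ ℕ ] 24 * n + 1 ≡ x * x
  f-support n h with bilateral-support (pent 1 2) (pent 2 1) (suc n) n h
  ... | zero  , inj₁ refl = 1 , refl
  ... | suc j , inj₁ refl = 6 * j + 5 , square j
    where
    square : ∀ j → 24 * pent 1 2 (suc j) + 1 ≡ (6 * j + 5) * (6 * j + 5)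
    square zero    = refl
    square (suc j) = trans (ring₁₆ (1 + suc j * 3) (pent 1 2 (suc j))) (trans (cong (λ y → 24 * (1 + suc j * 3) + y) (square j)) (ring₁₇ j))
  ... | j , inj₂ refl = 6 * j + 1 , square j
    where
    square : ∀ j → 24 * pent 2 1 j + 1 ≡ (6 * j + 1) * (6 * j + 1)
    square zero    = refl
    square (suc j) = trans (ring₁₆ (2 + j * 3) (pent 2 1 j)) (trans (cong (λ y → 24 * (2 + j * 3) + y) (square j)) (ring₁₈ j))

  lambert-even : ∀ {a b c : F₂⟦q⟧} N → (q^ 1 ⊛ sub 2 a) N ≡ false → (q^ 2 ⊛ sub 2 b) N ≡ false → (q^ 3 ⊛ sub 2 c) N ≡ false →
    lambert a b c N ≡ false
  lambert-even N ea eb ec = trans (⊕-at _ _ N) (cong₂ _xor_ (trans (⊕-at _ _ N) (cong₂ _xor_ ea eb)) ec)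

  sub-1-even : ∀ g n → (∀ t → n ≡ t * 2 → g t ≡ false) → sub 1 g n ≡ false
  sub-1-even g n h with n % 2 | n / 2 | m≡m%n+[m/n]*n n 2 | m%n<n n 2
  ... | zero        | t | eq | _ = trans (cong (sub 1 g) eq) (trans (sub-at-* 1 g t) (h t eq))
  ... | suc zero    | t | eq | _ = trans (cong (sub 1 g) eq) (sub-at-< 1 g t (s≤s z≤n))
  ... | suc (suc _) | _ | _  | s≤s (s≤s ())

  private
    ring₃ : ∀ t → 12 * (t * 2) + 1 ≡ 24 * t + 1
    ring₃ = solve-∀
    ring₁₄ : ∀ x → ℤ.- (+ 8 ℤ.+ + 9 ℤ.* x) ≡ + 1 ℤ.+ + 9 ℤ.* (ℤ.- (+ 1 ℤ.+ x))
    ring₁₄ = ℤ-Ring.solve-∀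
    ring₁₅ : ∀ n → 3 * (n * 4) + 1 ≡ 12 * n + 1
    ring₁₅ = solve-∀
    ring₁₉ : ∀ x → 3 * (1 + x * 3) + 1 ≡ 9 * x + 4
    ring₁₉ = solve-∀
    ring₂₀ : ∀ x → 3 * (2 + x * 3) + 1 ≡ 9 * x + 7
    ring₂₀ = solve-∀
    ring₂₁ : ∀ x → 3 * (3 + x * 3) + 1 ≡ 9 * x + 10
    ring₂₁ = solve-∀

  module _ {n p : ℕ} (p-prime : Prime p) (p≡±1 : p % 9 ≡ 1 ⊎ p % 9 ≡ 8)
    (p∣ : p ℕ.∣ 12 * n + 1) (p²∤ : ¬ p * p ℕ.∣ 12 * n + 1) where

    private
      -- In the class 8 the integer -p is 1 modulo 9. The factorisations behind `J` are over the
      -- integers, so a negative `P` is as good.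
      signed : p % 9 ≡ 1 ⊎ p % 9 ≡ 8 → Σ[ P ∈ ℤ ] Σ[ c ∈ ℤ ] (P ≡ + 1 ℤ.+ + 9 ℤ.* c × ∣ P ∣ ≡ p)
      signed (inj₁ r) = + p , + (p / 9) , trans (cong +_ (trans (m≡m%n+[m/n]*n p 9) (cong₂ _+_ r (*-comm (p / 9) 9))))
                       (cong (λ y → + 1 ℤ.+ y) (ℤ.pos-* 9 (p / 9))) , refl
      signed (inj₂ r) = ℤ.- + p , ℤ.- (+ 1 ℤ.+ + (p / 9)) , trans (cong (λ x → ℤ.- + x) (trans (m≡m%n+[m/n]*n p 9) (cong₂ _+_ r (*-comm (p / 9) 9))))
                       (trans (cong (λ y → ℤ.- (+ 8 ℤ.+ y)) (ℤ.pos-* 9 (p / 9))) (ring₁₄ (+ (p / 9)))) , ℤ.∣-i∣≡∣i∣ (+ p)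

      term-even : ∀ u′ b′ a → Reciprocal.k u′ b′ ≡ 9 →
        (∀ x → a + x * 3 ≡ n * 4 → Reciprocal.k u′ b′ * x + suc b′ * suc u′ ≡ 12 * n + 1) →
        (q^ a ⊛ sub 2 (Reciprocal.J u′ b′)) (n * 4) ≡ false
      term-even u′ b′ a k≡9 M≡ with q^-sub-2-at a (Reciprocal.J u′ b′) (n * 4) | signed p≡±1
      ... | inj₁ e           | _ = e
      ... | inj₂ (x , N≡ , e) | P , c , P≡ , ∣P∣≡p = trans e (EvenCoefficients.J-even u′ b′ x P c
            (trans P≡ (cong (λ k → + 1 ℤ.+ + k ℤ.* c) (sym k≡9))) (subst Prime (sym ∣P∣≡p) p-prime)
            (subst₂ ℕ._∣_ (sym ∣P∣≡p) (sym (M≡ x N≡)) p∣)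
            (λ d → p²∤ (subst₂ ℕ._∣_ (cong₂ _*_ ∣P∣≡p ∣P∣≡p) (M≡ x N≡) d)))

      n*4 : ∀ a c x → a + x * 3 ≡ n * 4 → 3 * (a + x * 3) + 1 ≡ c → c ≡ 12 * n + 1
      n*4 a c x e refl = trans (cong (λ y → 3 * y + 1) e) (ring₁₅ n)

      -- The series f(q²) meets n = 2t only if 12n + 1 = 24t + 1 is a square, which a prime dividing
      -- it exactly once forbids.
      f-even : ∀ t → n ≡ t * 2 → f t ≡ false
      f-even t eq = ¬-not λ ft → let x , sq = f-support t ft in square-free x sq
        where
        square-free : ∀ x → 24 * t + 1 ≡ x * x → ⊥
        square-free x sq = p²∤ (subst (p * p ℕ.∣_) (sym n≡) (ℕ.*-pres-∣ p∣x p∣x))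
          where
          n≡ : 12 * n + 1 ≡ x * x
          n≡ = trans (cong (λ n → 12 * n + 1) eq) (trans (ring₃ t) sq)
          p∣x : p ℕ.∣ x
          p∣x = reduce (euclidsLemma x x p-prime (subst (p ℕ.∣_) n≡ p∣))

    b₉-even : odd (Defs.b 9 (4 * n)) ≡ false
    b₉-even = trans (cong (λ N → odd (Defs.b 9 N)) (*-comm 4 n)) (xor-cancel
      (trans (sym (⊕-at (section 4 (lambert Jα Jβ Jγ)) (section 4 B) n))
        (trans (at (section-lambert Jα Jβ Jγ B (Reciprocal.reciprocal 0 3) (Reciprocal.reciprocal 6 0) (Reciprocal.reciprocal 4 1)
          (≈-trans (RegularPartitions.b-series-f 8) (sub8≈sub2∘sub2 f))) n) (sub-1-even f n f-even)))
      (lambert-even {Jα} {Jβ} {Jγ} (n * 4)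
        (term-even 0 3 1 refl λ x e → n*4 1 (9 * x + 4) x e (ring₁₉ x))
        (term-even 6 0 2 refl λ x e → n*4 2 (9 * x + 7) x e (ring₂₀ x))
        (term-even 4 1 3 refl λ x e → n*4 3 (9 * x + 10) x e (ring₂₁ x))))
      where
      Jα Jβ Jγ B : F₂⟦q⟧
      Jα = Reciprocal.J 0 3
      Jβ = Reciprocal.J 6 0
      Jγ = Reciprocal.J 4 1
      B  = RegularPartitions.b-series 8
      xor-cancel : ∀ {x y} → x xor y ≡ false → x ≡ false → y ≡ false
      xor-cancel h refl = h

-- The cubic norm form modulo a prime

module Cubic where

  open import Data.Empty using (⊥-elim)
  open import Data.Integer.Base using (ℤ; +_; _+_; _*_; _-_; -_) renaming (∣_∣ to abs)
  import Data.Integer.Properties as ℤ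
  open import Data.Integer.Divisibility.Signed
  open import Data.Integer.Tactic.RingSolver using (solve-∀)
  open import Data.Nat.Base as ℕ using (ℕ)
  import Data.Nat.Coprimality as ℕ
  import Data.Nat.Divisibility as ℕ
  open import Data.Nat.GCD using (module Bézout)
  open import Data.Nat.Primality using (Prime; euclidsLemma; prime⇒irreducible)
  open import Data.Product.Base using (_×_; _,_; proj₁; proj₂; ∃-syntax)
  open import Data.Sum.Base using (_⊎_; inj₁; inj₂; reduce)
  open import Relation.Binary.PropositionalEquality hiding (J)
  open import Relation.Nullary using (¬_; yes; no; contradiction)

  -- The norm of x + yρ + zρ², where ρ = 2 + ζ + ζ⁻¹ for a primitive ninth root of unity ζ is a root of g;
  -- this ρ is totally positive, which makes all coefficients of the norm form positive.

  opaque
    g : ℤ → ℤ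
    g t = t * t * t - + 6 * t * t + + 9 * t - + 1

    norm : ℤ → ℤ → ℤ → ℤ
    norm x y z = x * x * x + + 6 * x * x * y + + 18 * x * x * z + + 9 * x * y * y + + 51 * x * y * z
      + + 69 * x * z * z + y * y * y + + 6 * y * y * z + + 9 * y * z * z + z * z * z

    evaluate : ℤ → ℤ → ℤ → ℤ → ℤ
    evaluate x y z r = x + y * r + z * (r * r)

    g-≡ : ∀ t → g t ≡ t * t * t - + 6 * t * t + + 9 * t - + 1
    g-≡ t = refl

    norm-≡ : ∀ x y z → norm x y z ≡ x * x * x + + 6 * x * x * y + + 18 * x * x * z + + 9 * x * y * y + + 51 * x * y * z
      + + 69 * x * z * z + y * y * y + + 6 * y * y * z + + 9 * y * z * z + z * z * z
    norm-≡ x y z = refl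

    evaluate-≡ : ∀ x y z r → evaluate x y z r ≡ x + y * r + z * (r * r)
    evaluate-≡ x y z r = refl

  ∣-cong : ∀ {d a b} → a ≡ b → d ∣ a → d ∣ b
  ∣-cong refl d∣a = d∣a

  private
    ring₁ : ∀ a b → a - b + b ≡ a
    ring₁ = solve-∀
    ring₂ : ∀ a b → a - (a - b) ≡ b
    ring₂ = solve-∀
    ring₃ : ∀ w a → w * (- a) ≡ a * (- w)
    ring₃ = solve-∀
    ring₄ : ∀ x y z → x * (x * x) ≡ (x * x * x + + 6 * x * x * y + + 18 * x * x * z + + 9 * x * y * y + + 51 * x * y * z + + 69 * x * z * z + y * y * y + + 6 * y * y * z + + 9 * y * z * z + z * z * z) * + 1 + y * (- (+ 6 * x * x + + 9 * x * y + + 51 * x * z + y * y + + 6 * y * z + + 9 * z * z)) + z * (- (+ 18 * x * x + + 69 * x * z + z * z))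
    ring₄ = solve-∀
    ring₅ : ∀ x y z w → y * (y * (y * ((- (x * w)) * (- (x * w)) * (- (x * w)) - + 6 * (- (x * w)) * (- (x * w)) + + 9 * (- (x * w)) - + 1))) ≡ (x * x * x + + 6 * x * x * y + + 18 * x * x * z + + 9 * x * y * y + + 51 * x * y * z + + 69 * x * z * z + y * y * y + + 6 * y * y * z + + 9 * y * z * z + z * z * z) * (- + 1) + z * (+ 18 * x * x + + 51 * x * y + + 69 * x * z + + 6 * y * y + + 9 * y * z + z * z) + (y * w - + 1) * (- (x * x * x) * (y * w * (y * w) + y * w + + 1) - + 6 * x * x * y * (y * w + + 1) - + 9 * x * y * y)
    ring₅ = solve-∀
    ring₆ : ∀ x y z r → let α = + 9 * z * z - x * z + + 6 * y * z + y * y ; β = - (z * z) + + 6 * x * z + x * y in α * (α * (x + y * r + z * (r * r))) ≡ (x * x * x + + 6 * x * x * y + + 18 * x * x * z + + 9 * x * y * y + + 51 * x * y * z + + 69 * x * z * z + y * y * y + + 6 * y * y * z + + 9 * y * z * z + z * z * z) * (z * z) + (α * r + β) * (y * α + z * (α * r - β))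
    ring₆ = solve-∀
    ring₇ : ∀ x y z → let α = + 9 * z * z - x * z + + 6 * y * z + y * y ; β = - (z * z) + + 6 * x * z + x * y in z * (β * β) ≡ (x * x * x + + 6 * x * x * y + + 18 * x * x * z + + 9 * x * y * y + + 51 * x * y * z + + 69 * x * z * z + y * y * y + + 6 * y * y * z + + 9 * y * z * z + z * z * z) * (z * z) + α * (y * β - α * x)
    ring₇ = solve-∀
    ring₈ : ∀ x y z r → z * (z * (r * r * r - + 6 * r * r + + 9 * r - + 1)) ≡ (x + y * r + z * (r * r)) * (z * r - (+ 6 * z + y)) + ((+ 9 * z * z - x * z + + 6 * y * z + y * y) * r + (- (z * z) + + 6 * x * z + x * y))
    ring₈ = solve-∀
    ring₉ : ∀ r → let s = (r - + 2) * (r - + 2) in r * s + (r + s) * (+ 6 - r - s) - + 9 ≡ (r * r * r - + 6 * r * r + + 9 * r - + 1) * (+ 1 - r)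
    ring₉ = solve-∀
    ring₁₀ : ∀ r → let s = (r - + 2) * (r - + 2) in r * s * (+ 6 - r - s) - + 1 ≡ (r * r * r - + 6 * r * r + + 9 * r - + 1) * (+ 1 + r - r * r)
    ring₁₀ = solve-∀
    ring₁₁ : ∀ x y z r s → let t = + 6 - r - s ; e₂ = r * s + (r + s) * t ; e₃ = r * s * t in (x + y * r + z * (r * r)) * ((x + y * s + z * (s * s)) * (x + y * t + z * (t * t))) - (x * x * x + + 6 * x * x * y + + 18 * x * x * z + + 9 * x * y * y + + 51 * x * y * z + + 69 * x * z * z + y * y * y + + 6 * y * y * z + + 9 * y * z * z + z * z * z) ≡ (e₂ - + 9) * (x * y * y - + 2 * x * x * z + + 6 * x * y * z + x * z * z * (e₂ + + 9) + y * z * z * e₃) + (e₃ - + 1) * (y * y * y - + 3 * x * y * z - + 12 * x * z * z + + 6 * y * y * z + + 9 * y * z * z + z * z * z * (e₃ + + 1))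
    ring₁₁ = solve-∀
    ring₁₂ : ∀ y q → + 1 + y * q - + 1 ≡ y * q
    ring₁₂ = solve-∀
    ring₁₃ : ∀ x a → (- x) * a - + 1 ≡ - (+ 1 + x * a)
    ring₁₃ = solve-∀
    ring₁₄ : ∀ a w b → a * (- (b * w)) + b ≡ (a * w - + 1) * (- b)
    ring₁₄ = solve-∀
    ring₁₅ : ∀ a w b → a * (b * w) - b ≡ (a * w - + 1) * b
    ring₁₅ = solve-∀
    ring₁₆ : ∀ a u b → a * u + b ≡ a * u + b * + 1
    ring₁₆ = solve-∀

  module ModPrime {p : ℕ} (p-prime : Prime p) where

    q : ℤ
    q = + p

    euclid : ∀ a b → q ∣ a * b → q ∣ a ⊎ q ∣ b
    euclid a b d with euclidsLemma (abs a) (abs b) p-prime (subst (p ℕ.∣_) (ℤ.abs-* a b) (∣⇒∣ᵤ d))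
    ... | inj₁ h = inj₁ (∣ᵤ⇒∣ h)
    ... | inj₂ h = inj₂ (∣ᵤ⇒∣ h)

    euclid-∤ : ∀ a b → ¬ q ∣ a → q ∣ a * b → q ∣ b
    euclid-∤ a b ∤a d with euclid a b d
    ... | inj₁ h = contradiction h ∤a
    ... | inj₂ h = h

    euclid² : ∀ a → q ∣ a * a → q ∣ a
    euclid² a d = reduce (euclid a a d)

    inverse : ∀ a → ¬ q ∣ a → ∃[ a′ ] q ∣ a * a′ - + 1
    inverse a ∤a with ℕ.coprime-Bézout coprime
      where
      coprime : ℕ.Coprime (abs a) p
      coprime {d} (d∣a , d∣p) with prime⇒irreducible p-prime d∣p
      ... | inj₁ d≡1  = d≡1
      ... | inj₂ refl = contradiction (∣ᵤ⇒∣ {q} {a} d∣a) ∤a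
    ... | Bézout.+- x y eq = signed (+ x) (divides (+ y) (trans (cong (λ w → w - + 1) (trans (sym (ℤ.pos-* x (abs a))) (trans (cong +_ (sym eq)) (cong (λ w → + 1 + w) (ℤ.pos-* y p))))) (ring₁₂ (+ y) q)))
      where
      signed : ∀ w → q ∣ w * + abs a - + 1 → ∃[ a′ ] q ∣ a * a′ - + 1
      signed w h with ℤ.+∣i∣≡i⊎+∣i∣≡-i a
      ... | inj₁ e = w , ∣-cong (cong (λ y → y - + 1) (trans (cong (w *_) e) (ℤ.*-comm w a))) h
      ... | inj₂ e = - w , ∣-cong (cong (λ y → y - + 1) (trans (cong (w *_) e) (ring₃ w a))) h
    ... | Bézout.-+ x y eq = signed (- + x) (divides (- + y) (trans (ring₁₃ (+ x) (+ abs a)) (trans (cong -_ (trans (cong (λ w → + 1 + w) (sym (ℤ.pos-* x (abs a)))) (trans (cong +_ eq) (ℤ.pos-* y p)))) (ℤ.neg-distribˡ-* (+ y) q))))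
      where
      signed : ∀ w → q ∣ w * + abs a - + 1 → ∃[ a′ ] q ∣ a * a′ - + 1
      signed w h with ℤ.+∣i∣≡i⊎+∣i∣≡-i a
      ... | inj₁ e = w , ∣-cong (cong (λ y → y - + 1) (trans (cong (w *_) e) (ℤ.*-comm w a))) h
      ... | inj₂ e = - w , ∣-cong (cong (λ y → y - + 1) (trans (cong (w *_) e) (ring₃ w a))) h

    dvd₁ : ∀ a u n → n ≡ a * u → q ∣ a → q ∣ n
    dvd₁ a u _ refl d = ∣m⇒∣m*n u d

    dvd₂ : ∀ a u b v n → n ≡ a * u + b * v → q ∣ a → q ∣ b → q ∣ n
    dvd₂ a u b v _ refl d e = ∣m∣n⇒∣m+n (∣m⇒∣m*n u d) (∣m⇒∣m*n v e)

    dvd₃ : ∀ a u b v c w n → n ≡ a * u + b * v + c * w → q ∣ a → q ∣ b → q ∣ c → q ∣ n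
    dvd₃ a u b v c w _ refl d e f = ∣m∣n⇒∣m+n (∣m∣n⇒∣m+n (∣m⇒∣m*n u d) (∣m⇒∣m*n v e)) (∣m⇒∣m*n w f)

    private
      norm-y,z≡0 : ∀ x y z N → N ≡ (x * x * x + + 6 * x * x * y + + 18 * x * x * z + + 9 * x * y * y + + 51 * x * y * z + + 69 * x * z * z + y * y * y + + 6 * y * y * z + + 9 * y * z * z + z * z * z) →
        x * (x * x) ≡ N * + 1 + y * (- (+ 6 * x * x + + 9 * x * y + + 51 * x * z + y * y + + 6 * y * z + + 9 * z * z))
          + z * (- (+ 18 * x * x + + 69 * x * z + z * z))
      norm-y,z≡0 x y z _ refl = ring₄ x y z

      norm-z≡0 : ∀ x y z w t N G → t ≡ - (x * w) → N ≡ (x * x * x + + 6 * x * x * y + + 18 * x * x * z + + 9 * x * y * y + + 51 * x * y * z + + 69 * x * z * z + y * y * y + + 6 * y * y * z + + 9 * y * z * z + z * z * z) → G ≡ (t * t * t - + 6 * t * t + + 9 * t - + 1) → y * (y * (y * G)) ≡ N * (- + 1)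
        + z * (+ 18 * x * x + + 51 * x * y + + 69 * x * z + + 6 * y * y + + 9 * y * z + z * z)
        + (y * w - + 1) * (- (x * x * x) * (y * w * (y * w) + y * w + + 1) - + 6 * x * x * y * (y * w + + 1) - + 9 * x * y * y)
      norm-z≡0 x y z w _ _ _ refl refl refl = ring₅ x y z w

      resultant : ∀ x y z r α β N E → α ≡ + 9 * z * z - x * z + + 6 * y * z + y * y → β ≡ - (z * z) + + 6 * x * z + x * y → N ≡ (x * x * x + + 6 * x * x * y + + 18 * x * x * z + + 9 * x * y * y + + 51 * x * y * z + + 69 * x * z * z + y * y * y + + 6 * y * y * z + + 9 * y * z * z + z * z * z) →
        E ≡ x + y * r + z * (r * r) → α * (α * E) ≡ N * (z * z) + (α * r + β) * (y * α + z * (α * r - β))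
      resultant x y z r _ _ _ _ refl refl refl refl = ring₆ x y z r

      resultant₀ : ∀ x y z α β N → α ≡ + 9 * z * z - x * z + + 6 * y * z + y * y → β ≡ - (z * z) + + 6 * x * z + x * y → N ≡ (x * x * x + + 6 * x * x * y + + 18 * x * x * z + + 9 * x * y * y + + 51 * x * y * z + + 69 * x * z * z + y * y * y + + 6 * y * y * z + + 9 * y * z * z + z * z * z) →
        z * (β * β) ≡ N * (z * z) + α * (y * β - α * x)
      resultant₀ x y z _ _ _ refl refl refl = ring₇ x y z

      remainder : ∀ x y z r α β G E l → α ≡ + 9 * z * z - x * z + + 6 * y * z + y * y → β ≡ - (z * z) + + 6 * x * z + x * y →
        G ≡ (r * r * r - + 6 * r * r + + 9 * r - + 1) → E ≡ x + y * r + z * (r * r) → l ≡ z * r - (+ 6 * z + y) → z * (z * G) ≡ E * l + (α * r + β)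
      remainder x y z r _ _ _ _ _ refl refl refl refl refl = ring₈ x y z r

    -- z² g = v·(zt - (6z + y)) + (αt + β) for v = x + yt + zt², and the resultant of v and αt + β is z² norm v.
    norm-root : ∀ x y z → q ∣ norm x y z → ¬ (q ∣ x × q ∣ y × q ∣ z) → ∃[ r ] q ∣ g r
    norm-root x y z d ∤v with q ∣? z | q ∣? y
    ... | yes q∣z | yes q∣y = ⊥-elim (∤v (q∣x , q∣y , q∣z))
      where
      q∣x : q ∣ x
      q∣x with euclid x (x * x) (dvd₃ (norm x y z) _ y _ z _ _ (norm-y,z≡0 x y z _ (norm-≡ x y z)) d q∣y q∣z)
      ... | inj₁ h = h
      ... | inj₂ h = euclid² x h
    -- With z = 0 modulo p the polynomial v is linear, and its zero -x/y is the root.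
    ... | yes q∣z | no q∤y = t , euclid-∤ y _ q∤y (euclid-∤ y _ q∤y (euclid-∤ y _ q∤y
        (dvd₃ (norm x y z) _ z _ (y * y′ - + 1) _ _ (norm-z≡0 x y z y′ t _ (g t) refl (norm-≡ x y z) (g-≡ t)) d q∣z (proj₂ (inverse y q∤y)))))
      where
      y′ t : ℤ
      y′ = proj₁ (inverse y q∤y)
      t = - (x * y′)
    ... | no q∤z | _ = go (+ 9 * z * z - x * z + + 6 * y * z + y * y) (- (z * z) + + 6 * x * z + x * y) refl refl
      where
      go : ∀ α β → α ≡ + 9 * z * z - x * z + + 6 * y * z + y * y → β ≡ - (z * z) + + 6 * x * z + x * y → ∃[ r ] q ∣ g r
      go α β α≡ β≡ with q ∣? α
      -- The zero -β/α of the remainder is a zero of v by the resultant, hence one of `g`.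
      ... | no q∤α = root (- (β * α′)) (dvd₁ (α * α′ - + 1) (- β) _ (ring₁₄ α α′ β) (proj₂ (inverse α q∤α)))
        where
        α′ = proj₁ (inverse α q∤α)
        root : ∀ r → q ∣ α * r + β → ∃[ r ] q ∣ g r
        root r lin = r , euclid-∤ z _ q∤z (euclid-∤ z _ q∤z
          (dvd₂ (evaluate x y z r) (z * r - (+ 6 * z + y)) (α * r + β) (+ 1) _
            (trans (remainder x y z r α β (g r) (evaluate x y z r) (z * r - (+ 6 * z + y)) α≡ β≡ (g-≡ r) (evaluate-≡ x y z r) refl)
              (ring₁₆ (evaluate x y z r) (z * r - (+ 6 * z + y)) (α * r + β)))
            (euclid-∤ α _ q∤α (euclid-∤ α _ q∤α (dvd₂ (norm x y z) (z * z) (α * r + β) (y * α + z * (α * r - β)) _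
              (resultant x y z r α β (norm x y z) (evaluate x y z r) α≡ β≡ (norm-≡ x y z) (evaluate-≡ x y z r)) d lin))) lin))
      -- If α vanishes, so does β; then v divides z² g, and the cofactor z t - (6z + y) supplies the
      -- root.
      ... | yes q∣α = root ((+ 6 * z + y) * z′) (dvd₁ (z * z′ - + 1) (+ 6 * z + y) _ (ring₁₅ z z′ (+ 6 * z + y)) (proj₂ (inverse z q∤z)))
        where
        z′ = proj₁ (inverse z q∤z)
        q∣β : q ∣ β
        q∣β = euclid² β (euclid-∤ z _ q∤z (dvd₂ (norm x y z) (z * z) α (y * β - α * x) _
          (resultant₀ x y z α β (norm x y z) α≡ β≡ (norm-≡ x y z)) d q∣α))
        root : ∀ r → q ∣ z * r - (+ 6 * z + y) → ∃[ r ] q ∣ g r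
        root r lin = r , euclid-∤ z _ q∤z (euclid-∤ z _ q∤z
          (∣-cong (sym (remainder x y z r α β (g r) (evaluate x y z r) (z * r - (+ 6 * z + y)) α≡ β≡ (g-≡ r) (evaluate-≡ x y z r) refl))
            (∣m∣n⇒∣m+n (∣n⇒∣m*n (evaluate x y z r) lin) (∣m∣n⇒∣m+n (∣m⇒∣m*n r q∣α) q∣β))))

    private
      e₂-9 : ∀ r s t G → s ≡ (r - + 2) * (r - + 2) → t ≡ + 6 - r - s → G ≡ (r * r * r - + 6 * r * r + + 9 * r - + 1) → r * s + (r + s) * t - + 9 ≡ G * (+ 1 - r)
      e₂-9 r _ _ _ refl refl refl = ring₉ r

      e₃-1 : ∀ r s t G → s ≡ (r - + 2) * (r - + 2) → t ≡ + 6 - r - s → G ≡ (r * r * r - + 6 * r * r + + 9 * r - + 1) → r * s * t - + 1 ≡ G * (+ 1 + r - r * r)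
      e₃-1 r _ _ _ refl refl refl = ring₁₀ r

      norm-product : ∀ x y z r s t N E E₁ E₂ e₂ e₃ → t ≡ + 6 - r - s → N ≡ (x * x * x + + 6 * x * x * y + + 18 * x * x * z + + 9 * x * y * y + + 51 * x * y * z + + 69 * x * z * z + y * y * y + + 6 * y * y * z + + 9 * y * z * z + z * z * z) → E ≡ x + y * r + z * (r * r) → E₁ ≡ x + y * s + z * (s * s) →
        E₂ ≡ x + y * t + z * (t * t) → e₂ ≡ r * s + (r + s) * t → e₃ ≡ r * s * t →
        E * (E₁ * E₂) - N ≡ (e₂ - + 9) * (x * y * y - + 2 * x * x * z + + 6 * x * y * z + x * z * z * (e₂ + + 9) + y * z * z * e₃)
            + (e₃ - + 1) * (y * y * y - + 3 * x * y * z - + 12 * x * z * z + + 6 * y * y * z + + 9 * y * z * z + z * z * z * (e₃ + + 1))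
      norm-product x y z r s _ _ _ _ _ _ _ refl refl refl refl refl refl refl = ring₁₁ x y z r s

    -- Here r - 2 plays the part of ζ + ζ⁻¹, whose square is 2 + ζ² + ζ⁻²: the root belonging to ζ².
    -- The third root is found from the sum 6 of the roots.
    conjugate : ℤ → ℤ
    conjugate r = (r - + 2) * (r - + 2)

    module _ (r : ℤ) (q∣g : q ∣ g r) where

      -- The three roots have elementary symmetric functions 6, 9 and 1, the latter two only modulo
      -- g(r) and so modulo p. The norm is the product over the roots, written in these functions.
      norm-splits : ∀ x y z → q ∣ evaluate x y z r * (evaluate x y z (conjugate r) * evaluate x y z (+ 6 - r - conjugate r)) - norm x y z
      norm-splits x y z = go (conjugate r) (+ 6 - r - conjugate r) _ _ refl refl refl refl
        where
        go : ∀ s t e₂ e₃ → s ≡ (r - + 2) * (r - + 2) → t ≡ + 6 - r - s → e₂ ≡ r * s + (r + s) * t → e₃ ≡ r * s * t →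
          q ∣ evaluate x y z r * (evaluate x y z s * evaluate x y z t) - norm x y z
        go s t e₂ e₃ s≡ t≡ e₂≡ e₃≡ = dvd₂ (e₂ - + 9) _ (e₃ - + 1) _ _
          (norm-product x y z r s t (norm x y z) (evaluate x y z r) (evaluate x y z s) (evaluate x y z t) e₂ e₃ t≡
            (norm-≡ x y z) (evaluate-≡ x y z r) (evaluate-≡ x y z s) (evaluate-≡ x y z t) e₂≡ e₃≡)
          (dvd₁ (g r) (+ 1 - r) _ (trans (cong (λ e → e - + 9) e₂≡) (e₂-9 r s t (g r) s≡ t≡ (g-≡ r))) q∣g)
          (dvd₁ (g r) (+ 1 + r - r * r) _ (trans (cong (λ e → e - + 1) e₃≡) (e₃-1 r s t (g r) s≡ t≡ (g-≡ r))) q∣g)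

      Conjugate : ℤ → Set
      Conjugate s = s ≡ r ⊎ s ≡ conjugate r ⊎ s ≡ + 6 - r - conjugate r

      norm-zero : ∀ x y z → q ∣ norm x y z →
        q ∣ evaluate x y z r ⊎ q ∣ evaluate x y z (conjugate r) ⊎ q ∣ evaluate x y z (+ 6 - r - conjugate r)
      norm-zero x y z d = go _ _ _ (norm x y z) (norm-splits x y z) d
        where
        go : ∀ a b c n → q ∣ a * (b * c) - n → q ∣ n → q ∣ a ⊎ q ∣ b ⊎ q ∣ c
        go a b c n h d with euclid a (b * c) (∣-cong (ring₁ (a * (b * c)) n) (∣m∣n⇒∣m+n h d))
        ... | inj₁ h = inj₁ h
        ... | inj₂ h = inj₂ (euclid b c h)

      evaluate-zero : ∀ x y z s → Conjugate s → q ∣ evaluate x y z s → q ∣ norm x y z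
      evaluate-zero x y z s c d = go (evaluate x y z r) (evaluate x y z (conjugate r)) (evaluate x y z (+ 6 - r - conjugate r)) (norm x y z)
          (norm-splits x y z) (split c)
        where
        split : Conjugate s → q ∣ evaluate x y z r ⊎ q ∣ evaluate x y z (conjugate r) ⊎ q ∣ evaluate x y z (+ 6 - r - conjugate r)
        split (inj₁ refl)        = inj₁ d
        split (inj₂ (inj₁ refl)) = inj₂ (inj₁ d)
        split (inj₂ (inj₂ refl)) = inj₂ (inj₂ d)
        go : ∀ a b c n → q ∣ a * (b * c) - n → q ∣ a ⊎ q ∣ b ⊎ q ∣ c → q ∣ n
        go a b c n h d = ∣-cong (ring₂ (a * (b * c)) n) (∣m∣n⇒∣m-n (product d) h)
          where
          product : q ∣ a ⊎ q ∣ b ⊎ q ∣ c → q ∣ a * (b * c)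
          product (inj₁ d)        = ∣m⇒∣m*n (b * c) d
          product (inj₂ (inj₁ d)) = ∣n⇒∣m*n a (∣m⇒∣m*n c d)
          product (inj₂ (inj₂ d)) = ∣n⇒∣m*n a (∣n⇒∣m*n b d)

-- Primes at which the cubic has a root are ±1 modulo 9

module Residue where

  open Cubic
  open import Data.Empty using (⊥; ⊥-elim)
  open import Data.Integer.Base using (ℤ; +_; 0ℤ; _+_; _*_; _-_; -_; _^_) renaming (∣_∣ to abs)
  import Data.Integer.Properties as ℤ
  import Data.Integer.DivMod as ℤ
  open import Data.Integer.Divisibility.Signed
  open import Data.Integer.Tactic.RingSolver using (solve-∀)
  open import Data.Nat.Base as ℕ using (ℕ; zero; suc; z≤n; s≤s; NonZero)
  open import Data.Nat.DivMod using (_%_; _/_; m≡m%n+[m/n]*n; m%n<n)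
  import Data.Nat.Divisibility as ℕ
  open import Data.Nat.Primality using (Prime; euclidsLemma; prime⇒irreducible; prime⇒nonZero; ¬prime[1]; ¬prime[0]; prime[2])
  import Data.Nat.Properties as ℕ
  import Data.Nat.Tactic.RingSolver as ℕ-Ring
  open import Data.Product.Base using (_×_; _,_; ∃-syntax)
  open import Data.Sum.Base using (_⊎_; inj₁; inj₂)
  open import Relation.Binary.PropositionalEquality hiding (J)
  open import Relation.Nullary using (¬_; contradiction)

  binomial : ℕ → ℕ → ℕ
  binomial n       zero    = 1
  binomial zero    (suc k) = 0
  binomial (suc n) (suc k) = binomial n k ℕ.+ binomial n (suc k)

  binomial-> : ∀ n k → binomial n (suc (n ℕ.+ k)) ≡ 0
  binomial-> zero    k = refl
  binomial-> (suc n) k = cong₂ ℕ._+_ (binomial-> n k) (trans (cong (λ m → binomial n (suc m)) (sym (ℕ.+-suc n k))) (binomial-> n (suc k)))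

  private
    ring₁₈ : ∀ k a c → (2 ℕ.+ k) ℕ.* (a ℕ.+ c) ≡ a ℕ.+ (1 ℕ.+ k) ℕ.* a ℕ.+ (2 ℕ.+ k) ℕ.* c
    ring₁₈ = ℕ-Ring.solve-∀
    ring₁₉ : ∀ n a b → a ℕ.+ b ℕ.+ (1 ℕ.+ n) ℕ.* a ℕ.+ (1 ℕ.+ n) ℕ.* b ≡ (2 ℕ.+ n) ℕ.* (a ℕ.+ b)
    ring₁₉ = ℕ-Ring.solve-∀

  -- With n + 1 = p this yields the divisibility of the inner binomial coefficients by p through
  -- Euclid's lemma, without factorials.
  binomial-absorb : ∀ n k → suc k ℕ.* binomial (suc n) (suc k) ≡ suc n ℕ.* binomial n k
  binomial-absorb zero    zero    = refl
  binomial-absorb zero    (suc k) = ℕ.*-zeroʳ k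
  binomial-absorb (suc n) zero    = trans (ℕ.*-identityˡ _) (trans (cong suc (trans (sym (ℕ.*-identityˡ _)) (trans (binomial-absorb n zero) (ℕ.*-identityʳ (suc n))))) (sym (ℕ.*-identityʳ (2 ℕ.+ n))))
  binomial-absorb (suc n) (suc k) = begin
    (2 ℕ.+ k) ℕ.* (a ℕ.+ c)              ≡⟨ ring₁₈ k a c ⟩
    a ℕ.+ suc k ℕ.* a ℕ.+ (2 ℕ.+ k) ℕ.* c ≡⟨ cong₂ (λ x y → a ℕ.+ x ℕ.+ y) (binomial-absorb n k) (binomial-absorb n (suc k)) ⟩
    a ℕ.+ suc n ℕ.* binomial n k ℕ.+ suc n ℕ.* binomial n (suc k) ≡⟨ ring₁₉ n (binomial n k) (binomial n (suc k)) ⟩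
    (2 ℕ.+ n) ℕ.* a ∎
    where
    open ≡-Reasoning
    a = binomial (suc n) (suc k)
    c = binomial (suc n) (2 ℕ.+ k)

  Σ≤ : ℕ → (ℕ → ℤ) → ℤ
  Σ≤ zero    F = F 0
  Σ≤ (suc n) F = Σ≤ n F + F (suc n)

  Σ≤-unfoldˡ : ∀ n F → Σ≤ (suc n) F ≡ F 0 + Σ≤ n (λ k → F (suc k))
  Σ≤-unfoldˡ zero    F = refl
  Σ≤-unfoldˡ (suc n) F = trans (cong (λ y → y + F (2 ℕ.+ n)) (Σ≤-unfoldˡ n F)) (ℤ.+-assoc (F 0) _ _)

  private
    ring₂₀ : ∀ a b c d → a + b + (c + d) ≡ a + c + (b + d)
    ring₂₀ = solve-∀

  Σ≤-+ : ∀ n F G → Σ≤ n (λ k → F k + G k) ≡ Σ≤ n F + Σ≤ n G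
  Σ≤-+ zero    F G = refl
  Σ≤-+ (suc n) F G = trans (cong (λ y → y + (F (suc n) + G (suc n))) (Σ≤-+ n F G)) (ring₂₀ (Σ≤ n F) (Σ≤ n G) (F (suc n)) (G (suc n)))

  Σ≤-cong : ∀ n {F G} → (∀ k → F k ≡ G k) → Σ≤ n F ≡ Σ≤ n G
  Σ≤-cong zero    e = e 0
  Σ≤-cong (suc n) e = cong₂ _+_ (Σ≤-cong n e) (e (suc n))

  -- binomial-sum n U is the value at U of the n-th power of 1 + (the shift operator)
  binomial-sum : ℕ → (ℕ → ℤ) → ℤ
  binomial-sum zero    U = U 0
  binomial-sum (suc n) U = binomial-sum n U + binomial-sum n (λ k → U (suc k))

  private
    ring₂₁ : ∀ a b c → a + (b + c) ≡ a + c + b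
    ring₂₁ = solve-∀

  binomial-sum-≡ : ∀ n U → binomial-sum n U ≡ Σ≤ n (λ k → + binomial n k * U k)
  binomial-sum-≡ zero    U = sym (ℤ.*-identityˡ (U 0))
  binomial-sum-≡ (suc n) U = sym (begin
    Σ≤ (suc n) (λ k → + binomial (suc n) k * U k)
      ≡⟨ Σ≤-unfoldˡ n _ ⟩
    u₀ + Σ≤ n (λ k → + (binomial n k ℕ.+ binomial n (suc k)) * U (suc k))
      ≡⟨ cong (λ y → u₀ + y) (trans (Σ≤-cong n λ k → ℤ.*-distribʳ-+ (U (suc k)) (+ binomial n k) (+ binomial n (suc k))) (Σ≤-+ n _ _)) ⟩
    u₀ + (Σ≤ n (λ k → + binomial n k * U (suc k)) + Σ≤ n (λ k → + binomial n (suc k) * U (suc k)))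
      ≡⟨ ring₂₁ u₀ _ _ ⟩
    u₀ + Σ≤ n (λ k → + binomial n (suc k) * U (suc k)) + Σ≤ n (λ k → + binomial n k * U (suc k))
      ≡⟨ cong₂ _+_ (sym (Σ≤-unfoldˡ n (λ k → + binomial n k * U k))) (sym (binomial-sum-≡ n (λ k → U (suc k)))) ⟩
    Σ≤ n (λ k → + binomial n k * U k) + + binomial n (suc n) * U (suc n) + binomial-sum n (λ k → U (suc k))
      ≡⟨ cong (λ y → y + binomial-sum n (λ k → U (suc k))) (trans (cong₂ _+_ (sym (binomial-sum-≡ n U)) (cong (λ b → + b * U (suc n)) zero-binomial)) (ℤ.+-identityʳ (binomial-sum n U))) ⟩
    binomial-sum n U + binomial-sum n (λ k → U (suc k)) ∎)
    where
    open ≡-Reasoning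
    u₀ = + 1 * U 0
    zero-binomial : binomial n (suc n) ≡ 0
    zero-binomial = trans (cong (λ m → binomial n (suc m)) (sym (ℕ.+-identityʳ n))) (binomial-> n 0)

  -- The value ζ^n + ζ^(-n) as a polynomial in t = ζ + ζ⁻¹, so that powers of ζ can be handled
  -- inside the integers.
  lucas : ℤ → ℕ → ℤ
  lucas t zero          = + 2
  lucas t (suc zero)    = t
  lucas t (suc (suc n)) = t * lucas t (suc n) - lucas t n

  private
    ring₁ : ∀ m c d → d ℕ.+ c ℕ.+ m ℕ.* 9 ≡ d ℕ.+ (m ℕ.* 9 ℕ.+ c)
    ring₁ = ℕ-Ring.solve-∀
    ring₂ : ∀ m c d → d ℕ.+ c ℕ.+ m ℕ.* 2 ℕ.* 9 ℕ.+ c ≡ d ℕ.+ (m ℕ.* 9 ℕ.+ c) ℕ.* 2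
    ring₂ = ℕ-Ring.solve-∀
    ring₃ : ∀ m c → m ℕ.* 9 ℕ.+ c ℕ.* 3 ≡ (m ℕ.* 3 ℕ.+ c) ℕ.* 3
    ring₃ = ℕ-Ring.solve-∀
    ring₄ : ∀ a b c → + 1 * a + (b + + 1 * c) - (a + c) ≡ b
    ring₄ = solve-∀
    ring₅ : ∀ t → let v₂ = t * t - + 2 ; v₃ = t * v₂ - t ; v₄ = t * v₃ - v₂ ; v₅ = t * v₄ - v₃ ; v₆ = t * v₅ - v₄ ; v₇ = t * v₆ - v₅ in + 6 ≡ (t * t * t - + 3 * t + + 1) * (+ 2 - (- + 2 + t + + 4 * t * t - t * t * t * t) * (t + + 1)) + (+ 2 * t - v₇ - v₂) * (t + + 1)
    ring₅ = solve-∀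
    ring₆ : ∀ t → let v₂ = t * t - + 2 ; v₃ = t * v₂ - t ; v₄ = t * v₃ - v₂ ; v₅ = t * v₄ - v₃ in + 6 * (t - + 1) ≡ (t * t * t - + 3 * t + + 1) * (+ 2 + (+ 2 - t - t * t) * (t - + 2)) + (+ 2 * t - v₅ - v₄) * (+ 2 - t)
    ring₆ = solve-∀
    ring₇ : ∀ t → + 1 ≡ (t * t * t - + 3 * t + + 1) * (- + 1) + (t - + 1) * (t * t + t - + 2)
    ring₇ = solve-∀
    ring₈ : ∀ c a x → c * x + c * a * x ≡ c * ((+ 1 + a) * x)
    ring₈ = solve-∀
    ring₉ : ∀ t a b → let c = t * b - a ; d = t * c - b ; e = t * d - c ; f = t * e - d ; g = t * f - e ; h = t * g - f ; i = t * h - g ; j = t * i - h in j - a ≡ (t * t * t - + 3 * t + + 1) * (g - d)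
    ring₉ = solve-∀
    ring₁₀ : ∀ a b c → a - b + (b - c) ≡ a - c
    ring₁₀ = solve-∀
    ring₁₁ : ∀ x t v a w b → (x - t) * (- v) + (v - + 2) * (- t) + (x * v - (a + w)) + (w - b) ≡ + 2 * t - a - b
    ring₁₁ = solve-∀
    ring₁₂ : ∀ a b c → a - b - c ≡ a - c - b
    ring₁₂ = solve-∀
    ring₁₃ : ∀ r t → t * t * t - + 3 * t + + 1 ≡ (r * r * r - + 6 * r * r + + 9 * r - + 1) * + 1 - (r - + 2 - t) * ((r - + 2) * (r - + 2) + (r - + 2) * t + t * t - + 3)
    ring₁₃ = solve-∀
    ring₁₄ : ∀ t k q w G → G - (t + k * q - t) * w ≡ G + q * (- k * w)
    ring₁₄ = solve-∀
    ring₁₅ : ∀ x y a → + 1 * x - (+ 1 + y) + (y - a) ≡ x - (+ 1 + a)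
    ring₁₅ = solve-∀
    ring₁₆ : ∀ a k → a ℕ.+ (2 ℕ.+ k ℕ.* 2) ≡ 2 ℕ.+ a ℕ.+ k ℕ.* 2
    ring₁₆ = ℕ-Ring.solve-∀
    ring₁₇ : ∀ t x v w → x * v + x * (t * w - v) ≡ t * x * w
    ring₁₇ = solve-∀

  module Frobenius {p : ℕ} (p-prime : Prime p) where
    open ModPrime p-prime

    -- (1 + S)^p ≡ 1 + S^p for the shift operator S. Stated for arbitrary sequences, it serves
    -- powers, giving Fermat's theorem, and Lucas sequences alike.
    frobenius-sum : ∀ U → q ∣ binomial-sum p U - (U 0 + U p)
    frobenius-sum U = ∣-cong (cong (λ y → y - (U 0 + U p)) (sym (binomial-sum-≡ p U))) (go p refl)
      where
      go : ∀ p′ → p′ ≡ p → q ∣ Σ≤ p′ (λ k → + binomial p′ k * U k) - (U 0 + U p′)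
      go zero          e = ⊥-elim (¬prime[0] (subst Prime (sym e) p-prime))
      go (suc zero)    e = ⊥-elim (¬prime[1] (subst Prime (sym e) p-prime))
      go (suc (suc n)) e = ∣-cong eq (middle n (ℕ.n<1+n n))
        where
        F : ℕ → ℤ
        F k = + binomial (2 ℕ.+ n) k * U k
        p∣binomial : ∀ k → k ℕ.< suc n → p ℕ.∣ binomial (2 ℕ.+ n) (suc k)
        p∣binomial k k< with euclidsLemma (suc k) (binomial (2 ℕ.+ n) (suc k)) p-prime
          (subst (p ℕ.∣_) (sym (binomial-absorb (suc n) k)) (subst (ℕ._∣ suc (suc n) ℕ.* binomial (suc n) k) e (ℕ.m∣m*n (binomial (suc n) k))))
        ... | inj₂ d = d
        ... | inj₁ d = contradiction d (ℕ.>⇒∤ (subst (suc k ℕ.<_) e (s≤s k<)))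
        middle : ∀ m → m ℕ.< suc n → q ∣ Σ≤ m (λ k → F (suc k))
        middle zero    m< = ∣m⇒∣m*n (U 1) (∣ᵤ⇒∣ {q} {+ binomial (2 ℕ.+ n) 1} (p∣binomial 0 m<))
        middle (suc m) m< = ∣m∣n⇒∣m+n (middle m (ℕ.<-trans (ℕ.n<1+n m) m<))
          (∣m⇒∣m*n (U (2 ℕ.+ m)) (∣ᵤ⇒∣ {q} {+ binomial (2 ℕ.+ n) (2 ℕ.+ m)} (p∣binomial (suc m) m<)))
        binomial-n : ∀ n → binomial n n ≡ 1
        binomial-n zero    = refl
        binomial-n (suc n) = cong₂ ℕ._+_ (binomial-n n) (trans (cong (λ m → binomial n (suc m)) (sym (ℕ.+-identityʳ n))) (binomial-> n 0))
        eq : Σ≤ n (λ k → F (suc k)) ≡ Σ≤ (2 ℕ.+ n) F - (U 0 + U (2 ℕ.+ n))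
        eq = sym (trans (cong (λ y → y - (U 0 + U (2 ℕ.+ n))) (Σ≤-unfoldˡ (suc n) F))
          (trans (cong (λ b → + 1 * U 0 + (Σ≤ n (λ k → F (suc k)) + + b * U (2 ℕ.+ n)) - (U 0 + U (2 ℕ.+ n))) (binomial-n (2 ℕ.+ n)))
            (ring₄ (U 0) (Σ≤ n (λ k → F (suc k))) (U (2 ℕ.+ n)))))

    fermat : ∀ a → q ∣ (+ a) ^ p - + a
    fermat zero    = ∣-cong (sym (cong (λ y → y - + 0) (zero^ p refl))) (divides 0ℤ refl)
      where
      zero^ : ∀ p′ → p′ ≡ p → (+ 0) ^ p′ ≡ 0ℤ
      zero^ zero     e = ⊥-elim (¬prime[0] (subst Prime (sym e) p-prime))
      zero^ (suc p′) e = refl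
    fermat (suc a) = ∣-cong (ring₁₅ ((+ suc a) ^ p) ((+ a) ^ p) (+ a)) (∣m∣n⇒∣m+n (∣-cong (cong (λ y → y - (+ 1 + (+ a) ^ p)) (powers p (+ 1) (+ a)))
        (∣-cong (cong (λ y → binomial-sum p (λ k → + 1 * (+ a) ^ k) - (+ 1 + y)) (ℤ.*-identityˡ ((+ a) ^ p))) (frobenius-sum (λ k → + 1 * (+ a) ^ k)))) (fermat a))
      where
      powers : ∀ n c a → binomial-sum n (λ k → c * a ^ k) ≡ c * (+ 1 + a) ^ n
      powers zero    c a = refl
      powers (suc n) c a = trans (cong₂ _+_ (powers n c a) (trans (shift n) (powers n (c * a) a))) (ring₈ c a ((+ 1 + a) ^ n))
        where
        shift : ∀ n → binomial-sum n (λ k → c * a ^ suc k) ≡ binomial-sum n (λ k → (c * a) * a ^ k)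
        shift n = congruence n (λ k → sym (ℤ.*-assoc c a (a ^ k)))
          where
          congruence : ∀ n {U V : ℕ → ℤ} → (∀ k → U k ≡ V k) → binomial-sum n U ≡ binomial-sum n V
          congruence zero    e = e 0
          congruence (suc n) e = cong₂ _+_ (congruence n e) (congruence n (λ k → e (suc k)))

    -- The sum of binomial coefficients times ζ^(a+2k) is ζ^a (1 + ζ²)^n = ζ^(a+n) (ζ + ζ⁻¹)^n; the
    -- conjugate is added.
    lucas-sum : ∀ t n a → binomial-sum n (λ k → lucas t (a ℕ.+ k ℕ.* 2)) ≡ t ^ n * lucas t (a ℕ.+ n)
    lucas-sum t zero    a = sym (ℤ.*-identityˡ _)
    lucas-sum t (suc n) a = trans (cong₂ _+_ (lucas-sum t n a) (trans (congruence n (λ k → cong (lucas t) (ring₁₆ a k))) (lucas-sum t n (2 ℕ.+ a))))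
      (trans (ring₁₇ t (t ^ n) (lucas t (a ℕ.+ n)) (lucas t (suc (a ℕ.+ n)))) (cong (λ m → t * t ^ n * lucas t m) (sym (ℕ.+-suc a n))))
      where
      congruence : ∀ n {U V : ℕ → ℤ} → (∀ k → U k ≡ V k) → binomial-sum n U ≡ binomial-sum n V
      congruence zero    e = e 0
      congruence (suc n) e = cong₂ _+_ (congruence n e) (congruence n (λ k → e (suc k)))

    module _ (θ : ℤ) (θ^p : q ∣ θ ^ p - θ) (θ-root : q ∣ θ * θ * θ - + 3 * θ + + 1) where
      private
        F : ℤ
        F = θ * θ * θ - + 3 * θ + + 1

      -- The cubic says ζ³ + ζ⁻³ = -1 for a ζ with ζ + ζ⁻¹ = θ, whence ζ⁹ = 1.
      lucas-period : ∀ n → q ∣ lucas θ (9 ℕ.+ n) - lucas θ n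
      lucas-period n = dvd₁ F (lucas θ (6 ℕ.+ n) - lucas θ (3 ℕ.+ n)) _ (ring₉ θ (lucas θ n) (lucas θ (suc n))) θ-root

      lucas-mod : ∀ m c → q ∣ lucas θ (m ℕ.* 9 ℕ.+ c) - lucas θ c
      lucas-mod zero    c = divides 0ℤ (ℤ.i≡j⇒i-j≡0 {lucas θ c} refl)
      lucas-mod (suc m) c = ∣-cong (ring₁₀ (lucas θ (9 ℕ.+ (m ℕ.* 9 ℕ.+ c))) (lucas θ (m ℕ.* 9 ℕ.+ c)) (lucas θ c))
        (∣m∣n⇒∣m+n (lucas-period (m ℕ.* 9 ℕ.+ c)) (lucas-mod m c))

      -- ζ^p + ζ^(-p) = (ζ + ζ⁻¹)^p = ζ + ζ⁻¹ modulo p, for the ninth root of unity with ζ + ζ⁻¹ = θ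
      lucas-frobenius : ∀ m c d → p ≡ m ℕ.* 9 ℕ.+ c → d ℕ.+ c ≡ 9 → q ∣ + 2 * θ - lucas θ d - lucas θ c
      lucas-frobenius m c d p≡ d+c = ∣-cong (ring₁₁ (θ ^ p) θ (lucas θ (d ℕ.+ p)) (lucas θ d) (lucas θ (d ℕ.+ p ℕ.* 2)) (lucas θ c))
          (∣m∣n⇒∣m+n (∣m∣n⇒∣m+n (∣m∣n⇒∣m+n (∣m⇒∣m*n (- lucas θ (d ℕ.+ p)) θ^p) (∣m⇒∣m*n (- θ) q∣V₁))
            (∣-cong (cong₂ (λ x y → x - (y + lucas θ (d ℕ.+ p ℕ.* 2))) (lucas-sum θ p d) (cong (lucas θ) (ℕ.+-identityʳ d))) (frobenius-sum (λ k → lucas θ (d ℕ.+ k ℕ.* 2)))))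
            q∣V₂)
        where
        q∣V₁ : q ∣ lucas θ (d ℕ.+ p) - + 2
        q∣V₁ = ∣-cong (cong (λ n → lucas θ n - + 2) (trans (lem₁ m c d d+c) (cong (d ℕ.+_) (sym p≡)))) (lucas-mod (suc m) 0)
          where
          lem₁ : ∀ m c d → d ℕ.+ c ≡ 9 → suc m ℕ.* 9 ℕ.+ 0 ≡ d ℕ.+ (m ℕ.* 9 ℕ.+ c)
          lem₁ m c d e = trans (ℕ.+-identityʳ _) (trans (cong (ℕ._+ m ℕ.* 9) (sym e)) (ring₁ m c d))
        q∣V₂ : q ∣ lucas θ (d ℕ.+ p ℕ.* 2) - lucas θ c
        q∣V₂ = ∣-cong (cong (λ n → lucas θ n - lucas θ c) (trans (lem₁ m c d d+c) (cong (λ p → d ℕ.+ p ℕ.* 2) (sym p≡)))) (lucas-mod (suc (m ℕ.* 2)) c)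
          where
          lem₁ : ∀ m c d → d ℕ.+ c ≡ 9 → suc (m ℕ.* 2) ℕ.* 9 ℕ.+ c ≡ d ℕ.+ (m ℕ.* 9 ℕ.+ c) ℕ.* 2
          lem₁ m c d e = trans (cong (λ n → n ℕ.+ m ℕ.* 2 ℕ.* 9 ℕ.+ c) (sym e)) (ring₂ m c d)

      private
        -- A certificate that the ideal generated by the cubic and the congruence for the classes 2
        -- and 7 contains 6, so that p would be 2 or 3.
        case-2 : ∀ t F X v₀ v₁ v₂ v₃ v₄ v₅ v₆ v₇ → F ≡ t * t * t - + 3 * t + + 1 → X ≡ + 2 * t - v₇ - v₂ → v₀ ≡ + 2 → v₁ ≡ t →
          v₂ ≡ t * v₁ - v₀ → v₃ ≡ t * v₂ - v₁ → v₄ ≡ t * v₃ - v₂ → v₅ ≡ t * v₄ - v₃ → v₆ ≡ t * v₅ - v₄ → v₇ ≡ t * v₆ - v₅ →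
          + 6 ≡ F * (+ 2 - (- + 2 + t + + 4 * t * t - t * t * t * t) * (t + + 1)) + X * (t + + 1)
        case-2 t _ _ _ _ _ _ _ _ _ _ refl refl refl refl refl refl refl refl refl refl = ring₅ t

        -- For the classes 4 and 5 the ideal contains 6(t - 1), and `unit` shows that t - 1 is
        -- invertible modulo the cubic.
        case-4 : ∀ t F X v₀ v₁ v₂ v₃ v₄ v₅ → F ≡ t * t * t - + 3 * t + + 1 → X ≡ + 2 * t - v₅ - v₄ → v₀ ≡ + 2 → v₁ ≡ t →
          v₂ ≡ t * v₁ - v₀ → v₃ ≡ t * v₂ - v₁ → v₄ ≡ t * v₃ - v₂ → v₅ ≡ t * v₄ - v₃ →
          + 6 * (t - + 1) ≡ F * (+ 2 + (+ 2 - t - t * t) * (t - + 2)) + X * (+ 2 - t)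
        case-4 t _ _ _ _ _ _ _ _ refl refl refl refl refl refl refl refl = ring₆ t

        unit : ∀ t F → F ≡ t * t * t - + 3 * t + + 1 → + 1 ≡ F * (- + 1) + (t - + 1) * (t * t + t - + 2)
        unit t _ refl = ring₇ t

      module _ (3<p : 3 ℕ.< p) where
        ∤6 : ¬ q ∣ + 6
        ∤6 d with euclidsLemma 2 3 p-prime (∣⇒∣ᵤ d)
        ... | inj₁ d₂ = contradiction d₂ (ℕ.>⇒∤ (ℕ.<-trans (s≤s (s≤s (s≤s z≤n))) 3<p))
        ... | inj₂ d₃ = contradiction d₃ (ℕ.>⇒∤ 3<p)

        ∤1 : ¬ q ∣ + 1
        ∤1 d = contradiction (∣⇒∣ᵤ d) (ℕ.>⇒∤ (ℕ.<-trans (s≤s (s≤s z≤n)) 3<p))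

        p%9 : p % 9 ≡ 1 ⊎ p % 9 ≡ 8
        p%9 = exclude (lucas θ) refl refl (λ _ → refl) lucas-frobenius
          where
          multiple : ∀ m c → p ≡ m ℕ.* 9 ℕ.+ c ℕ.* 3 → ⊥
          multiple m c e = three (prime⇒irreducible p-prime (ℕ.divides (m ℕ.* 3 ℕ.+ c) (trans e (ring₃ m c))))
            where
            three : 3 ≡ 1 ⊎ 3 ≡ p → ⊥
            three (inj₂ 3≡p) = ℕ.<-irrefl 3≡p 3<p
          conclude₂ : ∀ X u w → + 6 ≡ F * u + X * w → q ∣ X → ⊥
          conclude₂ X u w e d = ∤6 (dvd₂ F u X w (+ 6) e θ-root d)
          conclude₄ : ∀ X u w → + 6 * (θ - + 1) ≡ F * u + X * w → q ∣ X → ⊥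
          conclude₄ X u w e d with euclid (+ 6) (θ - + 1) (dvd₂ F u X w (+ 6 * (θ - + 1)) e θ-root d)
          ... | inj₁ d₆ = ∤6 d₆
          ... | inj₂ d₁ = ∤1 (dvd₂ F (- + 1) (θ - + 1) (θ * θ + θ - + 2) (+ 1) (unit θ F refl) θ-root d₁)
          -- Only the recurrence of the sequence matters, so its values up to index 7 remain letters
          -- in the two certificates.
          exclude : (V : ℕ → ℤ) → V 0 ≡ + 2 → V 1 ≡ θ → (∀ n → V (2 ℕ.+ n) ≡ θ * V (suc n) - V n) →
            (∀ m c d → p ≡ m ℕ.* 9 ℕ.+ c → d ℕ.+ c ≡ 9 → q ∣ + 2 * θ - V d - V c) → p % 9 ≡ 1 ⊎ p % 9 ≡ 8
          exclude V V₀ V₁ step frobenius = go (p % 9) (p / 9) (trans (m≡m%n+[m/n]*n p 9) (ℕ.+-comm (p % 9) _)) (m%n<n p 9)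
            where
            refute₂ : ∀ X → X ≡ + 2 * θ - V 7 - V 2 → q ∣ X → ⊥
            refute₂ X X≡ = conclude₂ X _ _ (case-2 θ F X (V 0) (V 1) (V 2) (V 3) (V 4) (V 5) (V 6) (V 7)
              refl X≡ V₀ V₁ (step 0) (step 1) (step 2) (step 3) (step 4) (step 5))
            refute₄ : ∀ X → X ≡ + 2 * θ - V 5 - V 4 → q ∣ X → ⊥
            refute₄ X X≡ = conclude₄ X _ _ (case-4 θ F X (V 0) (V 1) (V 2) (V 3) (V 4) (V 5) refl X≡ V₀ V₁ (step 0) (step 1) (step 2) (step 3))
            go : ∀ c m → p ≡ m ℕ.* 9 ℕ.+ c → c ℕ.< 9 → c ≡ 1 ⊎ c ≡ 8
            go 0 m e _ = ⊥-elim (multiple m 0 e)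
            go 1 m e _ = inj₁ refl
            go 2 m e _ = ⊥-elim (refute₂ _ refl (frobenius m 2 7 e refl))
            go 3 m e _ = ⊥-elim (multiple m 1 e)
            go 4 m e _ = ⊥-elim (refute₄ _ refl (frobenius m 4 5 e refl))
            go 5 m e _ = ⊥-elim (refute₄ _ (ring₁₂ (+ 2 * θ) (V 4) (V 5)) (frobenius m 5 4 e refl))
            go 6 m e _ = ⊥-elim (multiple m 2 e)
            go 7 m e _ = ⊥-elim (refute₂ _ (ring₁₂ (+ 2 * θ) (V 2) (V 7)) (frobenius m 7 2 e refl))
            go 8 m e _ = inj₂ refl
            go (suc (suc (suc (suc (suc (suc (suc (suc (suc c))))))))) m e (s≤s (s≤s (s≤s (s≤s (s≤s (s≤s (s≤s (s≤s (s≤s ())))))))))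

    -- The shift by 2 turns `g` into the minimal polynomial of ζ + ζ⁻¹. Reduction below p gives a
    -- natural number, to which `fermat` applies and which for p = 2 can only be 0 or 1.
    natural-root : ∀ r → q ∣ g r → ∃[ t ] (t ℕ.< p × q ∣ + t * + t * + t - + 3 * + t + + 1)
    natural-root r d = t , ℤ.n%ℕd<d (r - + 2) p , dvd₂ (g r) (+ 1) q _ _ (shifted r (+ t) ((r - + 2) ℤ./ℕ p) q (g r) (g-≡ r) (ℤ.a≡a%ℕn+[a/ℕn]*n (r - + 2) p)) d ∣-refl
      where
      instance
        p≢0 : NonZero p
        p≢0 = prime⇒nonZero p-prime
      t = (r - + 2) ℤ.%ℕ p
      shifted : ∀ r t k q G → G ≡ r * r * r - + 6 * r * r + + 9 * r - + 1 → r - + 2 ≡ t + k * q →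
        t * t * t - + 3 * t + + 1 ≡ G * + 1 + q * (- k * ((r - + 2) * (r - + 2) + (r - + 2) * t + t * t - + 3))
      shifted r t k q _ refl e = trans (ring₁₃ r t) (trans (cong (λ x → (r * r * r - + 6 * r * r + + 9 * r - + 1) * + 1 - (x - t) * ((r - + 2) * (r - + 2) + (r - + 2) * t + t * t - + 3)) e)
          (ring₁₄ t k q ((r - + 2) * (r - + 2) + (r - + 2) * t + t * t - + 3) ((r * r * r - + 6 * r * r + + 9 * r - + 1) * + 1)))

  root-residue : ∀ {p} (p-prime : Prime p) r → + p ∣ g r → 3 ℕ.< p → p % 9 ≡ 1 ⊎ p % 9 ≡ 8
  root-residue p-prime r d 3<p with Frobenius.natural-root p-prime r d
  ... | t , _ , root = Frobenius.p%9 p-prime (+ t) (Frobenius.fermat p-prime t) root 3<p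

  -- The shifted cubic takes the odd values 1 and -1 at 0 and 1: the prime 2 is inert.
  no-root-2 : ∀ r → ¬ + 2 ∣ g r
  no-root-2 r d with Frobenius.natural-root prime[2] r d
  ... | zero        , _ , root = contradiction (∣⇒∣ᵤ root) (ℕ.>⇒∤ (s≤s (s≤s z≤n)))
  ... | suc zero    , _ , root = contradiction (∣⇒∣ᵤ root) (ℕ.>⇒∤ (s≤s (s≤s z≤n)))
  ... | suc (suc t) , s≤s (s≤s ()) , _

-- Size and zeros of the norm form

module Norm where

  open Cubic
  open Residue using (no-root-2)
  open import Data.Empty using (⊥-elim)
  open import Data.Integer.Base using (ℤ; +_; 0ℤ; _+_; _*_) renaming (∣_∣ to abs)
  import Data.Integer.Properties as ℤ
  open import Data.Integer.Divisibility.Signed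
  open import Data.Integer.Tactic.RingSolver using (solve-∀)
  open import Data.Nat.Base as ℕ using (ℕ; zero; suc; z≤n; s≤s)
  open import Data.Nat.Primality using (prime[2])
  import Data.Nat.Properties as ℕ
  import Data.Nat.Tactic.RingSolver as ℕ-Ring
  open import Data.Product.Base using (_×_; _,_; proj₂)
  open import Relation.Binary.Definitions using (tri<; tri≈; tri>)
  open import Relation.Binary.PropositionalEquality hiding (J)
  open import Relation.Nullary using (yes; no; contradiction)
  open import Relation.Nullary.Decidable using (_×-dec_)

  private
    ring₂ : ∀ x y z → let X = x * + 2 ; Y = y * + 2 ; Z = z * + 2 in X * X * X + + 6 * X * X * Y + + 18 * X * X * Z + + 9 * X * Y * Y + + 51 * X * Y * Z + + 69 * X * Z * Z + Y * Y * Y + + 6 * Y * Y * Z + + 9 * Y * Z * Z + Z * Z * Z ≡ (x * x * x + + 6 * x * x * y + + 18 * x * x * z + + 9 * x * y * y + + 51 * x * y * z + + 69 * x * z * z + y * y * y + + 6 * y * y * z + + 9 * y * z * z + z * z * z) * + 8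
    ring₂ = solve-∀

  private
    norm-double : ∀ x y z → norm (x * + 2) (y * + 2) (z * + 2) ≡ norm x y z * + 8
    norm-double x y z = trans (norm-≡ _ _ _) (trans (ring₂ x y z) (cong (λ n → n * + 8) (sym (norm-≡ x y z))))

  private
    ring₁ : ∀ a b c → a ℕ.* 2 ℕ.+ b ℕ.* 2 ℕ.+ c ℕ.* 2 ≡ (a ℕ.+ b ℕ.+ c) ℕ.* 2
    ring₁ = ℕ-Ring.solve-∀

  -- Descent at the inert prime 2: by `norm-root` a zero has even coordinates, and half of it is
  -- again a zero. The sum of absolute values decreases.
  norm-anisotropic : ∀ x y z → norm x y z ≡ 0ℤ → x ≡ 0ℤ × y ≡ 0ℤ × z ≡ 0ℤ
  norm-anisotropic x y z = go _ x y z ℕ.≤-refl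
    where
    go : ∀ B x y z → abs x ℕ.+ abs y ℕ.+ abs z ℕ.≤ B → norm x y z ≡ 0ℤ → x ≡ 0ℤ × y ≡ 0ℤ × z ≡ 0ℤ
    go zero x y z le _ = ℤ.∣i∣≡0⇒i≡0 (ℕ.m+n≡0⇒m≡0 _ xy≡0) , ℤ.∣i∣≡0⇒i≡0 (ℕ.m+n≡0⇒n≡0 (abs x) xy≡0) , ℤ.∣i∣≡0⇒i≡0 (ℕ.m+n≡0⇒n≡0 (abs x ℕ.+ abs y) sum≡0)
      where
      sum≡0 = ℕ.n≤0⇒n≡0 le
      xy≡0 = ℕ.m+n≡0⇒m≡0 (abs x ℕ.+ abs y) sum≡0
    go (suc B) x y z le n≡0 with (+ 2 ∣? x) ×-dec (+ 2 ∣? y) ×-dec (+ 2 ∣? z)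
    ... | no ∤v = ⊥-elim (no-root-2 _ (proj₂ (ModPrime.norm-root prime[2] x y z (divides 0ℤ n≡0) ∤v)))
    ... | yes (divides x′ refl , divides y′ refl , divides z′ refl) = double (go B x′ y′ z′ smaller half)
      where
      double : x′ ≡ 0ℤ × y′ ≡ 0ℤ × z′ ≡ 0ℤ → x′ * + 2 ≡ 0ℤ × y′ * + 2 ≡ 0ℤ × z′ * + 2 ≡ 0ℤ
      double (refl , refl , refl) = refl , refl , refl
      half : norm x′ y′ z′ ≡ 0ℤ
      half = ℤ.*-cancelʳ-≡ (norm x′ y′ z′) 0ℤ (+ 8) (trans (sym (norm-double x′ y′ z′)) n≡0)
      sum = abs x′ ℕ.+ abs y′ ℕ.+ abs z′
      doubled : sum ℕ.* 2 ℕ.≤ suc B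
      doubled = subst (ℕ._≤ suc B) (trans (cong₂ ℕ._+_ (cong₂ ℕ._+_ (ℤ.abs-* x′ (+ 2)) (ℤ.abs-* y′ (+ 2))) (ℤ.abs-* z′ (+ 2))) (ring₁ (abs x′) (abs y′) (abs z′))) le
      halve : ∀ s → s ℕ.* 2 ℕ.≤ suc B → s ℕ.≤ B
      halve zero    _        = z≤n
      halve (suc s) (s≤s le) = ℕ.≤-trans (s≤s (ℕ.m≤m*n s 2)) le
      smaller = halve sum doubled

  opaque
    normℕ : ℕ → ℕ → ℕ → ℕ
    normℕ x y z = x ℕ.* x ℕ.* x ℕ.+ 6 ℕ.* x ℕ.* x ℕ.* y ℕ.+ 18 ℕ.* x ℕ.* x ℕ.* z ℕ.+ 9 ℕ.* x ℕ.* y ℕ.* y ℕ.+ 51 ℕ.* x ℕ.* y ℕ.* z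
      ℕ.+ 69 ℕ.* x ℕ.* z ℕ.* z ℕ.+ y ℕ.* y ℕ.* y ℕ.+ 6 ℕ.* y ℕ.* y ℕ.* z ℕ.+ 9 ℕ.* y ℕ.* z ℕ.* z ℕ.+ z ℕ.* z ℕ.* z

    norm-pos : ∀ x y z → norm (+ x) (+ y) (+ z) ≡ + normℕ x y z
    norm-pos x y z = trans (norm-≡ (+ x) (+ y) (+ z)) (sym
      (cong₂ _+_ (cong₂ _+_ (cong₂ _+_ (cong₂ _+_ (cong₂ _+_ (cong₂ _+_ (cong₂ _+_ (cong₂ _+_ (cong₂ _+_
        (mul₃ x x x) (mul₄ 6 x x y)) (mul₄ 18 x x z)) (mul₄ 9 x y y)) (mul₄ 51 x y z)) (mul₄ 69 x z z)) (mul₃ y y y))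
        (mul₄ 6 y y z)) (mul₄ 9 y z z)) (mul₃ z z z)))
      where
      mul₃ : ∀ a b c → + (a ℕ.* b ℕ.* c) ≡ + a * + b * + c
      mul₃ a b c = trans (ℤ.pos-* (a ℕ.* b) c) (cong (λ w → w * + c) (ℤ.pos-* a b))
      mul₄ : ∀ a b c d → + (a ℕ.* b ℕ.* c ℕ.* d) ≡ + a * + b * + c * + d
      mul₄ a b c d = trans (ℤ.pos-* (a ℕ.* b ℕ.* c) d) (cong (λ w → w * + d) (mul₃ a b c))

    normℕ-mono-< : ∀ {x x′} y z → x ℕ.< x′ → normℕ x y z ℕ.< normℕ x′ y z
    normℕ-mono-< {x} {x′} y z x<x′ =
      ℕ.+-monoˡ-< _ (ℕ.+-monoˡ-< _ (ℕ.+-monoˡ-< _ (ℕ.+-monoˡ-< _ (ℕ.+-mono-<-≤ (ℕ.+-mono-<-≤ (ℕ.+-mono-<-≤ (ℕ.+-mono-<-≤ (ℕ.+-mono-<-≤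
        (ℕ.*-mono-< (ℕ.*-mono-< x<x′ x<x′) x<x′)
        (ℕ.*-monoˡ-≤ y (ℕ.*-mono-≤ (ℕ.*-monoʳ-≤ 6 x≤) x≤)))
        (ℕ.*-monoˡ-≤ z (ℕ.*-mono-≤ (ℕ.*-monoʳ-≤ 18 x≤) x≤)))
        (ℕ.*-monoˡ-≤ y (ℕ.*-monoˡ-≤ y (ℕ.*-monoʳ-≤ 9 x≤))))
        (ℕ.*-monoˡ-≤ z (ℕ.*-monoˡ-≤ y (ℕ.*-monoʳ-≤ 51 x≤))))
        (ℕ.*-monoˡ-≤ z (ℕ.*-monoˡ-≤ z (ℕ.*-monoʳ-≤ 69 x≤)))))))
      where
      x≤ : x ℕ.≤ x′
      x≤ = ℕ.<⇒≤ x<x′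

    normℕ>0 : ∀ x y z → 0 ℕ.< normℕ (suc x) (suc y) (suc z)
    normℕ>0 x y z = s≤s z≤n

  private
    record _⊑_ (a : ℤ) (A : ℕ) : Set where
      constructor bounded
      field bound : abs a ℕ.≤ A
    open _⊑_

    add : ∀ {a b A B} → a ⊑ A → b ⊑ B → (a + b) ⊑ (A ℕ.+ B)
    add {a} {b} p q = bounded (ℕ.≤-trans (ℤ.∣i+j∣≤∣i∣+∣j∣ a b) (ℕ.+-mono-≤ (bound p) (bound q)))

    mul : ∀ {a b A B} → a ⊑ A → b ⊑ B → (a * b) ⊑ (A ℕ.* B)
    mul {a} {b} p q = bounded (ℕ.≤-trans (ℕ.≤-reflexive (ℤ.abs-* a b)) (ℕ.*-mono-≤ (bound p) (bound q)))

    term : ∀ c {a b d A B D} → a ⊑ A → b ⊑ B → d ⊑ D → (+ c * a * b * d) ⊑ (c ℕ.* A ℕ.* B ℕ.* D)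
    term c p q r = mul (mul (mul (bounded {+ c} ℕ.≤-refl) p) q) r

  private
    ring₃ : ∀ s → s ℕ.* s ℕ.* s ℕ.+ 6 ℕ.* s ℕ.* s ℕ.* s ℕ.+ 18 ℕ.* s ℕ.* s ℕ.* s ℕ.+ 9 ℕ.* s ℕ.* s ℕ.* s ℕ.+ 51 ℕ.* s ℕ.* s ℕ.* s ℕ.+ 69 ℕ.* s ℕ.* s ℕ.* s ℕ.+ s ℕ.* s ℕ.* s ℕ.+ 6 ℕ.* s ℕ.* s ℕ.* s ℕ.+ 9 ℕ.* s ℕ.* s ℕ.* s ℕ.+ s ℕ.* s ℕ.* s ≡ 171 ℕ.* (s ℕ.* s ℕ.* s)
    ring₃ = ℕ-Ring.solve-∀

  -- 171 is the sum of the coefficients of the form.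
  norm-bound : ∀ s x y z → abs x ℕ.≤ s → abs y ℕ.≤ s → abs z ℕ.≤ s → abs (norm x y z) ℕ.≤ 171 ℕ.* (s ℕ.* s ℕ.* s)
  norm-bound s x y z x≤ y≤ z≤ = subst₂ (λ n m → abs n ℕ.≤ m) (sym (norm-≡ x y z)) (ring₃ s) (bound
    (add (add (add (add (add (add (add (add (add
      (mul (mul X X) X) (term 6 X X Y)) (term 18 X X Z)) (term 9 X Y Y)) (term 51 X Y Z)) (term 69 X Z Z))
      (mul (mul Y Y) Y)) (term 6 Y Y Z)) (term 9 Y Z Z)) (mul (mul Z Z) Z)))
    where
    X = bounded {x} x≤
    Y = bounded {y} y≤
    Z = bounded {z} z≤

  normℕ-bound : ∀ T x y z → x ℕ.≤ T → y ℕ.≤ T → z ℕ.≤ T → normℕ x y z ℕ.≤ 171 ℕ.* (T ℕ.* T ℕ.* T)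
  normℕ-bound T x y z x≤ y≤ z≤ = subst (λ n → abs n ℕ.≤ 171 ℕ.* (T ℕ.* T ℕ.* T)) (norm-pos x y z) (norm-bound T (+ x) (+ y) (+ z) x≤ y≤ z≤)

  -- Positive coefficients make the form increasing in x. This is what limits the number of points
  -- with norm in a given list.
  normℕ-injective : ∀ x x′ y z → normℕ x y z ≡ normℕ x′ y z → x ≡ x′
  normℕ-injective x x′ y z e with ℕ.<-cmp x x′
  ... | tri< x<x′ _ _ = contradiction e (ℕ.<⇒≢ (normℕ-mono-< y z x<x′))
  ... | tri≈ _ x≡x′ _ = x≡x′
  ... | tri> _ _ x>x′ = contradiction (sym e) (ℕ.<⇒≢ (normℕ-mono-< y z x>x′))

-- Union bounds for finite counts

module Counting where

  open import Data.List.Base using (List; []; _∷_; length; filter; map; cartesianProduct)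
  open import Data.List.Properties using (length-map; length-++; filter-none)
  open import Data.List.Membership.Propositional using (_∈_)
  open import Data.List.Membership.Propositional.Properties
  import Data.List.Relation.Unary.All as All
  open import Data.List.Relation.Unary.Any using (here; there)
  open import Data.Nat.Base
  open import Data.Nat.ListAction using (sum)
  open import Data.Nat.Properties
  open import Data.Product.Base using (_×_; _,_; proj₁; proj₂; ∃-syntax)
  open import Data.Sum.Base using (_⊎_; inj₁; inj₂)
  open import Relation.Binary.PropositionalEquality hiding (J)
  open import Relation.Nullary using (¬_; yes; no; contradiction; ¬?)
  open import Relation.Nullary.Decidable using (_×-dec_)
  open import Relation.Unary using (Pred; Decidable)
  open import Level using (0ℓ)

  module _ {A : Set} where

    private variable
      I : Set
      P Q R : Pred A 0ℓ

    count : Decidable P → List A → ℕ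
    count P? xs = length (filter P? xs)

    count-cover : (P? : Decidable P) (Q? : Decidable Q) (R? : Decidable R) → ∀ xs →
      (∀ {x} → x ∈ xs → P x → Q x ⊎ R x) → count P? xs ≤ count Q? xs + count R? xs
    count-cover P? Q? R? []       h = z≤n
    count-cover P? Q? R? (x ∷ xs) h with P? x | Q? x | R? x | count-cover P? Q? R? xs (λ x∈ → h (there x∈))
    ... | no  _  | no  _  | no  _  | ih = ih
    ... | no  _  | no  _  | yes _  | ih = ≤-trans ih (+-monoʳ-≤ (count Q? xs) (n≤1+n _))
    ... | no  _  | yes _  | no  _  | ih = m≤n⇒m≤1+n ih
    ... | no  _  | yes _  | yes _  | ih = m≤n⇒m≤1+n (≤-trans ih (+-monoʳ-≤ (count Q? xs) (n≤1+n _)))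
    ... | yes _  | yes _  | no  _  | ih = s≤s ih
    ... | yes _  | yes _  | yes _  | ih = s≤s (≤-trans ih (+-monoʳ-≤ (count Q? xs) (n≤1+n _)))
    ... | yes _  | no  _  | yes _  | ih = ≤-trans (s≤s ih) (≤-reflexive (sym (+-suc (count Q? xs) _)))
    ... | yes px | no ¬qx | no ¬rx | ih with h (here refl) px
    ...   | inj₁ qx = contradiction qx ¬qx
    ...   | inj₂ rx = contradiction rx ¬rx

    count-coverΣ : {S : I → Pred A 0ℓ} (P? : Decidable P) (S? : ∀ i → Decidable (S i)) → ∀ is xs →
      (∀ {x} → x ∈ xs → P x → ∃[ i ] (i ∈ is × S i x)) → count P? xs ≤ sum (map (λ i → count (S? i) xs) is)
    count-coverΣ P? S? [] xs h = ≤-reflexive (cong length (filter-none P? (All.tabulate λ x∈ px → contradiction (proj₁ (proj₂ (h x∈ px))) ∉[])))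
    count-coverΣ {P = P} {S = S} P? S? (i ∷ is) xs h = ≤-trans
      (count-cover P? (S? i) (λ x → P? x ×-dec ¬? (S? i x)) xs split)
      (+-monoʳ-≤ (count (S? i) xs) (count-coverΣ (λ x → P? x ×-dec ¬? (S? i x)) S? is xs rest))
      where
      split : ∀ {x} → x ∈ xs → P x → S i x ⊎ P x × ¬ S i x
      split {x} _ px with S? i x
      ... | yes sx = inj₁ sx
      ... | no ¬sx = inj₂ (px , ¬sx)
      rest : ∀ {x} → x ∈ xs → P x × ¬ S i x → ∃[ j ] (j ∈ is × S j x)
      rest x∈ (px , ¬sx) with h x∈ px
      ... | j , here refl , sx = contradiction sx ¬sx
      ... | j , there j∈  , sx = j , j∈ , sx

    count-complement : (P? : Decidable P) → ∀ xs → count P? xs + count (λ x → ¬? (P? x)) xs ≡ length xs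
    count-complement P? []       = refl
    count-complement P? (x ∷ xs) with P? x
    ... | yes _ = cong suc (count-complement P? xs)
    ... | no  _ = trans (+-suc _ _) (cong suc (count-complement P? xs))

  length-cartesianProduct : ∀ {A B : Set} (xs : List A) (ys : List B) → length (cartesianProduct xs ys) ≡ length xs * length ys
  length-cartesianProduct []       ys = refl
  length-cartesianProduct (x ∷ xs) ys = trans (length-++ (map (x ,_) ys)) (cong₂ _+_ (length-map (x ,_) ys) (length-cartesianProduct xs ys))

-- Points of a box with norm divisible by a given prime

module Lattice where

  open Cubic
  open Norm
  open Counting
  open Parity using (length-injection)
  open import Data.Integer.Base as ℤ using (ℤ; +_; 0ℤ) renaming (∣_∣ to abs)
  import Data.Integer.Properties as ℤ
  open import Data.Integer.Divisibility.Signed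
  import Data.Integer.Tactic.RingSolver as ℤ-Ring
  open import Data.List.Base using (List; []; _∷_; length; filter; cartesianProduct; upTo)
  open import Data.List.Properties using (length-upTo)
  open import Data.List.Membership.Propositional using (_∈_)
  open import Data.List.Membership.Propositional.Properties
  open import Data.List.Relation.Unary.Any using (here)
  open import Data.List.Relation.Unary.Unique.Propositional using (Unique)
  import Data.List.Relation.Unary.Unique.Propositional.Properties as Unique
  open import Data.Nat.Base
  open import Data.Nat.DivMod
  import Data.Nat.Divisibility as ℕ
  open import Data.Nat.Primality using (Prime)
  open import Data.Nat.Properties
  open import Data.Nat.Tactic.RingSolver using (solve-∀)
  open import Data.Product.Base using (_×_; _,_; proj₁; proj₂; ∃-syntax)
  open import Data.Sum.Base using (inj₁; inj₂)
  open import Relation.Binary.PropositionalEquality hiding (J)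
  open import Relation.Nullary using (¬_; Dec; yes; no; contradiction; ¬?)
  open import Relation.Nullary.Decidable using (_×-dec_; _⊎-dec_)

  Point : Set
  Point = ℕ × ℕ × ℕ

  box : ℕ → List Point
  box T = cartesianProduct (upTo T) (cartesianProduct (upTo T) (upTo T))

  box-unique : ∀ T → Unique (box T)
  box-unique T = Unique.cartesianProduct⁺ (Unique.upTo⁺ T) (Unique.cartesianProduct⁺ (Unique.upTo⁺ T) (Unique.upTo⁺ T))

  length-box : ∀ T → length (box T) ≡ T * T * T
  length-box T = trans (length-cartesianProduct (upTo T) _) (trans (cong₂ _*_ (length-upTo T)
    (trans (length-cartesianProduct (upTo T) (upTo T)) (cong₂ _*_ (length-upTo T) (length-upTo T)))) (sym (*-assoc T T T)))

  ∈-box : ∀ T {x y z} → x < T → y < T → z < T → (x , y , z) ∈ box T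
  ∈-box T x< y< z< = ∈-cartesianProduct⁺ (∈-upTo⁺ x<) (∈-cartesianProduct⁺ (∈-upTo⁺ y<) (∈-upTo⁺ z<))

  box-∈ : ∀ T {x y z} → (x , y , z) ∈ box T → x < T × y < T × z < T
  box-∈ T v∈ = let x∈ , yz∈ = ∈-cartesianProduct⁻ (upTo T) (cartesianProduct (upTo T) (upTo T)) v∈
                   y∈ , z∈ = ∈-cartesianProduct⁻ (upTo T) (upTo T) yz∈ in ∈-upTo⁻ x∈ , ∈-upTo⁻ y∈ , ∈-upTo⁻ z∈

  -- The point (x , y , z) of a box stands for the vector (x+1 , y+1 , z+1).
  N : Point → ℕ
  N (x , y , z) = normℕ (suc x) (suc y) (suc z)

  Divides : ℕ → Point → Set
  Divides d (x , y , z) = d ℕ.∣ suc x × d ℕ.∣ suc y × d ℕ.∣ suc z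

  Divides? : ∀ d v → Dec (Divides d v)
  Divides? d (x , y , z) = (d ℕ.∣? suc x) ×-dec (d ℕ.∣? suc y) ×-dec (d ℕ.∣? suc z)

  eval : ℤ → Point → ℤ
  eval r (x , y , z) = evaluate (+ suc x) (+ suc y) (+ suc z) r

  -- The root of p/171, rounded down strictly: vectors with coordinates at most s have norm below p,
  -- while a cell of side s + 1 still has volume at least p/171.
  cube-root : ∀ p T → 0 < p → p ≤ 171 * (T * T * T) → ∃[ s ] (s < T × 171 * (s * s * s) < p × p ≤ 171 * (suc s * suc s * suc s))
  cube-root p zero    0<p p≤ = contradiction 0<p (≤⇒≯ p≤)
  cube-root p (suc T) 0<p p≤ with p ≤? 171 * (T * T * T)
  ... | no p≰  = T , ≤-refl , ≰⇒> p≰ , p≤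
  ... | yes p≤′ with cube-root p T 0<p p≤′
  ...   | s , s<T , lo , hi = s , m<n⇒m<1+n s<T , lo , hi

  private
    ring₅ : ∀ a b k → + 1 ℤ.+ (a ℤ.+ k) ℤ.- (+ 1 ℤ.+ (b ℤ.+ k)) ≡ a ℤ.- b
    ring₅ = ℤ-Ring.solve-∀

  /-close : ∀ s x y → x / suc s ≡ y / suc s → abs (+ suc x ℤ.- + suc y) ≤ s
  /-close s x y e = subst (λ w → abs w ≤ s) (sym diff) (≤-trans (ℤ.∣m⊝n∣≤m⊔n (x % suc s) (y % suc s)) (⊔-lub (s≤s⁻¹ (m%n<n x (suc s))) (s≤s⁻¹ (m%n<n y (suc s)))))
    where
    diff : + suc x ℤ.- + suc y ≡ (x % suc s) ℤ.⊖ (y % suc s)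
    diff = trans (cong₂ (λ a b → + suc a ℤ.- + suc b) (m≡m%n+[m/n]*n x (suc s)) (trans (m≡m%n+[m/n]*n y (suc s)) (cong (λ k → y % suc s + k * suc s) (sym e))))
      (trans (ring₅ (+ (x % suc s)) (+ (y % suc s)) (+ (x / suc s * suc s))) (ℤ.m-n≡m⊖n (x % suc s) (y % suc s)))

  private
    ring₆ : ∀ x y z x′ y′ z′ r → (x ℤ.- x′) ℤ.+ (y ℤ.- y′) ℤ.* r ℤ.+ (z ℤ.- z′) ℤ.* (r ℤ.* r) ≡ (x ℤ.+ y ℤ.* r ℤ.+ z ℤ.* (r ℤ.* r)) ℤ.- (x′ ℤ.+ y′ ℤ.* r ℤ.+ z′ ℤ.* (r ℤ.* r))
    ring₆ = ℤ-Ring.solve-∀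

  evaluate-- : ∀ x y z x′ y′ z′ r → evaluate (x ℤ.- x′) (y ℤ.- y′) (z ℤ.- z′) r ≡ evaluate x y z r ℤ.- evaluate x′ y′ z′ r
  evaluate-- x y z x′ y′ z′ r = trans (evaluate-≡ _ _ _ r) (trans (ring₆ x y z x′ y′ z′ r) (sym (cong₂ ℤ._-_ (evaluate-≡ x y z r) (evaluate-≡ x′ y′ z′ r))))

  -- A prime dividing the whole vector divides the norm whatever its class, so such points say
  -- nothing and are excluded.
  Proper? : ∀ p v → Dec (p ℕ.∣ N v × ¬ Divides p v)
  Proper? p v = (p ℕ.∣? N v) ×-dec ¬? (Divides? p v)

  private
    ring₁ : ∀ c k → c * c * c * (171 * (k * k * k)) ≡ 171 * ((c * k) * (c * k) * (c * k))
    ring₁ = solve-∀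
    ring₂ : ∀ T → 171 * ((T + T) * (T + T) * (T + T)) ≡ 1368 * (T * T * T)
    ring₂ = solve-∀
    ring₃ : ∀ a b c p → (a + (b + c)) * p ≡ a * p + (b * p + c * p)
    ring₃ = solve-∀
    ring₄ : ∀ W → 1368 * W + (1368 * W + 1368 * W) ≡ 4104 * W
    ring₄ = solve-∀

  module _ {p : ℕ} (p-prime : Prime p) where
    open ModPrime p-prime

    -- Two points of the lattice q ∣ x + y s + z s² in a common cell of side (p/171)^(1/3)
    -- differ by a vector of norm divisible by p and smaller than p, hence by zero.
    module _ (r : ℤ) (q∣g : q ∣ g r) (s : ℤ) (conj : Conjugate r q∣g s) where

      lattice-count : ∀ T → 0 < p → p ≤ 171 * (T * T * T) → count (λ v → q ∣? eval s v) (box T) * p ≤ 1368 * (T * T * T)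
      lattice-count T 0<p p≤ with cube-root p T 0<p p≤
      ... | k , k<T , lo , hi = begin
        count (λ v → q ∣? eval s v) (box T) * p        ≤⟨ *-monoˡ-≤ p count≤ ⟩
        c * c * c * p                                  ≤⟨ *-monoʳ-≤ (c * c * c) hi ⟩
        c * c * c * (171 * (suc k * suc k * suc k))    ≡⟨ ring₁ c (suc k) ⟩
        171 * ((c * suc k) * (c * suc k) * (c * suc k)) ≤⟨ *-monoʳ-≤ 171 (*-mono-≤ (*-mono-≤ c≤ c≤) c≤) ⟩
        171 * ((T + T) * (T + T) * (T + T))            ≡⟨ ring₂ T ⟩
        1368 * (T * T * T)                             ∎
        where
        open ≤-Reasoning
        -- Cells per axis, the last one possibly incomplete. As k < T, there are at most 2T/(k + 1),
        -- which gives the constant 1368 = 171 · 2³.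
        c = suc (T / suc k)
        c≤ : c * suc k ≤ T + T
        c≤ = +-mono-≤ k<T (m/n*n≤m T (suc k))
        cell : Point → Point
        cell (x , y , z) = x / suc k , y / suc k , z / suc k
        cell< : ∀ {x} → x < T → x / suc k < c
        cell< {x} x<T = s≤s (/-monoˡ-≤ (suc k) (<⇒≤ x<T))
        points = filter (λ v → q ∣? eval s v) (box T)
        into : ∀ {v} → v ∈ points → cell v ∈ box c
        into {x , y , z} v∈ with box-∈ T (proj₁ (∈-filter⁻ (λ v → q ∣? eval s v) {xs = box T} v∈))
        ... | x< , y< , z< = ∈-box c (cell< x<) (cell< y<) (cell< z<)
        injective : ∀ {v w} → v ∈ points → w ∈ points → cell v ≡ cell w → v ≡ w
        injective {x , y , z} {x′ , y′ , z′} v∈ w∈ e = cong₂ _,_ (coordinate x x′ (proj₁ zero′)) (cong₂ _,_ (coordinate y y′ (proj₁ (proj₂ zero′))) (coordinate z z′ (proj₂ (proj₂ zero′))))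
          where
          dx = + suc x ℤ.- + suc x′
          dy = + suc y ℤ.- + suc y′
          dz = + suc z ℤ.- + suc z′
          q∣ : q ∣ norm dx dy dz
          q∣ = evaluate-zero r q∣g dx dy dz s conj (∣-cong (sym (evaluate-- (+ suc x) (+ suc y) (+ suc z) (+ suc x′) (+ suc y′) (+ suc z′) s))
            (∣m∣n⇒∣m-n (proj₂ (∈-filter⁻ (λ v → q ∣? eval s v) {xs = box T} v∈)) (proj₂ (∈-filter⁻ (λ v → q ∣? eval s v) {xs = box T} w∈))))
          small : abs (norm dx dy dz) < p
          small = ≤-<-trans (norm-bound k dx dy dz (/-close k x x′ (cong proj₁ e)) (/-close k y y′ (cong (λ v → proj₁ (proj₂ v)) e)) (/-close k z z′ (cong (λ v → proj₂ (proj₂ v)) e))) lo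
          norm≡0 : norm dx dy dz ≡ 0ℤ
          norm≡0 = ℤ.∣i∣≡0⇒i≡0 (small-multiple (abs (norm dx dy dz)) small (∣⇒∣ᵤ q∣))
            where
            small-multiple : ∀ n → n < p → p ℕ.∣ n → n ≡ 0
            small-multiple zero    _  _ = refl
            small-multiple (suc n) n< d = contradiction d (ℕ.>⇒∤ n<)
          zero′ = norm-anisotropic dx dy dz norm≡0
          coordinate : ∀ x x′ → + suc x ℤ.- + suc x′ ≡ 0ℤ → x ≡ x′
          coordinate x x′ h = suc-injective (ℤ.+-injective (ℤ.i-j≡0⇒i≡j (+ suc x) (+ suc x′) h))
        count≤ : count (λ v → q ∣? eval s v) (box T) ≤ c * c * c
        count≤ = ≤-trans (length-injection cell (Unique.filter⁺ (λ v → q ∣? eval s v) (box-unique T)) into injective) (≤-reflexive (length-box c))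

    q∣norm : ∀ v → p ℕ.∣ N v → q ∣ norm (+ suc (proj₁ v)) (+ suc (proj₁ (proj₂ v))) (+ suc (proj₂ (proj₂ v)))
    q∣norm (x , y , z) d = ∣ᵤ⇒∣ (subst (λ n → p ℕ.∣ abs n) (sym (norm-pos (suc x) (suc y) (suc z))) d)

    proper-root : ∀ v → p ℕ.∣ N v × ¬ Divides p v → ∃[ r ] q ∣ g r
    proper-root v@(x , y , z) (d , ∤v) = norm-root (+ suc x) (+ suc y) (+ suc z) (q∣norm v d) λ (dx , dy , dz) → ∤v (∣⇒∣ᵤ dx , ∣⇒∣ᵤ dy , ∣⇒∣ᵤ dz)

    -- The three conjugate roots give three lattices, and 4104 = 3 · 1368. The root is obtained from
    -- a counted point; if there is none, nothing has to be bounded.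
    proper-count : ∀ T → 0 < p → p ≤ 171 * (T * T * T) → count (Proper? p) (box T) * p ≤ 4104 * (T * T * T)
    proper-count T 0<p p≤ with filter (Proper? p) (box T) in eq
    ... | []     = z≤n
    ... | v ∷ vs = subst (λ xs → length xs * p ≤ 4104 * (T * T * T)) eq (with-root (proper-root v (proj₂ (∈-filter⁻ (Proper? p) {xs = box T} (subst (v ∈_) (sym eq) (here refl))))))
      where
      with-root : ∃[ r ] q ∣ g r → count (Proper? p) (box T) * p ≤ 4104 * (T * T * T)
      with-root (r , q∣g) = begin
        count (Proper? p) (box T) * p          ≤⟨ *-monoˡ-≤ p (≤-trans
             (count-cover (Proper? p) (L? r) (λ v → L? r′ v ⊎-dec L? r″ v) (box T) (λ {v} _ (d , _) → norm-zero r q∣g _ _ _ (q∣norm v d)))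
             (+-monoʳ-≤ (count (L? r) (box T)) (count-cover (λ v → L? r′ v ⊎-dec L? r″ v) (L? r′) (L? r″) (box T) (λ _ h → h)))) ⟩
        (count (L? r) (box T) + (count (L? r′) (box T) + count (L? r″) (box T))) * p
          ≡⟨ ring₃ (count (L? r) (box T)) (count (L? r′) (box T)) (count (L? r″) (box T)) p ⟩
        count (L? r) (box T) * p + (count (L? r′) (box T) * p + count (L? r″) (box T) * p)
          ≤⟨ +-mono-≤ (lattice-count r q∣g r (inj₁ refl) T 0<p p≤) (+-mono-≤ (lattice-count r q∣g r′ (inj₂ (inj₁ refl)) T 0<p p≤) (lattice-count r q∣g r″ (inj₂ (inj₂ refl)) T 0<p p≤)) ⟩
        1368 * W + (1368 * W + 1368 * W)   ≡⟨ ring₄ W ⟩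
        4104 * W                           ∎
        where
        open ≤-Reasoning
        W = T * T * T
        r′ = conjugate r
        r″ = + 6 ℤ.- r ℤ.- conjugate r
        L? : ∀ s (v : Point) → Dec (q ∣ eval s v)
        L? s v = q ∣? eval s v

-- Blocks of primes ±1 modulo 9 of substantial reciprocal sum

module Primes where

  open Residue using (root-residue)
  open Norm
  open Counting
  open Lattice
  open Parity using (length-injection)
  open import Data.List.Base using (List; []; _∷_; length; filter; map; cartesianProduct; cartesianProductWith; upTo)
  open import Data.List.Properties using (length-upTo; length-map; length-++; filter-all)
  open import Data.List.Membership.Propositional using (_∈_; find; lose)
  open import Data.List.Membership.Propositional.Properties
  open import Data.Nat.Properties using (_≟_)
  open import Data.List.Membership.DecPropositional _≟_ using (_∈?_)
  open import Data.List.Relation.Unary.All as All using (All; []; _∷_)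
  open import Data.List.Relation.Unary.Any as Any using (Any; here; there; any?)
  open import Data.List.Relation.Unary.Unique.Propositional using (Unique)
  import Data.List.Relation.Unary.Unique.Propositional.Properties as Unique
  open import Data.Nat.Base
  open import Data.Nat.DivMod
  open import Data.Nat.Divisibility
  open import Data.Nat.ListAction using (sum; product)
  open import Data.Nat.Primality using (Prime; prime?; prime⇒nonTrivial)
  open import Data.Nat.Primality.Factorisation using (factorise)
  open import Data.Nat.Properties
  open import Data.Nat.Tactic.RingSolver using (solve-∀)
  open import Data.Product.Base using (_×_; _,_; proj₁; proj₂; ∃-syntax)
  open import Data.Sum.Base using (_⊎_; inj₁; inj₂)
  open import Data.Unit.Base using (tt)
  open import Relation.Binary.PropositionalEquality hiding (J)
  open import Relation.Nullary using (¬_; Dec; yes; no; contradiction)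
  open import Relation.Nullary.Decidable using (decidable-stable; _×-dec_; _⊎-dec_)

  prime-divisor : ∀ n → 2 ≤ n → ∃[ p ] (Prime p × p ∣ n)
  prime-divisor n@(suc _) 2≤n with factorise n
  ... | record { factors = []     ; isFactorisation = e } = contradiction 2≤n (subst (λ m → ¬ 2 ≤ m) (sym e) λ { (s≤s ()) })
  ... | record { factors = p ∷ ps ; isFactorisation = e ; factorsPrime = p-prime ∷ _ } = p , p-prime , subst (p ∣_) (sym e) (m∣m*n (product ps))

  -- smooths Y L contains every integer below 2^L without prime factors exceeding Y
  smooths : ℕ → ℕ → List ℕ
  smooths zero    L = 1 ∷ []
  smooths (suc Y) L = cartesianProductWith (λ e m → suc Y ^ e * m) (upTo (suc L)) (smooths Y L)

  length-smooths : ∀ Y L → length (smooths Y L) ≡ suc L ^ Y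
  length-smooths zero    L = refl
  length-smooths (suc Y) L = trans (go (upTo (suc L))) (cong₂ _*_ (length-upTo (suc L)) (length-smooths Y L))
    where
    go : ∀ es → length (cartesianProductWith (λ e m → suc Y ^ e * m) es (smooths Y L)) ≡ length es * length (smooths Y L)
    go []       = refl
    go (e ∷ es) = trans (length-++ (map (λ m → suc Y ^ e * m) (smooths Y L))) (cong₂ _+_ (length-map _ (smooths Y L)) (go es))

  private
    ring₁₀ : ∀ d x m → x * m * d ≡ d * x * m
    ring₁₀ = solve-∀

  -- Each division by d ≥ 2 at least halves n, so fewer than L + 1 divisions are possible. This
  -- bounds the choices per prime in `smooths`.
  strip : ∀ d → 2 ≤ d → ∀ L n → 0 < n → n < 2 ^ L → ∃[ e ] ∃[ m ] (e ≤ L × n ≡ d ^ e * m × ¬ d ∣ m × 0 < m)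
  strip d 2≤d zero    n 0<n n<1 = contradiction (n<1⇒n≡0 n<1) (>⇒≢ 0<n)
  strip d 2≤d (suc L) n 0<n n< with d ∣? n
  ... | no ∤n = 0 , n , z≤n , sym (+-identityʳ n) , ∤n , 0<n
  ... | yes (divides (suc n′) refl) with strip d 2≤d L (suc n′) z<s
          (*-cancelˡ-< 2 (suc n′) (2 ^ L) (≤-<-trans (≤-trans (≤-reflexive (*-comm 2 (suc n′))) (*-monoʳ-≤ (suc n′) 2≤d)) n<))
  ...   | e , m , e≤L , n≡ , ∤m , 0<m = suc e , m , s≤s e≤L , trans (cong (_* d) n≡) (ring₁₀ d (d ^ e) m) , ∤m , 0<m

  ∈-smooths : ∀ Y L n → 0 < n → n < 2 ^ L → (∀ p → Prime p → p ∣ n → p ≤ Y) → n ∈ smooths Y L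
  ∈-smooths zero L (suc zero) _ _ _ = here refl
  ∈-smooths zero L n@(suc (suc _)) _ _ h with prime-divisor n (s≤s (s≤s z≤n))
  ... | p , p-prime , p∣n = contradiction (h p p-prime p∣n) (<⇒≱ (≤-trans (s≤s z≤n) (nonTrivial⇒n>1 p {{prime⇒nonTrivial p-prime}})))
  ∈-smooths (suc Y) L n 0<n n< h with prime? (suc Y)
  ... | no ¬prime = subst (_∈ smooths (suc Y) L) (+-identityʳ n)
          (∈-cartesianProductWith⁺ (λ e m → suc Y ^ e * m) (∈-upTo⁺ {suc L} z<s) (∈-smooths Y L n 0<n n< smaller))
    where
    smaller : ∀ p → Prime p → p ∣ n → p ≤ Y
    smaller p p-prime p∣n with m≤n⇒m<n∨m≡n (h p p-prime p∣n)
    ... | inj₁ (s≤s p≤Y) = p≤Y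
    ... | inj₂ refl      = contradiction p-prime ¬prime
  ... | yes Y-prime with strip (suc Y) (nonTrivial⇒n>1 (suc Y) {{prime⇒nonTrivial Y-prime}}) L n 0<n n<
  ...   | e , m , e≤L , refl , ∤m , 0<m = ∈-cartesianProductWith⁺ (λ e m → suc Y ^ e * m) (∈-upTo⁺ {suc L} (s≤s e≤L))
            (∈-smooths Y L m 0<m (≤-<-trans (m≤n*m m (suc Y ^ e) {{m^n≢0 (suc Y) e}}) n<) smaller)
    where
    smaller : ∀ p → Prime p → p ∣ m → p ≤ Y
    smaller p p-prime p∣m with m≤n⇒m<n∨m≡n (h p p-prime (∣n⇒∣m*n (suc Y ^ e) p∣m))
    ... | inj₁ (s≤s p≤Y) = p≤Y
    ... | inj₂ refl      = contradiction p∣m ∤m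

  from-2 : ℕ → List ℕ
  from-2 zero    = []
  from-2 (suc n) = 2 + n ∷ from-2 n

  ∈-from-2 : ∀ n {d} → 2 ≤ d → d ≤ suc n → d ∈ from-2 n
  ∈-from-2 zero    2≤d d≤ = contradiction 2≤d (≤⇒≯ d≤)
  ∈-from-2 (suc n) 2≤d d≤ with m≤n⇒m<n∨m≡n d≤
  ... | inj₁ (s≤s d≤′) = there (∈-from-2 n 2≤d d≤′)
  ... | inj₂ refl      = here refl

  private
    ring₁ : ∀ a C → 2 * (a * a * a + C) ≡ a * 2 * (a * a) + 2 * C
    ring₁ = solve-∀
    ring₂ : ∀ n a S → (1 + n) * ((2 + n) * (a * a + S)) ≡ (1 + n) * (2 + n) * (a * a) + (2 + n) * ((1 + n) * S)
    ring₂ = solve-∀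
    ring₃ : ∀ n a → (2 + n) * (2 + n) * (a * a) ≡ (a * (2 + n)) * (a * (2 + n))
    ring₃ = solve-∀
    ring₄ : ∀ n X → X + (2 + n) * (n * X) ≡ (1 + n) * ((1 + n) * X)
    ring₄ = solve-∀

  module _ (T : ℕ) where
    -- T / d, with the junk value 0 at d = 0
    quot : ℕ → ℕ
    quot zero    = 0
    quot (suc d) = T / suc d

    quot-* : ∀ d → quot d * d ≤ T
    quot-* zero    = z≤n
    quot-* (suc d) = m/n*n≤m T (suc d)

    -- The telescoping estimate 1/d² ≤ 1/(d - 1) - 1/d, summed from 2 to n + 1 and multiplied out.
    Σ-squares : ∀ n → suc n * sum (map (λ d → quot d * quot d) (from-2 n)) ≤ n * (T * T)
    Σ-squares zero    = z≤n
    Σ-squares (suc n) = *-cancelˡ-≤ (suc n) (begin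
      suc n * ((2 + n) * (a * a + S))                       ≡⟨ ring₂ n a S ⟩
      suc n * (2 + n) * (a * a) + (2 + n) * (suc n * S)     ≤⟨ +-mono-≤ (*-monoˡ-≤ (a * a) (*-monoˡ-≤ (2 + n) (n≤1+n (suc n)))) (*-monoʳ-≤ (2 + n) (Σ-squares n)) ⟩
      (2 + n) * (2 + n) * (a * a) + (2 + n) * (n * (T * T)) ≡⟨ cong (_+ (2 + n) * (n * (T * T))) (ring₃ n a) ⟩
      (a * (2 + n)) * (a * (2 + n)) + (2 + n) * (n * (T * T)) ≤⟨ +-monoˡ-≤ _ (*-mono-≤ (quot-* (2 + n)) (quot-* (2 + n))) ⟩
      T * T + (2 + n) * (n * (T * T))                       ≡⟨ ring₄ n (T * T) ⟩
      suc n * (suc n * (T * T))                             ∎)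
      where
      open ≤-Reasoning
      a = quot (2 + n)
      S = sum (map (λ d → quot d * quot d) (from-2 n))

    -- For d ≥ 2 one of the three factors is at most T/2, and the squares add up to at most T².
    -- Hence at least half of the box is primitive.
    Σ-cubes : ∀ n → 2 * sum (map (λ d → quot d * quot d * quot d) (from-2 n)) ≤ T * T * T
    Σ-cubes n = ≤-trans (go n) (≤-trans (*-monoʳ-≤ T (*-cancelˡ-≤ (suc n) (≤-trans (Σ-squares n) (*-monoˡ-≤ (T * T) (n≤1+n n))))) (≤-reflexive (sym (*-assoc T T T))))
      where
      go : ∀ n → 2 * sum (map (λ d → quot d * quot d * quot d) (from-2 n)) ≤ T * sum (map (λ d → quot d * quot d) (from-2 n))
      go zero    = z≤n
      go (suc n) = begin
        2 * (a * a * a + C)     ≡⟨ ring₁ a C ⟩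
        a * 2 * (a * a) + 2 * C ≤⟨ +-mono-≤ (*-monoˡ-≤ (a * a) (≤-trans (*-monoʳ-≤ a (s≤s (s≤s z≤n))) (quot-* (2 + n)))) (go n) ⟩
        T * (a * a) + T * S     ≡⟨ *-distribˡ-+ T (a * a) S ⟨
        T * (a * a + S)         ∎
        where
        open ≤-Reasoning
        a = quot (2 + n)
        C = sum (map (λ d → quot d * quot d * quot d) (from-2 n))
        S = sum (map (λ d → quot d * quot d) (from-2 n))

    count-Divides : ∀ d → count (Divides? d) (box T) ≤ quot d * quot d * quot d
    count-Divides zero    = ≤-reflexive (cong length (filter-none′ (box T)))
      where
      filter-none′ : ∀ vs → filter (Divides? 0) vs ≡ []
      filter-none′ []       = refl
      filter-none′ (v ∷ vs) with Divides? 0 v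
      ... | yes (d , _) = contradiction (0∣⇒≡0 d) λ ()
      ... | no  _       = filter-none′ vs
    count-Divides d@(suc _) = ≤-trans (length-injection f (Unique.filter⁺ (Divides? d) (box-unique T)) into injective) (≤-reflexive (length-box (T / d)))
      where
      f : Point → Point
      f (x , y , z) = suc x / d ∸ 1 , suc y / d ∸ 1 , suc z / d ∸ 1
      positive : ∀ {x} → d ∣ suc x → 0 < suc x / d
      positive {x} d∣x = m≥n⇒m/n>0 (∣⇒≤ d∣x)
      small : ∀ {x} → x < T → d ∣ suc x → suc x / d ∸ 1 < T / d
      small x<T d∣x = <-≤-trans (∸-monoʳ-< z<s (positive d∣x)) (/-monoˡ-≤ d x<T)
      into : ∀ {v} → v ∈ filter (Divides? d) (box T) → f v ∈ box (T / d)
      into v∈ with ∈-filter⁻ (Divides? d) {xs = box T} v∈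
      ... | v∈box , (dx , dy , dz) with box-∈ T v∈box
      ...   | x< , y< , z< = ∈-box (T / d) (small x< dx) (small y< dy) (small z< dz)
      cancel : ∀ {x x′} → d ∣ suc x → d ∣ suc x′ → suc x / d ∸ 1 ≡ suc x′ / d ∸ 1 → x ≡ x′
      cancel {x} {x′} dx dx′ e = suc-injective (trans (sym (m/n*n≡m dx)) (trans (cong (_* d) (trans (sym (m∸n+n≡m (positive dx)))
        (trans (cong (_+ 1) e) (m∸n+n≡m (positive dx′))))) (m/n*n≡m dx′)))
      injective : ∀ {v w} → v ∈ filter (Divides? d) (box T) → w ∈ filter (Divides? d) (box T) → f v ≡ f w → v ≡ w
      injective v∈ w∈ e with ∈-filter⁻ (Divides? d) {xs = box T} v∈ | ∈-filter⁻ (Divides? d) {xs = box T} w∈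
      ... | _ , (dx , dy , dz) | _ , (dx′ , dy′ , dz′) =
        cong₂ _,_ (cancel dx dx′ (cong proj₁ e)) (cong₂ _,_ (cancel dy dy′ (cong (λ v → proj₁ (proj₂ v)) e)) (cancel dz dz′ (cong (λ v → proj₂ (proj₂ v)) e)))

    -- By `normℕ-injective` a point is determined by y, z and its norm, so each listed value costs
    -- only T² points.
    count-norm∈ : ∀ ns → count (λ v → N v ∈? ns) (box T) ≤ T * T * length ns
    count-norm∈ ns = ≤-trans (length-injection f (Unique.filter⁺ (λ v → N v ∈? ns) (box-unique T)) into injective)
      (≤-reflexive (trans (length-cartesianProduct (upTo T) _) (trans (cong₂ _*_ (length-upTo T)
        (trans (length-cartesianProduct (upTo T) ns) (cong (_* length ns) (length-upTo T)))) (sym (*-assoc T T _)))))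
      where
      f : Point → ℕ × ℕ × ℕ
      f v@(x , y , z) = y , z , N v
      into : ∀ {v} → v ∈ filter (λ v → N v ∈? ns) (box T) → f v ∈ cartesianProduct (upTo T) (cartesianProduct (upTo T) ns)
      into v∈ with ∈-filter⁻ (λ v → N v ∈? ns) {xs = box T} v∈
      ... | v∈box , n∈ with box-∈ T v∈box
      ...   | x< , y< , z< = ∈-cartesianProduct⁺ (∈-upTo⁺ y<) (∈-cartesianProduct⁺ (∈-upTo⁺ z<) n∈)
      injective : ∀ {v w} → v ∈ filter (λ v → N v ∈? ns) (box T) → w ∈ filter (λ v → N v ∈? ns) (box T) → f v ≡ f w → v ≡ w
      injective {x , y , z} {x′ , y′ , z′} _ _ e with cong proj₁ e | cong (λ v → proj₁ (proj₂ v)) e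
      ... | refl | refl = cong (_, y , z) (suc-injective (normℕ-injective (suc x) (suc x′) (suc y) (suc z) (cong (λ v → proj₂ (proj₂ v)) e)))

  Residue : ℕ → Set
  Residue p = p % 9 ≡ 1 ⊎ p % 9 ≡ 8

  opaque
    K : ℕ
    K = 4104

    K-≡ : 4104 ≡ K
    K-≡ = refl

  -- With `weight-≤` bounding each weight by K W / p, `total` says that the reciprocals of the
  -- primes add up to at least 1/(4K), independently of `Y`, without fractions.
  record PrimeBlock (Y : ℕ) : Set where
    field
      primes   : List ℕ
      unique   : Unique primes
      prime    : ∀ {p} → p ∈ primes → Prime p
      residue  : ∀ {p} → p ∈ primes → Residue p
      large    : ∀ {p} → p ∈ primes → Y < p
      W        : ℕ
      W>0      : 0 < W
      weight   : ℕ → ℕ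
      weight-≤ : ∀ {p} → p ∈ primes → weight p * p ≤ K * W
      total    : W ≤ 4 * sum (map weight primes)

  private
    ring₅ : ∀ Y → 2 + (4 + (2 + Y + (2 + Y))) * Y + (14 + 2 * Y * Y + 8 * Y) ≡ (2 * (2 + Y)) * (2 * (2 + Y))
    ring₅ = solve-∀

  -- The box will have side T = 2^t and the list of smooth numbers (9 + 3t)^Y entries, each the norm
  -- of at most T² points; the inequality keeps these to a quarter of the box. Taking t itself a
  -- power of 2 reduces it to one between exponents.
  parameters : ∀ Y → ∃[ t ] 4 * (9 + 3 * t) ^ Y ≤ 2 ^ t
  parameters Y = t , (begin
    4 * (9 + 3 * t) ^ Y              ≤⟨ *-monoʳ-≤ 4 (^-monoˡ-≤ Y small) ⟩
    4 * (2 ^ (4 + j)) ^ Y            ≡⟨ cong (4 *_) (^-*-assoc 2 (4 + j) Y) ⟩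
    2 ^ 2 * 2 ^ ((4 + j) * Y)        ≡⟨ ^-distribˡ-+-* 2 2 ((4 + j) * Y) ⟨
    2 ^ (2 + (4 + j) * Y)            ≤⟨ ^-monoʳ-≤ 2 exponent ⟩
    2 ^ t                            ∎)
    where
    open ≤-Reasoning
    n<2^n : ∀ n → n < 2 ^ n
    n<2^n zero    = s≤s z≤n
    n<2^n (suc n) = ≤-trans (+-mono-≤ (≤-trans (s≤s z≤n) (n<2^n n)) (n<2^n n)) (≤-reflexive (cong (2 ^ n +_) (sym (+-identityʳ (2 ^ n)))))
    m = 2 + Y
    j = m + m
    t = 2 ^ j
    small : 9 + 3 * t ≤ 2 ^ (4 + j)
    small = ≤-trans (+-monoˡ-≤ (3 * t) (*-monoʳ-≤ 9 (m^n>0 2 j))) (≤-trans (≤-reflexive (sym (*-distribʳ-+ t 9 3)))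
      (≤-trans (*-monoˡ-≤ t {12} {16} (s≤s (s≤s (s≤s (s≤s (s≤s (s≤s (s≤s (s≤s (s≤s (s≤s (s≤s (s≤s z≤n))))))))))))) (≤-reflexive (sym (^-distribˡ-+-* 2 4 j)))))
    double : ∀ m → 0 < m → 2 * m ≤ 2 ^ m
    double (suc m) _ = *-monoʳ-≤ 2 (n<2^n m)
    exponent : 2 + (4 + j) * Y ≤ t
    exponent = begin
      2 + (4 + j) * Y      ≤⟨ ≤-trans (m≤m+n _ (14 + 2 * Y * Y + 8 * Y)) (≤-reflexive (ring₅ Y)) ⟩
      (2 * m) * (2 * m)    ≤⟨ *-mono-≤ (double m z<s) (double m z<s) ⟩
      2 ^ m * 2 ^ m        ≡⟨ ^-distribˡ-+-* 2 m m ⟨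
      t                    ∎

  private
    ring₆ : ∀ t → 3 * t ≡ t + t + t
    ring₆ = solve-∀
    ring₇ : ∀ a b → 4 * (a * b) ≡ a * (4 * b)
    ring₇ = solve-∀
    ring₈ : ∀ W → 2 * W + W + W ≡ 4 * W
    ring₈ = solve-∀
    ring₉ : ∀ a b c → 4 * (a + (b + c)) ≡ 2 * (2 * a) + 4 * b + 4 * c
    ring₉ = solve-∀

  prime-block : ∀ Y → 3 ≤ Y → PrimeBlock Y
  prime-block Y 3≤Y = record
    { primes   = ps
    ; unique   = Unique.filter⁺ good? (Unique.upTo⁺ (suc (171 * W)))
    ; prime    = λ p∈ → proj₁ (proj₂ (ps-good p∈))
    ; residue  = λ p∈ → proj₂ (proj₂ (ps-good p∈))
    ; large    = λ p∈ → proj₁ (ps-good p∈)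
    ; W        = W
    ; W>0      = *-mono-≤ (*-mono-≤ T>0 T>0) T>0
    ; weight   = λ p → count (Proper? p) (box T)
    ; weight-≤ = λ {p} p∈ → subst (λ K → count (Proper? p) (box T) * p ≤ K * W) K-≡ (proper-count (proj₁ (proj₂ (ps-good p∈))) T (≤-trans (s≤s z≤n) (proj₁ (ps-good p∈)))
                   (s≤s⁻¹ (∈-upTo⁻ (proj₁ (∈-filter⁻ good? {xs = upTo (suc (171 * W))} p∈)))))
    ; total    = total
    }
    where
    t = proj₁ (parameters Y)
    T = 2 ^ t
    W = T * T * T
    -- 171 < 2^8, so that the norms, at most 171 T³, lie below 2^L.
    L = 8 + 3 * t
    T>0 : 0 < T
    T>0 = m^n>0 2 t

    good? : ∀ p → Dec (Y < p × Prime p × Residue p)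
    good? p = (Y <? p) ×-dec prime? p ×-dec ((p % 9 ≟ 1) ⊎-dec (p % 9 ≟ 8))
    ps = filter good? (upTo (suc (171 * W)))
    ps-good : ∀ {p} → p ∈ ps → Y < p × Prime p × Residue p
    ps-good p∈ = proj₂ (∈-filter⁻ good? {xs = upTo (suc (171 * W))} p∈)

    -- The divisors 2, ..., T; the coordinates, shifted by 1, do not exceed T.
    ds = from-2 (T ∸ 1)
    2^L : 171 * W < 2 ^ L
    2^L = <-≤-trans (*-monoˡ-< W {{>-nonZero (*-mono-≤ (*-mono-≤ T>0 T>0) T>0)}} {171} {256} (m≤m+n 172 84)) (≤-reflexive (sym (trans (^-distribˡ-+-* 2 8 (3 * t))
      (cong (256 *_) (trans (cong (2 ^_) (ring₆ t)) (trans (^-distribˡ-+-* 2 (t + t) t) (cong (_* T) (^-distribˡ-+-* 2 t t))))))))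

    A? : ∀ v → Dec (Any (λ d → Divides d v) ds)
    A? v = any? (λ d → Divides? d v) ds
    B? : ∀ v → Dec (N v ∈ smooths Y L)
    B? v = N v ∈? smooths Y L
    C? : ∀ v → Dec (Any (λ p → p ∣ N v × ¬ Divides p v) ps)
    C? v = any? (λ p → Proper? p v) ps

    N-positive : ∀ v → 0 < N v
    N-positive (x , y , z) = normℕ>0 x y z

    cover : ∀ {v} → v ∈ box T → Any (λ d → Divides d v) ds ⊎ (N v ∈ smooths Y L ⊎ Any (λ p → p ∣ N v × ¬ Divides p v) ps)
    cover {v} v∈ = cases (A? v) (C? v)
      where
      bounds = box-∈ T v∈
      N≤ : N v ≤ 171 * W
      N≤ = normℕ-bound T _ _ _ (proj₁ bounds) (proj₁ (proj₂ bounds)) (proj₂ (proj₂ bounds))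
      -- No prime divides all coordinates of a primitive vector, so p divides its norm properly;
      -- this yields a root of `g` modulo p and with it the residue class.
      large-divisor : ¬ Any (λ d → Divides d v) ds → ∀ p → Prime p → p ∣ N v → ¬ p ≤ Y → Any (λ p → p ∣ N v × ¬ Divides p v) ps
      large-divisor ¬a p p-prime p∣ p≰Y = lose p∈ (p∣ , ∤v)
        where
        ∤v : ¬ Divides p v
        ∤v d = ¬a (lose (∈-from-2 (T ∸ 1) (nonTrivial⇒n>1 p {{prime⇒nonTrivial p-prime}})
          (≤-trans (∣⇒≤ (proj₁ d)) (≤-trans (proj₁ bounds) (≤-reflexive (sym (m+[n∸m]≡n T>0)))))) d)
        p∈ : p ∈ ps
        p∈ = ∈-filter⁺ good? (∈-upTo⁺ {suc (171 * W)} (s≤s (≤-trans (∣⇒≤ {{>-nonZero (N-positive v)}} p∣) N≤)))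
          (≰⇒> p≰Y , p-prime , root-residue p-prime (proj₁ root) (proj₂ root) (≤-<-trans 3≤Y (≰⇒> p≰Y)))
          where root = proper-root p-prime v (p∣ , ∤v)
      cases : Dec (Any (λ d → Divides d v) ds) → Dec (Any (λ p → p ∣ N v × ¬ Divides p v) ps) →
        Any (λ d → Divides d v) ds ⊎ (N v ∈ smooths Y L ⊎ Any (λ p → p ∣ N v × ¬ Divides p v) ps)
      cases (yes a) _       = inj₁ a
      cases (no _)  (yes c) = inj₂ (inj₂ c)
      cases (no ¬a) (no ¬c) = inj₂ (inj₁ (∈-smooths Y L (N v) (N-positive v) (≤-<-trans N≤ 2^L)
        λ p p-prime p∣ → decidable-stable (p ≤? Y) λ p≰Y → ¬c (large-divisor ¬a p p-prime p∣ p≰Y)))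

    countA = count A? (box T)
    countB = count B? (box T)
    countC = count C? (box T)

    all-covered : W ≤ countA + (countB + countC)
    all-covered = subst (_≤ countA + (countB + countC)) (trans (cong length (filter-all (λ _ → yes tt) (All.universal (λ _ → tt) (box T)))) (length-box T))
      (≤-trans (count-cover (λ _ → yes tt) A? (λ v → B? v ⊎-dec C? v) (box T) (λ v∈ _ → cover v∈))
        (+-monoʳ-≤ countA (count-cover (λ v → B? v ⊎-dec C? v) B? C? (box T) (λ _ h → h))))

    A-bound : 2 * countA ≤ W
    A-bound = ≤-trans (*-monoʳ-≤ 2 (≤-trans (count-coverΣ A? Divides? ds (box T) (λ _ a → find a)) (sum-mono ds))) (Σ-cubes T (T ∸ 1))
      where
      sum-mono : ∀ ds → sum (map (λ d → count (Divides? d) (box T)) ds) ≤ sum (map (λ d → quot T d * quot T d * quot T d) ds)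
      sum-mono []       = z≤n
      sum-mono (d ∷ ds) = +-mono-≤ (count-Divides T d) (sum-mono ds)

    B-bound : 4 * countB ≤ W
    B-bound = begin
      4 * countB                        ≤⟨ *-monoʳ-≤ 4 (count-norm∈ T (smooths Y L)) ⟩
      4 * (T * T * length (smooths Y L)) ≡⟨ cong (λ n → 4 * (T * T * n)) (length-smooths Y L) ⟩
      4 * (T * T * suc L ^ Y)           ≡⟨ ring₇ (T * T) (suc L ^ Y) ⟩
      T * T * (4 * suc L ^ Y)           ≤⟨ *-monoʳ-≤ (T * T) (proj₂ (parameters Y)) ⟩
      T * T * T                         ∎
      where
      open ≤-Reasoning

    C-bound : countC ≤ sum (map (λ p → count (Proper? p) (box T)) ps)
    C-bound = count-coverΣ C? Proper? ps (box T) (λ _ c → find c)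

    -- Half of the box at most is imprimitive and a quarter at most has smooth norm, which leaves a
    -- quarter to be covered by the primes of the block.
    total : W ≤ 4 * sum (map (λ p → count (Proper? p) (box T)) ps)
    total = +-cancelˡ-≤ (2 * W + W) _ _ (begin
      2 * W + W + W                                  ≡⟨ ring₈ W ⟩
      4 * W                                          ≤⟨ *-monoʳ-≤ 4 all-covered ⟩
      4 * (countA + (countB + countC))               ≡⟨ ring₉ countA countB countC ⟩
      2 * (2 * countA) + 4 * countB + 4 * countC     ≤⟨ +-mono-≤ (+-mono-≤ (*-monoʳ-≤ 2 A-bound) B-bound) (*-monoʳ-≤ 4 C-bound) ⟩
      2 * W + W + 4 * sum (map (λ p → count (Proper? p) (box T)) ps) ∎)
      where
      open ≤-Reasoning

-- The sieve and the limit

module Density where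

  open import Defs using (b; ℤ⟦q⟧; Lim; LacunaryMod; zerosMod)
  open Partition using (odd)
  open Parity using (length-injection)
  open Counting
  open Primes
  open Divisors using (b₉-even)
  open import Data.Bool.Base using (true; false)
  import Data.Bool.Properties
  open import Data.Unit.Base using (tt)
  import Data.Integer.Base as ℤ
  import Data.Integer.Properties as ℤ
  import Data.Integer.Divisibility.Signed as ℤ
  open import Data.List.Base using (List; []; _∷_; _++_; length; filter; map; cartesianProduct; upTo)
  open import Data.List.Properties using (length-upTo; length-filter; filter-all; map-++)
  open import Data.List.Membership.Propositional using (_∈_; _∉_)
  open import Data.List.Membership.Propositional.Properties
  open import Data.List.Relation.Unary.All as All using (All; []; _∷_; all?)
  import Data.List.Relation.Unary.All.Properties as All
  open import Data.List.Relation.Unary.All.Properties using (All¬⇒¬Any)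
  open import Data.List.Relation.Unary.AllPairs using ([]; _∷_)
  open import Data.List.Relation.Unary.Any using (here; there)
  open import Data.List.Relation.Unary.Unique.Propositional using (Unique)
  import Data.List.Relation.Unary.Unique.Propositional.Properties as Unique
  open import Data.Nat.Base
  open import Data.Nat.Coprimality using (Coprime; coprime-divisor)
  open import Data.Nat.DivMod
  open import Data.Nat.Divisibility
  open import Data.Nat.ListAction using (sum; product)
  open import Data.Nat.ListAction.Properties using (product-++; ∈⇒∣product)
  open import Data.Nat.Primality using (Prime; prime⇒nonTrivial; prime⇒nonZero; prime⇒irreducible; euclidsLemma; ¬prime[1])
  open import Data.Nat.Properties
  open import Data.Nat.Tactic.RingSolver using (solve-∀)
  open import Data.Product.Base using (_×_; _,_; proj₁; proj₂; ∃-syntax)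
  import Data.Rational.Base as ℚ
  import Data.Rational.Properties as ℚ
  import Data.Rational.Unnormalised.Base as ℚᵘ
  import Data.Rational.Unnormalised.Properties as ℚᵘ
  open import Data.Sum.Base using (_⊎_; inj₁; inj₂; reduce)
  open import Relation.Binary.PropositionalEquality hiding (J)
  open import Relation.Nullary using (¬_; Dec; yes; contradiction; ¬?)
  open import Relation.Nullary.Decidable using (_×-dec_)

  ≡-mod⇒∣ : ∀ a c d .{{_ : NonZero d}} → a % d ≡ c % d → d ∣ ∣ a - c ∣
  ≡-mod⇒∣ a c d e = divides ∣ a / d - c / d ∣ (trans (cong₂ ∣_-_∣ (m≡m%n+[m/n]*n a d) (trans (m≡m%n+[m/n]*n c d) (cong (_+ c / d * d) (sym e))))
    (trans (∣m+n-m+o∣≡∣n-o∣ (a % d) _ _) (sym (*-distribʳ-∣-∣ d (a / d) (c / d)))))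

  ∣a-c∣<⇒≡ : ∀ a c d → a < d → c < d → d ∣ ∣ a - c ∣ → a ≡ c
  ∣a-c∣<⇒≡ a c d a< c< h with ∣ a - c ∣ in eq
  ... | zero  = ∣m-n∣≡0⇒m≡n eq
  ... | suc n = contradiction h (>⇒∤ (subst (_< d) eq (≤-<-trans (∣m-n∣≤m⊔n a c) (⊔-lub-< a< c<))))
    where
    ⊔-lub-< : ∀ {a c d} → a < d → c < d → a ⊔ c < d
    ⊔-lub-< {a} {c} a< c< with ≤-total a c
    ... | inj₁ a≤c = subst (_< _) (sym (m≤n⇒m⊔n≡n a≤c)) c<
    ... | inj₂ c≤a = subst (_< _) (sym (m≥n⇒m⊔n≡m c≤a)) a<

  prime∣prime : ∀ {p r} → Prime p → Prime r → p ∣ r → p ≡ r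
  prime∣prime p-prime r-prime d with prime⇒irreducible r-prime d
  ... | inj₁ refl = contradiction p-prime ¬prime[1]
  ... | inj₂ p≡r  = p≡r

  coprime-square : ∀ {p k} → Prime p → ¬ p ∣ k → Coprime (p * p) k
  coprime-square {p} {k} p-prime ∤k {zero} (0∣ , _) = contradiction (0∣⇒≡0 0∣) (≢-nonZero⁻¹ (p * p) {{m*n≢0 p p {{prime⇒nonZero p-prime}} {{prime⇒nonZero p-prime}}}})
  coprime-square p-prime ∤k {suc zero} _ = refl
  coprime-square {p} {k} p-prime ∤k {d@(suc (suc _))} (d∣p² , d∣k) with prime-divisor d (s≤s (s≤s z≤n))
  ... | r , r-prime , r∣d = contradiction (subst (_∣ k) (prime∣prime r-prime p-prime (reduce (euclidsLemma p p r-prime (∣-trans r∣d d∣p²)))) (∣-trans r∣d d∣k)) ∤k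

  _∥_ : ℕ → ℕ → Set
  p ∥ x = p ∣ x × ¬ p * p ∣ x

  _∥?_ : ∀ p x → Dec (p ∥ x)
  p ∥? x = (p ∣? x) ×-dec ¬? (p * p ∣? x)

  Avoids : List ℕ → ℕ → Set
  Avoids ps n = All (λ p → ¬ p ∥ (12 * n + 1)) ps

  avoids? : ∀ ps n → Dec (Avoids ps n)
  avoids? ps n = all? (λ p → ¬? (p ∥? (12 * n + 1))) ps

  -- Of the p² residues modulo p², exactly p - 1 are divisible by p and not by p²; the other p(p -
  -- 1) + 1 survive the sieve.
  modulus survivors : List ℕ → ℕ
  modulus ps   = product (map (λ p → p * p) ps)
  survivors ps = product (map (λ p → p * (p ∸ 1) + 1) ps)

  record Admissible (ps : List ℕ) : Set where
    field
      unique  : Unique ps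
      prime   : All Prime ps
      residue : All Residue ps
      large   : All (3 <_) ps

  modulus≢0 : ∀ ps → All Prime ps → NonZero (modulus ps)
  modulus≢0 []       []         = _
  modulus≢0 (p ∷ ps) (pr ∷ prs) = m*n≢0 (p * p) _ {{m*n≢0 p p {{prime⇒nonZero pr}} {{prime⇒nonZero pr}}}} {{modulus≢0 ps prs}}

  ∤modulus : ∀ {p} ps → Prime p → All Prime ps → p ∉ ps → ¬ p ∣ modulus ps
  ∤modulus []       p-prime _          _  p∣1 = contradiction (subst Prime (∣1⇒≡1 p∣1) p-prime) ¬prime[1]
  ∤modulus (r ∷ ps) p-prime (pr ∷ prs) p∉ p∣ with euclidsLemma (r * r) (modulus ps) p-prime p∣
  ... | inj₁ p∣r² = p∉ (here (prime∣prime p-prime pr (reduce (euclidsLemma r r p-prime p∣r²))))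
  ... | inj₂ p∣M  = ∤modulus ps p-prime prs (λ p∈ → p∉ (there p∈)) p∣M

  private
    ring₇ : ∀ p → (1 + p) * (1 + p) ≡ p + ((1 + p) * p + 1)
    ring₇ = solve-∀

  residues-count : ∀ p → Prime p → count (λ x → ¬? (p ∥? x)) (upTo (p * p)) ≤ p * (p ∸ 1) + 1
  residues-count p@(suc p′) p-prime = +-cancelˡ-≤ p′ _ _ (begin
    p′ + count (λ x → ¬? (p ∥? x)) (upTo (p * p))       ≤⟨ +-monoˡ-≤ _ multiples ⟩
    count (p ∥?_) (upTo (p * p)) + count (λ x → ¬? (p ∥? x)) (upTo (p * p)) ≡⟨ count-complement (p ∥?_) (upTo (p * p)) ⟩
    length (upTo (p * p))                               ≡⟨ length-upTo (p * p) ⟩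
    p * p                                               ≡⟨ ring₇ p′ ⟩
    p′ + (p * p′ + 1)                                   ∎)
    where
    open ≤-Reasoning
    multiples : p′ ≤ count (p ∥?_) (upTo (p * p))
    multiples = subst (_≤ count (p ∥?_) (upTo (p * p))) (length-upTo p′) (length-injection (λ i → p * suc i) (Unique.upTo⁺ p′) into
      (λ _ _ e → suc-injective (*-cancelˡ-≡ _ _ p e)))
      where
      into : ∀ {i} → i ∈ upTo p′ → p * suc i ∈ filter (p ∥?_) (upTo (p * p))
      into {i} i∈ = ∈-filter⁺ (p ∥?_) (∈-upTo⁺ (*-monoʳ-< p i<)) (m∣m*n (suc i) , λ d → >⇒∤ i< (*-cancelˡ-∣ p d))
        where i< = s≤s (∈-upTo⁻ i∈)

  ∥-≡-mod : ∀ {p x y} m .{{_ : NonZero m}} → p * p ∣ m → x % m ≡ y % m → p ∥ x → p ∥ y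
  ∥-≡-mod {p} {x} {y} m p²∣m e (p∣x , p²∤x) = transfer (∣-trans (m∣m*n p) p²∣m) e p∣x , λ d → p²∤x (transfer p²∣m (sym e) d)
    where
    transfer : ∀ {d x y} → d ∣ m → x % m ≡ y % m → d ∣ x → d ∣ y
    transfer d∣m e d∣x = ∣n∣m%n⇒∣m d∣m (subst (_ ∣_) e (%-presˡ-∣ d∣x d∣m))

  private
    ring₈ : ∀ r k m → 12 * (r + k * m) + 1 ≡ 12 * r + 1 + 12 * k * m
    ring₈ = solve-∀

  affine-mod : ∀ n m .{{_ : NonZero m}} → (12 * n + 1) % m ≡ (12 * (n % m) + 1) % m
  affine-mod n m = trans (cong (_% m) (trans (cong (λ n → 12 * n + 1) (m≡m%n+[m/n]*n n m)) (ring₈ (n % m) (n / m) m))) ([m+kn]%n≡m%n (12 * (n % m) + 1) (12 * (n / m)) m)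

  Avoids-mod : ∀ ps n m .{{_ : NonZero m}} → (∀ {p} → p ∈ ps → p * p ∣ m) → Avoids ps n → Avoids ps (n % m)
  Avoids-mod ps n m h av = All.tabulate λ p∈ ex → All.lookup av p∈ (∥-≡-mod m (h p∈) (sym (affine-mod n m)) ex)

  square∣modulus : ∀ {p ps} → p ∈ ps → p * p ∣ modulus ps
  square∣modulus {p} {ps} p∈ = ∈⇒∣product (∈-map⁺ (λ p → p * p) p∈)

  coprime-product : ∀ {d e x} → Coprime d e → d ∣ x → e ∣ x → d * e ∣ x
  coprime-product {d} {e} {x} coprime d∣x (divides y x≡ye) with coprime-divisor {n = e} {o = y} coprime (subst (d ∣_) (trans x≡ye (*-comm y e)) d∣x)
  ... | divides z y≡zd = divides z (trans x≡ye (trans (cong (_* e) y≡zd) (*-assoc z d e)))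

  cancel-affine : ∀ {d} a c {x y} → Coprime d a → d ∣ ∣ a * x + c - a * y + c ∣ → d ∣ ∣ x - y ∣
  cancel-affine {d} a c {x} {y} coprime h = coprime-divisor {n = a} {o = ∣ x - y ∣} coprime
    (subst (d ∣_) (trans (trans (cong₂ ∣_-_∣ (+-comm (a * x) c) (+-comm (a * y) c)) (∣m+n-m+o∣≡∣n-o∣ c (a * x) (a * y))) (sym (*-distribˡ-∣-∣ a x y))) h)

  -- Chinese remainder theorem: n is determined modulo p² modulus(ps) by n mod modulus(ps) and 12 n + 1 mod p².
  sieve : ∀ ps → Unique ps → All Prime ps → All (3 <_) ps → count (avoids? ps) (upTo (modulus ps)) ≤ survivors ps
  sieve []       _        _          _          = s≤s z≤n
  sieve (p ∷ ps) (p∉ ∷ u) (pr ∷ prs) (3<p ∷ ls) = ≤-trans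
    (length-injection f (Unique.filter⁺ (avoids? (p ∷ ps)) (Unique.upTo⁺ (p * p * M))) into injective)
    (≤-trans (≤-reflexive (length-cartesianProduct rs ss)) (*-mono-≤ (residues-count p pr) (sieve ps u prs ls)))
    where
    M = modulus ps
    instance
      p≢0 : NonZero p
      p≢0 = prime⇒nonZero pr
      p²≢0 : NonZero (p * p)
      p²≢0 = m*n≢0 p p
      M≢0 : NonZero M
      M≢0 = modulus≢0 ps prs
    rs = filter (λ x → ¬? (p ∥? x)) (upTo (p * p))
    ss = filter (avoids? ps) (upTo M)
    f : ℕ → ℕ × ℕ
    f n = (12 * n + 1) % (p * p) , n % M
    into : ∀ {n} → n ∈ filter (avoids? (p ∷ ps)) (upTo (p * p * M)) → f n ∈ cartesianProduct rs ss
    into {n} n∈ with ∈-filter⁻ (avoids? (p ∷ ps)) {xs = upTo (p * p * M)} n∈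
    ... | _ , (¬ex ∷ av) = ∈-cartesianProduct⁺
      (∈-filter⁺ (λ x → ¬? (p ∥? x)) (∈-upTo⁺ (m%n<n (12 * n + 1) (p * p))) λ ex → ¬ex (∥-≡-mod (p * p) ∣-refl (m%n%n≡m%n (12 * n + 1) (p * p)) ex))
      (∈-filter⁺ (avoids? ps) (∈-upTo⁺ (m%n<n n M)) (Avoids-mod ps n M square∣modulus av))
    -- From p > 3: 12 is invertible modulo p², so 12n + 1 determines n there.
    p∤12 : ¬ p ∣ 12
    p∤12 d with euclidsLemma 3 4 pr d
    ... | inj₁ d₃ = >⇒∤ 3<p d₃
    ... | inj₂ d₄ = >⇒∤ (<-trans (s≤s (s≤s (s≤s z≤n))) 3<p) (reduce (euclidsLemma 2 2 pr d₄))
    injective : ∀ {n n′} → n ∈ filter (avoids? (p ∷ ps)) (upTo (p * p * M)) → n′ ∈ filter (avoids? (p ∷ ps)) (upTo (p * p * M)) → f n ≡ f n′ → n ≡ n′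
    injective {n} {n′} n∈ n′∈ e = ∣a-c∣<⇒≡ n n′ (p * p * M) (below n∈) (below n′∈) product∣
      where
      below : ∀ {n} → n ∈ filter (avoids? (p ∷ ps)) (upTo (p * p * M)) → n < p * p * M
      below n∈ = ∈-upTo⁻ (proj₁ (∈-filter⁻ (avoids? (p ∷ ps)) {xs = upTo (p * p * M)} n∈))
      p²∣ : p * p ∣ ∣ n - n′ ∣
      p²∣ = cancel-affine 12 1 {n} {n′} (coprime-square pr p∤12) (≡-mod⇒∣ (12 * n + 1) (12 * n′ + 1) (p * p) (cong proj₁ e))
      product∣ : p * p * M ∣ ∣ n - n′ ∣
      product∣ = coprime-product (coprime-square pr (∤modulus ps pr prs (All¬⇒¬Any p∉))) p²∣ (≡-mod⇒∣ n n′ M (cong proj₂ e))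

  private
    ring₁ : ∀ p B c → ((1 + p) * p + 1) * (B + c) ≡ ((1 + p) * p + 1) * B + ((1 + p) * p + 1) * c
    ring₁ = solve-∀
    ring₂ : ∀ p B → ((1 + p) * p + 1) * B + p * B ≡ (1 + p) * (1 + p) * B
    ring₂ = solve-∀
    ring₃ : ∀ p c → p * (2 * (c * (1 + p))) ≡ ((1 + p) * p + (1 + p) * p) * c
    ring₃ = solve-∀
    ring₉ : ∀ x A u w S → x * A * (u + (w + S)) ≡ A * (x * (u + S + w))
    ring₉ = solve-∀
    ring₁₀ : ∀ a c d → a * (c * d) ≡ c * (a * d)
    ring₁₀ = solve-∀

  -- This replaces taking logarithms of a product of densities. Each density 1 - (p - 1)/p² is at
  -- most B/(B + w p) as soon as 2 p (w p) ≤ B; letting B start at 2U and grow by the weights makes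
  -- the quotients telescope to 2U/(2U + sum of weights).
  block-fraction : ∀ U (w : ℕ → ℕ) ps → All Prime ps → (∀ {p} → p ∈ ps → w p * p ≤ U) →
    survivors ps * (2 * U + sum (map w ps)) ≤ modulus ps * (2 * U)
  block-fraction U w []       _          _ = ≤-reflexive (cong (1 *_) (+-identityʳ (2 * U)))
  block-fraction U w (p ∷ ps) (pr ∷ prs) h = begin
    (p * (p ∸ 1) + 1) * A * (2 * U + (w p + S))       ≡⟨ ring₉ (p * (p ∸ 1) + 1) A (2 * U) (w p) S ⟩
    A * ((p * (p ∸ 1) + 1) * (2 * U + S + w p))       ≤⟨ *-monoʳ-≤ A (step p pr (2 * U + S) (≤-trans (*-monoʳ-≤ 2 (h (here refl))) (m≤m+n (2 * U) S))) ⟩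
    A * (p * p * (2 * U + S))                         ≡⟨ ring₁₀ A (p * p) (2 * U + S) ⟩
    p * p * (A * (2 * U + S))                         ≤⟨ *-monoʳ-≤ (p * p) (block-fraction U w ps prs (λ p∈ → h (there p∈))) ⟩
    p * p * (modulus ps * (2 * U))                    ≡⟨ *-assoc (p * p) (modulus ps) (2 * U) ⟨
    p * p * modulus ps * (2 * U)                      ∎
    where
    open ≤-Reasoning
    A = survivors ps
    S = sum (map w ps)
    step : ∀ p → Prime p → ∀ B → 2 * (w p * p) ≤ B → (p * (p ∸ 1) + 1) * (B + w p) ≤ p * p * B
    step p pr B le = go p (nonTrivial⇒n>1 p {{prime⇒nonTrivial pr}}) (w p) le
      where
      go : ∀ p → 1 < p → ∀ c → 2 * (c * p) ≤ B → (p * (p ∸ 1) + 1) * (B + c) ≤ p * p * B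
      go (suc p′) (s≤s 0<p′) c le = begin
        (suc p′ * p′ + 1) * (B + c)                          ≡⟨ ring₁ p′ B c ⟩
        (suc p′ * p′ + 1) * B + (suc p′ * p′ + 1) * c        ≤⟨ +-monoʳ-≤ _ bound ⟩
        (suc p′ * p′ + 1) * B + p′ * B                       ≡⟨ ring₂ p′ B ⟩
        suc p′ * suc p′ * B                                  ∎
        where
        bound : (suc p′ * p′ + 1) * c ≤ p′ * B
        bound = begin
          -- For p ≥ 2 the surviving residues number at most 2p(p - 1); this is where the 2 in the
          -- hypothesis on B goes.
          (suc p′ * p′ + 1) * c                     ≤⟨ *-monoˡ-≤ c (+-monoʳ-≤ (suc p′ * p′) (*-mono-≤ {1} {suc p′} {1} {p′} (s≤s z≤n) 0<p′)) ⟩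
          (suc p′ * p′ + suc p′ * p′) * c           ≡⟨ ring₃ p′ c ⟨
          p′ * (2 * (c * suc p′))                   ≤⟨ *-monoʳ-≤ p′ le ⟩
          p′ * B                                    ∎

  -- `block-fraction` with U = K W and weights of sum at least W/4 bounds the density by 2KW/(2KW +
  -- W/4) = 8K/(8K + 1).
  κ : ℕ
  κ = 8 * K

  private
    ring₁₁ : ∀ K A W → A * (8 * K + 1) * W ≡ 4 * (A * (2 * (K * W))) + A * W
    ring₁₁ = solve-∀
    ring₁₂ : ∀ A u S → 4 * (A * u) + A * (4 * S) ≡ 4 * (A * (u + S))
    ring₁₂ = solve-∀
    ring₁₃ : ∀ K M W → 4 * (M * (2 * (K * W))) ≡ 8 * K * M * W
    ring₁₃ = solve-∀

  block-ratio : ∀ {Y} (β : PrimeBlock Y) → survivors (PrimeBlock.primes β) * (κ + 1) ≤ κ * modulus (PrimeBlock.primes β)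
  block-ratio β = *-cancelʳ-≤ _ _ W {{>-nonZero W>0}} (begin
    A * (κ + 1) * W                           ≡⟨ ring₁₁ K A W ⟩
    4 * (A * (2 * (K * W))) + A * W        ≤⟨ +-monoʳ-≤ _ (*-monoʳ-≤ A total) ⟩
    4 * (A * (2 * (K * W))) + A * (4 * S)  ≡⟨ ring₁₂ A (2 * (K * W)) S ⟩
    4 * (A * (2 * (K * W) + S))            ≤⟨ *-monoʳ-≤ 4 (block-fraction (K * W) weight primes (All.tabulate prime) weight-≤) ⟩
    4 * (M * (2 * (K * W)))                ≡⟨ ring₁₃ K M W ⟩
    κ * M * W                                 ∎)
    where
    open ≤-Reasoning
    open PrimeBlock β
    A = survivors primes
    M = modulus primes
    S = sum (map weight primes)

  κ>0 : 0 < κ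
  κ>0 = *-mono-≤ {1} {8} {1} {K} (s≤s z≤n) (subst (1 ≤_) K-≡ (s≤s z≤n))

  ∈⇒≤sum : ∀ {x xs} → x ∈ xs → x ≤ sum xs
  ∈⇒≤sum (here refl) = m≤m+n _ _
  ∈⇒≤sum {xs = y ∷ xs} (there x∈) = ≤-trans (∈⇒≤sum x∈) (m≤n+m (sum xs) y)

  product-map-++ : ∀ (h : ℕ → ℕ) xs ys → product (map h (xs ++ ys)) ≡ product (map h xs) * product (map h ys)
  product-map-++ h xs ys = trans (cong product (map-++ h xs ys)) (product-++ (map h xs) (map h ys))

  private
    ring₄ : ∀ κ A A′ k → κ * (A * A′ * (κ + (1 + k))) + A * A′ * k ≡ (A * (κ + 1)) * (A′ * (κ + k))
    ring₄ = solve-∀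
    ring₅ : ∀ κ M M′ → (κ * M) * (κ * M′) ≡ κ * (κ * (M * M′))
    ring₅ = solve-∀
    ring₁₄ : ∀ κ → 1 * (κ + 0) ≡ κ * 1
    ring₁₄ = solve-∀

  -- A new block multiplies the density by at most κ/(κ + 1), and (κ + 1)(κ + k) ≥ κ(κ + k + 1). The
  -- resulting bound κ/(κ + k) tends to 0.
  sparse : ∀ k → ∃[ ps ] (Admissible ps × survivors ps * (κ + k) ≤ κ * modulus ps)
  sparse zero    = [] , record { unique = [] ; prime = [] ; residue = [] ; large = [] } , ≤-reflexive (ring₁₄ κ)
  sparse (suc k) with sparse k
  ... | ps , adm , ratio = qs ++ ps , adm′ , ratio′
    where
    -- No prime of `ps` exceeds their sum, so the primes of the new block are different ones, and
    -- the 3 makes them exceed 3.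
    β = prime-block (3 + sum ps) (m≤m+n 3 (sum ps))
    open PrimeBlock β using () renaming (primes to qs)
    module β = PrimeBlock β
    open Admissible
    adm′ : Admissible (qs ++ ps)
    adm′ = record
      { unique  = Unique.++⁺ β.unique (unique adm) λ (x∈qs , x∈ps) → <⇒≱ (β.large x∈qs) (≤-trans (∈⇒≤sum x∈ps) (m≤n+m (sum ps) 3))
      ; prime   = All.++⁺ (All.tabulate β.prime) (prime adm)
      ; residue = All.++⁺ (All.tabulate β.residue) (residue adm)
      ; large   = All.++⁺ (All.tabulate λ p∈ → ≤-<-trans (m≤m+n 3 (sum ps)) (β.large p∈)) (large adm) }
    ratio′ : survivors (qs ++ ps) * (κ + suc k) ≤ κ * modulus (qs ++ ps)
    ratio′ = *-cancelˡ-≤ κ {{>-nonZero κ>0}} (begin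
      κ * (survivors (qs ++ ps) * (κ + suc k))    ≡⟨ cong (λ x → κ * (x * (κ + suc k))) (product-map-++ _ qs ps) ⟩
      κ * (A * A′ * (κ + suc k))                  ≤⟨ ≤-trans (m≤m+n _ (A * A′ * k)) (≤-reflexive (ring₄ κ A A′ k)) ⟩
      (A * (κ + 1)) * (A′ * (κ + k))              ≤⟨ *-mono-≤ (block-ratio β) ratio ⟩
      (κ * modulus qs) * (κ * modulus ps)         ≡⟨ ring₅ κ (modulus qs) (modulus ps) ⟩
      κ * (κ * (modulus qs * modulus ps))         ≡⟨ cong (λ x → κ * (κ * x)) (product-map-++ _ qs ps) ⟨
      κ * (κ * modulus (qs ++ ps))                ∎)
      where
      open ≤-Reasoning
      A = survivors qs
      A′ = survivors ps

  b₉-odd? : ∀ n → Dec (odd (b 9 (4 * n)) ≡ true)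
  b₉-odd? n = odd (b 9 (4 * n)) Data.Bool.Properties.≟ true

  odd⇒avoids : ∀ ps → Admissible ps → ∀ n → odd (b 9 (4 * n)) ≡ true → Avoids ps n
  odd⇒avoids ps adm n h = All.tabulate λ p∈ (p∣ , p²∤) →
    contradiction (trans (sym h) (b₉-even {n} (All.lookup (Admissible.prime adm) p∈) (All.lookup (Admissible.residue adm) p∈) p∣ p²∤)) λ ()

  -- The numbers up to X meet at most X/M + 1 periods of length M, and each period contains at most
  -- as many odd values as the sieve has survivors.
  count-odd : ∀ ps → Admissible ps → ∀ X .{{_ : NonZero (modulus ps)}} →
    count b₉-odd? (upTo (suc X)) ≤ suc (X / modulus ps) * survivors ps
  count-odd ps adm X = ≤-trans (length-injection f (Unique.filter⁺ b₉-odd? (Unique.upTo⁺ (suc X))) into injective)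
    (≤-trans (≤-reflexive (trans (length-cartesianProduct (upTo (suc (X / M))) ss) (cong (_* length ss) (length-upTo (suc (X / M))))))
      (*-monoʳ-≤ (suc (X / M)) (sieve ps (Admissible.unique adm) (Admissible.prime adm) (Admissible.large adm))))
    where
    M = modulus ps
    ss = filter (avoids? ps) (upTo M)
    f : ℕ → ℕ × ℕ
    f n = n / M , n % M
    into : ∀ {n} → n ∈ filter b₉-odd? (upTo (suc X)) → f n ∈ cartesianProduct (upTo (suc (X / M))) ss
    into {n} n∈ with ∈-filter⁻ b₉-odd? {xs = upTo (suc X)} n∈
    ... | n<X , h = ∈-cartesianProduct⁺ (∈-upTo⁺ (s≤s (/-monoˡ-≤ M (s≤s⁻¹ (∈-upTo⁻ n<X)))))
      (∈-filter⁺ (avoids? ps) (∈-upTo⁺ (m%n<n n M)) (Avoids-mod ps n M square∣modulus (odd⇒avoids ps adm n h)))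
    injective : ∀ {n n′} → n ∈ filter b₉-odd? (upTo (suc X)) → n′ ∈ filter b₉-odd? (upTo (suc X)) → f n ≡ f n′ → n ≡ n′
    injective {n} {n′} _ _ e = trans (m≡m%n+[m/n]*n n M) (trans (cong₂ (λ q r → r + q * M) (cong proj₁ e) (cong proj₂ e)) (sym (m≡m%n+[m/n]*n n′ M)))

  private
    ring₆ : ∀ κ A x → κ * (A * x) ≡ A * (κ * x)
    ring₆ = solve-∀
    ring₁₅ : ∀ q A E → 2 * ((1 + (1 + q) * A) * E) ≡ q * (A * (2 * E)) + (2 * (A * E) + 2 * E)
    ring₁₅ = solve-∀

  -- At stage k = 2κE the survivors are at most M/(2E). That spends half of the budget X/E; the
  -- other half covers the incomplete last period and the added 1 once X is large.
  odd-sparse : ∀ E → 0 < E → ∃[ N ] (∀ X → N ≤ X → suc (count b₉-odd? (upTo (suc X))) * E < X)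
  odd-sparse E 0<E with sparse (κ * (2 * E))
  ... | ps , adm , ratio = suc (2 * (A * E) + 2 * E) , λ X N≤X → *-cancelˡ-< 2 _ _ (begin-strict
      2 * (suc (count b₉-odd? (upTo (suc X))) * E)     ≤⟨ *-monoʳ-≤ 2 (*-monoˡ-≤ E (s≤s (count-odd ps adm X))) ⟩
      2 * (suc (suc (X / M) * A) * E)                  ≡⟨ ring₁₅ (X / M) A E ⟩
      (X / M) * (A * (2 * E)) + (2 * (A * E) + 2 * E)  ≤⟨ +-monoˡ-≤ _ (≤-trans (*-monoʳ-≤ (X / M) A≤) (m/n*n≤m X M)) ⟩
      X + (2 * (A * E) + 2 * E)                        <⟨ +-monoʳ-< X N≤X ⟩
      X + X                                            ≡⟨ cong (X +_) (+-identityʳ X) ⟨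
      2 * X                                            ∎)
    where
    open ≤-Reasoning
    M = modulus ps
    A = survivors ps
    instance
      M≢0 : NonZero M
      M≢0 = modulus≢0 ps (Admissible.prime adm)
    A≤ : A * (2 * E) ≤ M
    A≤ = *-cancelˡ-≤ κ {{>-nonZero κ>0}} (begin
      κ * (A * (2 * E))       ≡⟨ ring₆ κ A (2 * E) ⟩
      A * (κ * (2 * E))       ≤⟨ *-monoʳ-≤ A (m≤n+m (κ * (2 * E)) κ) ⟩
      A * (κ + κ * (2 * E))   ≤⟨ ratio ⟩
      κ * M                   ∎)

  odd-false⇒∣ : ∀ n → odd n ≡ false → ℤ.+ 2 ℤ.∣ ℤ.+ n
  odd-false⇒∣ n h = ℤ.∣ᵤ⇒∣ (go n h)
    where
    go : ∀ n → odd n ≡ false → 2 ∣ n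
    go zero          _ = divides 0 refl
    go (suc (suc n)) h with go n (trans (sym (Data.Bool.Properties.not-involutive (odd n))) h)
    ... | divides k refl = divides (suc k) refl

  coefficient : ℤ⟦q⟧
  coefficient n = ℤ.+ b 9 (4 * n)

  -- There are X + 1 indices up to X while the density divides by X; the surplus of one is absorbed
  -- by the `suc o` of `near-one`.
  zeros+odd : ∀ X → suc X ≤ zerosMod 2 coefficient X + count b₉-odd? (upTo (suc X))
  zeros+odd X = subst (_≤ zerosMod 2 coefficient X + count b₉-odd? (upTo (suc X)))
    (trans (cong length (filter-all (λ _ → yes tt) (All.universal (λ _ → tt) (upTo (suc X))))) (length-upTo (suc X)))
    (count-cover (λ _ → yes tt) (λ n → ℤ.+ 2 ℤ.∣? coefficient n) b₉-odd? (upTo (suc X)) λ {n} _ _ → split n)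
    where
    split : ∀ n → ℤ.+ 2 ℤ.∣ coefficient n ⊎ odd (b 9 (4 * n)) ≡ true
    split n with odd (b 9 (4 * n)) in eq
    ... | true  = inj₂ refl
    ... | false = inj₁ (odd-false⇒∣ (b 9 (4 * n)) eq)

  zeros≤ : ∀ X → zerosMod 2 coefficient X ≤ suc X
  zeros≤ X = ≤-trans (length-filter (λ n → ℤ.+ 2 ℤ.∣? coefficient n) (upTo (suc X))) (≤-reflexive (length-upTo (suc X)))

  -- ∣z/X - 1∣ ≤ (o+1)/X < ε, since ε is at least the inverse of its denominator
  near-one : ∀ z o X .{{_ : NonZero X}} ε → ℚ.0ℚ ℚ.< ε → suc X ≤ z + o → z ≤ suc X → suc o * ℚ.↧ₙ ε < X →
    ℚ.∣ ℤ.+ z ℚ./ X ℚ.- ℚ.1ℚ ∣ ℚ.< ε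
  near-one z o X (ℚ.mkℚ (ℤ.+ zero) d c) (ℚ.*<* (ℤ.+<+ ())) _ _ _
  near-one z o X (ℚ.mkℚ ℤ.-[1+ m ] d c) (ℚ.*<* ()) _ _ _
  near-one z o (suc X) ε@(ℚ.mkℚ (ℤ.+ suc m) d c) ε>0 X≤ z≤ small =
    ℚ.toℚᵘ-cancel-< (ℚᵘ.<-respˡ-≃ (ℚᵘ.≃-sym value) (ℚᵘ.*<* (subst₂ ℤ._<_ (ℤ.pos-* t (suc d)) (ℤ.pos-* (suc m) (suc X * 1)) (ℤ.+<+ bound))))
    where
    t = ℤ.∣ ℤ.+ z ℤ.* ℤ.+ 1 ℤ.+ ℤ.-[1+ 0 ] ℤ.* ℤ.+ suc X ∣
    value : ℚ.toℚᵘ ℚ.∣ ℤ.+ z ℚ./ suc X ℚ.- ℚ.1ℚ ∣ ℚᵘ.≃ ℚᵘ.∣ ℚᵘ.mkℚᵘ (ℤ.+ z) X ℚᵘ.- ℚᵘ.1ℚᵘ ∣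
    value = ℚᵘ.≃-trans (ℚ.toℚᵘ-homo-∣-∣ (ℤ.+ z ℚ./ suc X ℚ.- ℚ.1ℚ)) (ℚᵘ.∣-∣-cong (ℚᵘ.≃-trans (ℚ.toℚᵘ-homo-+ (ℤ.+ z ℚ./ suc X) (ℚ.- ℚ.1ℚ))
      (ℚᵘ.+-congˡ (ℚᵘ.- ℚᵘ.1ℚᵘ) (ℚ.toℚᵘ-fromℚᵘ (ℚᵘ.mkℚᵘ (ℤ.+ z) X)))))
    distance : ∀ X → suc X ≤ z + o → z ≤ suc X → ℤ.∣ z ℤ.⊖ X ∣ ≤ suc o
    distance X X≤ z≤ with ≤-total z X
    ... | inj₁ z≤X = subst (_≤ suc o) (sym (trans (cong ℤ.∣_∣ (ℤ.⊖-≤ z≤X)) (ℤ.∣-i∣≡∣i∣ (ℤ.+ (X ∸ z)))))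
                       (m≤n⇒m≤1+n (m≤n+o⇒m∸n≤o X z (≤-trans (n≤1+n X) X≤)))
    ... | inj₂ X≤z = subst (_≤ suc o) (sym (cong ℤ.∣_∣ (ℤ.⊖-≥ X≤z)))
                       (≤-trans (m≤n+o⇒m∸n≤o z X (≤-trans z≤ (≤-reflexive (+-comm 1 X)))) (s≤s z≤n))
    t≤ : t ≤ suc o
    t≤ = subst (_≤ suc o) (cong ℤ.∣_∣ (sym (trans (cong₂ ℤ._+_ (ℤ.*-identityʳ (ℤ.+ z)) (ℤ.-1*i≡-i (ℤ.+ suc X))) (ℤ.m-n≡m⊖n z (suc X))))) (distance (suc X) X≤ z≤)
    bound : t * suc d < suc m * (suc X * 1)
    bound = begin-strict
      t * suc d          ≤⟨ *-monoˡ-≤ (suc d) t≤ ⟩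
      suc o * suc d      <⟨ small ⟩
      suc X              ≤⟨ m≤n*m (suc X) (suc m) ⟩
      suc m * suc X      ≡⟨ cong (suc m *_) (*-identityʳ (suc X)) ⟨
      suc m * (suc X * 1) ∎
      where open ≤-Reasoning

  near-one⇒Lim : ∀ (z o : ℕ → ℕ) → (∀ X → suc X ≤ z X + o X) → (∀ X → z X ≤ suc X) →
    (∀ E → 0 < E → ∃[ N ] (∀ X → N ≤ X → suc (o X) * E < X)) → Lim (λ X → ℤ.+ z X ℚ./ X) ℚ.1ℚ
  near-one⇒Lim z o X≤ z≤ sparse ε ε>0 with sparse (ℚ.↧ₙ ε) z<s
  ... | N , h = N , λ X N≤X → near-one (z X) (o X) X ε ε>0 (X≤ X) (z≤ X) (h X N≤X)

  lacunary : LacunaryMod 2 coefficient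
  lacunary = near-one⇒Lim (zerosMod 2 coefficient) (λ X → count b₉-odd? (upTo (suc X))) zeros+odd zeros≤ odd-sparse

open import Defs
open import Data.Nat.Base using (_*_)
open import Data.Integer.Base using (+_)

theorem1p7 : LacunaryMod 2 (λ n → + b 9 (4 * n))
theorem1p7 = Density.lacunary
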